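{- Let $\ell$ be a prime and let $t,r$ be positive integers with $t\ge2$. Then \[ \sum_{n=0}^{\infty}b_t(rn+s)q^{n}\not\equiv 0\pmod{\ell} \] for every $s\in\{0,1,\ldots,r-1\}$ such that $s\equiv (t-1)\frac{d^{2}-1}{24}\pmod r$ for some integer $d$ with $\gcd(d,6tr)=1$.
   Context: For an integer $t\ge 2$, $b_t(n)$ is the number of partitions of $n$ none of whose parts is divisible by $t$; equivalently $\sum_{n\ge0}b_t(n)q^n=f_t/f_1$ with $f_k=\prod_{j\ge1}(1-q^{jk})$. A power series is $\not\equiv0\pmod\ell$ if at least one coefficient is not divisible by $\ell$. -}

module Defs where

open import Data.Nat using (ℕ; zero; suc; _+_; _*_; _∸_; _≤?_)
open import Data.Nat.Divisibility using (_∣?_)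
open import Data.Integer as ℤ using (ℤ)
open import Relation.Nullary using (does)
open import Data.Bool using (if_then_else_)

-- Partition counting.
-- copies fuel k n : number of ways to write n = j*k + (rest), summing 'rest-count'
-- over the number j ≥ 0 of copies of part k (fuel bounds j).
sumCopies : (ℕ → ℕ) → ℕ → ℕ → ℕ → ℕ
sumCopies f zero    k n = f n
sumCopies f (suc j) k n =
  f n + (if does (k ≤? n) then sumCopies f j k (n ∸ k) else 0)

-- cnt t m n : number of partitions of n into parts from {1,…,m}, no part divisible by t.
cnt : ℕ → ℕ → ℕ → ℕ
cnt t zero    zero    = 1
cnt t zero    (suc n) = 0
cnt t (suc m) n =
  if does (t ∣? suc m)
  then cnt t m n
  else sumCopies (cnt t m) n (suc m) n

b : ℕ → ℕ → ℕ
b t n = cnt t n n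

-- (d² - 1)/24 as an integer (exact when gcd(d,6) = 1).
dTerm : ℤ → ℤ
dTerm d = ((d ℤ.* d) ℤ.- ℤ.+ 1) ℤ./ ℤ.+ 24

{-# OPTIONS --safe #-}

-- By the count of r-cores and the pentagonal number theorem, the coefficients of Σ b_t(n) qⁿ · f_r^r are
-- signed counts of the vectors y in a coset of 2rℤʳ with B₀(y, y) = q₀ + 24 r² n, where B₀ is positive
-- definite and q₀ is attained with coefficient 1. Since f_r^r is a series in q^r, if b_t(rn + s) vanishes
-- modulo ℓ for all n, then so does the theta series of the corresponding weight w : ℤʳ → ℤ, which is
-- periodic modulo some N. The weight w(D ·) with D ≡ ±d modulo N moves q₀ into the section s, so that its
-- theta series has the coefficient ±1. Choose D with all prime factors p large. After adding three more
-- copies of B₀, the form is hyperbolic modulo p, and summing the theta series over the Lagrangian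
-- sublattices (a Hecke operator at p) shows: if the series of w vanishes modulo ℓ but that of w(p ·) does
-- not, then there is a nonzero series modulo ℓ that vanishes to order p. These series lie in a space of
-- finite dimension independent of p, because every such sublattice has an orthogonal frame with vectors of
-- norm O(p). As p is arbitrarily large, this is impossible.
module Submission where

-- The section enters through a square. As `q₀` = r²(r² + t - 1), a multiplier D with D² ≡ d² modulo
-- 24r⁴t has D²`q₀` ≡ `q₀` + 24r²(t - 1)(d² - 1)/24 modulo 24r³, and this is the level of an index
-- congruent to s modulo r. For modular forms, the return from w(D ·) to w would be the q-expansion
-- principle; a count of dimensions takes its place. The difficulty is uniformity in p. One copy of
-- `B₀` need not split modulo p, but -1 is a sum of two squares modulo every prime, so four copies
-- do. On the added copies the weight lives on multiples of N, and `q₀` < N keeps its coefficient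
-- unchanged. The sublattices are given by h congruences in rank 2h. As the form is divisible by p
-- on them, a pigeonhole argument finds frames with entries O(√p) and norms p a_j with a_j bounded.
-- In the coordinates B(x, y_j)/p the series become combinations of diagonal theta series whose
-- coefficients divide a fixed factorial and whose residue classes have a fixed modulus. All
-- alternatives are settled by bounded searches, so the index n is computed.

-- Finite integer sums over lists, and lists used as finite sets.

module Sums where

  open import Data.Nat as ℕ using (ℕ; zero; suc; z≤n)
  import Data.Nat.Properties as ℕ
  open import Data.Integer hiding (suc)
  open import Data.Integer.Properties
  open import Data.Integer.Tactic.RingSolver using (solve-∀)
  open import Data.List using (List; []; _∷_; _++_; cartesianProductWith)
  import Data.List as List
  open import Data.Vec using (Vec; []; _∷_)
  import Data.Vec.Properties as Vec
  open import Data.Vec.Relation.Unary.All using (All; []; _∷_)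
  open import Data.Product using (_×_; _,_; proj₁; proj₂; ∃)
  open import Relation.Nullary
  open import Relation.Binary using (DecidableEquality)
  open import Relation.Binary.PropositionalEquality
  open import Function using (_∘_)

  𝟙 : {P : Set} → Dec P → ℤ
  𝟙 (yes _) = 1ℤ
  𝟙 (no _)  = 0ℤ

  𝟙-yes : {P : Set} (d : Dec P) → P → 𝟙 d ≡ 1ℤ
  𝟙-yes (yes _) _ = refl
  𝟙-yes (no ¬p) p = contradiction p ¬p

  𝟙-no : {P : Set} (d : Dec P) → ¬ P → 𝟙 d ≡ 0ℤ
  𝟙-no (yes p) ¬p = contradiction p ¬p
  𝟙-no (no _)  _  = refl

  𝟙-⇔ : {P Q : Set} (d : Dec P) (e : Dec Q) → (P → Q) → (Q → P) → 𝟙 d ≡ 𝟙 e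
  𝟙-⇔ (yes p) e f g = sym (𝟙-yes e (f p))
  𝟙-⇔ (no ¬p) e f g = sym (𝟙-no e (¬p ∘ g))

  𝟙-× : {P Q R : Set} (d : Dec P) (e : Dec Q) (f : Dec R) → (R → P × Q) → (P → Q → R) → 𝟙 f ≡ 𝟙 d * 𝟙 e
  𝟙-× (yes p) (yes q) f g h = 𝟙-yes f (h p q)
  𝟙-× (yes p) (no ¬q) f g h = 𝟙-no f (¬q ∘ proj₂ ∘ g)
  𝟙-× (no ¬p) e f g h = 𝟙-no f (¬p ∘ proj₁ ∘ g)

  𝟙*-cong : {P : Set} (d : Dec P) {a b : ℤ} → (P → a ≡ b) → 𝟙 d * a ≡ 𝟙 d * b
  𝟙*-cong (yes p) f = cong (1ℤ *_) (f p)
  𝟙*-cong (no _)  f = refl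

  𝟙*≢0 : {P : Set} (d : Dec P) (a : ℤ) → 𝟙 d * a ≢ 0ℤ → P × a ≢ 0ℤ
  𝟙*≢0 (yes p) a h = p , λ e → h (trans (*-identityˡ a) e)
  𝟙*≢0 (no _)  a h = contradiction refl h

  𝟙*-yes : {P : Set} (d : Dec P) (a : ℤ) → P → 𝟙 d * a ≡ a
  𝟙*-yes d a p = trans (cong (_* a) (𝟙-yes d p)) (*-identityˡ a)

  𝟙*-no : {P : Set} (d : Dec P) (a : ℤ) → ¬ P → 𝟙 d * a ≡ 0ℤ
  𝟙*-no d a p = cong (_* a) (𝟙-no d p)

  ∑ : {A : Set} → List A → (A → ℤ) → ℤ
  ∑ []       f = 0ℤ
  ∑ (x ∷ xs) f = f x + ∑ xs f

  syntax ∑ xs (λ x → e) = ∑[ x ∈ xs ] e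

  module _ {A : Set} where

    ∑-cong : (xs : List A) {f g : A → ℤ} → (∀ x → f x ≡ g x) → ∑ xs f ≡ ∑ xs g
    ∑-cong []       h = refl
    ∑-cong (x ∷ xs) h = cong₂ _+_ (h x) (∑-cong xs h)

    ∑-zero : (xs : List A) → ∑[ x ∈ xs ] 0ℤ ≡ 0ℤ
    ∑-zero []       = refl
    ∑-zero (x ∷ xs) = trans (+-identityˡ _) (∑-zero xs)

    ∑-all0 : (xs : List A) {f : A → ℤ} → (∀ x → f x ≡ 0ℤ) → ∑ xs f ≡ 0ℤ
    ∑-all0 xs h = trans (∑-cong xs h) (∑-zero xs)

    ∑-+ : (xs : List A) (f g : A → ℤ) → ∑[ x ∈ xs ] (f x + g x) ≡ ∑ xs f + ∑ xs g
    ∑-+ []       f g = refl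
    ∑-+ (x ∷ xs) f g = trans (cong (λ z → (f x + g x) + z) (∑-+ xs f g)) (lem (f x) (g x) (∑ xs f) (∑ xs g))
      where
      lem : ∀ a b c d → a + b + (c + d) ≡ a + c + (b + d)
      lem = solve-∀

    ∑-*ˡ : (xs : List A) (k : ℤ) (f : A → ℤ) → ∑[ x ∈ xs ] (k * f x) ≡ k * ∑ xs f
    ∑-*ˡ []       k f = sym (*-zeroʳ k)
    ∑-*ˡ (x ∷ xs) k f = trans (cong (λ z → k * f x + z) (∑-*ˡ xs k f)) (sym (*-distribˡ-+ k (f x) (∑ xs f)))

    ∑-*ʳ : (xs : List A) (k : ℤ) (f : A → ℤ) → ∑[ x ∈ xs ] (f x * k) ≡ ∑ xs f * k
    ∑-*ʳ xs k f = trans (∑-cong xs (λ x → *-comm (f x) k)) (trans (∑-*ˡ xs k f) (*-comm k (∑ xs f)))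

    ∑-++ : (xs ys : List A) (f : A → ℤ) → ∑ (xs ++ ys) f ≡ ∑ xs f + ∑ ys f
    ∑-++ []       ys f = sym (+-identityˡ _)
    ∑-++ (x ∷ xs) ys f = trans (cong (λ z → f x + z) (∑-++ xs ys f)) (sym (+-assoc (f x) (∑ xs f) (∑ ys f)))

    ∑-map : {B : Set} (φ : A → B) (xs : List A) (f : B → ℤ) → ∑ (List.map φ xs) f ≡ ∑ xs (f ∘ φ)
    ∑-map φ []       f = refl
    ∑-map φ (x ∷ xs) f = cong (λ z → f (φ x) + z) (∑-map φ xs f)

  ∑-swap : {A B : Set} (xs : List A) (ys : List B) (f : A → B → ℤ) →
    ∑[ x ∈ xs ] ∑[ y ∈ ys ] f x y ≡ ∑[ y ∈ ys ] ∑[ x ∈ xs ] f x y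
  ∑-swap []       ys f = sym (∑-zero ys)
  ∑-swap (x ∷ xs) ys f = trans (cong (λ z → ∑ ys (f x) + z) (∑-swap xs ys f)) (sym (∑-+ ys (f x) _))

  -- Applied with `Z` as divisibility by `ℓ`; decidability of `Z` turns the failure for the sum into
  -- an explicit summand.
  ∑-nonzero : {A : Set} (xs : List A) {f : A → ℤ} (Z : ℤ → Set) → (∀ a → Dec (Z a)) → Z 0ℤ →
    (∀ {a b} → Z a → Z b → Z (a + b)) → ¬ Z (∑ xs f) → ∃ λ x → ¬ Z (f x)
  ∑-nonzero []       Z Z? Z0 Z+ h = contradiction Z0 h
  ∑-nonzero (x ∷ xs) {f} Z Z? Z0 Z+ h with Z? (f x)
  ... | no ¬z = x , ¬z
  ... | yes z = ∑-nonzero xs Z Z? Z0 Z+ (h ∘ Z+ z)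

  module Enumeration {A : Set} (_≟ₐ_ : DecidableEquality A) where

    infix 4 _∈!_
    -- Multiplicity one, written as a sum: membership and absence of repetition in one equation, in
    -- the form in which delta sums consume it.
    _∈!_ : A → List A → Set
    a ∈! xs = ∑[ x ∈ xs ] 𝟙 (x ≟ₐ a) ≡ 1ℤ

    ∑-δ : (a : A) (xs : List A) → a ∈! xs → (g : A → ℤ) → ∑[ x ∈ xs ] (𝟙 (x ≟ₐ a) * g x) ≡ g a
    ∑-δ a xs h g = begin
      ∑[ x ∈ xs ] (𝟙 (x ≟ₐ a) * g x) ≡⟨ ∑-cong xs (λ x → 𝟙*-cong (x ≟ₐ a) (cong g)) ⟩
      ∑[ x ∈ xs ] (𝟙 (x ≟ₐ a) * g a) ≡⟨ ∑-*ʳ xs (g a) _ ⟩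
      ∑[ x ∈ xs ] 𝟙 (x ≟ₐ a) * g a   ≡⟨ cong (_* g a) h ⟩
      1ℤ * g a                       ≡⟨ *-identityˡ (g a) ⟩
      g a                            ∎
      where open ≡-Reasoning

    ∑-only : (a : A) (xs : List A) {f : A → ℤ} → a ∈! xs → (∀ x → f x ≢ 0ℤ → x ≡ a) → ∑ xs f ≡ f a
    ∑-only a xs {f} h only = trans (∑-cong xs step) (∑-δ a xs h f)
      where
      step : ∀ x → f x ≡ 𝟙 (x ≟ₐ a) * f x
      step x with f x ≟ 0ℤ | x ≟ₐ a
      ... | yes e  | d     = trans e (sym (trans (cong (𝟙 d *_) e) (*-zeroʳ (𝟙 d))))
      ... | no _   | yes _ = sym (*-identityˡ (f x))
      ... | no f≢0 | no x≢a = contradiction (only x f≢0) x≢a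

  module _ {A B : Set} (_≟ₐ_ : DecidableEquality A) (_≟ᵦ_ : DecidableEquality B) where
    private
      module A = Enumeration _≟ₐ_
      module B = Enumeration _≟ᵦ_

    -- The maps have to be mutually inverse on the supports only, because the boxes are larger than
    -- the sets of vectors that count. Both sums expand to one double sum over the common graph of
    -- `φ` and `ψ`; where the graphs disagree the summand is zero.
    ∑-bij : (xs : List A) (ys : List B) {F : A → ℤ} {G : B → ℤ} (φ : A → B) (ψ : B → A) →
      (∀ x → F x ≢ 0ℤ → φ x B.∈! ys × G (φ x) ≡ F x × ψ (φ x) ≡ x) →
      (∀ y → G y ≢ 0ℤ → ψ y A.∈! xs × F (ψ y) ≡ G y × φ (ψ y) ≡ y) →
      ∑ xs F ≡ ∑ ys G
    ∑-bij xs ys {F} {G} φ ψ h k = begin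
      ∑ xs F                                                   ≡⟨ ∑-cong xs left ⟩
      ∑[ x ∈ xs ] ∑[ y ∈ ys ] (𝟙 (y ≟ᵦ φ x) * F x)             ≡⟨ ∑-cong xs (λ x → ∑-cong ys (λ y → middle x y)) ⟩
      ∑[ x ∈ xs ] ∑[ y ∈ ys ] (𝟙 (x ≟ₐ ψ y) * G y)             ≡⟨ ∑-swap xs ys _ ⟩
      ∑[ y ∈ ys ] ∑[ x ∈ xs ] (𝟙 (x ≟ₐ ψ y) * G y)             ≡⟨ ∑-cong ys right ⟨
      ∑ ys G                                                   ∎
      where
      open ≡-Reasoning
      left : ∀ x → F x ≡ ∑[ y ∈ ys ] (𝟙 (y ≟ᵦ φ x) * F x)
      left x with F x ≟ 0ℤ
      ... | yes e = trans e (sym (∑-all0 ys (λ y → trans (cong (𝟙 (y ≟ᵦ φ x) *_) e) (*-zeroʳ (𝟙 (y ≟ᵦ φ x))))))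
      ... | no ne = sym (B.∑-δ (φ x) ys (proj₁ (h x ne)) (λ _ → F x))
      right : ∀ y → G y ≡ ∑[ x ∈ xs ] (𝟙 (x ≟ₐ ψ y) * G y)
      right y with G y ≟ 0ℤ
      ... | yes e = trans e (sym (∑-all0 xs (λ x → trans (cong (𝟙 (x ≟ₐ ψ y) *_) e) (*-zeroʳ (𝟙 (x ≟ₐ ψ y))))))
      ... | no ne = sym (A.∑-δ (ψ y) xs (proj₁ (k y ne)) (λ _ → G y))
      middle : ∀ x y → 𝟙 (y ≟ᵦ φ x) * F x ≡ 𝟙 (x ≟ₐ ψ y) * G y
      middle x y with y ≟ᵦ φ x | x ≟ₐ ψ y
      ... | yes refl | yes e with F x ≟ 0ℤ | G (φ x) ≟ 0ℤ
      ...   | no ne | _ = cong (1ℤ *_) (sym (proj₁ (proj₂ (h x ne))))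
      ...   | yes f0 | yes g0 = cong (1ℤ *_) (trans f0 (sym g0))
      ...   | yes f0 | no gne = cong (1ℤ *_) (trans (cong F e) (proj₁ (proj₂ (k (φ x) gne))))
      middle x y | yes refl | no ne with F x ≟ 0ℤ
      ... | yes f0 = trans (*-identityˡ (F x)) f0
      ... | no fne = contradiction (sym (proj₂ (proj₂ (h x fne)))) ne
      middle x y | no ne | yes refl with G y ≟ 0ℤ
      ... | yes g0 = sym (trans (*-identityˡ (G y)) g0)
      ... | no gne = contradiction (sym (proj₂ (proj₂ (k y gne)))) ne
      middle x y | no _ | no _ = refl

  vecs : {A : Set} → List A → (m : ℕ) → List (Vec A m)
  vecs xs zero    = [] ∷ []
  vecs xs (suc m) = cartesianProductWith _∷_ xs (vecs xs m)

  ∑-cartesian : {A B C : Set} (c : A → B → C) (xs : List A) (ys : List B) (f : C → ℤ) →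
    ∑ (cartesianProductWith c xs ys) f ≡ ∑[ x ∈ xs ] ∑[ y ∈ ys ] f (c x y)
  ∑-cartesian c []       ys f = refl
  ∑-cartesian c (x ∷ xs) ys f =
    trans (∑-++ (List.map (c x) ys) (cartesianProductWith c xs ys) f)
          (cong₂ _+_ (∑-map (c x) ys f) (∑-cartesian c xs ys f))

  ∑-vecs : {A : Set} (xs : List A) (m : ℕ) (f : Vec A (suc m) → ℤ) →
    ∑ (vecs xs (suc m)) f ≡ ∑[ a ∈ xs ] ∑[ v ∈ vecs xs m ] f (a ∷ v)
  ∑-vecs xs m f = ∑-cartesian _∷_ xs (vecs xs m) f

  module _ {B : Set} (_≟ᵦ_ : DecidableEquality B) where
    open Enumeration _≟ᵦ_

    ∑-fibres : {A : Set} (xs : List A) (ys : List B) (f : A → B) → (∀ x → f x ∈! ys) → (u : A → ℤ) (v : B → ℤ) →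
      ∑[ x ∈ xs ] (u x * v (f x)) ≡ ∑[ y ∈ ys ] (v y * ∑[ x ∈ xs ] (𝟙 (f x ≟ᵦ y) * u x))
    ∑-fibres xs ys f h u v = begin
      ∑[ x ∈ xs ] (u x * v (f x))                                 ≡⟨ ∑-cong xs (λ x → sym (∑-δ (f x) ys (h x) (λ y → u x * v y))) ⟩
      ∑[ x ∈ xs ] ∑[ y ∈ ys ] (𝟙 (y ≟ᵦ f x) * (u x * v y))        ≡⟨ ∑-swap xs ys _ ⟩
      ∑[ y ∈ ys ] ∑[ x ∈ xs ] (𝟙 (y ≟ᵦ f x) * (u x * v y))        ≡⟨ ∑-cong ys (λ y → trans (∑-cong xs (λ x →
          trans (cong (_* (u x * v y)) (𝟙-⇔ (y ≟ᵦ f x) (f x ≟ᵦ y) sym sym)) (lem (𝟙 (f x ≟ᵦ y)) (u x) (v y)))) (∑-*ˡ xs (v y) (λ x → 𝟙 (f x ≟ᵦ y) * u x))) ⟩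
      ∑[ y ∈ ys ] (v y * ∑[ x ∈ xs ] (𝟙 (f x ≟ᵦ y) * u x))        ∎
      where
      open ≡-Reasoning
      lem : ∀ a b c → a * (b * c) ≡ c * (a * b)
      lem = solve-∀

    ∑-select : {C : Set} (ys : List B) (zs : List C) (b : B) → b ∈! ys → (v : C → ℤ) (t : B × C → ℤ) →
      ∑[ g ∈ cartesianProductWith _,_ ys zs ] (𝟙 (proj₁ g ≟ᵦ b) * v (proj₂ g) * t g) ≡ ∑[ z ∈ zs ] (v z * t (b , z))
    ∑-select ys zs b h v t = begin
      ∑[ g ∈ cartesianProductWith _,_ ys zs ] (𝟙 (proj₁ g ≟ᵦ b) * v (proj₂ g) * t g) ≡⟨ ∑-cartesian _,_ ys zs _ ⟩
      ∑[ y ∈ ys ] ∑[ z ∈ zs ] (𝟙 (y ≟ᵦ b) * v z * t (y , z))      ≡⟨ ∑-cong ys (λ y → trans (∑-cong zs (λ z → *-assoc (𝟙 (y ≟ᵦ b)) (v z) (t (y , z)))) (∑-*ˡ zs (𝟙 (y ≟ᵦ b)) (λ z → v z * t (y , z)))) ⟩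
      ∑[ y ∈ ys ] (𝟙 (y ≟ᵦ b) * ∑[ z ∈ zs ] (v z * t (y , z)))    ≡⟨ ∑-δ b ys h (λ y → ∑[ z ∈ zs ] (v z * t (y , z))) ⟩
      ∑[ z ∈ zs ] (v z * t (b , z))                               ∎
      where open ≡-Reasoning

  module VecEnumeration {A : Set} (_≟ₐ_ : DecidableEquality A) where
    open Enumeration _≟ₐ_

    private
      infix 4 _≟ᵥ_
      _≟ᵥ_ : {m : ℕ} → DecidableEquality (Vec A m)
      _≟ᵥ_ = Vec.≡-dec _≟ₐ_

    module V {m : ℕ} = Enumeration {Vec A m} (Vec.≡-dec _≟ₐ_)

    vecs-∈! : {xs : List A} {m : ℕ} {v : Vec A m} → All (_∈! xs) v → v V.∈! vecs xs m
    vecs-∈! [] = refl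
    vecs-∈! {xs} {suc m} {a ∷ v} (p ∷ ps) = begin
      ∑[ w ∈ vecs xs (suc m) ] 𝟙 (w ≟ᵥ a ∷ v)                  ≡⟨ ∑-vecs xs m _ ⟩
      ∑[ b ∈ xs ] ∑[ w ∈ vecs xs m ] 𝟙 (b ∷ w ≟ᵥ a ∷ v)        ≡⟨ ∑-cong xs (λ b → ∑-cong (vecs xs m) (λ w →
                                                                  𝟙-× (b ≟ₐ a) (w ≟ᵥ v) (b ∷ w ≟ᵥ a ∷ v) Vec.∷-injective (λ { refl refl → refl }))) ⟩
      ∑[ b ∈ xs ] ∑[ w ∈ vecs xs m ] (𝟙 (b ≟ₐ a) * 𝟙 (w ≟ᵥ v)) ≡⟨ ∑-cong xs (λ b → ∑-*ˡ (vecs xs m) (𝟙 (b ≟ₐ a)) _) ⟩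
      ∑[ b ∈ xs ] (𝟙 (b ≟ₐ a) * ∑[ w ∈ vecs xs m ] 𝟙 (w ≟ᵥ v)) ≡⟨ ∑-δ a xs p _ ⟩
      ∑[ w ∈ vecs xs m ] 𝟙 (w ≟ᵥ v)                            ≡⟨ vecs-∈! ps ⟩
      1ℤ                                                       ∎
      where open ≡-Reasoning

  infix 4 _≟ᵥ_
  _≟ᵥ_ : {m : ℕ} → DecidableEquality (Vec ℤ m)
  _≟ᵥ_ = Vec.≡-dec _≟_

  open Enumeration _≟_ public
  open VecEnumeration _≟_ public

  residues : ℕ → List ℤ
  residues zero    = []
  residues (suc n) = + n ∷ residues n

  interval : ℕ → List ℤ
  interval zero    = 0ℤ ∷ []
  interval (suc b) = + suc b ∷ -[1+ b ] ∷ interval b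

  residues-∉ : ∀ n {k} → n ℕ.≤ k → ∑[ x ∈ residues n ] 𝟙 (x ≟ + k) ≡ 0ℤ
  residues-∉ zero    le = refl
  residues-∉ (suc n) {k} le =
    cong₂ _+_ (𝟙-no (+ n ≟ + k) (λ e → ℕ.<⇒≢ le (+-injective e))) (residues-∉ n (ℕ.≤-trans (ℕ.n≤1+n n) le))

  residues-∈! : ∀ n {k} → k ℕ.< n → + k ∈! residues n
  residues-∈! (suc n) {k} lt with k ℕ.≟ n
  ... | yes refl = cong₂ _+_ (𝟙-yes (+ n ≟ + n) refl) (residues-∉ n ℕ.≤-refl)
  ... | no ne = cong₂ _+_ (𝟙-no (+ n ≟ + k) (λ e → ne (sym (+-injective e)))) (residues-∈! n (ℕ.≤∧≢⇒< (ℕ.≤-pred lt) ne))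

  interval-∉ : ∀ b {a} → b ℕ.< ∣ a ∣ → ∑[ x ∈ interval b ] 𝟙 (x ≟ a) ≡ 0ℤ
  interval-∉ zero    {a} lt = cong (_+ 0ℤ) (𝟙-no (0ℤ ≟ a) λ e → ℕ.<⇒≢ lt (cong ∣_∣ e))
  interval-∉ (suc b) {a} lt =
    cong₂ _+_ (𝟙-no (+ suc b ≟ a) (λ e → ℕ.<⇒≢ lt (cong ∣_∣ e)))
     (cong₂ _+_ (𝟙-no (-[1+ b ] ≟ a) (λ e → ℕ.<⇒≢ lt (cong ∣_∣ e))) (interval-∉ b (ℕ.<-trans ℕ.≤-refl lt)))

  interval-∈! : ∀ b {a} → ∣ a ∣ ℕ.≤ b → a ∈! interval b
  interval-∈! zero    {a} le = cong (_+ 0ℤ) (𝟙-yes (0ℤ ≟ a) (sym (∣i∣≡0⇒i≡0 (ℕ.n≤0⇒n≡0 le))))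
  interval-∈! (suc b) {a} le with + suc b ≟ a
  ... | yes refl = cong (λ z → 1ℤ + z) (cong₂ _+_ (𝟙-no (-[1+ b ] ≟ + suc b) (λ ())) (interval-∉ b ℕ.≤-refl))
  ... | no ne with -[1+ b ] ≟ a
  ...   | yes refl = cong (λ z → 0ℤ + (1ℤ + z)) (interval-∉ b ℕ.≤-refl)
  ...   | no ne′ = cong (λ z → 0ℤ + (0ℤ + z)) (interval-∈! b (ℕ.≤-pred (ℕ.≤∧≢⇒< le (λ e → distinct a e ne ne′))))
    where
    distinct : ∀ a → ∣ a ∣ ≡ suc b → + suc b ≢ a → -[1+ b ] ≢ a → _
    distinct (+ n) e p q = contradiction (cong +_ (sym e)) p
    distinct -[1+ n ] e p q = contradiction (cong -[1+_] (sym (ℕ.suc-injective e))) q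

  -- The forms below take the value `n` inside `box n` only, so a theta coefficient is a finite sum
  -- over this box, and any larger box gives the same value.
  box : ℕ → (m : ℕ) → List (Vec ℤ m)
  box b m = vecs (interval b) m

  box-∈! : ∀ b {m} (v : Vec ℤ m) → All (λ a → ∣ a ∣ ℕ.≤ b) v → v V.∈! box b m
  box-∈! b v h = vecs-∈! (lift h)
    where
    lift : ∀ {m} {v : Vec ℤ m} → All (λ a → ∣ a ∣ ℕ.≤ b) v → All (_∈! interval b) v
    lift []       = []
    lift (p ∷ ps) = interval-∈! b p ∷ lift ps

  ∑-interval-cong : ∀ b {f g : ℤ → ℤ} → (∀ j → ∣ j ∣ ℕ.≤ b → f j ≡ g j) → ∑ (interval b) f ≡ ∑ (interval b) g
  ∑-interval-cong zero    h = cong (_+ 0ℤ) (h 0ℤ ℕ.z≤n)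
  ∑-interval-cong (suc b) h = cong₂ _+_ (h (+ suc b) ℕ.≤-refl) (cong₂ _+_ (h -[1+ b ] ℕ.≤-refl) (∑-interval-cong b (λ j le → h j (ℕ.m≤n⇒m≤1+n le))))

-- Linear dependence modulo a prime ideal of ℤ.

module LinDep where

  open import Data.Nat as ℕ using (ℕ; zero; suc)
  open import Data.Integer hiding (suc)
  open import Data.Integer.Properties
  open import Data.Integer.Divisibility.Signed
  open import Data.Integer.Tactic.RingSolver using (solve-∀)
  open import Data.Fin using (Fin; zero; suc; punchIn)
  import Data.Fin.Properties as Fin
  open import Data.List using (List; []; _∷_; length)
  open import Data.List.Relation.Unary.All using (All; []; _∷_)
  import Data.List.Relation.Unary.All as All
  open import Data.Vec.Functional using (insertAt)
  open import Data.Vec.Functional.Properties using (insertAt-lookup; insertAt-punchIn)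
  open import Algebra.Properties.Semiring.Sum +-*-semiring public using (*-distribˡ-sum; *-distribʳ-sum)
  open import Algebra.Properties.CommutativeMonoid.Sum +-0-commutativeMonoid public
    using (sum; sum-remove; ∑-distrib-+; sum-cong-≗)
  open import Data.Product using (_×_; _,_; proj₁; proj₂; ∃)
  open import Data.Sum using (_⊎_; [_,_]′)
  open import Relation.Nullary
  open import Relation.Binary.PropositionalEquality
  open import Function using (_∘_)

  -- Holds for `q` prime and for `q` = 0, so that one elimination serves both the series modulo `ℓ`
  -- and the linear algebra over ℤ.
  record PrimeIdeal (q : ℕ) : Set where
    field
      prime  : ∀ a b → (+ q ∣ a * b) → (+ q ∣ a) ⊎ (+ q ∣ b)
      proper : ¬ + q ∣ 1ℤ

  module _ {q : ℕ} (P : PrimeIdeal q) where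
    open PrimeIdeal P

    Dependent : {A : Set} {n : ℕ} → List A → (Fin n → A → ℤ) → Set
    Dependent {n = n} G v = ∃ λ (c : Fin n → ℤ) → (∃ λ i → ¬ + q ∣ c i) × All (λ g → + q ∣ sum (λ i → c i * v i g)) G

    -- Fraction-free Gaussian elimination, one coordinate at a time, with one vector more than there
    -- are coordinates.
    dependent : {A : Set} (G : List A) (v : Fin (suc (length G)) → A → ℤ) → Dependent G v
    dependent []      v = (λ _ → 1ℤ) , (zero , proper) , []
    dependent (g ∷ G) v with Fin.any? (λ i → ¬? (+ q ∣? v i g))
    ... | no all =
      c , (suc (proj₁ (proj₁ (proj₂ ih))) , proj₂ (proj₁ (proj₂ ih)))
        , sum-∣ (λ i → c i * v i g) (λ i → ∣n⇒∣m*n (c i) (vanish i)) ∷ All.map (subst (+ q ∣_) (sym (+-identityˡ _))) (proj₂ (proj₂ ih))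
      where
      ih = dependent G (v ∘ suc)
      c : Fin (suc (suc (length G))) → ℤ
      c zero    = 0ℤ
      c (suc i) = proj₁ ih i
      vanish : ∀ i → + q ∣ v i g
      vanish i = decidable-stable (+ q ∣? v i g) (λ h → all (i , h))
      sum-∣ : ∀ {n} (f : Fin n → ℤ) → (∀ i → + q ∣ f i) → + q ∣ sum f
      sum-∣ {zero}  f h = divides 0ℤ refl
      sum-∣ {suc n} f h = ∣m∣n⇒∣m+n (h zero) (sum-∣ (f ∘ suc) (h ∘ suc))
    -- `v′` clears the coordinate `g` by means of the pivot `a`. A relation `c′` among the `v′`
    -- lifts to `a * c′` with the coefficient `x` at `j`; it stays nontrivial since `a` lies outside
    -- the prime ideal.
    ... | yes (j , a∉) = c , (punchIn j i′ , nonzero) , subst (+ q ∣_) (sym (at-pivot g)) at-g ∷ All.map (λ {h} d → subst (+ q ∣_) (sym (at h)) d) (proj₂ (proj₂ ih))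
      where
      a = v j g
      v′ : Fin (suc (length G)) → _ → ℤ
      v′ i h = a * v (punchIn j i) h - v (punchIn j i) g * v j h
      ih = dependent G v′
      c′ = proj₁ ih
      i′ = proj₁ (proj₁ (proj₂ ih))
      x = - sum (λ i → c′ i * v (punchIn j i) g)
      c : Fin (suc (suc (length G))) → ℤ
      c = insertAt (λ i → a * c′ i) j x
      nonzero : ¬ + q ∣ c (punchIn j i′)
      nonzero d = [ a∉ , proj₂ (proj₁ (proj₂ ih)) ]′ (prime a (c′ i′) (subst (+ q ∣_) (insertAt-punchIn (λ k → a * c′ k) j x i′) d))
      at-pivot : ∀ h → sum (λ i → c i * v i h) ≡ x * v j h + sum (λ i → a * c′ i * v (punchIn j i) h)
      at-pivot h = trans (sum-remove {i = j} (λ i → c i * v i h)) (cong₂ _+_ (cong (_* v j h) (insertAt-lookup (λ k → a * c′ k) j x))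
        (sum-cong-≗ (λ i → cong (_* v (punchIn j i) h) (insertAt-punchIn (λ k → a * c′ k) j x i))))
      at : ∀ h → sum (λ i → c i * v i h) ≡ sum (λ i → c′ i * v′ i h)
      at h = begin
        sum (λ i → c i * v i h)                            ≡⟨ at-pivot h ⟩
        - sum w * v j h + sum u                            ≡⟨ cong (_+ sum u) (trans (sym (neg-distribˡ-* (sum w) (v j h))) (cong -_ (*-distribʳ-sum (v j h) w))) ⟩
        - sum (λ i → w i * v j h) + sum u                  ≡⟨ cong (_+ sum u) (sum-neg (λ i → w i * v j h)) ⟩
        sum (λ i → - (w i * v j h)) + sum u                ≡⟨ ∑-distrib-+ (λ i → - (w i * v j h)) u ⟨
        sum (λ i → - (w i * v j h) + u i)                  ≡⟨ sum-cong-≗ (λ i → lem (c′ i) (v (punchIn j i) g) (v j h) a (v (punchIn j i) h)) ⟩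
        sum (λ i → c′ i * v′ i h)                          ∎
        where
        open ≡-Reasoning
        w u : Fin (suc (length G)) → ℤ
        w i = c′ i * v (punchIn j i) g
        u i = a * c′ i * v (punchIn j i) h
        lem : ∀ c w y a z → - (c * w * y) + a * c * z ≡ c * (a * z - w * y)
        lem = solve-∀
        sum-neg : ∀ {n} (f : Fin n → ℤ) → - sum f ≡ sum (λ i → - f i)
        sum-neg {zero}  f = refl
        sum-neg {suc n} f = trans (neg-distrib-+ (f zero) _) (cong (λ z → - f zero + z) (sum-neg (f ∘ suc)))
      at-g : + q ∣ x * v j g + sum (λ i → a * c′ i * v (punchIn j i) g)
      at-g = divides 0ℤ (trans (cong₂ _+_ {x = x * a} refl (trans (sum-cong-≗ (λ i → *-assoc a (c′ i) (v (punchIn j i) g))) (sym (*-distribˡ-sum a (λ i → c′ i * v (punchIn j i) g)))))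
        (lem (sum (λ i → c′ i * v (punchIn j i) g)) a))
        where
        lem : ∀ s a → - s * a + a * s ≡ 0ℤ
        lem = solve-∀

-- Integer vectors, the dot product, and divisibility of all entries.

module Vectors where

  open import Data.Nat as ℕ using (ℕ; zero; suc)
  open import Data.Integer hiding (suc; _⊖_)
  open import Data.Integer.Properties
  open import Data.Integer.Divisibility.Signed
  open import Data.Integer.Tactic.RingSolver using (solve-∀)
  open import Data.Vec using (Vec; []; _∷_; zipWith; map; replicate)
  open import Data.Vec.Relation.Unary.All using (All; []; _∷_; all?)
  open import Relation.Nullary
  open import Relation.Binary.PropositionalEquality

  infixl 6 _⊕_ _⊖_
  infixr 7 _·_

  _⊕_ _⊖_ : {m : ℕ} → Vec ℤ m → Vec ℤ m → Vec ℤ m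
  _⊕_ = zipWith _+_
  _⊖_ = zipWith _-_

  _·_ : {m : ℕ} → ℤ → Vec ℤ m → Vec ℤ m
  k · v = map (k *_) v

  𝟘 : {m : ℕ} → Vec ℤ m
  𝟘 = replicate _ 0ℤ

  ⟨_,_⟩ : {m : ℕ} → Vec ℤ m → Vec ℤ m → ℤ
  ⟨ [] , [] ⟩       = 0ℤ
  ⟨ a ∷ u , b ∷ v ⟩ = a * b + ⟨ u , v ⟩

  ⟨,⟩-comm : {m : ℕ} (u v : Vec ℤ m) → ⟨ u , v ⟩ ≡ ⟨ v , u ⟩
  ⟨,⟩-comm []      []      = refl
  ⟨,⟩-comm (a ∷ u) (b ∷ v) = cong₂ _+_ (*-comm a b) (⟨,⟩-comm u v)

  ⟨,⟩-⊕ : {m : ℕ} (u v w : Vec ℤ m) → ⟨ u ⊕ v , w ⟩ ≡ ⟨ u , w ⟩ + ⟨ v , w ⟩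
  ⟨,⟩-⊕ []      []      []      = refl
  ⟨,⟩-⊕ (a ∷ u) (b ∷ v) (c ∷ w) = trans (cong (λ z → (a + b) * c + z) (⟨,⟩-⊕ u v w)) (lem a b c ⟨ u , w ⟩ ⟨ v , w ⟩)
    where
    lem : ∀ a b c x y → (a + b) * c + (x + y) ≡ a * c + x + (b * c + y)
    lem = solve-∀

  ⟨,⟩-⊖ : {m : ℕ} (u v w : Vec ℤ m) → ⟨ u ⊖ v , w ⟩ ≡ ⟨ u , w ⟩ - ⟨ v , w ⟩
  ⟨,⟩-⊖ []      []      []      = refl
  ⟨,⟩-⊖ (a ∷ u) (b ∷ v) (c ∷ w) = trans (cong (λ z → (a - b) * c + z) (⟨,⟩-⊖ u v w)) (lem a b c ⟨ u , w ⟩ ⟨ v , w ⟩)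
    where
    lem : ∀ a b c x y → (a - b) * c + (x - y) ≡ a * c + x - (b * c + y)
    lem = solve-∀

  ⟨,⟩-· : {m : ℕ} (k : ℤ) (u v : Vec ℤ m) → ⟨ k · u , v ⟩ ≡ k * ⟨ u , v ⟩
  ⟨,⟩-· k []      []      = sym (*-zeroʳ k)
  ⟨,⟩-· k (a ∷ u) (b ∷ v) = trans (cong (λ z → k * a * b + z) (⟨,⟩-· k u v)) (lem k a b ⟨ u , v ⟩)
    where
    lem : ∀ k a b x → k * a * b + k * x ≡ k * (a * b + x)
    lem = solve-∀

  ⟨,⟩-⊕ʳ : {m : ℕ} (w u v : Vec ℤ m) → ⟨ w , u ⊕ v ⟩ ≡ ⟨ w , u ⟩ + ⟨ w , v ⟩
  ⟨,⟩-⊕ʳ w u v = trans (⟨,⟩-comm w (u ⊕ v)) (trans (⟨,⟩-⊕ u v w) (cong₂ _+_ (⟨,⟩-comm u w) (⟨,⟩-comm v w)))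

  ⟨,⟩-·ʳ : {m : ℕ} (k : ℤ) (u v : Vec ℤ m) → ⟨ u , k · v ⟩ ≡ k * ⟨ u , v ⟩
  ⟨,⟩-·ʳ k u v = trans (⟨,⟩-comm u (k · v)) (trans (⟨,⟩-· k v u) (cong (k *_) (⟨,⟩-comm v u)))

  ⊕-interchange : {m : ℕ} (a b c d : Vec ℤ m) → (a ⊕ b) ⊕ (c ⊕ d) ≡ (a ⊕ c) ⊕ (b ⊕ d)
  ⊕-interchange []      []      []      []      = refl
  ⊕-interchange (a ∷ u) (b ∷ v) (c ∷ w) (d ∷ x) = cong₂ _∷_ (lem a b c d) (⊕-interchange u v w x)
    where
    lem : ∀ a b c d → a + b + (c + d) ≡ a + c + (b + d)
    lem = solve-∀

  ·-distribˡ : {m : ℕ} (k : ℤ) (u v : Vec ℤ m) → k · (u ⊕ v) ≡ k · u ⊕ k · v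
  ·-distribˡ k []      []      = refl
  ·-distribˡ k (a ∷ u) (b ∷ v) = cong₂ _∷_ (*-distribˡ-+ k a b) (·-distribˡ k u v)

  ·-distribʳ : {m : ℕ} (j k : ℤ) (u : Vec ℤ m) → (j + k) · u ≡ j · u ⊕ k · u
  ·-distribʳ j k []      = refl
  ·-distribʳ j k (a ∷ u) = cong₂ _∷_ (*-distribʳ-+ a j k) (·-distribʳ j k u)

  ·-assoc : {m : ℕ} (j k : ℤ) (u : Vec ℤ m) → (j * k) · u ≡ j · k · u
  ·-assoc j k []      = refl
  ·-assoc j k (a ∷ u) = cong₂ _∷_ (*-assoc j k a) (·-assoc j k u)

  ⊕-identityʳ : {m : ℕ} (u : Vec ℤ m) → u ⊕ 𝟘 ≡ u
  ⊕-identityʳ []      = refl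
  ⊕-identityʳ (a ∷ u) = cong₂ _∷_ (+-identityʳ a) (⊕-identityʳ u)

  0·≡𝟘 : {m : ℕ} (u : Vec ℤ m) → 0ℤ · u ≡ 𝟘
  0·≡𝟘 []      = refl
  0·≡𝟘 (a ∷ u) = cong (0ℤ ∷_) (0·≡𝟘 u)

  ·𝟘 : (m : ℕ) (k : ℤ) → k · 𝟘 {m} ≡ 𝟘
  ·𝟘 zero    k = refl
  ·𝟘 (suc m) k = cong₂ _∷_ (*-zeroʳ k) (·𝟘 m k)

  1·≡ : {m : ℕ} (u : Vec ℤ m) → 1ℤ · u ≡ u
  1·≡ []      = refl
  1·≡ (a ∷ u) = cong₂ _∷_ (*-identityˡ a) (1·≡ u)

  ⊖≡⊕- : {m : ℕ} (u v : Vec ℤ m) → u ⊖ v ≡ u ⊕ -1ℤ · v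
  ⊖≡⊕- []      []      = refl
  ⊖≡⊕- (a ∷ u) (b ∷ v) = cong₂ _∷_ (cong (λ z → a + z) (sym (-1*i≡-i b))) (⊖≡⊕- u v)

  ⊕⊖-cancel : {m : ℕ} (u v : Vec ℤ m) → v ⊕ (u ⊖ v) ≡ u
  ⊕⊖-cancel []      []      = refl
  ⊕⊖-cancel (a ∷ u) (b ∷ v) = cong₂ _∷_ (lem a b) (⊕⊖-cancel u v)
    where
    lem : ∀ a b → b + (a - b) ≡ a
    lem = solve-∀

  infix 4 _∣ᵥ_ _∣ᵥ?_

  _∣ᵥ_ : ℕ → {m : ℕ} → Vec ℤ m → Set
  p ∣ᵥ v = All (λ a → + p ∣ a) v

  _∣ᵥ?_ : (p : ℕ) {m : ℕ} (v : Vec ℤ m) → Dec (p ∣ᵥ v)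
  p ∣ᵥ? v = all? (+ p ∣?_) v

  module _ {p : ℕ} where

    ∣ᵥ-⊕ : {m : ℕ} {u v : Vec ℤ m} → p ∣ᵥ u → p ∣ᵥ v → p ∣ᵥ u ⊕ v
    ∣ᵥ-⊕ {u = []}    {[]}    []       []       = []
    ∣ᵥ-⊕ {u = _ ∷ _} {_ ∷ _} (d ∷ ds) (e ∷ es) = ∣m∣n⇒∣m+n d e ∷ ∣ᵥ-⊕ ds es

    ∣ᵥ-· : {m : ℕ} (k : ℤ) {v : Vec ℤ m} → p ∣ᵥ v → p ∣ᵥ k · v
    ∣ᵥ-· k []       = []
    ∣ᵥ-· k (d ∷ ds) = ∣n⇒∣m*n k d ∷ ∣ᵥ-· k ds

    ∣ᵥ-⊖ : {m : ℕ} {u v : Vec ℤ m} → p ∣ᵥ u → p ∣ᵥ v → p ∣ᵥ u ⊖ v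
    ∣ᵥ-⊖ {u = []}    {[]}    []       []       = []
    ∣ᵥ-⊖ {u = _ ∷ _} {_ ∷ _} (d ∷ ds) (e ∷ es) = ∣m∣n⇒∣m-n d e ∷ ∣ᵥ-⊖ ds es

    ∣ᵥ-⟨⟩ : {m : ℕ} {u : Vec ℤ m} (v : Vec ℤ m) → p ∣ᵥ u → + p ∣ ⟨ u , v ⟩
    ∣ᵥ-⟨⟩ []      []       = divides 0ℤ refl
    ∣ᵥ-⟨⟩ (b ∷ v) (d ∷ ds) = ∣m∣n⇒∣m+n (∣m⇒∣m*n b d) (∣ᵥ-⟨⟩ v ds)

    ∣ᵥ-scaled : {m : ℕ} {k : ℤ} (v : Vec ℤ m) → + p ∣ k → p ∣ᵥ k · v
    ∣ᵥ-scaled []      d = []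
    ∣ᵥ-scaled (a ∷ v) d = ∣m⇒∣m*n a d ∷ ∣ᵥ-scaled v d

-- Congruences modulo a prime.

module ModPrime where

  open import Data.Nat as ℕ using (ℕ; zero; suc)
  import Data.Nat.Properties as ℕ
  import Data.Nat.Divisibility as ℕ
  open import Data.Nat.Primality using (Prime; prime⇒nonZero; prime⇒irreducible; euclidsLemma; ¬prime[1])
  open import Data.Nat.Coprimality using (Coprime; coprime-Bézout)
  open import Data.Nat.GCD using (module Bézout)
  open import Data.Integer hiding (suc; _⊖_)
  open import Data.Integer.Properties
  open import Data.Integer.DivMod using (_%ℕ_; _/ℕ_; a≡a%ℕn+[a/ℕn]*n; n%ℕd<d)
  open import Data.Integer.Divisibility.Signed
  open import Data.Integer.Tactic.RingSolver using (solve-∀)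
  open import Data.Product using (_×_; _,_; ∃)
  open import Data.Sum using (inj₁; inj₂)
  import Data.Sum as Sum
  open import Relation.Nullary
  open import Relation.Binary.PropositionalEquality
  open import Function using (_∘_)
  open LinDep using (PrimeIdeal)
  open Sums

  prime-ideal : ∀ {p} → Prime p → PrimeIdeal p
  prime-ideal {p} pp = record
    { prime  = λ a b d → Sum.map ∣ᵤ⇒∣ ∣ᵤ⇒∣ (euclidsLemma ∣ a ∣ ∣ b ∣ pp (subst (p ℕ.∣_) (abs-* a b) (∣⇒∣ᵤ d)))
    ; proper = λ d → ¬prime[1] (subst Prime (ℕ.∣1⇒≡1 (∣⇒∣ᵤ d)) pp)
    }

  zero-ideal : PrimeIdeal 0
  zero-ideal = record
    { prime  = λ a b d → Sum.map zero-∣ zero-∣ (i*j≡0⇒i≡0∨j≡0 a (0∣⇒≡0 d))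
    ; proper = λ d → contradiction (0∣⇒≡0 d) λ ()
    }
    where
    zero-∣ : ∀ {a} → a ≡ 0ℤ → 0ℤ ∣ a
    zero-∣ e = divides 0ℤ e

  ∤⇒coprime : ∀ {p n} → Prime p → ¬ p ℕ.∣ n → Coprime p n
  ∤⇒coprime pp p∤n (d∣p , d∣n) with prime⇒irreducible pp d∣p
  ... | inj₁ d≡1  = d≡1
  ... | inj₂ refl = contradiction d∣n p∤n

  coprime-inverse : ∀ {p} (a : ℤ) → Coprime p ∣ a ∣ → ∃ λ b → + p ∣ a * b - 1ℤ
  coprime-inverse {p} a c = signed a (natural ∣ a ∣ (coprime-Bézout c))
    where
    lem₁ : ∀ n y x p → + 1 + y * n ≡ x * p → n * (- y) - 1ℤ ≡ - x * p
    lem₁ n y x p e = trans (lem n y) (trans (cong -_ e) (neg-distribˡ-* x p))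
      where
      lem : ∀ n y → n * (- y) - 1ℤ ≡ - (+ 1 + y * n)
      lem = solve-∀
    lem₂ : ∀ n y x p → + 1 + x * p ≡ y * n → n * y - 1ℤ ≡ x * p
    lem₂ n y x p e = trans (cong (_- 1ℤ) (trans (*-comm n y) (sym e))) (lem (x * p))
      where
      lem : ∀ z → + 1 + z - 1ℤ ≡ z
      lem = solve-∀
    push : ∀ a b c d → 1 ℕ.+ a ℕ.* b ≡ c ℕ.* d → + 1 + + a * + b ≡ + c * + d
    push a b c d e = trans (cong (λ z → + 1 + z) (sym (pos-* a b))) (trans (sym (pos-+ 1 (a ℕ.* b))) (trans (cong +_ e) (pos-* c d)))
    natural : ∀ n → Bézout.Identity 1 p n → ∃ λ b → + p ∣ + n * b - 1ℤ
    natural n (Bézout.+- x y e) = - + y , divides (- + x) (lem₁ (+ n) (+ y) (+ x) (+ p) (push y n x p e))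
    natural n (Bézout.-+ x y e) = + y , divides (+ x) (lem₂ (+ n) (+ y) (+ x) (+ p) (push x p y n e))
    signed : ∀ a → (∃ λ b → + p ∣ + ∣ a ∣ * b - 1ℤ) → ∃ λ b → + p ∣ a * b - 1ℤ
    signed (+ n)    (b , d) = b , d
    signed -[1+ n ] (b , d) = - b , subst (λ z → + p ∣ z - 1ℤ) (lem (+ suc n) b) d
      where
      lem : ∀ n b → n * b ≡ (- n) * (- b)
      lem = solve-∀

  ∤-abs : ∀ {p a} → ¬ + p ∣ a → ¬ p ℕ.∣ ∣ a ∣
  ∤-abs h = h ∘ ∣ᵤ⇒∣

  inverse : ∀ {p} → Prime p → (a : ℤ) → ¬ + p ∣ a → ∃ λ b → + p ∣ a * b - 1ℤ
  inverse pp a h = coprime-inverse a (∤⇒coprime pp (∤-abs h))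

  small-∣⇒≡ : ∀ {n a b} → a ℕ.< n → b ℕ.< n → + n ∣ + a - + b → a ≡ b
  small-∣⇒≡ {n} {a} {b} a<n b<n d = +-injective (i-j≡0⇒i≡j (+ a) (+ b) (∣i∣≡0⇒i≡0 (zero? (∣⇒∣ᵤ d))))
    where
    bound : ∣ + a - + b ∣ ℕ.< n
    bound = subst (ℕ._< n) (cong ∣_∣ (sym (m-n≡m⊖n a b))) (ℕ.≤-<-trans (∣m⊝n∣≤m⊔n a b) (ℕ.⊔-lub a<n b<n))
    zero? : ∀ {m} → n ℕ.∣ m → {{_ : m ≡ ∣ + a - + b ∣}} → m ≡ 0
    zero? {zero}  _ = refl
    zero? {suc m} n∣m {{e}} = contradiction (ℕ.∣⇒≤ n∣m) (ℕ.<⇒≱ (subst (ℕ._< n) (sym e) bound))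

  ∣-mod : ∀ n (a : ℤ) .{{_ : ℕ.NonZero n}} → + n ∣ a - + (a %ℕ n)
  ∣-mod n a = divides (a /ℕ n) (trans (cong (_- + (a %ℕ n)) (a≡a%ℕn+[a/ℕn]*n a n)) (lem (+ (a %ℕ n)) (a /ℕ n * + n)))
    where
    lem : ∀ x y → x + y - x ≡ y
    lem = solve-∀

  ∣⇒%≡ : ∀ n {a b : ℤ} .{{_ : ℕ.NonZero n}} → + n ∣ a - b → a %ℕ n ≡ b %ℕ n
  ∣⇒%≡ n {a} {b} d = small-∣⇒≡ (n%ℕd<d a n) (n%ℕd<d b n)
    (subst (+ n ∣_) (lem a b (+ (a %ℕ n)) (+ (b %ℕ n))) (∣m∣n⇒∣m+n (∣m∣n⇒∣m-n d (∣-mod n a)) (∣-mod n b)))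
    where
    lem : ∀ a b x y → a - b - (a - x) + (b - y) ≡ x - y
    lem = solve-∀

  %≡⇒∣ : ∀ n {a b : ℤ} .{{_ : ℕ.NonZero n}} → a %ℕ n ≡ b %ℕ n → + n ∣ a - b
  %≡⇒∣ n {a} {b} e = subst (+ n ∣_) (trans (cong (λ z → a - + z - (b - + (b %ℕ n))) e) (lem a b (+ (b %ℕ n)))) (∣m∣n⇒∣m-n (∣-mod n a) (∣-mod n b))
    where
    lem : ∀ a b y → a - y - (b - y) ≡ a - b
    lem = solve-∀

  ∑-residues-cong : ∀ n {f g : ℤ → ℤ} → (∀ k → k ℕ.< n → f (+ k) ≡ g (+ k)) → ∑ (residues n) f ≡ ∑ (residues n) g
  ∑-residues-cong zero    h = refl
  ∑-residues-cong (suc n) h = cong₂ _+_ (h n ℕ.≤-refl) (∑-residues-cong n (λ k k<n → h k (ℕ.<-trans k<n ℕ.≤-refl)))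

  -- Reduces a congruence to a polynomial identity: each use supplies the cofactors and leaves the
  -- equation to the ring solver.
  ∣-lin₂ : ∀ {n x y z} a b → n ∣ x → n ∣ y → z ≡ a * x + b * y → n ∣ z
  ∣-lin₂ a b d e eq = subst (_ ∣_) (sym eq) (∣m∣n⇒∣m+n (∣n⇒∣m*n a d) (∣n⇒∣m*n b e))

  ∣-lin₃ : ∀ {n x y w z} a b c → n ∣ x → n ∣ y → n ∣ w → z ≡ a * x + b * y + c * w → n ∣ z
  ∣-lin₃ {n} {x} {y} {w} a b c d e f eq = subst (n ∣_) (sym eq) (∣m∣n⇒∣m+n (∣m∣n⇒∣m+n (∣n⇒∣m*n a d) (∣n⇒∣m*n b e)) (∣n⇒∣m*n c f))

  module _ {p : ℕ} (pp : Prime p) where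
    open PrimeIdeal (prime-ideal pp)
    private instance
      p≢0 : ℕ.NonZero p
      p≢0 = prime⇒nonZero pp

    private
      forward : ∀ a b c x s → + p ∣ a * b - 1ℤ → + p ∣ c * b - s → + p ∣ c - a * x → ¬ + p ∣ a → + p ∣ x - s
      forward a b c x s ab sb d a∉ = Sum.fromInj₂ (λ d′ → contradiction d′ a∉) (prime a (x - s) (∣-lin₃ a (- c) -1ℤ sb ab d (lem a b c x s)))
        where
        lem : ∀ a b c x s → a * (x - s) ≡ a * (c * b - s) + - c * (a * b - 1ℤ) + -1ℤ * (c - a * x)
        lem = solve-∀

      backward : ∀ a b c s → + p ∣ a * b - 1ℤ → + p ∣ c * b - s → + p ∣ c - a * s
      backward a b c s ab sb = ∣-lin₂ a (- c) sb ab (lem a b c s)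
        where
        lem : ∀ a b c s → c - a * s ≡ a * (c * b - s) + - c * (a * b - 1ℤ)
        lem = solve-∀

    -- The solution is the residue of `c * b` with `b` inverse to `a`. It is phrased as a count
    -- because it feeds the enumeration of matrices.
    unique-solution : ∀ a c → ¬ + p ∣ a → ∑[ x ∈ residues p ] 𝟙 (+ p ∣? c - a * x) ≡ 1ℤ
    unique-solution a c a∉ with inverse pp a a∉
    ... | b , ab = trans (∑-residues-cong p (same ((c * b) %ℕ p) (n%ℕd<d (c * b) p) (∣-mod p (c * b)))) (residues-∈! p (n%ℕd<d (c * b) p))
      where
      same : ∀ s → s ℕ.< p → + p ∣ c * b - + s → ∀ k → k ℕ.< p → 𝟙 (+ p ∣? c - a * + k) ≡ 𝟙 (+ k ≟ + s)
      same s s<p sb k k<p = 𝟙-⇔ (+ p ∣? c - a * + k) (+ k ≟ + s)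
        (λ d → cong +_ (small-∣⇒≡ k<p s<p (forward a b c (+ k) (+ s) ab sb d a∉)))
        (λ e → subst (λ x → + p ∣ c - a * x) (sym e) (backward a b c (+ s) ab sb))

-- Alternating matrices modulo p and the number of their graphs through a point.

module Alternating where

  open import Data.Nat as ℕ using (ℕ; zero; suc)
  open import Data.Integer hiding (suc; _⊖_)
  open import Data.Integer.Properties
  open import Data.Integer.Divisibility.Signed
  open import Data.Integer.Tactic.RingSolver using (solve-∀)
  open import Data.Nat.Primality using (Prime)
  open import Data.List using (List; []; _∷_; cartesianProductWith)
  open import Data.Unit using (⊤; tt)
  open import Data.Vec using (Vec; []; _∷_)
  open import Data.Vec.Relation.Unary.All using ([]; _∷_)
  open import Data.Product using (_×_; _,_)
  open import Data.Sum using (fromInj₂)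
  open import Relation.Nullary
  open import Relation.Binary.PropositionalEquality
  open import Function using (_∘_)
  open LinDep using (PrimeIdeal)
  open Sums
  open Vectors
  open ModPrime

  -- An alternating matrix by the entries below its diagonal: (A , α) is the block matrix with
  -- corner 0, first row -αᵀ, first column α and remaining block A.
  Alt : ℕ → Set
  Alt zero    = ⊤
  Alt (suc h) = Alt h × Vec ℤ h

  act : {h : ℕ} → Alt h → Vec ℤ h → Vec ℤ h
  act {zero}  _       []      = []
  act {suc h} (A , α) (a ∷ u) = - ⟨ α , u ⟩ ∷ act A u ⊕ a · α

  alts : ℕ → (h : ℕ) → List (Alt h)
  alts p zero    = tt ∷ []
  alts p (suc h) = cartesianProductWith _,_ (alts p h) (vecs (residues p) h)

  act-⊕ : {h : ℕ} (A : Alt h) (u v : Vec ℤ h) → act A (u ⊕ v) ≡ act A u ⊕ act A v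
  act-⊕ {zero}  _       []      []      = refl
  act-⊕ {suc h} (A , α) (a ∷ u) (b ∷ v) = cong₂ _∷_
    (trans (cong -_ (⟨,⟩-⊕ʳ α u v)) (neg-distrib-+ ⟨ α , u ⟩ ⟨ α , v ⟩))
    (trans (cong₂ _⊕_ (act-⊕ A u v) (·-distribʳ a b α)) (⊕-interchange (act A u) (act A v) (a · α) (b · α)))

  act-· : {h : ℕ} (A : Alt h) (k : ℤ) (u : Vec ℤ h) → act A (k · u) ≡ k · act A u
  act-· {zero}  _       k []      = refl
  act-· {suc h} (A , α) k (a ∷ u) = cong₂ _∷_
    (trans (cong -_ (⟨,⟩-·ʳ k α u)) (neg-distribʳ-* k ⟨ α , u ⟩))
    (trans (cong₂ _⊕_ (act-· A k u) (·-assoc k a α)) (sym (·-distribˡ k (act A u) (a · α))))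

  ⟨u,Au⟩≡0 : {h : ℕ} (A : Alt h) (u : Vec ℤ h) → ⟨ u , act A u ⟩ ≡ 0ℤ
  ⟨u,Au⟩≡0 {zero}  _       []      = refl
  ⟨u,Au⟩≡0 {suc h} (A , α) (a ∷ u) = begin
    a * - ⟨ α , u ⟩ + ⟨ u , act A u ⊕ a · α ⟩           ≡⟨ cong (λ z → a * - ⟨ α , u ⟩ + z) (trans (⟨,⟩-⊕ʳ u (act A u) (a · α)) (cong₂ _+_ (⟨u,Au⟩≡0 A u)
                                                            (trans (⟨,⟩-·ʳ a u α) (cong (a *_) (⟨,⟩-comm u α))))) ⟩
    a * - ⟨ α , u ⟩ + (0ℤ + a * ⟨ α , u ⟩)              ≡⟨ lem a ⟨ α , u ⟩ ⟩
    0ℤ                                                  ∎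
    where
    open ≡-Reasoning
    lem : ∀ a x → a * - x + (0ℤ + a * x) ≡ 0ℤ
    lem = solve-∀

  ∣ᵥ-act : {p h : ℕ} (A : Alt h) {u : Vec ℤ h} → p ∣ᵥ u → p ∣ᵥ act A u
  ∣ᵥ-act {h = zero}  _       []       = []
  ∣ᵥ-act {p} {suc h} (A , α) {_ ∷ u} (d ∷ ds) =
    ∣m⇒∣-m (subst (+ p ∣_) (⟨,⟩-comm u α) (∣ᵥ-⟨⟩ α ds)) ∷ ∣ᵥ-⊕ (∣ᵥ-act A ds) (∣ᵥ-scaled α d)

  module _ {p : ℕ} (pp : Prime p) where
    open PrimeIdeal (prime-ideal pp)
    private
      R : List ℤ
      R = residues p

    card-R : ∑[ x ∈ R ] 1ℤ ≡ + p
    card-R = go p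
      where
      go : ∀ n → ∑[ x ∈ residues n ] 1ℤ ≡ + n
      go zero    = refl
      go (suc n) = cong (λ z → 1ℤ + z) (go n)

    card-vecs : ∀ h → ∑[ α ∈ vecs R h ] 1ℤ ≡ (+ p) ^ h
    card-vecs zero    = refl
    card-vecs (suc h) = begin
      ∑[ α ∈ vecs R (suc h) ] 1ℤ     ≡⟨ ∑-vecs R h _ ⟩
      ∑[ a ∈ R ] ∑[ α ∈ vecs R h ] 1ℤ ≡⟨ ∑-cong R (λ _ → trans (card-vecs h) (sym (*-identityˡ _))) ⟩
      ∑[ a ∈ R ] (1ℤ * (+ p) ^ h)      ≡⟨ ∑-*ʳ R ((+ p) ^ h) (λ _ → 1ℤ) ⟩
      ∑[ a ∈ R ] 1ℤ * (+ p) ^ h        ≡⟨ cong (_* (+ p) ^ h) card-R ⟩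
      + p * (+ p) ^ h                  ∎
      where open ≡-Reasoning

    -- The number p^(h(h-1)/2) of alternating matrices of size h modulo p.
    total : ℕ → ℤ
    total zero    = 1ℤ
    total (suc h) = (+ p) ^ h * total h

    ∑-alts-const : ∀ h k → ∑[ A ∈ alts p h ] k ≡ total h * k
    ∑-alts-const zero    k = trans (+-identityʳ k) (sym (*-identityˡ k))
    ∑-alts-const (suc h) k = begin
      ∑[ A ∈ alts p (suc h) ] k                 ≡⟨ ∑-cartesian _,_ (alts p h) (vecs R h) _ ⟩
      ∑[ A ∈ alts p h ] ∑[ α ∈ vecs R h ] k     ≡⟨ ∑-cong (alts p h) (λ _ → trans (∑-cong (vecs R h) (λ _ → sym (*-identityˡ k))) (trans (∑-*ʳ (vecs R h) k (λ _ → 1ℤ)) (cong (_* k) (card-vecs h)))) ⟩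
      ∑[ A ∈ alts p h ] ((+ p) ^ h * k)           ≡⟨ ∑-alts-const h ((+ p) ^ h * k) ⟩
      total h * ((+ p) ^ h * k)                   ≡⟨ lem (total h) ((+ p) ^ h) k ⟩
      (+ p) ^ h * total h * k                     ∎
      where
      open ≡-Reasoning
      lem : ∀ a b c → a * (b * c) ≡ b * a * c
      lem = solve-∀

    unique-solution-vec : ∀ {h} a (w : Vec ℤ h) → ¬ + p ∣ a → ∑[ α ∈ vecs R h ] 𝟙 (p ∣ᵥ? w ⊖ a · α) ≡ 1ℤ
    unique-solution-vec a []      a∉ = refl
    unique-solution-vec {suc h} a (c ∷ w) a∉ = begin
      ∑[ α ∈ vecs R (suc h) ] 𝟙 (p ∣ᵥ? (c ∷ w) ⊖ a · α)                            ≡⟨ ∑-vecs R h _ ⟩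
      ∑[ x ∈ R ] ∑[ α ∈ vecs R h ] 𝟙 (p ∣ᵥ? (c ∷ w) ⊖ a · (x ∷ α))                 ≡⟨ ∑-cong R (λ x → ∑-cong (vecs R h) (λ α →
            𝟙-× (+ p ∣? c - a * x) (p ∣ᵥ? w ⊖ a · α) (p ∣ᵥ? (c ∷ w) ⊖ a · (x ∷ α)) (λ { (d ∷ ds) → d , ds }) _∷_)) ⟩
      ∑[ x ∈ R ] ∑[ α ∈ vecs R h ] (𝟙 (+ p ∣? c - a * x) * 𝟙 (p ∣ᵥ? w ⊖ a · α))    ≡⟨ ∑-cong R (λ x → trans (∑-*ˡ (vecs R h) (𝟙 (+ p ∣? c - a * x)) _)
            (trans (cong (𝟙 (+ p ∣? c - a * x) *_) (unique-solution-vec a w a∉)) (*-identityʳ _))) ⟩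
      ∑[ x ∈ R ] 𝟙 (+ p ∣? c - a * x)                                              ≡⟨ unique-solution pp a c a∉ ⟩
      1ℤ                                                                           ∎
      where open ≡-Reasoning

    -- At a unit coordinate of `u` the entry of `α` is determined by all the others. Earlier
    -- coordinates of `u`, divisible by `p`, leave their entry of `α` free.
    hyperplane : ∀ {h} c (u : Vec ℤ (suc h)) → ¬ p ∣ᵥ u → ∑[ α ∈ vecs R (suc h) ] 𝟙 (+ p ∣? c + ⟨ α , u ⟩) ≡ (+ p) ^ h
    hyperplane {h} c (a ∷ u) u∉ with + p ∣? a
    ... | no a∉ = begin
      ∑[ α ∈ vecs R (suc h) ] 𝟙 (+ p ∣? c + ⟨ α , a ∷ u ⟩)                         ≡⟨ ∑-vecs R h _ ⟩
      ∑[ x ∈ R ] ∑[ α ∈ vecs R h ] 𝟙 (+ p ∣? c + (x * a + ⟨ α , u ⟩))              ≡⟨ ∑-swap R (vecs R h) _ ⟩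
      ∑[ α ∈ vecs R h ] ∑[ x ∈ R ] 𝟙 (+ p ∣? c + (x * a + ⟨ α , u ⟩))              ≡⟨ ∑-cong (vecs R h) (λ α → trans (∑-cong R (λ x → flip α x)) (unique-solution pp (- a) (c + ⟨ α , u ⟩) -a∉)) ⟩
      ∑[ α ∈ vecs R h ] 1ℤ                                                         ≡⟨ card-vecs h ⟩
      (+ p) ^ h                                                                      ∎
      where
      open ≡-Reasoning
      -a∉ : ¬ + p ∣ - a
      -a∉ d = a∉ (subst (+ p ∣_) (neg-involutive a) (∣m⇒∣-m d))
      lem : ∀ c x a y → c + (x * a + y) ≡ c + y - - a * x
      lem = solve-∀
      flip : ∀ α x → 𝟙 (+ p ∣? c + (x * a + ⟨ α , u ⟩)) ≡ 𝟙 (+ p ∣? c + ⟨ α , u ⟩ - - a * x)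
      flip α x = cong (λ z → 𝟙 (+ p ∣? z)) (lem c x a ⟨ α , u ⟩)
    hyperplane {zero}  c (a ∷ [])    u∉ | yes d = contradiction (d ∷ []) u∉
    hyperplane {suc h} c (a ∷ u) u∉ | yes d = begin
      ∑[ α ∈ vecs R (suc (suc h)) ] 𝟙 (+ p ∣? c + ⟨ α , a ∷ u ⟩)                   ≡⟨ ∑-vecs R (suc h) _ ⟩
      ∑[ x ∈ R ] ∑[ α ∈ vecs R (suc h) ] 𝟙 (+ p ∣? c + (x * a + ⟨ α , u ⟩))        ≡⟨ ∑-cong R (λ x → trans (∑-cong (vecs R (suc h)) (same x)) (trans (hyperplane c u (u∉ ∘ (d ∷_))) (sym (*-identityˡ _)))) ⟩
      ∑[ x ∈ R ] (1ℤ * (+ p) ^ h)                                                    ≡⟨ ∑-*ʳ R ((+ p) ^ h) (λ _ → 1ℤ) ⟩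
      ∑[ x ∈ R ] 1ℤ * (+ p) ^ h                                                      ≡⟨ cong (_* (+ p) ^ h) card-R ⟩
      + p * (+ p) ^ h                                                                ∎
      where
      open ≡-Reasoning
      lem₁ : ∀ c x a y → c + y ≡ 1ℤ * (c + (x * a + y)) + - x * a
      lem₁ = solve-∀
      lem₂ : ∀ c x a y → c + (x * a + y) ≡ 1ℤ * (c + y) + x * a
      lem₂ = solve-∀
      same : ∀ x α → 𝟙 (+ p ∣? c + (x * a + ⟨ α , u ⟩)) ≡ 𝟙 (+ p ∣? c + ⟨ α , u ⟩)
      same x α = 𝟙-⇔ (+ p ∣? c + (x * a + ⟨ α , u ⟩)) (+ p ∣? c + ⟨ α , u ⟩)
        (λ e → ∣-lin₂ 1ℤ (- x) e d (lem₁ c x a ⟨ α , u ⟩)) (λ e → ∣-lin₂ 1ℤ x e d (lem₂ c x a ⟨ α , u ⟩))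

    -- The number of Lagrangian graphs v = A u, taken modulo p, that pass through the given point
    -- (u, v).
    graphs : ∀ {h} → Vec ℤ h → Vec ℤ h → ℤ
    graphs {h} u v = ∑[ A ∈ alts p h ] 𝟙 (p ∣ᵥ? v ⊖ act A u)

    graphs-zero : ∀ {h} (u v : Vec ℤ h) → p ∣ᵥ u → graphs u v ≡ total h * 𝟙 (p ∣ᵥ? v)
    graphs-zero {h} u v d = trans (∑-cong (alts p h) (λ A → 𝟙-⇔ (p ∣ᵥ? v ⊖ act A u) (p ∣ᵥ? v)
        (λ e → subst (p ∣ᵥ_) (⊕⊖-cancel v (act A u)) (∣ᵥ-⊕ (∣ᵥ-act A d) e)) (λ e → ∣ᵥ-⊖ e (∣ᵥ-act A d))))
      (∑-alts-const h (𝟙 (p ∣ᵥ? v)))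

    -- If the head `a` is a unit, the block `A` is free, the lower rows determine `α`, and the head
    -- row follows from isotropy. If `p` divides `a`, the lower rows are the same problem one
    -- dimension down, while the head row puts `α` on a hyperplane.
    graphs-nonzero : ∀ {h} (u v : Vec ℤ (suc h)) → ¬ p ∣ᵥ u → + p ∣ ⟨ u , v ⟩ → graphs u v ≡ total h
    graphs-nonzero {h} (a ∷ u) (b ∷ v) u∉ uv with + p ∣? a
    ... | no a∉ = begin
      graphs (a ∷ u) (b ∷ v)                                             ≡⟨ ∑-cartesian _,_ (alts p h) (vecs R h) _ ⟩
      ∑[ A ∈ alts p h ] ∑[ α ∈ vecs R h ] 𝟙 (p ∣ᵥ? (b ∷ v) ⊖ act (A , α) (a ∷ u))  ≡⟨ ∑-cong (alts p h) (λ A → trans (∑-cong (vecs R h) (same A)) (unique-solution-vec a (v ⊖ act A u) a∉)) ⟩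
      ∑[ A ∈ alts p h ] 1ℤ                                               ≡⟨ trans (∑-alts-const h 1ℤ) (*-identityʳ (total h)) ⟩
      total h                                                            ∎
      where
      open ≡-Reasoning
      ⊖-⊕ : ∀ {m} (x y z : Vec ℤ m) → x ⊖ (y ⊕ z) ≡ (x ⊖ y) ⊖ z
      ⊖-⊕ []      []      []      = refl
      ⊖-⊕ (x ∷ xs) (y ∷ ys) (z ∷ zs) = cong₂ _∷_ (lem x y z) (⊖-⊕ xs ys zs)
        where
        lem : ∀ x y z → x - (y + z) ≡ x - y - z
        lem = solve-∀
      -- modulo p the head equation, multiplied by the unit a, follows from the others and ⟨ u , v ⟩ = 0
      head : ∀ A α → p ∣ᵥ (v ⊖ act A u) ⊖ a · α → + p ∣ b - - ⟨ α , u ⟩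
      head A α d = fromInj₂ (λ e → contradiction e a∉) (prime a (b - - ⟨ α , u ⟩)
        (∣-lin₂ 1ℤ -1ℤ uv (∣ᵥ-⟨⟩ u d) (trans (lem a b ⟨ α , u ⟩ ⟨ u , v ⟩) (cong (λ z → 1ℤ * (a * b + ⟨ u , v ⟩) + -1ℤ * z) (sym eq)))))
        where
        lem : ∀ a b x y → a * (b - - x) ≡ 1ℤ * (a * b + y) + -1ℤ * (y - 0ℤ - a * x)
        lem = solve-∀
        eq : ⟨ (v ⊖ act A u) ⊖ a · α , u ⟩ ≡ ⟨ u , v ⟩ - 0ℤ - a * ⟨ α , u ⟩
        eq = trans (⟨,⟩-⊖ (v ⊖ act A u) (a · α) u) (cong₂ _-_ (trans (⟨,⟩-⊖ v (act A u) u)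
          (cong₂ _-_ (⟨,⟩-comm v u) (trans (⟨,⟩-comm (act A u) u) (⟨u,Au⟩≡0 A u)))) (⟨,⟩-· a α u))
      same : ∀ A α → 𝟙 (p ∣ᵥ? (b ∷ v) ⊖ act (A , α) (a ∷ u)) ≡ 𝟙 (p ∣ᵥ? (v ⊖ act A u) ⊖ a · α)
      same A α = 𝟙-⇔ (p ∣ᵥ? (b ∷ v) ⊖ act (A , α) (a ∷ u)) (p ∣ᵥ? (v ⊖ act A u) ⊖ a · α)
        (λ { (_ ∷ ds) → subst (p ∣ᵥ_) (⊖-⊕ v (act A u) (a · α)) ds })
        (λ ds → head A α ds ∷ subst (p ∣ᵥ_) (sym (⊖-⊕ v (act A u) (a · α))) ds)
    graphs-nonzero {zero}  (a ∷ []) (b ∷ []) u∉ uv | yes d = contradiction (d ∷ []) u∉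
    graphs-nonzero {suc h} (a ∷ u) (b ∷ v) u∉ uv | yes d = begin
      graphs (a ∷ u) (b ∷ v)                                             ≡⟨ ∑-cartesian _,_ (alts p (suc h)) (vecs R (suc h)) _ ⟩
      ∑[ A ∈ alts p (suc h) ] ∑[ α ∈ vecs R (suc h) ] 𝟙 (p ∣ᵥ? (b ∷ v) ⊖ act (A , α) (a ∷ u))  ≡⟨ ∑-cong (alts p (suc h)) (λ A → ∑-cong (vecs R (suc h)) (same A)) ⟩
      ∑[ A ∈ alts p (suc h) ] ∑[ α ∈ vecs R (suc h) ] (𝟙 (p ∣ᵥ? v ⊖ act A u) * 𝟙 (+ p ∣? b + ⟨ α , u ⟩))
        ≡⟨ ∑-cong (alts p (suc h)) (λ A → trans (∑-*ˡ (vecs R (suc h)) (𝟙 (p ∣ᵥ? v ⊖ act A u)) _) (cong (𝟙 (p ∣ᵥ? v ⊖ act A u) *_) (hyperplane b u u′∉))) ⟩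
      ∑[ A ∈ alts p (suc h) ] (𝟙 (p ∣ᵥ? v ⊖ act A u) * (+ p) ^ h)           ≡⟨ ∑-*ʳ (alts p (suc h)) ((+ p) ^ h) _ ⟩
      graphs u v * (+ p) ^ h                                               ≡⟨ cong (_* (+ p) ^ h) (graphs-nonzero u v u′∉ uv′) ⟩
      total h * (+ p) ^ h                                                  ≡⟨ *-comm (total h) ((+ p) ^ h) ⟩
      (+ p) ^ h * total h                                                  ∎
      where
      open ≡-Reasoning
      u′∉ : ¬ p ∣ᵥ u
      u′∉ = u∉ ∘ (d ∷_)
      uv′ : + p ∣ ⟨ u , v ⟩
      uv′ = ∣-lin₂ 1ℤ (- b) uv d (lem a b ⟨ u , v ⟩)
        where
        lem : ∀ a b x → x ≡ 1ℤ * (a * b + x) + - b * a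
        lem = solve-∀
      ⊖-⊕-cancel : ∀ {m} (x y z : Vec ℤ m) → x ⊖ (y ⊕ z) ⊕ z ≡ x ⊖ y
      ⊖-⊕-cancel []      []      []      = refl
      ⊖-⊕-cancel (x ∷ xs) (y ∷ ys) (z ∷ zs) = cong₂ _∷_ (lem x y z) (⊖-⊕-cancel xs ys zs)
        where
        lem : ∀ x y z → x - (y + z) + z ≡ x - y
        lem = solve-∀
      ⊖-⊖-⊕ : ∀ {m} (x y z : Vec ℤ m) → (x ⊖ y) ⊖ z ≡ x ⊖ (y ⊕ z)
      ⊖-⊖-⊕ []      []      []      = refl
      ⊖-⊖-⊕ (x ∷ xs) (y ∷ ys) (z ∷ zs) = cong₂ _∷_ (lem x y z) (⊖-⊖-⊕ xs ys zs)
        where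
        lem : ∀ x y z → x - y - z ≡ x - (y + z)
        lem = solve-∀
      same : ∀ A α → 𝟙 (p ∣ᵥ? (b ∷ v) ⊖ act (A , α) (a ∷ u)) ≡ 𝟙 (p ∣ᵥ? v ⊖ act A u) * 𝟙 (+ p ∣? b + ⟨ α , u ⟩)
      same A α = 𝟙-× (p ∣ᵥ? v ⊖ act A u) (+ p ∣? b + ⟨ α , u ⟩) (p ∣ᵥ? (b ∷ v) ⊖ act (A , α) (a ∷ u))
        (λ { (e ∷ es) → subst (p ∣ᵥ_) (⊖-⊕-cancel v (act A u) (a · α)) (∣ᵥ-⊕ es (∣ᵥ-scaled α d))
                      , subst (+ p ∣_) (cong (λ z → b + z) (neg-involutive ⟨ α , u ⟩)) e })
        (λ es e → subst (+ p ∣_) (cong (λ z → b + z) (sym (neg-involutive ⟨ α , u ⟩))) e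
                ∷ subst (p ∣ᵥ_) (⊖-⊖-⊕ v (act A u) (a · α)) (∣ᵥ-⊖ es (∣ᵥ-scaled α d)))

-- Positive definite forms and the points of a cube.

module Frames where

  open import Data.Nat as ℕ using (ℕ; zero; suc)
  import Data.Nat.Properties as ℕ
  import Data.Nat.DivMod as ℕ
  open import Data.Integer hiding (suc; _⊖_)
  open import Data.Integer.Properties
  open import Data.Integer.Divisibility.Signed
  open import Data.Integer.Tactic.RingSolver using (solve-∀)
  import Data.Nat.Tactic.RingSolver as ℕ
  open import Data.Fin using (Fin; zero; suc; toℕ; combine; funToFin; finToFun)
  import Data.Fin.Properties as Fin
  open import Data.Vec using (Vec; []; _∷_; lookup; tabulate)
  open import Data.Vec.Properties using (lookup∘tabulate)
  open import Data.Vec.Relation.Unary.All using (All; []; _∷_)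
  open import Data.Product using (_×_; _,_; ∃)
  open import Relation.Nullary
  open import Relation.Binary.PropositionalEquality
  open import Function using (_∘_)
  open Vectors

  Bounded : ℕ → {m : ℕ} → Vec ℤ m → Set
  Bounded b = All (λ a → ∣ a ∣ ℕ.≤ b)

  -- Positivity is recorded through the estimates that get used. `coercive` is crude, with n in
  -- place of √n, but it makes theta coefficients finite sums over `box n`, and its case n = 0 is
  -- definiteness.
  record Form (m : ℕ) : Set where
    field
      B        : Vec ℤ m → Vec ℤ m → ℤ
      B-comm   : ∀ x y → B x y ≡ B y x
      B-⊕      : ∀ x y z → B (x ⊕ y) z ≡ B x z + B y z
      B-·      : ∀ k x y → B (k · x) y ≡ k * B x y
      bound    : ℕ
      B-bound  : ∀ {b b′} x y → Bounded b x → Bounded b′ y → ∣ B x y ∣ ℕ.≤ bound ℕ.* (b ℕ.* b′)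
      nonneg   : ∀ x → 0ℤ ≤ B x x
      coercive : ∀ {n} x → B x x ≡ + n → Bounded n x

    B-⊖ : ∀ x y z → B (x ⊖ y) z ≡ B x z - B y z
    B-⊖ x y z = trans (cong (λ w → B w z) (⊖≡⊕- x y)) (trans (B-⊕ x (-1ℤ · y) z) (cong (λ w → B x z + w) (trans (B-· -1ℤ y z) (-1*i≡-i (B y z)))))

    B-⊕ʳ : ∀ z x y → B z (x ⊕ y) ≡ B z x + B z y
    B-⊕ʳ z x y = trans (B-comm z (x ⊕ y)) (trans (B-⊕ x y z) (cong₂ _+_ (B-comm x z) (B-comm y z)))

    B-·ʳ : ∀ k x y → B x (k · y) ≡ k * B x y
    B-·ʳ k x y = trans (B-comm x (k · y)) (trans (B-· k y x) (cong (k *_) (B-comm y x)))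

    definite : ∀ x → B x x ≡ 0ℤ → x ≡ 𝟘
    definite x e = zeros (coercive x e)
      where
      zeros : ∀ {n} {v : Vec ℤ n} → Bounded 0 v → v ≡ 𝟘
      zeros []       = refl
      zeros (p ∷ ps) = cong₂ _∷_ (∣i∣≡0⇒i≡0 (ℕ.n≤0⇒n≡0 p)) (zeros ps)

    B𝟘 : ∀ x → B 𝟘 x ≡ 0ℤ
    B𝟘 x = trans (cong (λ z → B z x) (sym (0·≡𝟘 x))) (B-· 0ℤ x x)

  ∣ᵥ-lookup⁻ : ∀ {p m} (v : Vec ℤ m) → (∀ i → + p ∣ lookup v i) → p ∣ᵥ v
  ∣ᵥ-lookup⁻ []      h = []
  ∣ᵥ-lookup⁻ (a ∷ v) h = h zero ∷ ∣ᵥ-lookup⁻ v (h ∘ suc)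

  -- An integer within a factor 2 above √n. When `s` has to grow, (s + 1)² ≤ (2s)² preserves the
  -- upper bound.
  sqrt-bounds : ∀ n → 1 ℕ.≤ n → ∃ λ s → 1 ℕ.≤ s × n ℕ.≤ s ℕ.* s × s ℕ.* s ℕ.≤ 4 ℕ.* n
  sqrt-bounds (suc zero)    _ = 1 , ℕ.≤-refl , ℕ.≤-refl , ℕ.s≤s ℕ.z≤n
  sqrt-bounds (suc (suc n)) _ = step (sqrt-bounds (suc n) (ℕ.s≤s ℕ.z≤n))
    where
    N = suc n
    step : (∃ λ s → 1 ℕ.≤ s × N ℕ.≤ s ℕ.* s × s ℕ.* s ℕ.≤ 4 ℕ.* N) →
           ∃ λ s → 1 ℕ.≤ s × suc N ℕ.≤ s ℕ.* s × s ℕ.* s ℕ.≤ 4 ℕ.* suc N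
    step (s , 1≤s , lo , hi) with suc N ℕ.≤? s ℕ.* s
    ... | yes le = s , 1≤s , le , ℕ.≤-trans hi (ℕ.*-monoʳ-≤ 4 (ℕ.n≤1+n N))
    ... | no ¬le = suc s , ℕ.s≤s ℕ.z≤n , ℕ.≤-trans (ℕ.s≤s lo) low , high
      where
      s²≤N : s ℕ.* s ℕ.≤ N
      s²≤N = ℕ.≤-pred (ℕ.≰⇒> ¬le)
      expand : ∀ s → suc s ℕ.* suc s ≡ suc (s ℕ.* s ℕ.+ 2 ℕ.* s)
      expand = ℕ.solve-∀
      low : suc (s ℕ.* s) ℕ.≤ suc s ℕ.* suc s
      low = ℕ.≤-trans (ℕ.s≤s (ℕ.m≤m+n (s ℕ.* s) (2 ℕ.* s))) (ℕ.≤-reflexive (sym (expand s)))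
      high : suc s ℕ.* suc s ℕ.≤ 4 ℕ.* suc N
      high = begin
        suc s ℕ.* suc s     ≤⟨ ℕ.*-mono-≤ (ℕ.+-monoˡ-≤ s 1≤s) (ℕ.+-monoˡ-≤ s 1≤s) ⟩
        (s ℕ.+ s) ℕ.* (s ℕ.+ s) ≡⟨ lem s ⟩
        4 ℕ.* (s ℕ.* s)     ≤⟨ ℕ.*-monoʳ-≤ 4 (ℕ.≤-trans s²≤N (ℕ.n≤1+n N)) ⟩
        4 ℕ.* suc N         ∎
        where
        open ℕ.≤-Reasoning
        lem : ∀ s → (s ℕ.+ s) ℕ.* (s ℕ.+ s) ≡ 4 ℕ.* (s ℕ.* s)
        lem = ℕ.solve-∀

  funToFin-cong : ∀ {m n} (f g : Fin m → Fin n) → funToFin f ≡ funToFin g → ∀ i → f i ≡ g i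
  funToFin-cong f g e i = trans (sym (Fin.finToFun-funToFin f i)) (trans (cong (λ k → finToFun k i) e) (Fin.finToFun-funToFin g i))

  digit : ∀ b m → Fin (b ℕ.^ m) → Fin m → Fin b
  digit b m = finToFun {b} {m}

  digit-injective : ∀ b m (i j : Fin (b ℕ.^ m)) → (∀ k → digit b m i k ≡ digit b m j k) → i ≡ j
  digit-injective b m i j e = trans (sym (Fin.funToFin-finToFin {m} {b} i)) (trans (ext (digit b m i) (digit b m j) e) (Fin.funToFin-finToFin {m} {b} j))
    where
    ext : ∀ {m} (f g : Fin m → Fin b) → (∀ k → f k ≡ g k) → funToFin f ≡ funToFin g
    ext {zero}  f g h = refl
    ext {suc m} f g h = cong₂ combine (h zero) (ext (f ∘ suc) (g ∘ suc) (h ∘ suc))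

  -- The points of the cube {0, ..., b-1}^m, numbered by their base-b digits so that the pigeonhole
  -- principle applies to them.
  point : ∀ b m → Fin (b ℕ.^ m) → Vec ℤ m
  point b m i = tabulate (λ j → + toℕ (digit b m i j))

  point-injective : ∀ b m (i j : Fin (b ℕ.^ m)) → point b m i ≡ point b m j → i ≡ j
  point-injective b m i j e = digit-injective b m i j λ k → Fin.toℕ-injective (+-injective
    (trans (sym (lookup∘tabulate (λ j → + toℕ (digit b m i j)) k)) (trans (cong (λ v → lookup v k) e) (lookup∘tabulate (λ l → + toℕ (digit b m j l)) k))))

  point-bounded : ∀ b m (i : Fin (b ℕ.^ m)) → Bounded b (point b m i)
  point-bounded b m i = go m (digit b m i)
    where
    go : ∀ m (f : Fin m → Fin b) → Bounded b (tabulate (λ k → + toℕ (f k)))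
    go zero    f = []
    go (suc m) f = ℕ.<⇒≤ (Fin.toℕ<n (f zero)) ∷ go m (f ∘ suc)

  point-difference : ∀ b m (i j : Fin (b ℕ.^ m)) → Bounded b (point b m i ⊖ point b m j)
  point-difference b m i j = go m (digit b m i) (digit b m j)
    where
    bnd : (a c : Fin b) → ∣ + toℕ a - + toℕ c ∣ ℕ.≤ b
    bnd a c = subst (ℕ._≤ b) (cong ∣_∣ (sym (m-n≡m⊖n (toℕ a) (toℕ c))))
      (ℕ.≤-trans (∣m⊝n∣≤m⊔n (toℕ a) (toℕ c)) (ℕ.⊔-lub (ℕ.<⇒≤ (Fin.toℕ<n a)) (ℕ.<⇒≤ (Fin.toℕ<n c))))
    go : ∀ m (f g : Fin m → Fin b) → Bounded b (tabulate (λ k → + toℕ (f k)) ⊖ tabulate (λ k → + toℕ (g k)))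
    go zero    f g = []
    go (suc m) f g = bnd (f zero) (g zero) ∷ go m (f ∘ suc) (g ∘ suc)

  ⊖≡𝟘⇒≡ : ∀ {m} (u v : Vec ℤ m) → u ⊖ v ≡ 𝟘 → u ≡ v
  ⊖≡𝟘⇒≡ []      []      e = refl
  ⊖≡𝟘⇒≡ (a ∷ u) (b ∷ v) e = cong₂ _∷_ (i-j≡0⇒i≡j a b (cong (λ w → lookup w zero) e)) (⊖≡𝟘⇒≡ u v (cong (λ { (_ ∷ w) → w }) e))

-- Short orthogonal frames in isotropic sublattices.

module FrameStep where

  open import Data.Nat as ℕ using (ℕ; zero; suc)
  import Data.Nat.Properties as ℕ
  import Data.Nat.DivMod as ℕ
  open import Data.Integer hiding (suc; _⊖_)
  open import Data.Integer.Properties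
  open import Data.Integer.DivMod using (n%ℕd<d)
  open import Data.Integer.Divisibility.Signed
  open import Data.Integer.Tactic.RingSolver using (solve-∀)
  import Data.Nat.Tactic.RingSolver as ℕ
  open import Data.Nat.Primality using (Prime; prime⇒nonZero)
  open import Data.Fin using (Fin; zero; suc; toℕ; fromℕ<; combine; funToFin)
  import Data.Fin.Properties as Fin
  open import Data.Vec using (Vec; lookup)
  open import Data.Vec.Properties using (lookup-zipWith)
  open import Data.Vec.Relation.Unary.All using (All)
  import Data.Vec.Relation.Unary.All as All
  open import Data.Product using (_×_; _,_; proj₁; proj₂; ∃)
  open import Relation.Nullary
  open import Relation.Binary.PropositionalEquality
  open import Function using (_∘_)
  open Vectors
  open ModPrime
  open Frames

  -- The lattice is given by h congruences modulo p instead of a basis, since the pigeonhole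
  -- argument counts residues of `φ`. With m = 2h there are at most p^h = (√p)^m of them, which is
  -- why entries of size √p suffice.
  record Isotropic {m : ℕ} (F : Form m) (p h : ℕ) : Set where
    open Form F
    field
      φ    : Vec ℤ m → Vec ℤ h
      φ-⊕  : ∀ x y → φ (x ⊕ y) ≡ φ x ⊕ φ y
      φ-·  : ∀ k x → φ (k · x) ≡ k · φ x
      isotropic : ∀ x y → p ∣ᵥ φ x → p ∣ᵥ φ y → + p ∣ B x y

    infix 4 _∈Λ
    _∈Λ : Vec ℤ m → Set
    x ∈Λ = p ∣ᵥ φ x

    φ-⊖ : ∀ x y → φ (x ⊖ y) ≡ φ x ⊖ φ y
    φ-⊖ x y = trans (cong φ (⊖≡⊕- x y)) (trans (φ-⊕ x (-1ℤ · y)) (trans (cong (φ x ⊕_) (φ-· -1ℤ y)) (sym (⊖≡⊕- (φ x) (φ y)))))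

    ∈Λ-⊕ : ∀ {x y} → x ∈Λ → y ∈Λ → x ⊕ y ∈Λ
    ∈Λ-⊕ {x} {y} d e = subst (p ∣ᵥ_) (sym (φ-⊕ x y)) (∣ᵥ-⊕ d e)

    ∈Λ-· : ∀ k {x} → x ∈Λ → k · x ∈Λ
    ∈Λ-· k {x} d = subst (p ∣ᵥ_) (sym (φ-· k x)) (∣ᵥ-· k d)

  shift : ∀ a K → ∣ a ∣ ℕ.≤ K → + ∣ a + + K ∣ ≡ a + + K
  shift (+ n)    K le = refl
  shift -[1+ n ] K le = trans (cong (λ z → + ∣ z ∣) (⊖-≥ le)) (sym (⊖-≥ le))

  same-quotient : ∀ p a b .{{_ : ℕ.NonZero p}} → + p ∣ + a - + b → a ℕ./ p ≡ b ℕ./ p → a ≡ b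
  same-quotient p a b d e = trans (ℕ.m≡m%n+[m/n]*n a p) (trans (cong₂ (λ r q → r ℕ.+ q ℕ.* p) (∣⇒%≡ p {+ a} {+ b} d) e) (sym (ℕ.m≡m%n+[m/n]*n b p)))

  ^-distrib-* : ∀ n a b → (a ℕ.* b) ℕ.^ n ≡ a ℕ.^ n ℕ.* b ℕ.^ n
  ^-distrib-* zero    a b = refl
  ^-distrib-* (suc n) a b = trans (cong (a ℕ.* b ℕ.*_) (^-distrib-* n a b)) (lem a b (a ℕ.^ n) (b ℕ.^ n))
    where
    lem : ∀ a b x y → a ℕ.* b ℕ.* (x ℕ.* y) ≡ a ℕ.* x ℕ.* (b ℕ.* y)
    lem = ℕ.solve-∀

  module Growth (D m : ℕ) (1≤D : 1 ℕ.≤ D) where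
    abstract
      -- After k steps all frame vectors have entries at most `growth k * s`, with `s` of the size
      -- of √p. The recursion is dictated by `fewer-codes`; what matters is that p does not occur in
      -- it.
      growth : ℕ → ℕ
      growth zero    = 1
      growth (suc k) = suc ((9 ℕ.* D ℕ.* growth k) ℕ.^ m)

      growth-suc : ∀ k → growth (suc k) ≡ suc ((9 ℕ.* D ℕ.* growth k) ℕ.^ m)
      growth-suc k = refl

      growth≥1 : ∀ k → 1 ℕ.≤ growth k
      growth≥1 zero    = ℕ.≤-refl
      growth≥1 (suc k) = ℕ.s≤s ℕ.z≤n

    growth-mono : 1 ℕ.≤ m → ∀ k → growth k ℕ.≤ growth (suc k)
    growth-mono 1≤m k = begin
      c                    ≤⟨ ℕ.m≤n*m c (9 ℕ.* D) {{ℕ.m*n≢0 9 D {{_}} {{ℕ.>-nonZero 1≤D}}}} ⟩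
      G                    ≡⟨ ℕ.*-identityʳ G ⟨
      G ℕ.^ 1              ≤⟨ ℕ.^-monoʳ-≤ G {{ℕ.>-nonZero G≥1}} 1≤m ⟩
      G ℕ.^ m              ≤⟨ ℕ.n≤1+n (G ℕ.^ m) ⟩
      suc (G ℕ.^ m)        ≡⟨ growth-suc k ⟨
      growth (suc k)       ∎
      where
      open ℕ.≤-Reasoning
      c = growth k
      G = 9 ℕ.* D ℕ.* c
      G≥1 : 1 ℕ.≤ G
      G≥1 = ℕ.*-mono-≤ (ℕ.*-mono-≤ {1} {9} (ℕ.s≤s ℕ.z≤n) 1≤D) (growth≥1 k)

  -- the pigeonhole inequality: fewer codes than points
  module _ (p h k D c c′ s : ℕ) (1≤p : 1 ℕ.≤ p) (1≤D : 1 ℕ.≤ D) (p≤s² : p ℕ.≤ s ℕ.* s) (k<m : k ℕ.< h ℕ.+ h) (1≤c : 1 ℕ.≤ c)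
           (c′≡ : c′ ≡ suc ((9 ℕ.* D ℕ.* c) ℕ.^ (h ℕ.+ h))) where
    private
      m = h ℕ.+ h
      G = 9 ℕ.* D ℕ.* c
      c′≥1 : 1 ℕ.≤ c′
      c′≥1 = subst (1 ℕ.≤_) (sym c′≡) (ℕ.s≤s ℕ.z≤n)
      G≥1 : 1 ℕ.≤ G
      G≥1 = ℕ.*-mono-≤ (ℕ.*-mono-≤ {1} {9} (ℕ.s≤s ℕ.z≤n) 1≤D) 1≤c

    fewer-codes : p ℕ.^ h ℕ.* (suc (8 ℕ.* D ℕ.* c ℕ.* c′)) ℕ.^ k ℕ.< (c′ ℕ.* s) ℕ.^ m
    fewer-codes = begin-strict
      p ℕ.^ h ℕ.* suc (8 ℕ.* D ℕ.* c ℕ.* c′) ℕ.^ k     ≤⟨ ℕ.*-monoʳ-≤ (p ℕ.^ h) (ℕ.^-monoˡ-≤ k W≤) ⟩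
      p ℕ.^ h ℕ.* (G ℕ.* c′) ℕ.^ k                         ≡⟨ cong (p ℕ.^ h ℕ.*_) (^-distrib-* k G c′) ⟩
      p ℕ.^ h ℕ.* (G ℕ.^ k ℕ.* c′ ℕ.^ k)                   <⟨ ℕ.*-monoʳ-< (p ℕ.^ h) {{ℕ.m^n≢0 p h {{ℕ.>-nonZero 1≤p}}}} small ⟩
      p ℕ.^ h ℕ.* c′ ℕ.^ m                                 ≤⟨ ℕ.*-monoˡ-≤ (c′ ℕ.^ m) (ℕ.^-monoˡ-≤ h p≤s²) ⟩
      (s ℕ.* s) ℕ.^ h ℕ.* c′ ℕ.^ m                         ≡⟨ cong (ℕ._* c′ ℕ.^ m) (trans (^-distrib-* h s s) (sym (ℕ.^-distribˡ-+-* s h h))) ⟩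
      s ℕ.^ m ℕ.* c′ ℕ.^ m                                 ≡⟨ trans (ℕ.*-comm (s ℕ.^ m) (c′ ℕ.^ m)) (sym (^-distrib-* m c′ s)) ⟩
      (c′ ℕ.* s) ℕ.^ m                                     ∎
      where
      open ℕ.≤-Reasoning
      W≤ : suc (8 ℕ.* D ℕ.* c ℕ.* c′) ℕ.≤ G ℕ.* c′
      W≤ = begin
        suc (8 ℕ.* D ℕ.* c ℕ.* c′)                            ≤⟨ ℕ.+-monoˡ-≤ (8 ℕ.* D ℕ.* c ℕ.* c′) (ℕ.*-mono-≤ (ℕ.*-mono-≤ 1≤D 1≤c) c′≥1) ⟩
        D ℕ.* c ℕ.* c′ ℕ.+ 8 ℕ.* D ℕ.* c ℕ.* c′           ≡⟨ lem (D) c c′ ⟩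
        G ℕ.* c′                                                  ∎
        where
        lem : ∀ D c c′ → D ℕ.* c ℕ.* c′ ℕ.+ 8 ℕ.* D ℕ.* c ℕ.* c′ ≡ 9 ℕ.* D ℕ.* c ℕ.* c′
        lem = ℕ.solve-∀
      instance
        _ = ℕ.>-nonZero G≥1
        _ = ℕ.>-nonZero c′≥1
      -- As k < m, the right side has at least one more factor c′, and c′ was chosen larger than
      -- G^m.
      small : G ℕ.^ k ℕ.* c′ ℕ.^ k ℕ.< c′ ℕ.^ m
      small = begin-strict
        G ℕ.^ k ℕ.* c′ ℕ.^ k        ≤⟨ ℕ.*-monoˡ-≤ (c′ ℕ.^ k) (ℕ.^-monoʳ-≤ G (ℕ.<⇒≤ k<m)) ⟩
        G ℕ.^ m ℕ.* c′ ℕ.^ k        <⟨ ℕ.*-monoˡ-< (c′ ℕ.^ k) {{ℕ.m^n≢0 c′ k}} (ℕ.≤-reflexive (sym c′≡)) ⟩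
        c′ ℕ.^ suc k                ≤⟨ ℕ.^-monoʳ-≤ c′ k<m ⟩
        c′ ℕ.^ m                    ∎

  module _ {h : ℕ} (F : Form (h ℕ.+ h)) {p : ℕ} (pp : Prime p) (Λ : Isotropic F p h)
           (D : ℕ) (1≤D : 1 ℕ.≤ D) (bound≤D : Form.bound F ℕ.≤ D) (s : ℕ) (p≤s² : p ℕ.≤ s ℕ.* s) (s²≤4p : s ℕ.* s ℕ.≤ 4 ℕ.* p) where
    open Form F
    open Isotropic Λ
    private
      m = h ℕ.+ h
      instance
        p≢0 : ℕ.NonZero p
        p≢0 = prime⇒nonZero pp

    -- A point is coded by its residues under `φ` and by the quotients modulo p of its products with
    -- the earlier vectors. If two codes agree, the difference y lies in the lattice, so isotropy
    -- already makes B(y, y_j) divisible by p; equal quotients then force it to be exactly 0. Thus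
    -- each product costs W codes, a number independent of p.
    orthogonal-vector : (c b E W k : ℕ) → bound ℕ.* (b ℕ.* (c ℕ.* s)) ℕ.≤ E ℕ.* p → E ℕ.* p ℕ.+ E ℕ.* p ℕ.< W ℕ.* p →
      p ℕ.^ h ℕ.* W ℕ.^ k ℕ.< b ℕ.^ m →
      (ys : Fin k → Vec ℤ m) → (∀ j → ys j ∈Λ) → (∀ j → Bounded (c ℕ.* s) (ys j)) →
      ∃ λ y → y ≢ 𝟘 × y ∈Λ × Bounded b y × (∀ j → B y (ys j) ≡ 0ℤ)
    orthogonal-vector c b E W k bound≤E 2E<W few ys ys∈Λ ys-bounded = collision (Fin.pigeonhole few code)
      where
      pt : Fin (b ℕ.^ m) → Vec ℤ m
      pt = point b m
      B≤ : ∀ i j → ∣ B (pt i) (ys j) ∣ ℕ.≤ E ℕ.* p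
      B≤ i j = ℕ.≤-trans (B-bound (pt i) (ys j) (point-bounded b m i) (ys-bounded j)) bound≤E
      N : Fin (b ℕ.^ m) → Fin k → ℕ
      N i j = ∣ B (pt i) (ys j) + + (E ℕ.* p) ∣
      N≡ : ∀ i j → + N i j ≡ B (pt i) (ys j) + + (E ℕ.* p)
      N≡ i j = shift (B (pt i) (ys j)) (E ℕ.* p) (B≤ i j)
      N< : ∀ i j → N i j ℕ.< W ℕ.* p
      N< i j = ℕ.≤-<-trans (∣i+j∣≤∣i∣+∣j∣ (B (pt i) (ys j)) (+ (E ℕ.* p))) (ℕ.≤-<-trans (ℕ.+-monoˡ-≤ (E ℕ.* p) (B≤ i j)) 2E<W)
      residue : Fin (b ℕ.^ m) → Fin h → Fin p
      residue i j = fromℕ< (n%ℕd<d (lookup (φ (pt i)) j) p)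
      quot : Fin (b ℕ.^ m) → Fin k → Fin W
      quot i j = fromℕ< (ℕ.m<n*o⇒m/o<n {N i j} {W} {p} (N< i j))
      code : Fin (b ℕ.^ m) → Fin (p ℕ.^ h ℕ.* W ℕ.^ k)
      code i = combine (funToFin (residue i)) (funToFin (quot i))
      collision : (∃ λ i → ∃ λ i′ → (i Data.Fin.< i′) × code i ≡ code i′) → ∃ λ y → y ≢ 𝟘 × y ∈Λ × Bounded b y × (∀ j → B y (ys j) ≡ 0ℤ)
      collision (i , i′ , i<i′ , e) = y , y≢𝟘 , y∈Λ , point-difference b m i i′ , orth
        where
        y = pt i ⊖ pt i′
        es = Fin.combine-injective (funToFin (residue i)) (funToFin (quot i)) (funToFin (residue i′)) (funToFin (quot i′)) e
        y≢𝟘 : y ≢ 𝟘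
        y≢𝟘 eq = ℕ.<⇒≢ i<i′ (cong toℕ (point-injective b m i i′ (⊖≡𝟘⇒≡ (pt i) (pt i′) eq)))
        y∈Λ : y ∈Λ
        y∈Λ = subst (p ∣ᵥ_) (sym (φ-⊖ (pt i) (pt i′))) (∣ᵥ-lookup⁻ (φ (pt i) ⊖ φ (pt i′)) (λ j →
          subst (+ p ∣_) (sym (lookup-zipWith _-_ j (φ (pt i)) (φ (pt i′))))
            (%≡⇒∣ p {lookup (φ (pt i)) j} {lookup (φ (pt i′)) j} (Fin.fromℕ<-injective _ _ (n%ℕd<d (lookup (φ (pt i)) j) p) (n%ℕd<d (lookup (φ (pt i′)) j) p) (funToFin-cong (residue i) (residue i′) (proj₁ es) j)))))
        orth : ∀ j → B y (ys j) ≡ 0ℤ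
        orth j = trans (B-⊖ (pt i) (pt i′) (ys j)) (trans (lem (B (pt i) (ys j)) (B (pt i′) (ys j)) (+ (E ℕ.* p)))
          (i≡j⇒i-j≡0 (trans (sym (N≡ i j)) (trans (cong +_ N-equal) (N≡ i′ j)))))
          where
          lem : ∀ a b k → a - b ≡ a + k - (b + k)
          lem = solve-∀
          N-equal : N i j ≡ N i′ j
          N-equal = same-quotient p (N i j) (N i′ j)
            (subst (+ p ∣_) (trans (B-⊖ (pt i) (pt i′) (ys j)) (trans (lem (B (pt i) (ys j)) (B (pt i′) (ys j)) (+ (E ℕ.* p))) (sym (cong₂ _-_ (N≡ i j) (N≡ i′ j)))))
              (isotropic y (ys j) y∈Λ (ys∈Λ j)))
            (Fin.fromℕ<-injective _ _ (ℕ.m<n*o⇒m/o<n {N i j} {W} {p} (N< i j)) (ℕ.m<n*o⇒m/o<n {N i′ j} {W} {p} (N< i′ j)) (funToFin-cong (quot i) (quot i′) (proj₂ es) j))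

    -- The products with earlier vectors are at most D c c′ s² ≤ E p for E = 4 D c c′, because s² ≤
    -- 4p. Shifted by E p they lie between 0 and 2 E p, so that W = 2 E + 1 quotients are enough.
    next-vector : (c c′ k : ℕ) → k ℕ.< m → 1 ℕ.≤ c → c′ ≡ suc ((9 ℕ.* D ℕ.* c) ℕ.^ m) →
      (ys : Fin k → Vec ℤ m) → (∀ j → ys j ∈Λ) → (∀ j → Bounded (c ℕ.* s) (ys j)) →
      ∃ λ y → y ≢ 𝟘 × y ∈Λ × Bounded (c′ ℕ.* s) y × (∀ j → B y (ys j) ≡ 0ℤ)
    next-vector c c′ k k<m 1≤c c′≡ = orthogonal-vector c (c′ ℕ.* s) (4 ℕ.* D ℕ.* c ℕ.* c′) (suc (8 ℕ.* D ℕ.* c ℕ.* c′)) k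
      bound≤E 2E<W (fewer-codes p h k D c c′ s (ℕ.>-nonZero⁻¹ p) 1≤D p≤s² k<m 1≤c c′≡)
      where
      open ℕ.≤-Reasoning
      bound≤E : bound ℕ.* (c′ ℕ.* s ℕ.* (c ℕ.* s)) ℕ.≤ 4 ℕ.* D ℕ.* c ℕ.* c′ ℕ.* p
      bound≤E = begin
        bound ℕ.* (c′ ℕ.* s ℕ.* (c ℕ.* s))           ≤⟨ ℕ.*-monoˡ-≤ (c′ ℕ.* s ℕ.* (c ℕ.* s)) bound≤D ⟩
        D ℕ.* (c′ ℕ.* s ℕ.* (c ℕ.* s))               ≡⟨ lem D c c′ s ⟩
        D ℕ.* c ℕ.* c′ ℕ.* (s ℕ.* s)                 ≤⟨ ℕ.*-monoʳ-≤ (D ℕ.* c ℕ.* c′) s²≤4p ⟩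
        D ℕ.* c ℕ.* c′ ℕ.* (4 ℕ.* p)                 ≡⟨ lem′ D c c′ p ⟩
        4 ℕ.* D ℕ.* c ℕ.* c′ ℕ.* p                   ∎
        where
        lem : ∀ C c c′ s → C ℕ.* (c′ ℕ.* s ℕ.* (c ℕ.* s)) ≡ C ℕ.* c ℕ.* c′ ℕ.* (s ℕ.* s)
        lem = ℕ.solve-∀
        lem′ : ∀ C c c′ p → C ℕ.* c ℕ.* c′ ℕ.* (4 ℕ.* p) ≡ 4 ℕ.* C ℕ.* c ℕ.* c′ ℕ.* p
        lem′ = ℕ.solve-∀
      2E<W : 4 ℕ.* D ℕ.* c ℕ.* c′ ℕ.* p ℕ.+ 4 ℕ.* D ℕ.* c ℕ.* c′ ℕ.* p ℕ.< suc (8 ℕ.* D ℕ.* c ℕ.* c′) ℕ.* p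
      2E<W = begin-strict
        E ℕ.* p ℕ.+ E ℕ.* p                <⟨ ℕ.m<n+m (E ℕ.* p ℕ.+ E ℕ.* p) (ℕ.>-nonZero⁻¹ p) ⟩
        p ℕ.+ (E ℕ.* p ℕ.+ E ℕ.* p)        ≡⟨ lem D c c′ p ⟩
        suc (8 ℕ.* D ℕ.* c ℕ.* c′) ℕ.* p   ∎
        where
        E = 4 ℕ.* D ℕ.* c ℕ.* c′
        lem : ∀ C c c′ p → p ℕ.+ (4 ℕ.* C ℕ.* c ℕ.* c′ ℕ.* p ℕ.+ 4 ℕ.* C ℕ.* c ℕ.* c′ ℕ.* p) ≡ p ℕ.+ 8 ℕ.* C ℕ.* c ℕ.* c′ ℕ.* p
        lem = ℕ.solve-∀

    -- Entries O(√p) give norms O(p). By isotropy the norms are multiples of p, hence p times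
    -- integers that are bounded independently of p.
    record Frame : Set where
      field
        vec      : Fin m → Vec ℤ m
        nonzero  : ∀ j → vec j ≢ 𝟘
        member   : ∀ j → vec j ∈Λ
        bounded  : ∀ j → Bounded (Growth.growth D m 1≤D m ℕ.* s) (vec j)
        orth     : ∀ i j → i ≢ j → B (vec i) (vec j) ≡ 0ℤ

    open Growth D m 1≤D

    private
      record Partial (k : ℕ) : Set where
        field
          vec      : Fin k → Vec ℤ m
          nonzero  : ∀ j → vec j ≢ 𝟘
          member   : ∀ j → vec j ∈Λ
          bounded  : ∀ j → Bounded (growth k ℕ.* s) (vec j)
          orth     : ∀ i j → i ≢ j → B (vec i) (vec j) ≡ 0ℤ

      build : ∀ k → k ℕ.≤ m → Partial k
      build zero    _   = record { vec = λ () ; nonzero = λ () ; member = λ () ; bounded = λ () ; orth = λ () }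
      build (suc k) k<m = extend P (next-vector (growth k) (growth (suc k)) k k<m (growth≥1 k) (growth-suc k) (Partial.vec P) (Partial.member P) (Partial.bounded P))
        where
        P = build k (ℕ.<⇒≤ k<m)
        mono = growth-mono (ℕ.≤-trans (ℕ.s≤s ℕ.z≤n) k<m) k
        extend : (P : Partial k) → (∃ λ y → y ≢ 𝟘 × y ∈Λ × Bounded (growth (suc k) ℕ.* s) y × (∀ j → B y (Partial.vec P j) ≡ 0ℤ)) → Partial (suc k)
        extend P (y , y≢𝟘 , y∈Λ , y-bounded , y-orth) = record
          { vec     = λ { zero → y ; (suc j) → Partial.vec P j }
          ; nonzero = λ { zero → y≢𝟘 ; (suc j) → Partial.nonzero P j }
          ; member  = λ { zero → y∈Λ ; (suc j) → Partial.member P j }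
          ; bounded = λ { zero → y-bounded ; (suc j) → All.map (λ le → ℕ.≤-trans le (ℕ.*-monoˡ-≤ s mono)) (Partial.bounded P j) }
          ; orth    = λ { zero zero ne → contradiction refl ne
                        ; zero (suc j) _ → y-orth j
                        ; (suc i) zero _ → trans (B-comm (Partial.vec P i) y) (y-orth i)
                        ; (suc i) (suc j) ne → Partial.orth P i j (ne ∘ cong suc) }
          }

    frame : Frame
    frame = record { Partial (build m ℕ.≤-refl) }

-- Completeness of orthogonal systems.

module Parseval where

  open import Data.Nat as ℕ using (ℕ; zero; suc)
  import Data.Nat.Properties as ℕ
  import Data.Nat.DivMod as ℕ
  open import Data.Integer hiding (suc; _⊖_)
  open import Data.Integer.Properties
  open import Data.Integer.DivMod using (_%ℕ_; _/ℕ_; a≡a%ℕn+[a/ℕn]*n)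
  open import Data.Integer.Divisibility.Signed
  open import Data.Integer.Tactic.RingSolver using (solve-∀)
  open import Data.Fin using (Fin; zero; suc)
  open import Data.List using (List; length; allFin)
  open import Data.List.Properties using (length-tabulate)
  open import Data.List.Relation.Unary.All using () renaming (All to AllL; lookup to lookupL)
  open import Data.List.Membership.Propositional.Properties using (∈-allFin)
  open import Data.Vec using (Vec; []; _∷_; lookup)
  open import Data.Vec.Properties using (lookup-zipWith; lookup-map; lookup-replicate)
  open import Data.Product using (_,_; proj₁; proj₂; ∃)
  open import Data.Sum using (_⊎_; inj₁; inj₂)
  open import Relation.Nullary
  open import Relation.Binary.PropositionalEquality
  open import Function using (_∘_)
  open LinDep
  open Vectors
  open ModPrime
  open Frames

  ∑ᵥ : {n m : ℕ} → (Fin n → Vec ℤ m) → Vec ℤ m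
  ∑ᵥ {zero}  f = 𝟘
  ∑ᵥ {suc n} f = f zero ⊕ ∑ᵥ (f ∘ suc)

  lookup-∑ᵥ : ∀ {n m} (f : Fin n → Vec ℤ m) i → lookup (∑ᵥ f) i ≡ sum (λ j → lookup (f j) i)
  lookup-∑ᵥ {zero}  f i = lookup-replicate i 0ℤ
  lookup-∑ᵥ {suc n} f i = trans (lookup-zipWith _+_ i (f zero) (∑ᵥ (f ∘ suc))) (cong (λ z → lookup (f zero) i + z) (lookup-∑ᵥ (f ∘ suc) i))

  ∑ᵥ-cong : ∀ {n m} {f g : Fin n → Vec ℤ m} → (∀ j → f j ≡ g j) → ∑ᵥ f ≡ ∑ᵥ g
  ∑ᵥ-cong {zero}  h = refl
  ∑ᵥ-cong {suc n} h = cong₂ _⊕_ (h zero) (∑ᵥ-cong (h ∘ suc))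

  ∑ᵥ-⊕ : ∀ {n m} (f g : Fin n → Vec ℤ m) → ∑ᵥ (λ j → f j ⊕ g j) ≡ ∑ᵥ f ⊕ ∑ᵥ g
  ∑ᵥ-⊕ {zero}  f g = sym (⊕-identityʳ 𝟘)
  ∑ᵥ-⊕ {suc n} f g = trans (cong ((f zero ⊕ g zero) ⊕_) (∑ᵥ-⊕ (f ∘ suc) (g ∘ suc))) (⊕-interchange (f zero) (g zero) _ _)

  ∑ᵥ-· : ∀ {n m} k (f : Fin n → Vec ℤ m) → ∑ᵥ (λ j → k · f j) ≡ k · ∑ᵥ f
  ∑ᵥ-· {zero}  {m} k f = sym (·𝟘 m k)
  ∑ᵥ-· {suc n} k f = trans (cong (k · f zero ⊕_) (∑ᵥ-· k (f ∘ suc))) (sym (·-distribˡ k (f zero) _))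

  vec-ext : ∀ {m} (u v : Vec ℤ m) → (∀ i → lookup u i ≡ lookup v i) → u ≡ v
  vec-ext []      []      h = refl
  vec-ext (a ∷ u) (b ∷ v) h = cong₂ _∷_ (h zero) (vec-ext u v (h ∘ suc))

  sum-zero : ∀ {n} (f : Fin n → ℤ) → (∀ j → f j ≡ 0ℤ) → sum f ≡ 0ℤ
  sum-zero {zero}  f h = refl
  sum-zero {suc n} f h = cong₂ _+_ (h zero) (sum-zero (f ∘ suc) (h ∘ suc))

  sum-only : ∀ {n} (f : Fin n → ℤ) i → (∀ j → j ≢ i → f j ≡ 0ℤ) → sum f ≡ f i
  sum-only {suc n} f zero    h = trans (cong (λ z → f zero + z) (sum-zero (f ∘ suc) (λ j → h (suc j) λ ()))) (+-identityʳ (f zero))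
  sum-only {suc n} f (suc i) h = trans (cong₂ _+_ (h zero λ ()) (sum-only (f ∘ suc) i (λ j j≢i → h (suc j) (j≢i ∘ suc-injective)))) (+-identityˡ _)
    where
    open import Data.Fin.Properties using (suc-injective)

  /ℕ-shift : ∀ n a b .{{_ : ℕ.NonZero n}} → (a + + n * b) /ℕ n ≡ a /ℕ n + b
  /ℕ-shift n a b = *-cancelʳ-≡ _ _ (+ n) (trans (lem₁ (a + + n * b) (+ ((a + + n * b) %ℕ n)) ((a + + n * b) /ℕ n) (+ n) (a≡a%ℕn+[a/ℕn]*n (a + + n * b) n))
    (trans (cong (λ r → a + + n * b - + r) (∣⇒%≡ n {a + + n * b} {a} (divides b (lem₃ a (+ n) b)))) (lem₂ a (+ (a %ℕ n)) (a /ℕ n) b (+ n) (a≡a%ℕn+[a/ℕn]*n a n))))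
    where
    lem₁ : ∀ x r q n → x ≡ r + q * n → q * n ≡ x - r
    lem₁ x r q n refl = lem r q n
      where
      lem : ∀ r q n → q * n ≡ r + q * n - r
      lem = solve-∀
    lem₂ : ∀ a r q b n → a ≡ r + q * n → a + n * b - r ≡ (q + b) * n
    lem₂ a r q b n refl = lem r q b n
      where
      lem : ∀ r q b n → r + q * n + n * b - r ≡ (q + b) * n
      lem = solve-∀
    lem₃ : ∀ a n b → a + n * b - a ≡ b * n
    lem₃ = solve-∀

  /ℕ-exact : ∀ n b .{{_ : ℕ.NonZero n}} → (+ n * b) /ℕ n ≡ b
  /ℕ-exact n b = trans (cong (_/ℕ n) (sym (+-identityˡ (+ n * b)))) (trans (/ℕ-shift n 0ℤ b) (trans (cong (λ z → + z + b) (ℕ.0/n≡0 n)) (+-identityˡ b)))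

  module _ {m : ℕ} (F : Form m) where
    open Form F

    B-∑ᵥ : ∀ {n} (f : Fin n → Vec ℤ m) y → B (∑ᵥ f) y ≡ sum (λ j → B (f j) y)
    B-∑ᵥ {zero}  f y = B𝟘 y
    B-∑ᵥ {suc n} f y = trans (B-⊕ (f zero) (∑ᵥ (f ∘ suc)) y) (cong (λ z → B (f zero) y + z) (B-∑ᵥ (f ∘ suc) y))

    private
      0∣⇒≡ : ∀ {a} → + 0 ∣ a → a ≡ 0ℤ
      0∣⇒≡ (divides q e) = trans e (*-zeroʳ q)

      dependent-at : ∀ {d} (G : List (Fin m)) → length G ≡ d → (v : Fin (suc d) → Fin m → ℤ) → Dependent zero-ideal G v
      dependent-at G refl v = dependent zero-ideal G v

    -- The m + 1 vectors x and y_j are dependent over ℤ. Pairing the relation with y_i kills the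
    -- coefficient of y_i, so only a multiple of x is left, and pairing with x gives B(x, x) = 0.
    orthogonal-complete : (ys : Fin m → Vec ℤ m) → (∀ j → ys j ≢ 𝟘) → (∀ i j → i ≢ j → B (ys i) (ys j) ≡ 0ℤ) →
      ∀ x → (∀ j → B x (ys j) ≡ 0ℤ) → x ≡ 𝟘
    orthogonal-complete ys ys≢𝟘 orth x x⊥ys = definite x (conclude (proj₁ (proj₂ dep)))
      where
      w : Fin (suc m) → Vec ℤ m
      w zero    = x
      w (suc j) = ys j
      dep = dependent-at (allFin m) (length-tabulate {n = m} (λ i → i)) (λ k i → lookup (w k) i)
      c = proj₁ dep
      relation : ∑ᵥ (λ k → c k · w k) ≡ 𝟘
      relation = vec-ext _ _ λ i → trans (lookup-∑ᵥ (λ k → c k · w k) i) (trans (sum-cong-≗ (λ k → lookup-map i (c k *_) (w k)))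
        (trans (0∣⇒≡ (lookupL (proj₂ (proj₂ dep)) (∈-allFin i))) (sym (lookup-replicate i 0ℤ))))
      paired : ∀ y → sum (λ k → c k * B (w k) y) ≡ 0ℤ
      paired y = trans (sum-cong-≗ (λ k → sym (B-· (c k) (w k) y))) (trans (sym (B-∑ᵥ (λ k → c k · w k) y)) (trans (cong (λ v → B v y) relation) (B𝟘 y)))
      c-suc≡0 : ∀ i → c (suc i) ≡ 0ℤ
      c-suc≡0 i = cancel (i*j≡0⇒i≡0∨j≡0 (c (suc i)) (trans (sym (sum-only (λ k → c k * B (w k) (ys i)) (suc i) vanish)) (paired (ys i))))
        where
        cancel : c (suc i) ≡ 0ℤ ⊎ B (ys i) (ys i) ≡ 0ℤ → c (suc i) ≡ 0ℤ
        cancel (inj₁ e) = e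
        cancel (inj₂ e) = contradiction (definite (ys i) e) (ys≢𝟘 i)
        vanish : ∀ k → k ≢ suc i → c k * B (w k) (ys i) ≡ 0ℤ
        vanish zero    _  = trans (cong (c zero *_) (x⊥ys i)) (*-zeroʳ (c zero))
        vanish (suc j) ne = trans (cong (c (suc j) *_) (orth j i (ne ∘ cong suc))) (*-zeroʳ (c (suc j)))
      conclude : (∃ λ i → ¬ + 0 ∣ c i) → B x x ≡ 0ℤ
      conclude (suc i , h) = contradiction (divides 0ℤ (c-suc≡0 i)) h
      conclude (zero , h) = cancel (i*j≡0⇒i≡0∨j≡0 (c zero) (trans (sym (sum-only (λ k → c k * B (w k) x) zero vanish)) (paired x)))
        where
        cancel : c zero ≡ 0ℤ ⊎ B x x ≡ 0ℤ → B x x ≡ 0ℤ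
        cancel (inj₁ e) = contradiction (divides 0ℤ e) h
        cancel (inj₂ e) = e
        vanish : ∀ k → k ≢ zero → c k * B (w k) x ≡ 0ℤ
        vanish zero    ne = contradiction refl ne
        vanish (suc j) _  = cong (_* B (ys j) x) (c-suc≡0 j)

-- Theta series of sublattices as combinations of diagonal theta series.

module Span where

  open import Data.Nat as ℕ using (ℕ; zero; suc)
  import Data.Nat.Properties as ℕ
  open import Data.Integer hiding (suc; _⊖_)
  open import Data.Integer.Properties
  open import Data.Integer.DivMod using (_%ℕ_; _/ℕ_; a≡a%ℕn+[a/ℕn]*n; n%ℕd<d)
  open import Data.Integer.Divisibility.Signed
  open import Data.Integer.Tactic.RingSolver using (solve-∀)
  open import Data.Fin using (Fin; zero; suc)
  open import Data.List using (List; []; _∷_; cartesianProductWith)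
  open import Data.Vec using (Vec; []; _∷_; lookup; tabulate; map)
  open import Data.Vec.Properties using (lookup-map; lookup∘tabulate; lookup-zipWith)
  open import Data.Vec.Relation.Unary.All using (All; []; _∷_)
  open import Data.Product using (_×_; _,_; proj₁; proj₂; ∃)
  open import Relation.Nullary
  open import Relation.Binary.PropositionalEquality
  open import Function using (_∘_)
  open Sums
  open LinDep
  open Vectors
  open Frames
  open FrameStep
  open Parseval

  sum-nonneg : ∀ {n} (f : Fin n → ℤ) → (∀ i → 0ℤ ≤ f i) → 0ℤ ≤ sum f
  sum-nonneg {zero}  f h = ≤-refl
  sum-nonneg {suc n} f h = +-mono-≤ (h zero) (sum-nonneg (f ∘ suc) (h ∘ suc))

  term≤sum : ∀ {n} (f : Fin n → ℤ) → (∀ i → 0ℤ ≤ f i) → ∀ i → f i ≤ sum f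
  term≤sum {suc n} f h zero    = subst (_≤ f zero + sum (f ∘ suc)) (+-identityʳ (f zero)) (+-monoʳ-≤ (f zero) (sum-nonneg (f ∘ suc) (h ∘ suc)))
  term≤sum {suc n} f h (suc i) = ≤-trans (term≤sum (f ∘ suc) (h ∘ suc) i)
    (subst (_≤ f zero + sum (f ∘ suc)) (+-identityˡ (sum (f ∘ suc))) (+-monoˡ-≤ (sum (f ∘ suc)) (h zero)))

  weighted-square : ∀ k a → + k * (a * a) ≡ + (k ℕ.* (∣ a ∣ ℕ.* ∣ a ∣))
  weighted-square k a = trans (cong (+ k *_) (square a)) (sym (pos-* k (∣ a ∣ ℕ.* ∣ a ∣)))
    where
    square : ∀ a → a * a ≡ + (∣ a ∣ ℕ.* ∣ a ∣)
    square (+ n)    = sym (pos-* n n)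
    square -[1+ n ] = refl

  n≤n² : ∀ n → n ℕ.≤ n ℕ.* n
  n≤n² zero    = ℕ.z≤n
  n≤n² (suc n) = ℕ.m≤m*n (suc n) (suc n)

  lookup⇒All : ∀ {m} {P : ℤ → Set} (v : Vec ℤ m) → (∀ i → P (lookup v i)) → All P v
  lookup⇒All []      h = []
  lookup⇒All (a ∷ v) h = h zero ∷ lookup⇒All v (h ∘ suc)

  W : {m : ℕ} → Vec ℤ m → Vec ℤ m → ℤ
  W k z = sum (λ j → lookup k j * (lookup z j * lookup z j))

  W-coercive : ∀ {m n} (k : Fin m → ℕ) (z : Vec ℤ m) → (∀ j → 1 ℕ.≤ k j) → sum (λ j → + k j * (lookup z j * lookup z j)) ≡ + n → Bounded n z
  W-coercive {m} {n} k z 1≤k e = lookup⇒All z λ i → ℕ.≤-trans (n≤n² ∣ lookup z i ∣) (ℕ.≤-trans (ℕ.≤-trans (ℕ.≤-reflexive (sym (ℕ.*-identityˡ _))) (ℕ.*-monoˡ-≤ _ (1≤k i)))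
    (drop‿+≤+ (subst₂ _≤_ (weighted-square (k i) (lookup z i)) e (term≤sum _ nonneg i))))
    where
    nonneg : ∀ i → 0ℤ ≤ + k i * (lookup z i * lookup z i)
    nonneg i = subst (0ℤ ≤_) (sym (weighted-square (k i) (lookup z i))) (+≤+ ℕ.z≤n)

  modᵥ : (N : ℕ) .{{_ : ℕ.NonZero N}} {m : ℕ} → Vec ℤ m → Vec ℤ m
  modᵥ N = map (λ a → + (a %ℕ N))

  module Theta (m K N : ℕ) .{{N≢0 : ℕ.NonZero N}} where

    Index : Set
    Index = Vec ℤ m × Vec ℤ m

    -- Coefficients of a diagonal form, at most `K`, together with a residue class modulo `N`. The
    -- length of this list is the dimension bound, and it does not involve p.
    indices : List Index
    indices = cartesianProductWith _,_ (vecs (residues (suc K)) m) (vecs (residues N) m)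

    -- Read at `K * n`, because K B(x, x) = p W(z) carries the level p n of the form to the level K
    -- n of the diagonal form.
    θ : Index → ℕ → ℤ
    θ (k , ρ) n = ∑[ z ∈ box (K ℕ.* n) m ] (𝟙 (modᵥ N z ≟ᵥ ρ) * 𝟙 (W k z ≟ + (K ℕ.* n)))

    Spanned : (ℕ → ℤ) → Set
    Spanned f = ∃ λ (coef : Index → ℤ) → ∀ n → f n ≡ ∑[ g ∈ indices ] (coef g * θ g n)

    Spanned-+ : ∀ {f g} → Spanned f → Spanned g → Spanned (λ n → f n + g n)
    Spanned-+ (c , e) (d , e′) = (λ i → c i + d i) , λ n → trans (cong₂ _+_ (e n) (e′ n)) (trans (sym (∑-+ indices _ _))
      (∑-cong indices (λ i → sym (*-distribʳ-+ (θ i n) (c i) (d i)))))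

    Spanned-* : ∀ {f} k → Spanned f → Spanned (λ n → k * f n)
    Spanned-* k (c , e) = (λ i → k * c i) , λ n → trans (cong (k *_) (e n)) (trans (sym (∑-*ˡ indices k _))
      (∑-cong indices (λ i → sym (*-assoc k (c i) (θ i n)))))

    Spanned-∑ : {A : Set} (xs : List A) {f : A → ℕ → ℤ} → (∀ x → Spanned (f x)) → Spanned (λ n → ∑[ x ∈ xs ] f x n)
    Spanned-∑ []       h = (λ _ → 0ℤ) , λ n → sym (∑-zero indices)
    Spanned-∑ (x ∷ xs) h = Spanned-+ (h x) (Spanned-∑ xs h)

  -- Coordinates z_j = B(x, y_j)/p of a lattice Λ with respect to an orthogonal frame y_j with
  -- B(y_j, y_j) = p a_j:  K x = Σ k_j z_j y_j  and  K B(x, x) = p Σ k_j z_j²  whenever k_j a_j = K.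
  module Coordinates {h : ℕ} (𝓕 : Form (h ℕ.+ h)) {p : ℕ} .{{p≢0 : ℕ.NonZero p}} (Λ : Isotropic 𝓕 p h)
    (ys : Fin (h ℕ.+ h) → Vec ℤ (h ℕ.+ h)) (ys≢𝟘 : ∀ j → ys j ≢ 𝟘)
    (orth : ∀ i j → i ≢ j → Form.B 𝓕 (ys i) (ys j) ≡ 0ℤ) (ys∈Λ : ∀ j → p ∣ᵥ Isotropic.φ Λ (ys j))
    (K : ℕ) .{{K≢0 : ℕ.NonZero K}} (a k : Fin (h ℕ.+ h) → ℕ) (norm : ∀ j → Form.B 𝓕 (ys j) (ys j) ≡ + p * + a j)
    (ka≡K : ∀ j → + k j * + a j ≡ + K) (1≤k : ∀ j → 1 ℕ.≤ k j) (k≤K : ∀ j → k j ℕ.≤ K)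
    (N : ℕ) .{{N≢0 : ℕ.NonZero N}} (c : Vec ℤ (h ℕ.+ h) → ℤ) (periodic : ∀ x y → c (x ⊕ + N · y) ≡ c x) where

    open Form 𝓕
    open Isotropic Λ

    private
      m N′ : ℕ
      m = h ℕ.+ h
      N′ = N ℕ.* K
      instance
        N′≢0 : ℕ.NonZero N′
        N′≢0 = ℕ.m*n≢0 N K

    open Theta m K N′

    term : Vec ℤ m → Fin m → Vec ℤ m
    term z j = (+ k j * lookup z j) · ys j

    V : Vec ℤ m → Vec ℤ m
    V z = ∑ᵥ (term z)

    ζ ψ : Vec ℤ m → Vec ℤ m
    ζ x = tabulate (λ j → B x (ys j) /ℕ p)
    ψ z = map (_/ℕ K) (V z)

    ζ-exact : ∀ {x} → x ∈Λ → ∀ j → B x (ys j) ≡ + p * lookup (ζ x) j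
    ζ-exact {x} x∈Λ j with isotropic x (ys j) x∈Λ (ys∈Λ j)
    ... | divides q e = trans e (trans (*-comm q (+ p)) (cong (+ p *_) (sym (trans (lookup∘tabulate _ j)
      (trans (cong (_/ℕ p) (trans e (*-comm q (+ p)))) (/ℕ-exact p q))))))

    B-V : ∀ z i → B (V z) (ys i) ≡ + K * (+ p * lookup z i)
    B-V z i = begin
      B (V z) (ys i)                                              ≡⟨ B-∑ᵥ 𝓕 (λ j → (+ k j * lookup z j) · ys j) (ys i) ⟩
      sum (λ j → B ((+ k j * lookup z j) · ys j) (ys i))          ≡⟨ sum-only (λ j → B ((+ k j * lookup z j) · ys j) (ys i)) i (λ j j≢i → trans (B-· (+ k j * lookup z j) (ys j) (ys i)) (trans (cong (+ k j * lookup z j *_) (orth j i j≢i)) (*-zeroʳ (+ k j * lookup z j)))) ⟩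
      B ((+ k i * lookup z i) · ys i) (ys i)                      ≡⟨ trans (B-· (+ k i * lookup z i) (ys i) (ys i)) (cong (+ k i * lookup z i *_) (norm i)) ⟩
      + k i * lookup z i * (+ p * + a i)                          ≡⟨ lem (+ k i) (lookup z i) (+ p) (+ a i) ⟩
      + k i * + a i * (+ p * lookup z i)                          ≡⟨ cong (_* (+ p * lookup z i)) (ka≡K i) ⟩
      + K * (+ p * lookup z i)                                    ∎
      where
      open ≡-Reasoning
      lem : ∀ k z p a → k * z * (p * a) ≡ k * a * (p * z)
      lem = solve-∀

    -- Both sides have the same product with every frame vector, and a vector orthogonal to the
    -- whole frame vanishes.
    V-ζ : ∀ {x} → x ∈Λ → V (ζ x) ≡ + K · x
    V-ζ {x} x∈Λ = sym (⊖≡𝟘⇒≡ (+ K · x) (V (ζ x)) (orthogonal-complete 𝓕 ys ys≢𝟘 orth (+ K · x ⊖ V (ζ x)) λ j →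
      trans (B-⊖ (+ K · x) (V (ζ x)) (ys j)) (i≡j⇒i-j≡0 (trans (B-· (+ K) x (ys j)) (trans (cong (+ K *_) (ζ-exact x∈Λ j)) (sym (B-V (ζ x) j)))))))

    map-/ℕ-· : ∀ {n} (x : Vec ℤ n) → map (_/ℕ K) (+ K · x) ≡ x
    map-/ℕ-· []      = refl
    map-/ℕ-· (b ∷ x) = cong₂ _∷_ (/ℕ-exact K b) (map-/ℕ-· x)

    ψ-ζ : ∀ {x} → x ∈Λ → ψ (ζ x) ≡ x
    ψ-ζ {x} x∈Λ = trans (cong (map (_/ℕ K)) (V-ζ x∈Λ)) (map-/ℕ-· x)

    ζ-ψ : ∀ {z} → + K · ψ z ≡ V z → ζ (ψ z) ≡ z
    ζ-ψ {z} e = vec-ext (ζ (ψ z)) z λ j → trans (lookup∘tabulate _ j) (trans (cong (_/ℕ p) (B-ψ j)) (/ℕ-exact p (lookup z j)))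
      where
      B-ψ : ∀ j → B (ψ z) (ys j) ≡ + p * lookup z j
      B-ψ j = *-cancelˡ-≡ (+ K) (B (ψ z) (ys j)) (+ p * lookup z j) (trans (sym (B-· (+ K) (ψ z) (ys j))) (trans (cong (λ v → B v (ys j)) e) (B-V z j)))

    kᵥ : Vec ℤ m
    kᵥ = tabulate (λ j → + k j)

    W-kᵥ : ∀ z → W kᵥ z ≡ sum (λ j → + k j * (lookup z j * lookup z j))
    W-kᵥ z = sum-cong-≗ (λ j → cong (_* (lookup z j * lookup z j)) (lookup∘tabulate _ j))

    norm-ζ : ∀ {x} → x ∈Λ → + K * B x x ≡ + p * W kᵥ (ζ x)
    norm-ζ {x} x∈Λ = begin
      + K * B x x                                                     ≡⟨ B-· (+ K) x x ⟨
      B (+ K · x) x                                                   ≡⟨ cong (λ v → B v x) (V-ζ x∈Λ) ⟨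
      B (V (ζ x)) x                                                   ≡⟨ B-∑ᵥ 𝓕 (λ j → (+ k j * lookup (ζ x) j) · ys j) x ⟩
      sum (λ j → B ((+ k j * lookup (ζ x) j) · ys j) x)               ≡⟨ sum-cong-≗ (λ j → trans (B-· (+ k j * lookup (ζ x) j) (ys j) x)
                                                                          (trans (cong (+ k j * lookup (ζ x) j *_) (trans (B-comm (ys j) x) (ζ-exact x∈Λ j))) (lem (+ k j) (lookup (ζ x) j) (+ p)))) ⟩
      sum (λ j → + p * (+ k j * (lookup (ζ x) j * lookup (ζ x) j)))   ≡⟨ *-distribˡ-sum (+ p) (λ j → + k j * (lookup (ζ x) j * lookup (ζ x) j)) ⟨
      + p * sum (λ j → + k j * (lookup (ζ x) j * lookup (ζ x) j))     ≡⟨ cong (+ p *_) (W-kᵥ (ζ x)) ⟨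
      + p * W kᵥ (ζ x)                                                ∎
      where
      open ≡-Reasoning
      lem : ∀ k z p → k * z * (p * z) ≡ p * (k * (z * z))
      lem = solve-∀

    -- The weight in coordinates. `ψ` divides by `K` with rounding, so it is meaningful only if
    -- `V z` is divisible by `K`; the first indicator says this and the second that the vector lies
    -- in the lattice. Together they single out the z that are coordinates of lattice vectors.
    c′ : Vec ℤ m → ℤ
    c′ z = 𝟙 (+ K · ψ z ≟ᵥ V z) * (𝟙 (p ∣ᵥ? φ (ψ z)) * c (ψ z))

    norm-transfer : ∀ {x} n → x ∈Λ → B x x ≡ + (p ℕ.* n) → W kᵥ (ζ x) ≡ + (K ℕ.* n)
    norm-transfer {x} n x∈Λ e = *-cancelˡ-≡ (+ p) _ _ (trans (sym (norm-ζ x∈Λ)) (trans (cong (+ K *_) (trans e (pos-* p n))) (trans (lem (+ K) (+ p) (+ n)) (cong (+ p *_) (sym (pos-* K n))))))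
      where
      lem : ∀ k p n → k * (p * n) ≡ p * (k * n)
      lem = solve-∀

    norm-transfer⁻ : ∀ {x} n → x ∈Λ → W kᵥ (ζ x) ≡ + (K ℕ.* n) → B x x ≡ + (p ℕ.* n)
    norm-transfer⁻ {x} n x∈Λ e = *-cancelˡ-≡ (+ K) _ _ (trans (norm-ζ x∈Λ) (trans (cong (+ p *_) (trans e (pos-* K n))) (trans (lem (+ p) (+ K) (+ n)) (cong (+ K *_) (sym (pos-* p n))))))
      where
      lem : ∀ k p n → k * (p * n) ≡ p * (k * n)
      lem = solve-∀

    F G : ℕ → Vec ℤ m → ℤ
    F n x = 𝟙 (p ∣ᵥ? φ x) * (𝟙 (B x x ≟ + (p ℕ.* n)) * c x)
    G n z = 𝟙 (W kᵥ z ≟ + (K ℕ.* n)) * c′ z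

    restricted : ℕ → ℤ
    restricted n = ∑ (box (p ℕ.* n) m) (F n)

    F-value : ∀ {x} n → x ∈Λ → B x x ≡ + (p ℕ.* n) → F n x ≡ c x
    F-value {x} n d e = trans (𝟙*-yes (p ∣ᵥ? φ x) (𝟙 (B x x ≟ + (p ℕ.* n)) * c x) d) (𝟙*-yes (B x x ≟ + (p ℕ.* n)) (c x) e)

    F-support : ∀ n x → F n x ≢ 0ℤ → (x ∈Λ) × B x x ≡ + (p ℕ.* n)
    F-support n x ne = proj₁ ne₁ , proj₁ (𝟙*≢0 (B x x ≟ + (p ℕ.* n)) (c x) (proj₂ ne₁))
      where
      ne₁ : (x ∈Λ) × (𝟙 (B x x ≟ + (p ℕ.* n)) * c x ≢ 0ℤ)
      ne₁ = 𝟙*≢0 (p ∣ᵥ? φ x) (𝟙 (B x x ≟ + (p ℕ.* n)) * c x) ne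

    G-value : ∀ {z} n → W kᵥ z ≡ + (K ℕ.* n) → + K · ψ z ≡ V z → ψ z ∈Λ → G n z ≡ c (ψ z)
    G-value {z} n e e′ d = trans (𝟙*-yes (W kᵥ z ≟ + (K ℕ.* n)) (c′ z) e)
      (trans (𝟙*-yes (+ K · ψ z ≟ᵥ V z) (𝟙 (p ∣ᵥ? φ (ψ z)) * c (ψ z)) e′) (𝟙*-yes (p ∣ᵥ? φ (ψ z)) (c (ψ z)) d))

    G-support : ∀ n z → G n z ≢ 0ℤ → W kᵥ z ≡ + (K ℕ.* n) × (+ K · ψ z ≡ V z) × (ψ z ∈Λ)
    G-support n z ne = proj₁ ne₁ , proj₁ ne₂ , proj₁ (𝟙*≢0 (p ∣ᵥ? φ (ψ z)) (c (ψ z)) (proj₂ ne₂))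
      where
      ne₁ : (W kᵥ z ≡ + (K ℕ.* n)) × (c′ z ≢ 0ℤ)
      ne₁ = 𝟙*≢0 (W kᵥ z ≟ + (K ℕ.* n)) (c′ z) ne
      ne₂ : (+ K · ψ z ≡ V z) × (𝟙 (p ∣ᵥ? φ (ψ z)) * c (ψ z) ≢ 0ℤ)
      ne₂ = 𝟙*≢0 (+ K · ψ z ≟ᵥ V z) (𝟙 (p ∣ᵥ? φ (ψ z)) * c (ψ z)) (proj₂ ne₁)

    F⇒G : ∀ n x → (x ∈Λ) → B x x ≡ + (p ℕ.* n) → ζ x V.∈! box (K ℕ.* n) m × G n (ζ x) ≡ F n x × ψ (ζ x) ≡ x
    F⇒G n x d e = box-∈! (K ℕ.* n) (ζ x) (W-coercive {n = K ℕ.* n} k (ζ x) 1≤k (trans (sym (W-kᵥ (ζ x))) w)) , values , back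
      where
      back : ψ (ζ x) ≡ x
      back = ψ-ζ {x} d
      w : W kᵥ (ζ x) ≡ + (K ℕ.* n)
      w = norm-transfer {x} n d e
      exact : + K · ψ (ζ x) ≡ V (ζ x)
      exact = trans (cong (+ K ·_) back) (sym (V-ζ {x} d))
      values : G n (ζ x) ≡ F n x
      values = trans (G-value {ζ x} n w exact (subst (_∈Λ) (sym back) d)) (trans (cong c back) (sym (F-value {x} n d e)))

    G⇒F : ∀ n z → W kᵥ z ≡ + (K ℕ.* n) → + K · ψ z ≡ V z → (ψ z ∈Λ) → ψ z V.∈! box (p ℕ.* n) m × F n (ψ z) ≡ G n z × ζ (ψ z) ≡ z
    G⇒F n z w e d = box-∈! (p ℕ.* n) (ψ z) (coercive {p ℕ.* n} (ψ z) q) , values , ζ-ψ {z} e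
      where
      q : B (ψ z) (ψ z) ≡ + (p ℕ.* n)
      q = norm-transfer⁻ {ψ z} n d (trans (cong (W kᵥ) (ζ-ψ {z} e)) w)
      values : F n (ψ z) ≡ G n z
      values = trans (F-value {ψ z} n d q) (sym (G-value {z} n w e d))

    in-coordinates : ∀ n → restricted n ≡ ∑ (box (K ℕ.* n) m) (G n)
    in-coordinates n = ∑-bij _≟ᵥ_ _≟ᵥ_ (box (p ℕ.* n) m) (box (K ℕ.* n) m) {F n} {G n} ζ ψ
      (λ x ne → let (d , e) = F-support n x ne in F⇒G n x d e)
      (λ z ne → let (w , e , d) = G-support n z ne in G⇒F n z w e d)

    V-shift : ∀ z t → V (z ⊕ + N′ · t) ≡ V z ⊕ + K · (+ N · V t)
    V-shift z t = begin
      ∑ᵥ (term (z ⊕ + N′ · t))                             ≡⟨ ∑ᵥ-cong termwise ⟩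
      ∑ᵥ (λ j → term z j ⊕ + K · + N · term t j)           ≡⟨ ∑ᵥ-⊕ (term z) (λ j → + K · + N · term t j) ⟩
      V z ⊕ ∑ᵥ (λ j → + K · + N · term t j)                ≡⟨ cong (V z ⊕_) (∑ᵥ-· (+ K) (λ j → + N · term t j)) ⟩
      V z ⊕ + K · ∑ᵥ (λ j → + N · term t j)                ≡⟨ cong (λ v → V z ⊕ + K · v) (∑ᵥ-· (+ N) (term t)) ⟩
      V z ⊕ + K · (+ N · V t)                              ∎
      where
      open ≡-Reasoning
      lem : ∀ k z n K t → k * (z + n * K * t) ≡ k * z + K * (n * (k * t))
      lem = solve-∀
      coefficient : ∀ j → + k j * lookup (z ⊕ + N′ · t) j ≡ + k j * lookup z j + + K * (+ N * (+ k j * lookup t j))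
      coefficient j = trans (cong (+ k j *_) (trans (lookup-zipWith _+_ j z (+ N′ · t)) (cong (λ w → lookup z j + w) (trans (lookup-map j (+ N′ *_) t) (cong (_* lookup t j) (pos-* N K))))))
        (lem (+ k j) (lookup z j) (+ N) (+ K) (lookup t j))
      termwise : ∀ j → term (z ⊕ + N′ · t) j ≡ term z j ⊕ + K · + N · term t j
      termwise j = begin
        (+ k j * lookup (z ⊕ + N′ · t) j) · ys j                                     ≡⟨ cong (_· ys j) (coefficient j) ⟩
        (+ k j * lookup z j + + K * (+ N * (+ k j * lookup t j))) · ys j             ≡⟨ ·-distribʳ (+ k j * lookup z j) (+ K * (+ N * (+ k j * lookup t j))) (ys j) ⟩
        term z j ⊕ (+ K * (+ N * (+ k j * lookup t j))) · ys j                       ≡⟨ cong (term z j ⊕_) (·-assoc (+ K) (+ N * (+ k j * lookup t j)) (ys j)) ⟩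
        term z j ⊕ + K · (+ N * (+ k j * lookup t j)) · ys j                         ≡⟨ cong (λ v → term z j ⊕ + K · v) (·-assoc (+ N) (+ k j * lookup t j) (ys j)) ⟩
        term z j ⊕ + K · + N · term t j                                              ∎

    V∈Λ : ∀ t → V t ∈Λ
    V∈Λ t = go (term t) (λ j → ∈Λ-· (+ k j * lookup t j) (ys∈Λ j))
      where
      φ𝟘 : 𝟘 ∈Λ
      φ𝟘 = subst (_∈Λ) (0·≡𝟘 𝟘) (subst (p ∣ᵥ_) (sym (φ-· 0ℤ 𝟘)) (∣ᵥ-scaled (φ 𝟘) (divides 0ℤ refl)))
      go : ∀ {n} (f : Fin n → Vec ℤ m) → (∀ j → f j ∈Λ) → ∑ᵥ f ∈Λ
      go {zero}  f h = φ𝟘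
      go {suc n} f h = ∈Λ-⊕ (h zero) (go (f ∘ suc) (h ∘ suc))

    ψ-shift : ∀ z t → ψ (z ⊕ + N′ · t) ≡ ψ z ⊕ + N · V t
    ψ-shift z t = trans (cong (map (_/ℕ K)) (V-shift z t)) (go (V z) (+ N · V t))
      where
      go : ∀ {n} (u v : Vec ℤ n) → map (_/ℕ K) (u ⊕ + K · v) ≡ map (_/ℕ K) u ⊕ v
      go []      []      = refl
      go (b ∷ u) (d ∷ v) = cong₂ _∷_ (/ℕ-shift K b d) (go u v)

    -- A shift of z by N K t moves `V z` by K (N · V t), hence the quotient `ψ z` by N · V t. This
    -- vector lies in the lattice and is a period of `c`.
    c′-periodic : ∀ z t → c′ (z ⊕ + N′ · t) ≡ c′ z
    c′-periodic z t = cong₂ _*_ (𝟙-⇔ (+ K · ψ (z ⊕ + N′ · t) ≟ᵥ V (z ⊕ + N′ · t)) (+ K · ψ z ≟ᵥ V z)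
        (λ e → ⊕-cancelʳ (+ K · ψ z) (V z) (+ K · (+ N · V t)) (trans (sym left) (trans e (V-shift z t))))
        (λ e → trans left (trans (cong (_⊕ + K · (+ N · V t)) e) (sym (V-shift z t)))))
      (cong₂ _*_ (𝟙-⇔ (p ∣ᵥ? φ (ψ (z ⊕ + N′ · t))) (p ∣ᵥ? φ (ψ z))
          (λ d → subst (_∈Λ) (⊕⊖ (ψ z) (+ N · V t)) (∈Λ-⊖ (subst (_∈Λ) (ψ-shift z t) d) (∈Λ-· (+ N) (V∈Λ t))))
          (λ d → subst (_∈Λ) (sym (ψ-shift z t)) (∈Λ-⊕ d (∈Λ-· (+ N) (V∈Λ t)))))
        (trans (cong c (ψ-shift z t)) (periodic (ψ z) (V t))))
      where
      left : + K · ψ (z ⊕ + N′ · t) ≡ + K · ψ z ⊕ + K · (+ N · V t)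
      left = trans (cong (+ K ·_) (ψ-shift z t)) (·-distribˡ (+ K) (ψ z) (+ N · V t))
      ⊕⊖ : ∀ {n} (u v : Vec ℤ n) → (u ⊕ v) ⊖ v ≡ u
      ⊕⊖ []      []      = refl
      ⊕⊖ (a ∷ u) (b ∷ v) = cong₂ _∷_ (lem a b) (⊕⊖ u v)
        where
        lem : ∀ a b → a + b - b ≡ a
        lem = solve-∀
      ⊕-cancelʳ : ∀ {n} (u v w : Vec ℤ n) → u ⊕ w ≡ v ⊕ w → u ≡ v
      ⊕-cancelʳ u v w e = trans (sym (⊕⊖ u w)) (trans (cong (_⊖ w) e) (⊕⊖ v w))
      ∈Λ-⊖ : ∀ {x y} → x ∈Λ → y ∈Λ → x ⊖ y ∈Λ
      ∈Λ-⊖ {x} {y} d e = subst (p ∣ᵥ_) (sym (φ-⊖ x y)) (∣ᵥ-⊖ d e)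

    c′-mod : ∀ z → c′ (modᵥ N′ z) ≡ c′ z
    c′-mod z = trans (sym (c′-periodic (modᵥ N′ z) (map (_/ℕ N′) z))) (cong c′ (go z))
      where
      go : ∀ {n} (v : Vec ℤ n) → modᵥ N′ v ⊕ + N′ · map (_/ℕ N′) v ≡ v
      go []      = refl
      go (b ∷ v) = cong₂ _∷_ (sym (trans (a≡a%ℕn+[a/ℕn]*n b N′) (cong (λ w → + (b %ℕ N′) + w) (*-comm (b /ℕ N′) (+ N′))))) (go v)

    private
      modᵥ-∈! : ∀ z → modᵥ N′ z V.∈! vecs (residues N′) m
      modᵥ-∈! z = vecs-∈! (go z)
        where
        go : ∀ {n} (v : Vec ℤ n) → All (_∈! residues N′) (modᵥ N′ v)
        go []      = []
        go (b ∷ v) = residues-∈! N′ (n%ℕd<d b N′) ∷ go v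

      kᵥ-∈! : kᵥ V.∈! vecs (residues (suc K)) m
      kᵥ-∈! = vecs-∈! (go k k≤K)
        where
        go : ∀ {n} (f : Fin n → ℕ) → (∀ j → f j ℕ.≤ K) → All (_∈! residues (suc K)) (tabulate (λ j → + f j))
        go {zero}  f h = []
        go {suc n} f h = residues-∈! (suc K) (ℕ.s≤s (h zero)) ∷ go (f ∘ suc) (h ∘ suc)

    private
      Z : ℕ → List (Vec ℤ m)
      Z n = box (K ℕ.* n) m
      R ks : List (Vec ℤ m)
      R = vecs (residues N′) m
      ks = vecs (residues (suc K)) m
      weight : ℕ → Vec ℤ m → ℤ
      weight n z = 𝟙 (W kᵥ z ≟ + (K ℕ.* n))

    regroup : ∀ n → ∑ (Z n) (G n) ≡ ∑[ ρ ∈ R ] (c′ ρ * θ (kᵥ , ρ) n)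
    regroup n = trans (∑-cong (Z n) (λ z → cong (weight n z *_) (sym (c′-mod z)))) (∑-fibres _≟ᵥ_ (Z n) R (modᵥ N′) modᵥ-∈! (weight n) c′)

    coefficients : Index → ℤ
    coefficients g = 𝟙 (proj₁ g ≟ᵥ kᵥ) * c′ (proj₂ g)

    -- As `c′` sees z only modulo `N′`, the sum over z splits by residue classes ρ into series
    -- `θ (kᵥ , ρ)` with the coefficients `c′ ρ`.
    restricted-Spanned : Spanned restricted
    restricted-Spanned = coefficients , λ n → trans (in-coordinates n) (trans (regroup n) (sym (∑-select _≟ᵥ_ ks R kᵥ kᵥ-∈! c′ (λ g → θ g n))))

-- A Hecke operator at p and the argument from bounded dimension.

module Hecke where

  open import Data.Nat as ℕ using (ℕ; zero; suc)
  import Data.Nat.Properties as ℕ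
  import Data.Nat.Divisibility as ℕ
  open import Data.Integer hiding (suc; _⊖_)
  open import Data.Integer.Properties
  open import Data.Integer.Divisibility.Signed
  open import Data.Integer.Tactic.RingSolver using (solve-∀)
  import Data.Nat.Tactic.RingSolver as ℕ
  open import Data.Nat.Primality using (Prime; prime⇒nonZero; prime⇒irreducible; ¬prime[1])
  open import Data.Fin using (Fin; zero; suc)
  open import Data.List using (List; []; _∷_; length)
  open import Data.List.Relation.Unary.All using () renaming (All to AllL; [] to []ᴸ; _∷_ to _∷ᴸ_; lookup to lookupL)
  open import Data.Nat.ListAction using (product)
  open import Data.Vec using (Vec; []; _∷_; map)
  open import Data.Vec.Relation.Unary.All using ([]; _∷_)
  open import Data.Product using (_×_; _,_; proj₁; proj₂; ∃)
  open import Data.Sum using (_⊎_; inj₁; inj₂)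
  open import Relation.Nullary
  open import Relation.Binary.PropositionalEquality
  open import Function using (_∘_)
  open Sums
  open LinDep
  open Vectors
  open ModPrime
  open Alternating
  open Frames
  open FrameStep
  open Parseval
  open Span

  -- The form is ⟨u, v⟩ modulo p in the coordinates (u, v). `faithful` says that these coordinates
  -- determine a vector modulo p.
  record Hyperbolic {m : ℕ} (F : Form m) (p h : ℕ) : Set where
    open Form F
    field
      u v  : Vec ℤ m → Vec ℤ h
      u-⊕  : ∀ x y → u (x ⊕ y) ≡ u x ⊕ u y
      u-·  : ∀ k x → u (k · x) ≡ k · u x
      v-⊕  : ∀ x y → v (x ⊕ y) ≡ v x ⊕ v y
      v-·  : ∀ k x → v (k · x) ≡ k · v x
      split : ∀ x → + p ∣ B x x - ⟨ u x , v x ⟩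
      faithful : ∀ x → p ∣ᵥ u x → p ∣ᵥ v x → p ∣ᵥ x

  p∣ᵥ⇒multiple : ∀ p {m} .{{_ : ℕ.NonZero p}} {x : Vec ℤ m} → p ∣ᵥ x → + p · map (_/ℕ p) x ≡ x
  p∣ᵥ⇒multiple p []                  = refl
  p∣ᵥ⇒multiple p (divides q refl ∷ ds) = cong₂ _∷_
    (trans (cong (+ p *_) (trans (cong (_/ℕ p) (*-comm q (+ p))) (/ℕ-exact p q))) (*-comm (+ p) q)) (p∣ᵥ⇒multiple p ds)

  -- To the right of the diagonal the first row is divisible by ℓ, so the other unknowns satisfy the
  -- smaller system. Once they are divisible by ℓ, column zero isolates the first one.
  triangular : ∀ {ℓ n} → Prime ℓ → (M : Fin n → Fin n → ℤ) → (∀ i j → i Data.Fin.< j → + ℓ ∣ M i j) → (∀ j → ¬ + ℓ ∣ M j j) →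
    (c : Fin n → ℤ) → (∀ j → + ℓ ∣ sum (λ i → c i * M i j)) → ∀ i → + ℓ ∣ c i
  triangular {ℓ} {suc n} pp M above diagonal c h = λ { zero → head ; (suc i) → tail i }
    where
    open PrimeIdeal (prime-ideal pp)
    tail : ∀ i → + ℓ ∣ c (suc i)
    tail = triangular pp (λ i j → M (suc i) (suc j)) (λ i j i<j → above (suc i) (suc j) (ℕ.s≤s i<j)) (diagonal ∘ suc) (c ∘ suc)
      (λ j → ∣m+n∣m⇒∣n (h (suc j)) (∣n⇒∣m*n (c zero) (above zero (suc j) (ℕ.s≤s ℕ.z≤n))))
    sum-∣ : ∀ {n} (f : Fin n → ℤ) → (∀ i → + ℓ ∣ f i) → + ℓ ∣ sum f
    sum-∣ {zero}  f h = divides 0ℤ refl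
    sum-∣ {suc n} f h = ∣m∣n⇒∣m+n (h zero) (sum-∣ (f ∘ suc) (h ∘ suc))
    head : + ℓ ∣ c zero
    head = Data.Sum.fromInj₁ (λ d → contradiction d (diagonal zero)) (prime (c zero) (M zero zero)
      (∣m+n∣n⇒∣m (h zero) (sum-∣ (λ i → c (suc i) * M (suc i) zero) (λ i → ∣m⇒∣m*n (M (suc i) zero) (tail i)))))
      where import Data.Sum

  ∣-combination : ∀ {q n} {A : Set} (G : List A) (a : Fin n → A → ℤ) (t : A → ℤ) (c : Fin n → ℤ) →
    AllL (λ g → q ∣ sum (λ i → c i * a i g)) G → q ∣ sum (λ i → c i * ∑[ g ∈ G ] (a i g * t g))
  ∣-combination {q} G a t c h = subst (q ∣_) (sym rearranged) (∑-∣ G h)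
    where
    ∑-∣ : ∀ G → AllL (λ g → q ∣ sum (λ i → c i * a i g)) G → q ∣ ∑[ g ∈ G ] (sum (λ i → c i * a i g) * t g)
    ∑-∣ []      []ᴸ      = divides 0ℤ refl
    ∑-∣ (g ∷ G) (d ∷ᴸ ds) = ∣m∣n⇒∣m+n (∣m⇒∣m*n (t g) d) (∑-∣ G ds)
    sum-∑ : ∀ {n} (f : Fin n → _ → ℤ) → sum (λ i → ∑ G (f i)) ≡ ∑ G (λ g → sum (λ i → f i g))
    sum-∑ {zero}  f = sym (∑-zero G)
    sum-∑ {suc n} f = trans (cong (λ z → ∑ G (f zero) + z) (sum-∑ (f ∘ suc))) (sym (∑-+ G (f zero) (λ g → sum (λ i → f (suc i) g))))
    rearranged : sum (λ i → c i * ∑[ g ∈ G ] (a i g * t g)) ≡ ∑[ g ∈ G ] (sum (λ i → c i * a i g) * t g)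
    rearranged = trans (sum-cong-≗ (λ i → sym (∑-*ˡ G (c i) (λ g → a i g * t g)))) (trans (sum-∑ (λ i g → c i * (a i g * t g)))
      (∑-cong G (λ g → trans (sum-cong-≗ (λ i → sym (*-assoc (c i) (a i g) (t g)))) (sym (*-distribʳ-sum (t g) (λ i → c i * a i g))))))

  module Principle {h : ℕ} (F : Form (suc h ℕ.+ suc h)) (N : ℕ) .{{N≢0 : ℕ.NonZero N}} {ℓ : ℕ} (ℓ-prime : Prime ℓ) where
    open Form F

    private
      m H : ℕ
      H = suc h
      m = H ℕ.+ H
      1≤D : 1 ℕ.≤ suc bound
      1≤D = ℕ.s≤s ℕ.z≤n
      -- `g` bounds frame vectors in units of √p. With s² ≤ 4p this gives a_j ≤ `C` for the norms p
      -- a_j, and `K` = C! is divisible by every possible a_j, so that the diagonal coefficients K /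
      -- a_j are integers.
      g C K : ℕ
      g = Growth.growth (suc bound) m 1≤D m
      C = 4 ℕ.* bound ℕ.* (g ℕ.* g)
      K = C ℕ.!
      instance
        K≢0 : ℕ.NonZero K
        K≢0 = C ℕ.!≢0
        NK≢0 : ℕ.NonZero (N ℕ.* K)
        NK≢0 = ℕ.m*n≢0 N K

    open Theta m K (N ℕ.* K) public

    Periodic : (Vec ℤ m → ℤ) → Set
    Periodic c = ∀ x y → c (x ⊕ + N · y) ≡ c x

    series : (Vec ℤ m → ℤ) → ℕ → ℤ
    series c n = ∑[ x ∈ box n m ] (𝟙 (B x x ≟ + n) * c x)

    module _ {p : ℕ} (pp : Prime p) where
      private instance
        p≢0 : ℕ.NonZero p
        p≢0 = prime⇒nonZero pp

      sublattice : Isotropic F p H → (Vec ℤ m → ℤ) → ℕ → ℤ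
      sublattice Λ c n = ∑[ x ∈ box (p ℕ.* n) m ] (𝟙 (p ∣ᵥ? Isotropic.φ Λ x) * (𝟙 (B x x ≟ + (p ℕ.* n)) * c x))

      sublattice-Spanned : (Λ : Isotropic F p H) (c : Vec ℤ m → ℤ) → Periodic c → Spanned (sublattice Λ c)
      sublattice-Spanned Λ c periodic = from-root (sqrt-bounds p (ℕ.>-nonZero⁻¹ p))
        where
        open Isotropic Λ
        module Root (s : ℕ) (p≤s² : p ℕ.≤ s ℕ.* s) (s²≤4p : s ℕ.* s ℕ.≤ 4 ℕ.* p) where
          coordinates : Frame F pp Λ (suc bound) 1≤D (ℕ.n≤1+n bound) s p≤s² s²≤4p → Spanned (sublattice Λ c)
          coordinates fr = Coordinates.restricted-Spanned F Λ vec nonzero orth member K a k norm ka≡K 1≤k k≤K N c periodic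
            where
            open Frame fr
            a : Fin m → ℕ
            a j = ∣ quotient (isotropic (vec j) (vec j) (member j) (member j)) ∣
            norm-abs : ∀ j → ∣ B (vec j) (vec j) ∣ ≡ a j ℕ.* p
            norm-abs j with isotropic (vec j) (vec j) (member j) (member j)
            ... | divides q e = trans (cong ∣_∣ e) (abs-* q (+ p))
            norm : ∀ j → B (vec j) (vec j) ≡ + p * + a j
            norm j = trans (sym (0≤i⇒+∣i∣≡i (nonneg (vec j)))) (trans (cong +_ (trans (norm-abs j) (ℕ.*-comm (a j) p))) (pos-* p (a j)))
            a≢0 : ∀ j → a j ≢ 0
            a≢0 j e = nonzero j (definite (vec j) (trans (norm j) (trans (cong (λ z → + p * + z) e) (*-zeroʳ (+ p)))))
            a≤C : ∀ j → a j ℕ.≤ C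
            a≤C j = ℕ.*-cancelʳ-≤ (a j) C p (begin
              a j ℕ.* p                              ≡⟨ norm-abs j ⟨
              ∣ B (vec j) (vec j) ∣                  ≤⟨ B-bound (vec j) (vec j) (bounded j) (bounded j) ⟩
              bound ℕ.* (g ℕ.* s ℕ.* (g ℕ.* s))      ≡⟨ lem bound g s ⟩
              bound ℕ.* (g ℕ.* g) ℕ.* (s ℕ.* s)      ≤⟨ ℕ.*-monoʳ-≤ (bound ℕ.* (g ℕ.* g)) s²≤4p ⟩
              bound ℕ.* (g ℕ.* g) ℕ.* (4 ℕ.* p)      ≡⟨ lem′ bound g p ⟩
              C ℕ.* p                                ∎)
              where
              open ℕ.≤-Reasoning
              lem : ∀ b g s → b ℕ.* (g ℕ.* s ℕ.* (g ℕ.* s)) ≡ b ℕ.* (g ℕ.* g) ℕ.* (s ℕ.* s)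
              lem = ℕ.solve-∀
              lem′ : ∀ b g p → b ℕ.* (g ℕ.* g) ℕ.* (4 ℕ.* p) ≡ 4 ℕ.* b ℕ.* (g ℕ.* g) ℕ.* p
              lem′ = ℕ.solve-∀
            a∣K : ∀ j → a j ℕ.∣ K
            a∣K j = divides-factorial (a j) (a≢0 j) (a≤C j)
              where
              divides-factorial : ∀ n → n ≢ 0 → n ℕ.≤ C → n ℕ.∣ K
              divides-factorial zero    ne _  = contradiction refl ne
              divides-factorial (suc n) _  le = ℕ.∣-trans (ℕ.m∣m*n (n ℕ.!)) (ℕ.m≤n⇒m!∣n! le)
            k : Fin m → ℕ
            k j = ℕ.quotient (a∣K j)
            k*a : ∀ j → K ≡ k j ℕ.* a j
            k*a j = ℕ._∣_.equality (a∣K j)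
            ka≡K : ∀ j → + k j * + a j ≡ + K
            ka≡K j = trans (sym (pos-* (k j) (a j))) (cong +_ (sym (k*a j)))
            1≤k : ∀ j → 1 ℕ.≤ k j
            1≤k j = ℕ.n≢0⇒n>0 (λ e → ℕ.≢-nonZero⁻¹ K (trans (k*a j) (cong (ℕ._* a j) e)))
            k≤K : ∀ j → k j ℕ.≤ K
            k≤K j = subst (k j ℕ.≤_) (sym (k*a j)) (ℕ.m≤m*n (k j) (a j) {{ℕ.≢-nonZero (a≢0 j)}})
        from-root : (∃ λ s → 1 ℕ.≤ s × p ℕ.≤ s ℕ.* s × s ℕ.* s ℕ.≤ 4 ℕ.* p) → Spanned (sublattice Λ c)
        from-root (s , _ , p≤s² , s²≤4p) = Root.coordinates s p≤s² s²≤4p (frame F pp Λ (suc bound) 1≤D (ℕ.n≤1+n bound) s p≤s² s²≤4p)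

      module Operator (2<p : 2 ℕ.< p) (hyp : Hyperbolic F p H) where
        open Hyperbolic hyp
        open PrimeIdeal (prime-ideal pp)

        private
          -- Passes from the quadratic to the bilinear form. The identity yields 2 B(x, y), and p >
          -- 2 allows the division by 2.
          polarize : (φ : Vec ℤ m → Vec ℤ H) → (∀ x y → φ (x ⊕ y) ≡ φ x ⊕ φ y) → (∀ x → p ∣ᵥ φ x → + p ∣ B x x) →
            ∀ x y → p ∣ᵥ φ x → p ∣ᵥ φ y → + p ∣ B x y
          polarize φ φ-⊕ null x y d e = Data.Sum.fromInj₂ (λ d₂ → contradiction (ℕ.∣⇒≤ (∣⇒∣ᵤ d₂)) (ℕ.<⇒≱ 2<p)) (prime (+ 2) (B x y)
            (∣-lin₃ 1ℤ -1ℤ -1ℤ (null (x ⊕ y) (subst (p ∣ᵥ_) (sym (φ-⊕ x y)) (∣ᵥ-⊕ d e))) (null x d) (null y e)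
              (trans (lem (B x x) (B x y) (B y y)) (cong (λ z → 1ℤ * z + -1ℤ * B x x + -1ℤ * B y y) (sym expand)))))
            where
            import Data.Sum
            lem : ∀ a b c → + 2 * b ≡ 1ℤ * (a + b + (b + c)) + -1ℤ * a + -1ℤ * c
            lem = solve-∀
            expand : B (x ⊕ y) (x ⊕ y) ≡ B x x + B x y + (B x y + B y y)
            expand = trans (B-⊕ x y (x ⊕ y)) (cong₂ _+_ (B-⊕ʳ x x y) (trans (B-⊕ʳ y x y) (cong (_+ B y y) (B-comm y x))))

          null-split : ∀ x → + p ∣ ⟨ u x , v x ⟩ → + p ∣ B x x
          null-split x d = subst (+ p ∣_) (lem (B x x) ⟨ u x , v x ⟩) (∣m∣n⇒∣m+n (split x) d)
            where
            lem : ∀ a b → a - b + b ≡ a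
            lem = solve-∀

          split-null : ∀ x → + p ∣ B x x → + p ∣ ⟨ u x , v x ⟩
          split-null x d = subst (+ p ∣_) (lem (B x x) ⟨ u x , v x ⟩) (∣m∣n⇒∣m-n d (split x))
            where
            lem : ∀ a b → a - (a - b) ≡ b
            lem = solve-∀

        vertical : Isotropic F p H
        vertical = record { φ = u ; φ-⊕ = u-⊕ ; φ-· = u-· ; isotropic = polarize u u-⊕ (λ x d → null-split x (∣ᵥ-⟨⟩ (v x) d)) }

        graph : Alt H → Isotropic F p H
        graph A = record { φ = φ ; φ-⊕ = φ-⊕ ; φ-· = φ-· ; isotropic = polarize φ φ-⊕ null }
          where
          φ : Vec ℤ m → Vec ℤ H
          φ x = v x ⊖ act A (u x)
          ⊖-interchange : ∀ {n} (a b c d : Vec ℤ n) → (a ⊕ b) ⊖ (c ⊕ d) ≡ (a ⊖ c) ⊕ (b ⊖ d)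
          ⊖-interchange []      []      []      []      = refl
          ⊖-interchange (a ∷ as) (b ∷ bs) (c ∷ cs) (d ∷ ds) = cong₂ _∷_ (lem a b c d) (⊖-interchange as bs cs ds)
            where
            lem : ∀ a b c d → a + b - (c + d) ≡ a - c + (b - d)
            lem = solve-∀
          ·-⊖ : ∀ {n} k (a b : Vec ℤ n) → k · a ⊖ k · b ≡ k · (a ⊖ b)
          ·-⊖ k []       []       = refl
          ·-⊖ k (a ∷ as) (b ∷ bs) = cong₂ _∷_ (lem k a b) (·-⊖ k as bs)
            where
            lem : ∀ k a b → k * a - k * b ≡ k * (a - b)
            lem = solve-∀
          φ-⊕ : ∀ x y → φ (x ⊕ y) ≡ φ x ⊕ φ y
          φ-⊕ x y = trans (cong₂ _⊖_ (v-⊕ x y) (trans (cong (act A) (u-⊕ x y)) (act-⊕ A (u x) (u y)))) (⊖-interchange (v x) (v y) (act A (u x)) (act A (u y)))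
          φ-· : ∀ k x → φ (k · x) ≡ k · φ x
          φ-· k x = trans (cong₂ _⊖_ (v-· k x) (trans (cong (act A) (u-· k x)) (act-· A k (u x)))) (·-⊖ k (v x) (act A (u x)))
          null : ∀ x → p ∣ᵥ φ x → + p ∣ B x x
          null x d = null-split x (subst (+ p ∣_) (trans (⟨,⟩-⊖ (v x) (act A (u x)) (u x))
            (trans (cong₂ _-_ (⟨,⟩-comm (v x) (u x)) (trans (⟨,⟩-comm (act A (u x)) (u x)) (⟨u,Au⟩≡0 A (u x)))) (+-identityʳ ⟨ u x , v x ⟩))) (∣ᵥ-⟨⟩ (u x) d))

        -- The vertical lattice u = 0 is taken `total pp h` times: isotropic vectors with u ≢ 0 lie
        -- on that many graphs, and this multiplicity gives the vectors with u ≡ 0 the same count.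
        T : (Vec ℤ m → ℤ) → ℕ → ℤ
        T c n = ∑[ A ∈ alts p H ] sublattice (graph A) c n + total pp h * sublattice vertical c n

        T-Spanned : ∀ c → Periodic c → Spanned (T c)
        T-Spanned c per = Spanned-+ (Spanned-∑ (alts p H) (λ A → sublattice-Spanned (graph A) c per)) (Spanned-* (total pp h) (sublattice-Spanned vertical c per))

        multiples : (Vec ℤ m → ℤ) → ℕ → ℤ
        multiples c n = ∑[ x ∈ box (p ℕ.* n) m ] (𝟙 (p ∣ᵥ? x) * (𝟙 (B x x ≟ + (p ℕ.* n)) * c x))

        -- An isotropic vector with u ≢ 0 lies on total h graphs; one with u ≡ 0 only on the vertical lattice,
        -- unless it is divisible by p.
        T-formula : ∀ c n → T c n ≡ total pp h * series c (p ℕ.* n) + total pp H * multiples c n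
        T-formula c n = begin
          ∑[ A ∈ alts p H ] ∑[ x ∈ X ] (𝟙 (p ∣ᵥ? v x ⊖ act A (u x)) * w x) + κ * ∑[ x ∈ X ] (𝟙 (p ∣ᵥ? u x) * w x)
            ≡⟨ cong₂ _+_ (trans (∑-swap (alts p H) X _) (∑-cong X (λ x → ∑-*ʳ (alts p H) (w x) _))) (sym (∑-*ˡ X κ _)) ⟩
          ∑[ x ∈ X ] (graphs pp (u x) (v x) * w x) + ∑[ x ∈ X ] (κ * (𝟙 (p ∣ᵥ? u x) * w x))
            ≡⟨ ∑-+ X _ _ ⟨
          ∑[ x ∈ X ] (graphs pp (u x) (v x) * w x + κ * (𝟙 (p ∣ᵥ? u x) * w x))
            ≡⟨ ∑-cong X pointwise ⟩
          ∑[ x ∈ X ] (κ * w x + total pp H * (𝟙 (p ∣ᵥ? x) * w x))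
            ≡⟨ trans (∑-+ X _ _) (cong₂ _+_ (∑-*ˡ X κ w) (∑-*ˡ X (total pp H) _)) ⟩
          κ * ∑[ x ∈ X ] w x + total pp H * ∑[ x ∈ X ] (𝟙 (p ∣ᵥ? x) * w x) ∎
          where
          open ≡-Reasoning
          X = box (p ℕ.* n) m
          κ = total pp h
          w : Vec ℤ m → ℤ
          w x = 𝟙 (B x x ≟ + (p ℕ.* n)) * c x
          u-mult : ∀ x → p ∣ᵥ x → p ∣ᵥ u x
          u-mult x d = subst (λ z → p ∣ᵥ u z) (p∣ᵥ⇒multiple p d) (subst (p ∣ᵥ_) (sym (u-· (+ p) (map (_/ℕ p) x))) (∣ᵥ-scaled (u (map (_/ℕ p) x)) ∣-refl))
          v-mult : ∀ x → p ∣ᵥ x → p ∣ᵥ v x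
          v-mult x d = subst (λ z → p ∣ᵥ v z) (p∣ᵥ⇒multiple p d) (subst (p ∣ᵥ_) (sym (v-· (+ p) (map (_/ℕ p) x))) (∣ᵥ-scaled (v (map (_/ℕ p) x)) ∣-refl))
          cancel-w : ∀ G κ τ w → w ≡ 0ℤ → ∀ i j → G * w + κ * (i * w) ≡ κ * w + τ * (j * w)
          cancel-w G κ τ _ refl i j = lem G κ τ i j
            where
            lem : ∀ G κ τ i j → G * 0ℤ + κ * (i * 0ℤ) ≡ κ * 0ℤ + τ * (j * 0ℤ)
            lem = solve-∀
          combine : ∀ G κ τ w i j → G + κ * i ≡ κ + τ * j → G * w + κ * (i * w) ≡ κ * w + τ * (j * w)
          combine G κ τ w i j e = trans (lem G κ w i) (trans (cong (_* w) e) (lem′ κ τ w j))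
            where
            lem : ∀ G κ w i → G * w + κ * (i * w) ≡ (G + κ * i) * w
            lem = solve-∀
            lem′ : ∀ κ τ w j → (κ + τ * j) * w ≡ κ * w + τ * (j * w)
            lem′ = solve-∀
          count : ∀ x → + p ∣ B x x → graphs pp (u x) (v x) + κ * 𝟙 (p ∣ᵥ? u x) ≡ κ + total pp H * 𝟙 (p ∣ᵥ? x)
          count x d = by-cases (p ∣ᵥ? u x)
            where
            by-cases : Dec (p ∣ᵥ u x) → graphs pp (u x) (v x) + κ * 𝟙 (p ∣ᵥ? u x) ≡ κ + total pp H * 𝟙 (p ∣ᵥ? x)
            by-cases (yes ux) = trans (cong₂ _+_ (trans (graphs-zero pp (u x) (v x) ux) (cong (total pp H *_) (𝟙-⇔ (p ∣ᵥ? v x) (p ∣ᵥ? x) (faithful x ux) (v-mult x))))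
                (trans (cong (κ *_) (𝟙-yes (p ∣ᵥ? u x) ux)) (*-identityʳ κ)))
              (+-comm (total pp H * 𝟙 (p ∣ᵥ? x)) κ)
            by-cases (no ux∉) = trans (cong₂ _+_ (graphs-nonzero pp (u x) (v x) ux∉ (split-null x d)) (trans (cong (κ *_) (𝟙-no (p ∣ᵥ? u x) ux∉)) (*-zeroʳ κ)))
              (cong (λ z → κ + z) (sym (trans (cong (total pp H *_) (𝟙-no (p ∣ᵥ? x) (ux∉ ∘ u-mult x))) (*-zeroʳ (total pp H)))))
          pointwise : ∀ x → graphs pp (u x) (v x) * w x + κ * (𝟙 (p ∣ᵥ? u x) * w x) ≡ κ * w x + total pp H * (𝟙 (p ∣ᵥ? x) * w x)
          pointwise x = by-cases (B x x ≟ + (p ℕ.* n))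
            where
            by-cases : Dec (B x x ≡ + (p ℕ.* n)) → graphs pp (u x) (v x) * w x + κ * (𝟙 (p ∣ᵥ? u x) * w x) ≡ κ * w x + total pp H * (𝟙 (p ∣ᵥ? x) * w x)
            by-cases (yes e) = combine (graphs pp (u x) (v x)) κ (total pp H) (w x) (𝟙 (p ∣ᵥ? u x)) (𝟙 (p ∣ᵥ? x))
              (count x (divides (+ n) (trans e (trans (pos-* p n) (*-comm (+ p) (+ n))))))
            by-cases (no ne) = cancel-w (graphs pp (u x) (v x)) κ (total pp H) (w x) (𝟙*-no (B x x ≟ + (p ℕ.* n)) (c x) ne) (𝟙 (p ∣ᵥ? u x)) (𝟙 (p ∣ᵥ? x))

        B-scaled : ∀ y → B (+ p · y) (+ p · y) ≡ + p * (+ p * B y y)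
        B-scaled y = trans (B-· (+ p) y (+ p · y)) (cong (+ p *_) (B-·ʳ (+ p) y y))

        -- A multiple p y at level p n has p B(y, y) = n, so n < p leaves y = 𝟘 alone. This is where
        -- the vanishing of `c` at 𝟘 enters.
        multiples-small : ∀ c → c 𝟘 ≡ 0ℤ → ∀ n → n ℕ.< p → multiples c n ≡ 0ℤ
        multiples-small c c0 n n<p = ∑-all0 (box (p ℕ.* n) m) λ x → by-cases x (p ∣ᵥ? x) (B x x ≟ + (p ℕ.* n))
          where
          by-cases : ∀ x → (d : Dec (p ∣ᵥ x)) (e : Dec (B x x ≡ + (p ℕ.* n))) → 𝟙 d * (𝟙 e * c x) ≡ 0ℤ
          by-cases x (no _)  e      = refl
          by-cases x (yes d) (no _) = refl
          by-cases x (yes d) (yes e) = trans (cong (λ z → 1ℤ * (1ℤ * c z)) x≡𝟘) (cong (λ z → 1ℤ * (1ℤ * z)) c0)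
            where
            y = map (_/ℕ p) x
            x≡ = p∣ᵥ⇒multiple p d
            pQ≡n : + p * B y y ≡ + n
            pQ≡n = *-cancelˡ-≡ (+ p) _ _ (trans (sym (B-scaled y)) (trans (cong₂ B x≡ x≡) (trans e (pos-* p n))))
            n≡ : p ℕ.* ∣ B y y ∣ ≡ n
            n≡ = trans (sym (abs-* (+ p) (B y y))) (cong ∣_∣ pQ≡n)
            q≡0 : ∣ B y y ∣ ≡ 0
            q≡0 = small ∣ B y y ∣ n≡
              where
              small : ∀ q → p ℕ.* q ≡ n → q ≡ 0
              small zero    _  = refl
              small (suc q) eq = contradiction n<p (ℕ.≤⇒≯ (subst (p ℕ.≤_) eq (ℕ.m≤m*n p (suc q))))
            x≡𝟘 : x ≡ 𝟘
            x≡𝟘 = trans (sym x≡) (trans (cong (+ p ·_) (definite y (∣i∣≡0⇒i≡0 q≡0))) (·𝟘 m (+ p)))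

        M : (Vec ℤ m → ℤ) → ℕ → Vec ℤ m → ℤ
        M c n x = 𝟙 (p ∣ᵥ? x) * (𝟙 (B x x ≟ + (p ℕ.* (p ℕ.* n))) * c x)

        S : (Vec ℤ m → ℤ) → ℕ → Vec ℤ m → ℤ
        S c n y = 𝟙 (B y y ≟ + n) * c (+ p · y)

        B-scaled-up : ∀ y {n} → B y y ≡ + n → B (+ p · y) (+ p · y) ≡ + (p ℕ.* (p ℕ.* n))
        B-scaled-up y {n} e = trans (B-scaled y) (trans (cong (λ z → + p * (+ p * z)) e) (trans (cong (+ p *_) (sym (pos-* p n))) (sym (pos-* p (p ℕ.* n)))))

        B-scaled-down : ∀ y {n} → B (+ p · y) (+ p · y) ≡ + (p ℕ.* (p ℕ.* n)) → B y y ≡ + n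
        B-scaled-down y {n} e = *-cancelˡ-≡ (+ p) (B y y) (+ n) (*-cancelˡ-≡ (+ p) (+ p * B y y) (+ p * + n)
          (trans (sym (B-scaled y)) (trans e (trans (pos-* p (p ℕ.* n)) (cong (+ p *_) (pos-* p n))))))

        M-value : ∀ c n y → B y y ≡ + n → M c n (+ p · y) ≡ c (+ p · y)
        M-value c n y e = trans (𝟙*-yes (p ∣ᵥ? + p · y) (𝟙 (B (+ p · y) (+ p · y) ≟ + (p ℕ.* (p ℕ.* n))) * c (+ p · y)) (∣ᵥ-scaled y ∣-refl))
          (𝟙*-yes (B (+ p · y) (+ p · y) ≟ + (p ℕ.* (p ℕ.* n))) (c (+ p · y)) (B-scaled-up y e))

        M-support : ∀ c n x → M c n x ≢ 0ℤ → (p ∣ᵥ x) × B x x ≡ + (p ℕ.* (p ℕ.* n))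
        M-support c n x ne = proj₁ ne₁ , proj₁ (𝟙*≢0 (B x x ≟ + (p ℕ.* (p ℕ.* n))) (c x) (proj₂ ne₁))
          where
          ne₁ : (p ∣ᵥ x) × (𝟙 (B x x ≟ + (p ℕ.* (p ℕ.* n))) * c x ≢ 0ℤ)
          ne₁ = 𝟙*≢0 (p ∣ᵥ? x) (𝟙 (B x x ≟ + (p ℕ.* (p ℕ.* n))) * c x) ne

        M⇒S : ∀ c n x → p ∣ᵥ x → B x x ≡ + (p ℕ.* (p ℕ.* n)) → map (_/ℕ p) x V.∈! box n m × S c n (map (_/ℕ p) x) ≡ M c n x × + p · map (_/ℕ p) x ≡ x
        M⇒S c n x d e = box-∈! n y (coercive {n} y q) , trans (𝟙*-yes (B y y ≟ + n) (c (+ p · y)) q) (trans (sym (M-value c n y q)) (cong (M c n) x≡)) , x≡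
          where
          y = map (_/ℕ p) x
          x≡ : + p · y ≡ x
          x≡ = p∣ᵥ⇒multiple p d
          q : B y y ≡ + n
          q = B-scaled-down y (trans (cong₂ B x≡ x≡) e)

        S⇒M : ∀ c n y → B y y ≡ + n → + p · y V.∈! box (p ℕ.* (p ℕ.* n)) m × M c n (+ p · y) ≡ S c n y × map (_/ℕ p) (+ p · y) ≡ y
        S⇒M c n y q = box-∈! (p ℕ.* (p ℕ.* n)) (+ p · y) (coercive {p ℕ.* (p ℕ.* n)} (+ p · y) (B-scaled-up y q)) ,
          trans (M-value c n y q) (sym (𝟙*-yes (B y y ≟ + n) (c (+ p · y)) q)) , back y
          where
          back : ∀ {k} (y : Vec ℤ k) → map (_/ℕ p) (+ p · y) ≡ y
          back []      = refl
          back (b ∷ y) = cong₂ _∷_ (/ℕ-exact p b) (back y)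

        multiples-scaled : ∀ c n → multiples c (p ℕ.* n) ≡ series (λ x → c (+ p · x)) n
        multiples-scaled c n = ∑-bij _≟ᵥ_ _≟ᵥ_ (box (p ℕ.* (p ℕ.* n)) m) (box n m) {M c n} {S c n} (map (_/ℕ p)) (+ p ·_)
          (λ x ne → let (d , e) = M-support c n x ne in M⇒S c n x d e)
          (λ y ne → S⇒M c n y (proj₁ (𝟙*≢0 (B y y ≟ + n) (c (+ p · y)) ne)))

        ∤total : ℓ ≢ p → ∀ n → ¬ + ℓ ∣ total pp n
        ∤total ℓ≢p = go
          where
          module L = PrimeIdeal (prime-ideal ℓ-prime)
          ∤p : ¬ + ℓ ∣ + p
          ∤p d with prime⇒irreducible pp (∣⇒∣ᵤ d)
          ... | inj₁ e = ¬prime[1] (subst Prime e ℓ-prime)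
          ... | inj₂ e = ℓ≢p e
          ∤p^ : ∀ n → ¬ + ℓ ∣ (+ p) ^ n
          ∤p^ zero    d = L.proper d
          ∤p^ (suc n) d = Data.Sum.[ ∤p , ∤p^ n ]′ (L.prime (+ p) ((+ p) ^ n) d)
            where import Data.Sum
          go : ∀ n → ¬ + ℓ ∣ total pp n
          go zero    d = L.proper d
          go (suc n) d = Data.Sum.[ ∤p^ n , go n ]′ (L.prime ((+ p) ^ n) (total pp n) d)
            where import Data.Sum

    Visible : (ℕ → ℤ) → Set
    Visible f = ∃ λ n → ¬ + ℓ ∣ f n

    -- A series of the bounded space that is nonzero modulo `ℓ` but vanishes modulo `ℓ` up to `Y`.
    Deep : ℕ → Set
    Deep Y = ∃ λ f → Spanned f × (∀ n → n ℕ.≤ Y → + ℓ ∣ f n) × Visible f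

    -- If the series of `c` vanishes far enough modulo ℓ, `T-formula` makes `T c` divisible by ℓ up
    -- to Y, since the multiples of p contribute nothing there. At p n₀ the formula leaves
    -- `total pp H`, a power of p and hence a unit modulo ℓ, times the given nonzero coefficient.
    hecke-step : ∀ {p} (pp : Prime p) → 2 ℕ.< p → ℓ ≢ p → Hyperbolic F p H → ∀ Y → Y ℕ.< p →
      ∀ c → Periodic c → c 𝟘 ≡ 0ℤ → Visible (series (λ x → c (+ p · x))) → Visible (series c) ⊎ Deep Y
    hecke-step {p} pp 2<p ℓ≢p hyp Y Y<p c per c0 (n₀ , n₀∤) = search (ℕ.anyUpTo? (λ n → ¬? (+ ℓ ∣? series c n)) (suc depth))
      where
      open Operator pp 2<p hyp
      module L = PrimeIdeal (prime-ideal ℓ-prime)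
      -- Covers the coefficients of `series c` that are used: p n for n ≤ Y, and p (p n₀). A bounded
      -- search replaces the undecidable question whether the whole series vanishes.
      depth = p ℕ.* Y ℕ.+ p ℕ.* (p ℕ.* n₀)
      search : Dec (∃ λ n → n ℕ.< suc depth × ¬ + ℓ ∣ series c n) → Visible (series c) ⊎ Deep Y
      search (yes (n , _ , n∤)) = inj₁ (n , n∤)
      search (no none) = inj₂ (T c , T-Spanned c per , low , p ℕ.* n₀ , high)
        where
        below : ∀ n → n ℕ.≤ depth → + ℓ ∣ series c n
        below n le = decidable-stable (+ ℓ ∣? series c n) (λ n∤ → none (n , ℕ.s≤s le , n∤))
        low : ∀ n → n ℕ.≤ Y → + ℓ ∣ T c n
        low n le = subst (+ ℓ ∣_) (sym (trans (T-formula c n) (cong (λ z → total pp h * series c (p ℕ.* n) + total pp H * z) (multiples-small c c0 n (ℕ.≤-<-trans le Y<p)))))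
          (∣m∣n⇒∣m+n (∣n⇒∣m*n (total pp h) (below (p ℕ.* n) (ℕ.≤-trans (ℕ.*-monoʳ-≤ p le) (ℕ.m≤m+n _ _)))) (divides 0ℤ (*-zeroʳ (total pp H))))
        high : ¬ + ℓ ∣ T c (p ℕ.* n₀)
        high d = Data.Sum.[ ∤total ℓ≢p H , n₀∤ ]′ (L.prime (total pp H) (series (λ x → c (+ p · x)) n₀)
          (∣m+n∣m⇒∣n (subst (+ ℓ ∣_) (trans (T-formula c (p ℕ.* n₀)) (cong (λ z → total pp h * series c (p ℕ.* (p ℕ.* n₀)) + total pp H * z) (multiples-scaled c n₀))) d)
            (∣n⇒∣m*n (total pp h) (below (p ℕ.* (p ℕ.* n₀)) (ℕ.m≤n+m _ _)))))
          where import Data.Sum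

    Admissible : ℕ → ℕ → Set
    Admissible Y p = Prime p × 2 ℕ.< p × ℓ ≢ p × Hyperbolic F p H × Y ℕ.< p

    -- The primes of the multiplier are removed one at a time. Scaling by p preserves periodicity
    -- and the value at 𝟘, so the tail of the list is applied to `c (+ p · x)` and `hecke-step`
    -- removes p at the end.
    hecke-chain : ∀ Y (ps : List ℕ) → AllL (Admissible Y) ps → ∀ c → Periodic c → c 𝟘 ≡ 0ℤ →
      Visible (series (λ x → c (+ product ps · x))) → Visible (series c) ⊎ Deep Y
    hecke-chain Y []       []ᴸ        c per c0 (n , n∤) = inj₁ (n , λ d → n∤ (subst (+ ℓ ∣_) (∑-cong (box n m) (λ x → cong (λ z → 𝟙 (B x x ≟ + n) * c z) (sym (1·≡ x)))) d))
    hecke-chain Y (p ∷ ps) ((pp , 2<p , ℓ≢p , hyp , Y<p) ∷ᴸ adm) c per c0 (n , n∤) = continue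
      (hecke-chain Y ps adm (λ x → c (+ p · x)) per′ (trans (cong c (·𝟘 m (+ p))) c0)
        (n , λ d → n∤ (subst (+ ℓ ∣_) (∑-cong (box n m) (λ x → cong (λ z → 𝟙 (B x x ≟ + n) * c z) (trans (sym (·-assoc (+ p) (+ product ps) x)) (cong (_· x) (sym (pos-* p (product ps))))))) d)))
      where
      per′ : Periodic (λ x → c (+ p · x))
      per′ x y = trans (cong c (trans (·-distribˡ (+ p) x (+ N · y)) (cong (+ p · x ⊕_) (trans (sym (·-assoc (+ p) (+ N) y)) (trans (cong (_· y) (*-comm (+ p) (+ N))) (·-assoc (+ N) (+ p) y)))))) (per (+ p · x) (+ p · y))
      continue : Visible (series (λ x → c (+ p · x))) ⊎ Deep Y → Visible (series c) ⊎ Deep Y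
      continue (inj₁ vis) = hecke-step pp 2<p ℓ≢p hyp Y Y<p c per c0 vis
      continue (inj₂ deep) = inj₂ deep

    private
      -- Spanned series with a triangular matrix of coefficients modulo `ℓ`; `limit` records how
      -- deep the next series has to vanish.
      record Staircase (n : ℕ) : Set where
        field
          fn      : Fin n → ℕ → ℤ
          spanned : ∀ i → Spanned (fn i)
          index   : Fin n → ℕ
          diagonal : ∀ i → ¬ + ℓ ∣ fn i (index i)
          above   : ∀ i j → i Data.Fin.< j → + ℓ ∣ fn i (index j)
          limit   : ℕ
          index≤  : ∀ i → index i ℕ.≤ limit

      -- The coefficient vectors over `indices` are one too many, hence dependent modulo ℓ. The
      -- relation carries over to the values of the series, where the triangular matrix with unit
      -- diagonal forbids it.
      no-staircase : ¬ Staircase (suc (length indices))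
      no-staircase S = proj₂ (proj₁ (proj₂ dep)) (triangular ℓ-prime (λ i j → fn i (index j)) above diagonal c relation (proj₁ (proj₁ (proj₂ dep))))
        where
        open Staircase S
        dep = dependent (prime-ideal ℓ-prime) indices (λ i → proj₁ (spanned i))
        c = proj₁ dep
        relation : ∀ j → + ℓ ∣ sum (λ i → c i * fn i (index j))
        relation j = subst (+ ℓ ∣_) (sum-cong-≗ (λ i → cong (c i *_) (sym (proj₂ (spanned i) (index j)))))
          (∣-combination indices (λ i → proj₁ (spanned i)) (λ g → θ g (index j)) c (proj₂ (proj₂ dep)))

    -- Each attempt either shows a nonzero coefficient or yields a series that vanishes beyond the
    -- present limit. Placed in front, that series keeps the matrix triangular, and the dimension
    -- bounds the number of attempts.
    visible : ∀ c → Periodic c → c 𝟘 ≡ 0ℤ →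
      (∀ Y → ∃ λ ps → AllL (Admissible Y) ps × Visible (series (λ x → c (+ product ps · x)))) → Visible (series c)
    visible c per c0 conjugate = finish (climb (suc (length indices)))
      where
      climb : ∀ n → Visible (series c) ⊎ Staircase n
      climb zero    = inj₂ (record { fn = λ () ; spanned = λ () ; index = λ () ; diagonal = λ () ; above = λ () ; limit = 0 ; index≤ = λ () })
      climb (suc n) = extend (climb n)
        where
        push : (S : Staircase n) → Deep (Staircase.limit S) → Staircase (suc n)
        push S (f , sp , low , n₁ , n₁∤) = record
          { fn = λ { zero → f ; (suc i) → fn i }
          ; spanned = λ { zero → sp ; (suc i) → spanned i }
          ; index = λ { zero → n₁ ; (suc i) → index i }
          ; diagonal = λ { zero → n₁∤ ; (suc i) → diagonal i }
          ; above = λ { zero (suc j) _ → low (index j) (index≤ j) ; (suc i) (suc j) (ℕ.s≤s lt) → above i j lt }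
          ; limit = limit ℕ.⊔ n₁
          ; index≤ = λ { zero → ℕ.m≤n⊔m limit n₁ ; (suc i) → ℕ.≤-trans (index≤ i) (ℕ.m≤m⊔n limit n₁) }
          }
          where open Staircase S
        extend : Visible (series c) ⊎ Staircase n → Visible (series c) ⊎ Staircase (suc n)
        extend (inj₁ vis) = inj₁ vis
        extend (inj₂ S) with conjugate (Staircase.limit S)
        ... | ps , adm , vis with hecke-chain (Staircase.limit S) ps adm c per c0 vis
        ...   | inj₁ vis′ = inj₁ vis′
        ...   | inj₂ deep = inj₂ (push S deep)
      finish : Visible (series c) ⊎ Staircase (suc (length indices)) → Visible (series c)
      finish (inj₁ vis) = vis
      finish (inj₂ S) = contradiction S no-staircase

-- Formal power series over ℤ.

module Series where

  open import Data.Nat as ℕ using (ℕ; zero; suc)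
  import Data.Nat.Properties as ℕ
  open import Data.Integer hiding (suc; _⊖_)
  open import Data.Integer.Properties
  open import Data.Integer.Tactic.RingSolver using (solve-∀)
  open import Data.List using (List; []; _∷_)
  open import Data.Product using (_,_)
  open import Algebra using (CommutativeRing)
  import Algebra.Solver.Ring as Solver
  open import Level using (0ℓ)
  open import Relation.Binary.PropositionalEquality
  open import Function using (_∘_)
  open import Algebra.Solver.Ring.AlmostCommutativeRing using (fromCommutativeRing; _-Raw-AlmostCommutative⟶_)
  open import Relation.Nullary.Decidable using (dec⇒maybe)
  import Data.Maybe as Maybe
  open Sums

  Series : Set
  Series = ℕ → ℤ

  infix  4 _≋_
  infixl 6 _⊞_ _⊟_
  infixl 7 _⋆_

  _≋_ : Series → Series → Set
  f ≋ g = ∀ n → f n ≡ g n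

  _⊞_ _⊟_ _⋆_ : Series → Series → Series
  (f ⊞ g) n = f n + g n
  (f ⊟ g) n = f n - g n
  (f ⋆ g) zero    = f 0 * g 0
  (f ⋆ g) (suc n) = f 0 * g (suc n) + ((f ∘ suc) ⋆ g) n

  ⊝_ : Series → Series
  ⊝_ f n = - f n

  const : ℤ → Series
  const k zero    = k
  const k (suc n) = 0ℤ

  𝟎 𝟏 : Series
  𝟎 n = 0ℤ
  𝟏 = const 1ℤ

  ⋆-cong : ∀ {f f′ g g′} → f ≋ f′ → g ≋ g′ → f ⋆ g ≋ f′ ⋆ g′
  ⋆-cong p q zero    = cong₂ _*_ (p 0) (q 0)
  ⋆-cong p q (suc n) = cong₂ _+_ (cong₂ _*_ (p 0) (q (suc n))) (⋆-cong (p ∘ suc) q n)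

  ⋆-zeroˡ : ∀ g → 𝟎 ⋆ g ≋ 𝟎
  ⋆-zeroˡ g zero    = refl
  ⋆-zeroˡ g (suc n) = trans (+-identityˡ _) (⋆-zeroˡ g n)

  ⋆-identityˡ : ∀ g → 𝟏 ⋆ g ≋ g
  ⋆-identityˡ g zero    = *-identityˡ (g 0)
  ⋆-identityˡ g (suc n) = trans (cong₂ _+_ (*-identityˡ (g (suc n))) (⋆-zeroˡ g n)) (+-identityʳ (g (suc n)))

  ⋆-distribʳ : ∀ g f f′ → (f ⊞ f′) ⋆ g ≋ f ⋆ g ⊞ f′ ⋆ g
  ⋆-distribʳ g f f′ zero    = *-distribʳ-+ (g 0) (f 0) (f′ 0)
  ⋆-distribʳ g f f′ (suc n) = trans (cong (λ z → (f 0 + f′ 0) * g (suc n) + z) (⋆-distribʳ g (f ∘ suc) (f′ ∘ suc) n))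
    (lem (f 0) (f′ 0) (g (suc n)) (((f ∘ suc) ⋆ g) n) (((f′ ∘ suc) ⋆ g) n))
    where
    lem : ∀ a b c x y → (a + b) * c + (x + y) ≡ a * c + x + (b * c + y)
    lem = solve-∀

  ⋆-scale : ∀ k f g → (λ n → k * f n) ⋆ g ≋ (λ n → k * (f ⋆ g) n)
  ⋆-scale k f g zero    = *-assoc k (f 0) (g 0)
  ⋆-scale k f g (suc n) = trans (cong₂ _+_ (*-assoc k (f 0) (g (suc n))) (⋆-scale k (f ∘ suc) g n)) (sym (*-distribˡ-+ k (f 0 * g (suc n)) _))

  ⋆-tailʳ : ∀ f g n → (f ⋆ g) (suc n) ≡ f (suc n) * g 0 + (f ⋆ (g ∘ suc)) n
  ⋆-tailʳ f g zero    = +-comm (f 0 * g 1) (f 1 * g 0)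
  ⋆-tailʳ f g (suc n) = trans (cong (λ z → f 0 * g (suc (suc n)) + z) (⋆-tailʳ (f ∘ suc) g n)) (lem (f 0 * g (suc (suc n))) (f (suc (suc n)) * g 0) _)
    where
    lem : ∀ a b c → a + (b + c) ≡ b + (a + c)
    lem = solve-∀

  ⋆-comm : ∀ f g → f ⋆ g ≋ g ⋆ f
  ⋆-comm f g zero    = *-comm (f 0) (g 0)
  ⋆-comm f g (suc n) = trans (⋆-tailʳ f g n) (cong₂ _+_ (*-comm (f (suc n)) (g 0)) (⋆-comm f (g ∘ suc) n))

  ⋆-assoc : ∀ f g h → (f ⋆ g) ⋆ h ≋ f ⋆ (g ⋆ h)
  ⋆-assoc f g h zero    = *-assoc (f 0) (g 0) (h 0)
  ⋆-assoc f g h (suc n) = begin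
    f 0 * g 0 * h (suc n) + (((f ⋆ g) ∘ suc) ⋆ h) n
      ≡⟨ cong (λ z → f 0 * g 0 * h (suc n) + z) (trans (⋆-distribʳ h (λ k → f 0 * g (suc k)) ((f ∘ suc) ⋆ g) n) (cong₂ _+_ (⋆-scale (f 0) (g ∘ suc) h n) (⋆-assoc (f ∘ suc) g h n))) ⟩
    f 0 * g 0 * h (suc n) + (f 0 * ((g ∘ suc) ⋆ h) n + ((f ∘ suc) ⋆ (g ⋆ h)) n)
      ≡⟨ lem (f 0) (g 0) (h (suc n)) _ _ ⟩
    f 0 * (g 0 * h (suc n) + ((g ∘ suc) ⋆ h) n) + ((f ∘ suc) ⋆ (g ⋆ h)) n ∎
    where
    open ≡-Reasoning
    lem : ∀ a b c x y → a * b * c + (a * x + y) ≡ a * (b * c + x) + y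
    lem = solve-∀

  seriesRing : CommutativeRing 0ℓ 0ℓ
  seriesRing = record
    { Carrier = Series ; _≈_ = _≋_ ; _+_ = _⊞_ ; _*_ = _⋆_ ; -_ = ⊝_ ; 0# = 𝟎 ; 1# = 𝟏
    ; isCommutativeRing = record
      { isRing = record
        { +-isAbelianGroup = record
          { isGroup = record
            { isMonoid = record
              { isSemigroup = record
                { isMagma = record { isEquivalence = record { refl = λ n → refl ; sym = λ p n → sym (p n) ; trans = λ p q n → trans (p n) (q n) } ; ∙-cong = λ p q n → cong₂ _+_ (p n) (q n) }
                ; assoc = λ f g h n → +-assoc (f n) (g n) (h n) }
              ; identity = (λ f n → +-identityˡ (f n)) , (λ f n → +-identityʳ (f n)) }
            ; inverse = (λ f n → +-inverseˡ (f n)) , (λ f n → +-inverseʳ (f n))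
            ; ⁻¹-cong = λ p n → cong -_ (p n) }
          ; comm = λ f g n → +-comm (f n) (g n) }
        ; *-cong = ⋆-cong
        ; *-assoc = ⋆-assoc
        ; *-identity = ⋆-identityˡ , (λ f n → trans (⋆-comm f 𝟏 n) (⋆-identityˡ f n))
        ; distrib = (λ f g h n → trans (⋆-comm f (g ⊞ h) n) (trans (⋆-distribʳ f g h n) (cong₂ _+_ (⋆-comm g f n) (⋆-comm h f n)))) , ⋆-distribʳ }
      ; *-comm = ⋆-comm } }

  const-⋆ : ∀ a b → const (a * b) ≋ const a ⋆ const b
  const-⋆ a b zero    = refl
  const-⋆ a b (suc n) = sym (cong₂ _+_ (*-zeroʳ a) (⋆-zeroˡ (const b) n))

  const-homomorphism : CommutativeRing.rawRing +-*-commutativeRing -Raw-AlmostCommutative⟶ fromCommutativeRing seriesRing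
  const-homomorphism = record
    { ⟦_⟧    = const
    ; +-homo = λ { a b zero → refl ; a b (suc n) → refl }
    ; *-homo = const-⋆
    ; -‿homo = λ { a zero → refl ; a (suc n) → refl }
    ; 0-homo = λ { zero → refl ; (suc n) → refl }
    ; 1-homo = λ n → refl
    }

  const-≟ : ∀ a b → Maybe.Maybe (const a ≋ const b)
  const-≟ a b = Maybe.map (λ { refl n → refl }) (dec⇒maybe (a ≟ b))

  module ≋-Solver = Solver (CommutativeRing.rawRing +-*-commutativeRing) (fromCommutativeRing seriesRing) const-homomorphism const-≟

  module ≋ = CommutativeRing seriesRing
  open ≋ public using () renaming (setoid to series-setoid)

  ⋆-zeroʳ : ∀ f → f ⋆ 𝟎 ≋ 𝟎
  ⋆-zeroʳ f = ≋.trans (⋆-comm f 𝟎) (⋆-zeroˡ f)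

  ⋆-identityʳ : ∀ f → f ⋆ 𝟏 ≋ f
  ⋆-identityʳ f = ≋.trans (⋆-comm f 𝟏) (⋆-identityˡ f)

  delay : Series → Series
  delay f zero    = 0ℤ
  delay f (suc n) = f n

  X^ : ℕ → Series
  X^ zero    = 𝟏
  X^ (suc a) = delay (X^ a)

  delay-⋆ : ∀ f g → delay f ⋆ g ≋ delay (f ⋆ g)
  delay-⋆ f g zero    = refl
  delay-⋆ f g (suc n) = +-identityˡ ((f ⋆ g) n)

  delay-cong : ∀ {f g} → f ≋ g → delay f ≋ delay g
  delay-cong p zero    = refl
  delay-cong p (suc n) = p n

  X^-+ : ∀ a b → X^ (a ℕ.+ b) ≋ X^ a ⋆ X^ b
  X^-+ zero    b = ≋.sym (⋆-identityˡ (X^ b))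
  X^-+ (suc a) b = ≋.trans (delay-cong (X^-+ a b)) (≋.sym (delay-⋆ (X^ a) (X^ b)))

  X^-⋆-at : ∀ a f n → (X^ a ⋆ f) (a ℕ.+ n) ≡ f n
  X^-⋆-at zero    f n = ⋆-identityˡ f n
  X^-⋆-at (suc a) f n = trans (delay-⋆ (X^ a) f (suc a ℕ.+ n)) (X^-⋆-at a f n)

  X^-⋆-below : ∀ a f n → n ℕ.< a → (X^ a ⋆ f) n ≡ 0ℤ
  X^-⋆-below (suc a) f zero    lt = refl
  X^-⋆-below (suc a) f (suc n) lt = trans (delay-⋆ (X^ a) f (suc n)) (X^-⋆-below a f n (ℕ.≤-pred lt))

  X^-cancel : ∀ a {f g} → X^ a ⋆ f ≋ X^ a ⋆ g → f ≋ g
  X^-cancel a {f} {g} e n = trans (sym (X^-⋆-at a f n)) (trans (e (a ℕ.+ n)) (X^-⋆-at a g n))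

  X^-coefficient : ∀ a n → X^ a n ≡ 𝟙 (a ℕ.≟ n)
  X^-coefficient zero    zero    = refl
  X^-coefficient zero    (suc n) = refl
  X^-coefficient (suc a) zero    = refl
  X^-coefficient (suc a) (suc n) = trans (X^-coefficient a n) (𝟙-⇔ (a ℕ.≟ n) (suc a ℕ.≟ suc n) (cong suc) ℕ.suc-injective)

  ∑ₛ : {A : Set} → List A → (A → Series) → Series
  ∑ₛ xs f n = ∑[ x ∈ xs ] f x n

  ∑ₛ-cong : {A : Set} (xs : List A) {f g : A → Series} → (∀ x → f x ≋ g x) → ∑ₛ xs f ≋ ∑ₛ xs g
  ∑ₛ-cong xs h n = ∑-cong xs (λ x → h x n)

  ∑ₛ-⋆ : {A : Set} (xs : List A) (f : A → Series) (g : Series) → ∑ₛ xs f ⋆ g ≋ ∑ₛ xs (λ x → f x ⋆ g)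
  ∑ₛ-⋆ []       f g = ⋆-zeroˡ g
  ∑ₛ-⋆ (x ∷ xs) f g = ≋.trans (⋆-distribʳ g (f x) (∑ₛ xs f)) (λ n → cong (λ z → (f x ⋆ g) n + z) (∑ₛ-⋆ xs f g n))

  ⋆-∑ₛ : {A : Set} (xs : List A) (g : Series) (f : A → Series) → g ⋆ ∑ₛ xs f ≋ ∑ₛ xs (λ x → g ⋆ f x)
  ⋆-∑ₛ xs g f = ≋.trans (⋆-comm g (∑ₛ xs f)) (≋.trans (∑ₛ-⋆ xs f g) (∑ₛ-cong xs (λ x → ⋆-comm (f x) g)))

  infix 4 _≈[_]_
  -- Equality below degree `E`. Infinite products occur only through finite ones that agree with
  -- them to this precision.
  _≈[_]_ : Series → ℕ → Series → Set
  f ≈[ E ] g = ∀ n → n ℕ.< E → f n ≡ g n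

  module _ {E : ℕ} where

    ≋⇒≈ : ∀ {f g} → f ≋ g → f ≈[ E ] g
    ≋⇒≈ p n _ = p n

    ≈-sym : ∀ {f g} → f ≈[ E ] g → g ≈[ E ] f
    ≈-sym p n lt = sym (p n lt)

    ≈-trans : ∀ {f g h} → f ≈[ E ] g → g ≈[ E ] h → f ≈[ E ] h
    ≈-trans p q n lt = trans (p n lt) (q n lt)

    ⊞-≈ : ∀ {f f′ g g′} → f ≈[ E ] f′ → g ≈[ E ] g′ → f ⊞ g ≈[ E ] f′ ⊞ g′
    ⊞-≈ p q n lt = cong₂ _+_ (p n lt) (q n lt)

  ⋆-≈ : ∀ {E f f′ g g′} → f ≈[ E ] f′ → g ≈[ E ] g′ → f ⋆ g ≈[ E ] f′ ⋆ g′
  ⋆-≈ p q zero    lt = cong₂ _*_ (p 0 lt) (q 0 lt)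
  ⋆-≈ {suc E} p q (suc n) lt = cong₂ _+_ (cong₂ _*_ (p 0 (ℕ.s≤s ℕ.z≤n)) (q (suc n) lt))
    (⋆-≈ {E} (λ k k<E → p (suc k) (ℕ.s≤s k<E)) (λ k k<E → q k (ℕ.<-trans k<E ℕ.≤-refl)) n (ℕ.≤-pred lt))

  ∑ₛ-≈ : ∀ {E} {A : Set} (xs : List A) {f g : A → Series} → (∀ x → f x ≈[ E ] g x) → ∑ₛ xs f ≈[ E ] ∑ₛ xs g
  ∑ₛ-≈ xs h n lt = ∑-cong xs (λ x → h x n lt)

  X^-≈0 : ∀ {E} a f → E ℕ.≤ a → X^ a ⋆ f ≈[ E ] 𝟎
  X^-≈0 a f E≤a n lt = X^-⋆-below a f n (ℕ.<-≤-trans lt E≤a)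

  -- Constant term 1 lets the coefficients be compared one after another. It stands in for inverses
  -- of the products f_k.
  unit-cancel : ∀ {E} u f g → u 0 ≡ 1ℤ → u ⋆ f ≈[ E ] u ⋆ g → f ≈[ E ] g
  unit-cancel {E} u f g u0 e n n<E = go n n ℕ.≤-refl n<E
    where
    drop : ∀ x w → x + w - w ≡ x
    drop = solve-∀
    lower : ∀ v n → (∀ k → k ℕ.< n → f k ≡ g k) → v ≡ 1ℤ → ∀ w → v * f n + w ≡ v * g n + w → f n ≡ g n
    lower v n h refl w eq = trans (sym (*-identityˡ (f n))) (trans (trans (sym (drop (1ℤ * f n) w)) (trans (cong (_- w) eq) (drop (1ℤ * g n) w))) (*-identityˡ (g n)))
    tails : ∀ n → (∀ k → k ℕ.< suc n → f k ≡ g k) → ((u ∘ suc) ⋆ f) n ≡ ((u ∘ suc) ⋆ g) n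
    tails n h = ⋆-≈ {suc n} {u ∘ suc} {u ∘ suc} (λ _ _ → refl) h n ℕ.≤-refl
    go : ∀ b n → n ℕ.≤ b → n ℕ.< E → f n ≡ g n
    go b zero n≤b lt = trans (sym (*-identityˡ (f 0))) (trans (cong (_* f 0) (sym u0)) (trans (e 0 lt) (trans (cong (_* g 0) u0) (*-identityˡ (g 0)))))
    go (suc b) (suc n) n≤b lt = lower (u 0) (suc n) below u0 (((u ∘ suc) ⋆ g) n)
      (trans (cong (λ z → u 0 * f (suc n) + z) (sym (tails n below))) (e (suc n) lt))
      where
      below : ∀ k → k ℕ.< suc n → f k ≡ g k
      below k k<sn = go b k (ℕ.≤-trans (ℕ.≤-pred k<sn) (ℕ.≤-pred n≤b)) (ℕ.<-trans k<sn lt)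

-- Gaussian binomials and the finite q-binomial theorem.

module Gauss where

  open import Data.Nat as ℕ using (ℕ; zero; suc; _<_)
  import Data.Nat.Properties as ℕ
  open import Data.Nat.Tactic.RingSolver using (solve-∀)
  open import Data.Integer using (ℤ; +_; 0ℤ)
  import Data.Integer as ℤ
  import Data.Integer.Properties as ℤ
  open import Data.List using (List; []; _∷_; _++_; map; concatMap; length)
  open import Data.List.Relation.Binary.Permutation.Propositional using (_↭_; prep; swap; ↭-refl; ↭-sym; ↭-trans; ↭-reflexive)
  import Data.List.Relation.Binary.Permutation.Propositional as Perm
  open import Data.List.Relation.Binary.Permutation.Propositional.Properties using (++⁺ˡ; ++⁺ʳ; ++-assoc)
  import Data.List.Properties as List
  open import Data.Vec using ([]; _∷_)
  open import Relation.Binary.PropositionalEquality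
  open Series
  open ≋-Solver using (solve; _:=_; _:+_; _:*_; _:-_; con)

  tri : ℕ → ℕ
  tri zero    = 0
  tri (suc n) = n ℕ.+ tri n

  -- The product of 1 - q^(g i) over 1 ≤ i ≤ n; for large n it approximates f_g.
  poch : ℕ → ℕ → Series
  poch g zero    = 𝟏
  poch g (suc n) = poch g n ⋆ (𝟏 ⊟ X^ (g ℕ.* suc n))

  -- The Gaussian binomial of κ + μ over κ in q^g, defined by a Pascal rule so that no division of
  -- series is needed.
  gauss : ℕ → ℕ → ℕ → Series
  gauss g zero    μ       = 𝟏
  gauss g (suc κ) zero    = 𝟏
  gauss g (suc κ) (suc μ) = gauss g (suc κ) μ ⊞ X^ (g ℕ.* suc μ) ⋆ gauss g κ (suc μ)

  ≡⇒≋ : ∀ {f g : Series} → f ≡ g → f ≋ g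
  ≡⇒≋ refl n = refl

  open import Relation.Binary.Reasoning.Setoid series-setoid

  -- The quotient formula for Gaussian binomials, cleared of denominators. With u and y the powers
  -- for κ + 1 and μ + 1, the two Pascal terms combine by (1 - y) + (1 - u) y = 1 - u y.
  poch-gauss : ∀ g κ μ → poch g κ ⋆ poch g μ ⋆ gauss g κ μ ≋ poch g (κ ℕ.+ μ)
  poch-gauss g zero μ = solve 1 (λ p → con (+ 1) :* p :* con (+ 1) := p) (λ n → refl) (poch g μ)
  poch-gauss g (suc κ) zero = ≋.trans (solve 1 (λ p → p :* con (+ 1) :* con (+ 1) := p) (λ n → refl) (poch g (suc κ)))
    (≡⇒≋ (cong (λ k → poch g (suc k)) (sym (ℕ.+-identityʳ κ))))
  poch-gauss g (suc κ) (suc μ) = begin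
    P ⋆ (𝟏 ⊟ u) ⋆ (R ⋆ (𝟏 ⊟ y)) ⋆ (G ⊞ y ⋆ H)
      ≈⟨ solve 6 (λ P R u y G H → P :* (con (+ 1) :- u) :* (R :* (con (+ 1) :- y)) :* (G :+ y :* H)
          := (con (+ 1) :- y) :* (P :* (con (+ 1) :- u) :* R :* G) :+ (con (+ 1) :- u) :* y :* (P :* (R :* (con (+ 1) :- y)) :* H)) (λ n → refl) P R u y G H ⟩
    (𝟏 ⊟ y) ⋆ (poch g (suc κ) ⋆ poch g μ ⋆ G) ⊞ (𝟏 ⊟ u) ⋆ y ⋆ (poch g κ ⋆ poch g (suc μ) ⋆ H)
      ≈⟨ ≋.+-cong (⋆-cong {𝟏 ⊟ y} (λ n → refl) (≋.trans (poch-gauss g (suc κ) μ) (≡⇒≋ (cong (poch g) (sym (ℕ.+-suc κ μ))))))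
                  (⋆-cong {(𝟏 ⊟ u) ⋆ y} (λ n → refl) (poch-gauss g κ (suc μ))) ⟩
    (𝟏 ⊟ y) ⋆ Q ⊞ (𝟏 ⊟ u) ⋆ y ⋆ Q
      ≈⟨ solve 3 (λ Q u y → (con (+ 1) :- y) :* Q :+ (con (+ 1) :- u) :* y :* Q := Q :* (con (+ 1) :- u :* y)) (λ n → refl) Q u y ⟩
    Q ⋆ (𝟏 ⊟ u ⋆ y)
      ≈⟨ ⋆-cong {Q} (λ n → refl) (λ n → cong (λ z → 𝟏 n ℤ.- z) (≋.trans (≋.sym (X^-+ (g ℕ.* suc κ) (g ℕ.* suc μ))) (≡⇒≋ (cong X^ (lem g κ μ))) n)) ⟩
    Q ⋆ (𝟏 ⊟ X^ (g ℕ.* suc (κ ℕ.+ suc μ))) ∎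
    where
    P = poch g κ
    R = poch g μ
    u = X^ (g ℕ.* suc κ)
    y = X^ (g ℕ.* suc μ)
    G = gauss g (suc κ) μ
    H = gauss g κ (suc μ)
    Q = poch g (κ ℕ.+ suc μ)
    lem : ∀ g κ μ → g ℕ.* suc κ ℕ.+ g ℕ.* suc μ ≡ g ℕ.* suc (κ ℕ.+ suc μ)
    lem = solve-∀

  -- Coefficients in z of φ(z)·(1 + z a) and of φ(z)·Π (1 + z a) over the list.
  op : Series → (ℕ → Series) → ℕ → Series
  op a φ zero    = φ zero
  op a φ (suc κ) = φ (suc κ) ⊞ a ⋆ φ κ

  ops : List Series → (ℕ → Series) → ℕ → Series
  ops []       φ = φ
  ops (a ∷ as) φ = op a (ops as φ)

  δ : ℕ → Series
  δ zero    = 𝟏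
  δ (suc κ) = 𝟎

  op-cong : ∀ a {φ ψ} → (∀ κ → φ κ ≋ ψ κ) → ∀ κ → op a φ κ ≋ op a ψ κ
  op-cong a h zero    = h 0
  op-cong a h (suc κ) = ≋.+-cong (h (suc κ)) (⋆-cong {a} (λ n → refl) (h κ))

  op-comm : ∀ a b φ κ → op a (op b φ) κ ≋ op b (op a φ) κ
  op-comm a b φ zero          = ≋.refl
  op-comm a b φ (suc zero)    = solve 4 (λ x y u v → x :+ v :* y :+ u :* y := x :+ u :* y :+ v :* y) (λ n → refl) (φ 1) (φ 0) a b
  op-comm a b φ (suc (suc κ)) = solve 5 (λ x y z u v → x :+ v :* y :+ u :* (y :+ v :* z) := x :+ u :* y :+ v :* (y :+ u :* z)) (λ n → refl) (φ (suc (suc κ))) (φ (suc κ)) (φ κ) a b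

  ops-↭ : ∀ {as bs} → as ↭ bs → ∀ φ κ → ops as φ κ ≋ ops bs φ κ
  ops-↭ Perm.refl        φ κ = ≋.refl
  ops-↭ (prep a p)       φ κ = op-cong a (ops-↭ p φ) κ
  ops-↭ (swap {as} a b p) φ κ = ≋.trans (op-comm a b (ops as φ) κ) (op-cong b (op-cong a (ops-↭ p φ)) κ)
  ops-↭ (Perm.trans p q) φ κ = ≋.trans (ops-↭ p φ κ) (ops-↭ q φ κ)

  ops-++ : ∀ as bs φ → ops (as ++ bs) φ ≡ ops as (ops bs φ)
  ops-++ []       bs φ = refl
  ops-++ (a ∷ as) bs φ = cong (op a) (ops-++ as bs φ)

  -- The coefficients in z of z^v φ(z).
  shifted : ℕ → (ℕ → Series) → ℕ → Series
  shifted zero    φ κ       = φ κ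
  shifted (suc v) φ zero    = 𝟎
  shifted (suc v) φ (suc κ) = shifted v φ κ

  below : ℕ → List ℕ
  below zero    = []
  below (suc n) = n ∷ below n

  ∑ₛ-below-cong : ∀ n {f g : ℕ → Series} → (∀ v → v < n → f v ≋ g v) → ∑ₛ (below n) f ≋ ∑ₛ (below n) g
  ∑ₛ-below-cong zero    h = ≋.refl
  ∑ₛ-below-cong (suc n) {f} {g} h k = cong₂ ℤ._+_ (h n ℕ.≤-refl k) (∑ₛ-below-cong n (λ v lt → h v (ℕ.<-trans lt ℕ.≤-refl)) k)

  ops-zero : ∀ as κ → length as < κ → ops as δ κ ≋ 𝟎
  ops-zero []       (suc κ) lt = ≋.refl
  ops-zero (a ∷ as) (suc κ) lt = ≋.trans (≋.+-cong (ops-zero as (suc κ) (ℕ.<-trans ℕ.≤-refl lt)) (≋.trans (⋆-cong {a} (λ n → refl) (ops-zero as κ (ℕ.≤-pred lt))) (⋆-zeroʳ a)))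
    (λ n → refl)

  -- ∏ (1 + z a) is expanded as Σ_v e_v z^v and then multiplied with φ.
  ops-expand : ∀ as φ κ → ops as φ κ ≋ ∑ₛ (below (suc (length as))) (λ v → ops as δ v ⋆ shifted v φ κ)
  ops-expand []       φ κ = ≋.sym (λ n → trans (ℤ.+-identityʳ _) (⋆-identityˡ (φ κ) n))
  ops-expand (a ∷ as) φ κ = ≋.trans (expand κ) (≋.sym (split κ))
    where
    L = suc (length as)
    e : ℕ → Series
    e = ops as δ
    recombine : ∀ n κ → ∑ₛ (below (suc n)) (λ v → op a e v ⋆ shifted v φ (suc κ)) ≋ ∑ₛ (below (suc n)) (λ v → e v ⋆ shifted v φ (suc κ)) ⊞ a ⋆ ∑ₛ (below n) (λ v → e v ⋆ shifted v φ κ)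
    recombine zero    κ n = trans (sym (ℤ.+-identityʳ _)) (cong (λ z → (e 0 ⋆ φ (suc κ)) n ℤ.+ 0ℤ ℤ.+ z) (sym (⋆-zeroʳ a n)))
    recombine (suc m) κ = begin
      (e (suc m) ⊞ a ⋆ e m) ⋆ s ⊞ rest                                   ≈⟨ ≋.+-cong {(e (suc m) ⊞ a ⋆ e m) ⋆ s} ≋.refl (recombine m κ) ⟩
      (e (suc m) ⊞ a ⋆ e m) ⋆ s ⊞ (A ⊞ a ⋆ C)                            ≈⟨ solve 6 (λ x y a s A C → (x :+ a :* y) :* s :+ (A :+ a :* C) := x :* s :+ A :+ a :* (y :* s :+ C)) (λ n → refl) (e (suc m)) (e m) a s A C ⟩
      e (suc m) ⋆ s ⊞ A ⊞ a ⋆ (e m ⋆ s ⊞ C)                              ∎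
      where
      s = shifted m φ κ
      rest A C : Series
      rest = ∑ₛ (below (suc m)) (λ v → op a e v ⋆ shifted v φ (suc κ))
      A = ∑ₛ (below (suc m)) (λ v → e v ⋆ shifted v φ (suc κ))
      C = ∑ₛ (below m) (λ v → e v ⋆ shifted v φ κ)
    top : ∀ κ → e L ⋆ shifted L φ κ ≋ 𝟎
    top κ = ≋.trans (⋆-cong (ops-zero as L ℕ.≤-refl) (λ n → refl)) (⋆-zeroˡ (shifted L φ κ))
    drop-top : ∀ κ → ∑ₛ (below (suc L)) (λ v → e v ⋆ shifted v φ κ) ≋ ∑ₛ (below L) (λ v → e v ⋆ shifted v φ κ)
    drop-top κ n = trans (cong (ℤ._+ ∑ₛ (below L) (λ v → e v ⋆ shifted v φ κ) n) (top κ n)) (ℤ.+-identityˡ _)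
    expand : ∀ κ → op a (ops as φ) κ ≋ op a (λ κ → ∑ₛ (below L) (λ v → e v ⋆ shifted v φ κ)) κ
    expand = op-cong a (ops-expand as φ)
    at-zero : ∀ n → ∑ₛ (below (suc n)) (λ v → op a e v ⋆ shifted v φ 0) ≋ ∑ₛ (below (suc n)) (λ v → e v ⋆ shifted v φ 0)
    at-zero zero    = ≋.refl
    at-zero (suc n) = ≋.+-cong (≋.trans (⋆-zeroʳ (op a e (suc n))) (≋.sym (⋆-zeroʳ (e (suc n))))) (at-zero n)
    split : ∀ κ → ∑ₛ (below (suc L)) (λ v → op a e v ⋆ shifted v φ κ) ≋ op a (λ κ → ∑ₛ (below L) (λ v → e v ⋆ shifted v φ κ)) κ
    split zero    = ≋.trans (at-zero L) (drop-top 0)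
    split (suc κ) = ≋.trans (recombine L κ) (≋.+-cong (drop-top (suc κ)) ≋.refl)

  row : ℕ → ℕ → ℕ → List ℕ
  row r M i = map (λ j → i ℕ.+ r ℕ.* j) (below M)

  length-row : ∀ r M i → length (row r M i) ≡ M
  length-row r M i = trans (List.length-map (λ j → i ℕ.+ r ℕ.* j) (below M)) (go M)
    where
    go : ∀ M → length (below M) ≡ M
    go zero    = refl
    go (suc M) = cong suc (go M)

  -- Lets the product of all 1 + z q^j with j < M r be taken class by class modulo r; a permutation
  -- suffices by `ops-↭`.
  residue-classes : ∀ r M → below (M ℕ.* r) ↭ concatMap (row r M) (below r)
  residue-classes r zero = ↭-reflexive (sym (nil (below r)))
    where
    nil : ∀ (xs : List ℕ) → concatMap (λ _ → []) xs ≡ ([] {A = ℕ})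
    nil []       = refl
    nil (x ∷ xs) = nil xs
  residue-classes r (suc M) = ↭-trans (↭-reflexive (below-+ r)) (↭-trans (++⁺ˡ (map (ℕ._+ M ℕ.* r) (below r)) (residue-classes r M)) (interleave (below r)))
    where
    below-+ : ∀ a → below (a ℕ.+ M ℕ.* r) ≡ map (ℕ._+ M ℕ.* r) (below a) ++ below (M ℕ.* r)
    below-+ zero    = refl
    below-+ (suc a) = cong (a ℕ.+ M ℕ.* r ∷_) (below-+ a)
    interleave : ∀ xs → map (ℕ._+ M ℕ.* r) xs ++ concatMap (row r M) xs ↭ concatMap (row r (suc M)) xs
    interleave []       = ↭-refl
    interleave (x ∷ xs) = ↭-trans (↭-reflexive (cong (λ z → x ℕ.+ z ∷ map (ℕ._+ M ℕ.* r) xs ++ row r M x ++ concatMap (row r M) xs) (ℕ.*-comm M r)))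
      (prep (x ℕ.+ r ℕ.* M) (↭-trans (rotate (map (ℕ._+ M ℕ.* r) xs) (row r M x) (concatMap (row r M) xs)) (++⁺ˡ (row r M x) (interleave xs))))
      where
      rotate : ∀ (as bs cs : List ℕ) → as ++ bs ++ cs ↭ bs ++ as ++ cs
      rotate as bs cs = ↭-trans (↭-sym (++-assoc as bs cs)) (↭-trans (++⁺ʳ cs (++-comm as bs)) (++-assoc bs as cs))
        where open import Data.List.Relation.Binary.Permutation.Propositional.Properties using (++-comm)

  -- the finite q-binomial theorem
  q-binomial : ∀ r i κ μ → ops (map X^ (row r (κ ℕ.+ μ) i)) δ κ ≋ X^ (i ℕ.* κ ℕ.+ r ℕ.* tri κ) ⋆ gauss r κ μ
  q-binomial r i zero μ = ≋.trans (constant μ) (≋.sym (≋.trans (⋆-identityʳ _) (≡⇒≋ (cong X^ (lem i r)))))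
    where
    constant : ∀ μ → ops (map X^ (row r μ i)) δ 0 ≋ 𝟏
    constant zero    = ≋.refl
    constant (suc μ) = constant μ
    lem : ∀ i r → i ℕ.* 0 ℕ.+ r ℕ.* 0 ≡ 0
    lem = solve-∀
  q-binomial r i (suc κ) zero = begin
    ops (map X^ (row r (κ ℕ.+ 0) i)) δ (suc κ) ⊞ X^ (i ℕ.+ r ℕ.* (κ ℕ.+ 0)) ⋆ ops (map X^ (row r (κ ℕ.+ 0) i)) δ κ
      ≈⟨ ≋.+-cong (ops-zero (map X^ (row r (κ ℕ.+ 0) i)) (suc κ) (ℕ.s≤s (ℕ.≤-reflexive (trans (List.length-map X^ (row r (κ ℕ.+ 0) i)) (trans (length-row r (κ ℕ.+ 0) i) (ℕ.+-identityʳ κ))))))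
                 (⋆-cong {X^ (i ℕ.+ r ℕ.* (κ ℕ.+ 0))} (λ n → refl) (≋.trans (q-binomial r i κ zero) (≋.trans (⋆-cong {X^ (i ℕ.* κ ℕ.+ r ℕ.* tri κ)} (λ n → refl) (gauss-0 κ)) (⋆-identityʳ _)))) ⟩
    𝟎 ⊞ X^ (i ℕ.+ r ℕ.* (κ ℕ.+ 0)) ⋆ X^ (i ℕ.* κ ℕ.+ r ℕ.* tri κ)
      ≈⟨ (λ n → trans (ℤ.+-identityˡ _) (≋.trans (≋.sym (X^-+ (i ℕ.+ r ℕ.* (κ ℕ.+ 0)) (i ℕ.* κ ℕ.+ r ℕ.* tri κ))) (≡⇒≋ (cong X^ (lem i r κ (tri κ)))) n)) ⟩
    X^ (i ℕ.* suc κ ℕ.+ r ℕ.* tri (suc κ))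
      ≈⟨ ⋆-identityʳ _ ⟨
    X^ (i ℕ.* suc κ ℕ.+ r ℕ.* tri (suc κ)) ⋆ 𝟏 ∎
    where
    gauss-0 : ∀ κ → gauss r κ 0 ≋ 𝟏
    gauss-0 zero    = ≋.refl
    gauss-0 (suc κ) = ≋.refl
    lem : ∀ i r κ T → i ℕ.+ r ℕ.* (κ ℕ.+ 0) ℕ.+ (i ℕ.* κ ℕ.+ r ℕ.* T) ≡ i ℕ.* suc κ ℕ.+ r ℕ.* (κ ℕ.+ T)
    lem = solve-∀
  q-binomial r i (suc κ) (suc μ) = begin
    ops (map X^ (row r N i)) δ (suc κ) ⊞ X^ (i ℕ.+ r ℕ.* N) ⋆ ops (map X^ (row r N i)) δ κ
      ≈⟨ ≋.+-cong (≋.trans (≡⇒≋ (cong (λ n → ops (map X^ (row r n i)) δ (suc κ)) (ℕ.+-suc κ μ))) (q-binomial r i (suc κ) μ)) (⋆-cong {X^ (i ℕ.+ r ℕ.* N)} (λ n → refl) (q-binomial r i κ (suc μ))) ⟩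
    Z ⋆ gauss r (suc κ) μ ⊞ X^ (i ℕ.+ r ℕ.* N) ⋆ (X^ (i ℕ.* κ ℕ.+ r ℕ.* tri κ) ⋆ gauss r κ (suc μ))
      ≈⟨ ≋.+-cong {Z ⋆ gauss r (suc κ) μ} ≋.refl (≋.trans (≋.sym (⋆-assoc (X^ (i ℕ.+ r ℕ.* N)) (X^ (i ℕ.* κ ℕ.+ r ℕ.* tri κ)) (gauss r κ (suc μ)))) (⋆-cong merge (λ n → refl))) ⟩
    Z ⋆ gauss r (suc κ) μ ⊞ Z ⋆ X^ (r ℕ.* suc μ) ⋆ gauss r κ (suc μ)
      ≈⟨ solve 4 (λ z g y h → z :* g :+ z :* y :* h := z :* (g :+ y :* h)) (λ n → refl) Z (gauss r (suc κ) μ) (X^ (r ℕ.* suc μ)) (gauss r κ (suc μ)) ⟩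
    Z ⋆ (gauss r (suc κ) μ ⊞ X^ (r ℕ.* suc μ) ⋆ gauss r κ (suc μ)) ∎
    where
    N = κ ℕ.+ suc μ
    Z = X^ (i ℕ.* suc κ ℕ.+ r ℕ.* tri (suc κ))
    lem : ∀ i r κ μ T → i ℕ.+ r ℕ.* (κ ℕ.+ suc μ) ℕ.+ (i ℕ.* κ ℕ.+ r ℕ.* T) ≡ i ℕ.* suc κ ℕ.+ r ℕ.* (κ ℕ.+ T) ℕ.+ r ℕ.* suc μ
    lem = solve-∀
    merge : X^ (i ℕ.+ r ℕ.* N) ⋆ X^ (i ℕ.* κ ℕ.+ r ℕ.* tri κ) ≋ Z ⋆ X^ (r ℕ.* suc μ)
    merge = ≋.trans (≋.sym (X^-+ (i ℕ.+ r ℕ.* N) (i ℕ.* κ ℕ.+ r ℕ.* tri κ))) (≋.trans (≡⇒≋ (cong X^ (lem i r κ μ (tri κ)))) (X^-+ (i ℕ.* suc κ ℕ.+ r ℕ.* tri (suc κ)) (r ℕ.* suc μ)))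

-- The generating function of r-cores as a lattice sum.

module Core where

  open import Data.Nat as ℕ using (ℕ; zero; suc; _≤_; _∸_; z≤n; s≤s)
  import Data.Nat.Properties as ℕ
  open import Data.Nat.Tactic.RingSolver using (solve-∀)
  open import Data.Integer using (ℤ; +_; 0ℤ; 1ℤ)
  import Data.Integer as ℤ
  import Data.Integer.Properties as ℤ
  open import Data.List using (List; []; _∷_; _++_; map; concatMap; length)
  import Data.List.Properties as List
  open import Data.List.Relation.Binary.Permutation.Propositional.Properties using (map⁺)
  open import Data.Vec using (Vec; []; _∷_)
  open import Data.Product using (_×_; _,_)
  open import Data.Sum using (_⊎_; inj₁; inj₂)
  open import Relation.Nullary
  open import Relation.Binary.PropositionalEquality
  open import Function using (_∘_)
  open Sums
  open Series
  open Gauss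
  open ≋-Solver using (solve; _:=_; _:+_; _:*_; _:-_; con)

  shifted-∑ₛ : {A : Set} (xs : List A) (φ : A → ℕ → Series) → ∀ v κ → shifted v (λ κ → ∑ₛ xs (λ x → φ x κ)) κ ≋ ∑ₛ xs (λ x → shifted v (φ x) κ)
  shifted-∑ₛ xs φ zero    κ       = ≋.refl
  shifted-∑ₛ xs φ (suc v) zero    = λ n → sym (∑-zero xs)
  shifted-∑ₛ xs φ (suc v) (suc κ) = shifted-∑ₛ xs φ v κ

  shifted-⋆ : ∀ ψ c v κ → shifted v (λ κ → ψ κ ⋆ c) κ ≋ shifted v ψ κ ⋆ c
  shifted-⋆ ψ c zero    κ       = ≋.refl
  shifted-⋆ ψ c (suc v) zero    = ≋.sym (⋆-zeroˡ c)
  shifted-⋆ ψ c (suc v) (suc κ) = shifted-⋆ ψ c v κ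

  shifted-cong : ∀ {φ ψ} → (∀ κ → φ κ ≋ ψ κ) → ∀ v κ → shifted v φ κ ≋ shifted v ψ κ
  shifted-cong h zero    κ       = h κ
  shifted-cong h (suc v) zero    = ≋.refl
  shifted-cong h (suc v) (suc κ) = shifted-cong h v κ

  shifted-shifted : ∀ φ v s κ → shifted v (shifted s φ) κ ≡ shifted (v ℕ.+ s) φ κ
  shifted-shifted φ zero    s κ       = refl
  shifted-shifted φ (suc v) s zero    = refl
  shifted-shifted φ (suc v) s (suc κ) = shifted-shifted φ v s κ

  -- The Kronecker symbol of s and κ as a constant series: it extracts the coefficient of z^κ.
  selector : ℕ → ℕ → Series
  selector s κ = shifted s δ κ

  selector-yes : ∀ s → selector s s ≋ 𝟏
  selector-yes zero    = ≋.refl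
  selector-yes (suc s) = selector-yes s

  selector-no : ∀ s κ → s ≢ κ → selector s κ ≋ 𝟎
  selector-no zero    zero    ne = contradiction refl ne
  selector-no zero    (suc κ) ne = ≋.refl
  selector-no (suc s) zero    ne = ≋.refl
  selector-no (suc s) (suc κ) ne = selector-no s κ (ne ∘ cong suc)

  ∑ₛ-vecs : {A : Set} (xs : List A) (k : ℕ) (f : Vec A (suc k) → Series) → ∑ₛ (vecs xs (suc k)) f ≋ ∑ₛ xs (λ a → ∑ₛ (vecs xs k) (λ v → f (a ∷ v)))
  ∑ₛ-vecs xs k f n = ∑-vecs xs k (λ v → f v n)

  infixr 8 _↑_
  _↑_ : Series → ℕ → Series
  f ↑ zero  = 𝟏
  f ↑ suc k = f ⋆ f ↑ k

  tri-+ : ∀ a b → tri (a ℕ.+ b) ≡ tri a ℕ.+ tri b ℕ.+ a ℕ.* b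
  tri-+ zero    b = sym (ℕ.+-identityʳ (tri b))
  tri-+ (suc a) b = trans (cong (a ℕ.+ b ℕ.+_) (tri-+ a b)) (lem a b (tri a) (tri b))
    where
    lem : ∀ a b x y → a ℕ.+ b ℕ.+ (x ℕ.+ y ℕ.+ a ℕ.* b) ≡ a ℕ.+ x ℕ.+ y ℕ.+ suc a ℕ.* b
    lem = solve-∀

  tri-double : ∀ n → tri n ℕ.+ tri n ℕ.+ n ≡ n ℕ.* n
  tri-double zero    = refl
  tri-double (suc n) = trans (lem n (tri n)) (trans (cong (λ z → z ℕ.+ suc (n ℕ.+ n)) (tri-double n)) (lem′ n))
    where
    lem : ∀ n t → n ℕ.+ t ℕ.+ (n ℕ.+ t) ℕ.+ suc n ≡ t ℕ.+ t ℕ.+ n ℕ.+ suc (n ℕ.+ n)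
    lem = solve-∀
    lem′ : ∀ n → n ℕ.* n ℕ.+ suc (n ℕ.+ n) ≡ suc n ℕ.* suc n
    lem′ = solve-∀

  tri-mono : ∀ {a b} → a ≤ b → tri a ≤ tri b
  tri-mono z≤n       = z≤n
  tri-mono (s≤s a≤b) = ℕ.+-mono-≤ a≤b (tri-mono a≤b)

  module Lattice (r m : ℕ) where

    -- e_i(n) = r n(n-1)/2 + i n at n = v - m; one of the two truncated differences vanishes
    exponent : ℕ → ℕ → ℕ
    exponent i v = r ℕ.* tri (v ∸ m) ℕ.+ i ℕ.* (v ∸ m) ℕ.+ (r ℕ.* tri (m ∸ v) ℕ.+ (r ∸ i) ℕ.* (m ∸ v))

    -- the head of a vector of length suc i is attached to the residue class i
    exponents : ∀ {k} → Vec ℕ k → ℕ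
    exponents []               = 0
    exponents (_∷_ {i} v vs) = exponent i v ℕ.+ exponents vs

    weight : ∀ {k} → Vec ℕ k → ℕ
    weight []               = 0
    weight (_∷_ {i} v vs) = i ℕ.* v ℕ.+ r ℕ.* tri v ℕ.+ weight vs

    total : ∀ {k} → Vec ℕ k → ℕ
    total []       = 0
    total (v ∷ vs) = v ℕ.+ total vs

    exponent-identity : ∀ i v → i ≤ r → i ℕ.* v ℕ.+ r ℕ.* tri v ℕ.+ r ℕ.* (m ℕ.* m) ≡ r ℕ.* tri m ℕ.+ i ℕ.* m ℕ.+ r ℕ.* m ℕ.* v ℕ.+ exponent i v
    exponent-identity i v i≤r with ℕ.≤-total m v
    ... | inj₁ m≤v = subst P (ℕ.m+[n∸m]≡n m≤v) (above (v ∸ m))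
      where
      P : ℕ → Set
      P v = i ℕ.* v ℕ.+ r ℕ.* tri v ℕ.+ r ℕ.* (m ℕ.* m) ≡ r ℕ.* tri m ℕ.+ i ℕ.* m ℕ.+ r ℕ.* m ℕ.* v ℕ.+ exponent i v
      lem : ∀ r i j m d t u → i ℕ.* (m ℕ.+ d) ℕ.+ r ℕ.* (t ℕ.+ u ℕ.+ m ℕ.* d) ℕ.+ r ℕ.* (m ℕ.* m) ≡ r ℕ.* t ℕ.+ i ℕ.* m ℕ.+ r ℕ.* m ℕ.* (m ℕ.+ d) ℕ.+ (r ℕ.* u ℕ.+ i ℕ.* d ℕ.+ (r ℕ.* 0 ℕ.+ j ℕ.* 0))
      lem = solve-∀
      above : ∀ d → P (m ℕ.+ d)
      above d rewrite ℕ.m+n∸m≡n m d | ℕ.m≤n⇒m∸n≡0 (ℕ.m≤m+n m d) | tri-+ m d = lem r i (r ∸ i) m d (tri m) (tri d)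
    ... | inj₂ v≤m = subst Q (ℕ.m+[n∸m]≡n v≤m) (under (m ∸ v))
      where
      Q : ℕ → Set
      Q m = i ℕ.* v ℕ.+ r ℕ.* tri v ℕ.+ r ℕ.* (m ℕ.* m) ≡ r ℕ.* tri m ℕ.+ i ℕ.* m ℕ.+ r ℕ.* m ℕ.* v ℕ.+ (r ℕ.* tri (v ∸ m) ℕ.+ i ℕ.* (v ∸ m) ℕ.+ (r ℕ.* tri (m ∸ v) ℕ.+ (r ∸ i) ℕ.* (m ∸ v)))
      lem : ∀ i j v d t u → i ℕ.* v ℕ.+ (i ℕ.+ j) ℕ.* t ℕ.+ (i ℕ.+ j) ℕ.* (v ℕ.* v ℕ.+ 2 ℕ.* v ℕ.* d ℕ.+ (u ℕ.+ u ℕ.+ d)) ≡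
        (i ℕ.+ j) ℕ.* (t ℕ.+ u ℕ.+ v ℕ.* d) ℕ.+ i ℕ.* (v ℕ.+ d) ℕ.+ (i ℕ.+ j) ℕ.* (v ℕ.+ d) ℕ.* v ℕ.+ ((i ℕ.+ j) ℕ.* 0 ℕ.+ i ℕ.* 0 ℕ.+ ((i ℕ.+ j) ℕ.* u ℕ.+ j ℕ.* d))
      lem = solve-∀
      square : ∀ v d → v ℕ.* v ℕ.+ 2 ℕ.* v ℕ.* d ℕ.+ d ℕ.* d ≡ (v ℕ.+ d) ℕ.* (v ℕ.+ d)
      square = solve-∀
      core : ∀ d r′ → r′ ≡ i ℕ.+ (r ∸ i) → i ℕ.* v ℕ.+ r′ ℕ.* tri v ℕ.+ r′ ℕ.* ((v ℕ.+ d) ℕ.* (v ℕ.+ d)) ≡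
        r′ ℕ.* (tri v ℕ.+ tri d ℕ.+ v ℕ.* d) ℕ.+ i ℕ.* (v ℕ.+ d) ℕ.+ r′ ℕ.* (v ℕ.+ d) ℕ.* v ℕ.+ (r′ ℕ.* 0 ℕ.+ i ℕ.* 0 ℕ.+ (r′ ℕ.* tri d ℕ.+ (r ∸ i) ℕ.* d))
      core d _ refl = trans (cong (λ z → i ℕ.* v ℕ.+ (i ℕ.+ (r ∸ i)) ℕ.* tri v ℕ.+ (i ℕ.+ (r ∸ i)) ℕ.* z) (trans (sym (square v d)) (cong (v ℕ.* v ℕ.+ 2 ℕ.* v ℕ.* d ℕ.+_) (sym (tri-double d))))) (lem i (r ∸ i) v d (tri v) (tri d))
      under : ∀ d → Q (v ℕ.+ d)
      under d rewrite ℕ.m+n∸m≡n v d | ℕ.m≤n⇒m∸n≡0 (ℕ.m≤m+n v d) | tri-+ v d = core d r (sym (ℕ.m+[n∸m]≡n i≤r))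

    -- Centring changes each exponent by a linear function of the coordinate with slope r m, the
    -- same for all residue classes. The total change therefore depends only on `total v`, which the
    -- selector fixes.
    weight-identity : ∀ {k} (v : Vec ℕ k) → k ≤ r → weight v ℕ.+ k ℕ.* (r ℕ.* (m ℕ.* m)) ≡ k ℕ.* (r ℕ.* tri m) ℕ.+ m ℕ.* tri k ℕ.+ r ℕ.* m ℕ.* total v ℕ.+ exponents v
    weight-identity [] _ = lem r m
      where
      lem : ∀ r m → 0 ≡ m ℕ.* 0 ℕ.+ r ℕ.* m ℕ.* 0 ℕ.+ 0
      lem = solve-∀
    weight-identity (_∷_ {i} v vs) i<r = trans (lem₁ (i ℕ.* v ℕ.+ r ℕ.* tri v) (weight vs) (r ℕ.* (m ℕ.* m)) i)
      (trans (cong₂ ℕ._+_ (exponent-identity i v (ℕ.<⇒≤ i<r)) (weight-identity vs (ℕ.<⇒≤ i<r)))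
        (lem₂ i r m v (tri m) (tri i) (exponent i v) (total vs) (exponents vs)))
      where
      lem₁ : ∀ a b c i → a ℕ.+ b ℕ.+ suc i ℕ.* c ≡ a ℕ.+ c ℕ.+ (b ℕ.+ i ℕ.* c)
      lem₁ = solve-∀
      lem₂ : ∀ i r m v t u e s x → r ℕ.* t ℕ.+ i ℕ.* m ℕ.+ r ℕ.* m ℕ.* v ℕ.+ e ℕ.+ (i ℕ.* (r ℕ.* t) ℕ.+ m ℕ.* u ℕ.+ r ℕ.* m ℕ.* s ℕ.+ x) ≡
        suc i ℕ.* (r ℕ.* t) ℕ.+ m ℕ.* (i ℕ.+ u) ℕ.+ r ℕ.* m ℕ.* (v ℕ.+ s) ℕ.+ (e ℕ.+ x)
      lem₂ = solve-∀

    module Splitting (M : ℕ) where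

      gausses : ∀ {k} → Vec ℕ k → Series
      gausses []       = 𝟏
      gausses (v ∷ vs) = gauss r v (M ∸ v) ⋆ gausses vs

      summand : ∀ {k} → ℕ → Vec ℕ k → Series
      summand κ v = selector (total v) κ ⋆ (X^ (weight v) ⋆ gausses v)

      expand : ∀ k κ → ops (map X^ (concatMap (row r M) (below k))) δ κ ≋ ∑ₛ (vecs (below (suc M)) k) (summand κ)
      expand zero    κ = ≋.sym (λ n → trans (ℤ.+-identityʳ _) (≋.trans (⋆-cong {δ κ} ≋.refl (⋆-identityʳ 𝟏)) (⋆-identityʳ (δ κ)) n))
      expand (suc k) κ = begin
        ops (map X^ (row r M k ++ rest)) δ κ                                                      ≈⟨ ≡⇒≋ (cong (λ f → f κ) (trans (cong (λ l → ops l δ) (List.map-++ X^ (row r M k) rest)) (ops-++ as (map X^ rest) δ))) ⟩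
        ops as (ops (map X^ rest) δ) κ                                                            ≈⟨ ops-expand as (ops (map X^ rest) δ) κ ⟩
        ∑ₛ (below (suc (length as))) (λ v → ops as δ v ⋆ shifted v (ops (map X^ rest) δ) κ)       ≈⟨ ≡⇒≋ (cong (λ L → ∑ₛ (below (suc L)) (λ v → ops as δ v ⋆ shifted v (ops (map X^ rest) δ) κ)) (trans (List.length-map X^ (row r M k)) (length-row r M k))) ⟩
        ∑ₛ (below (suc M)) (λ v → ops as δ v ⋆ shifted v (ops (map X^ rest) δ) κ)                 ≈⟨ ∑ₛ-below-cong (suc M) (λ v v<sM → step v (ℕ.≤-pred v<sM)) ⟩
        ∑ₛ (below (suc M)) (λ v → ∑ₛ (vecs (below (suc M)) k) (λ vs → summand κ (v ∷ vs)))        ≈⟨ ∑ₛ-vecs (below (suc M)) k (summand κ) ⟨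
        ∑ₛ (vecs (below (suc M)) (suc k)) (summand κ)                                             ∎
        where
        open import Relation.Binary.Reasoning.Setoid series-setoid
        as = map X^ (row r M k)
        rest = concatMap (row r M) (below k)
        step : ∀ v → v ≤ M → ops as δ v ⋆ shifted v (ops (map X^ rest) δ) κ ≋ ∑ₛ (vecs (below (suc M)) k) (λ vs → summand κ (v ∷ vs))
        step v v≤M = begin
          ops as δ v ⋆ shifted v (ops (map X^ rest) δ) κ
            ≈⟨ ⋆-cong (≋.trans (≡⇒≋ (cong (λ L → ops (map X^ (row r L k)) δ v) (sym (ℕ.m+[n∸m]≡n v≤M)))) (q-binomial r k v (M ∸ v)))
                      (≋.trans (shifted-cong (expand k) v κ) (shifted-∑ₛ vs (λ w κ → summand κ w) v κ)) ⟩
          A ⋆ ∑ₛ vs (λ w → shifted v (λ κ → summand κ w) κ)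
            ≈⟨ ⋆-∑ₛ vs A (λ w → shifted v (λ κ → summand κ w) κ) ⟩
          ∑ₛ vs (λ w → A ⋆ shifted v (λ κ → summand κ w) κ)
            ≈⟨ ∑ₛ-cong vs termwise ⟩
          ∑ₛ vs (λ w → summand κ (v ∷ w)) ∎
          where
          vs = vecs (below (suc M)) k
          A = X^ (k ℕ.* v ℕ.+ r ℕ.* tri v) ⋆ gauss r v (M ∸ v)
          termwise : ∀ w → A ⋆ shifted v (λ κ → summand κ w) κ ≋ summand κ (v ∷ w)
          termwise w = begin
            A ⋆ shifted v (λ κ → summand κ w) κ
              ≈⟨ ⋆-cong {A} ≋.refl (≋.trans (shifted-⋆ (λ κ → selector (total w) κ) (X^ (weight w) ⋆ gausses w) v κ)
                   (⋆-cong (≡⇒≋ (shifted-shifted δ v (total w) κ)) (λ n → refl))) ⟩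
            X^ (k ℕ.* v ℕ.+ r ℕ.* tri v) ⋆ gauss r v (M ∸ v) ⋆ (selector (v ℕ.+ total w) κ ⋆ (X^ (weight w) ⋆ gausses w))
              ≈⟨ solve 5 (λ x g s y h → x :* g :* (s :* (y :* h)) := s :* (x :* y :* (g :* h))) (λ n → refl)
                   (X^ (k ℕ.* v ℕ.+ r ℕ.* tri v)) (gauss r v (M ∸ v)) (selector (v ℕ.+ total w) κ) (X^ (weight w)) (gausses w) ⟩
            selector (v ℕ.+ total w) κ ⋆ (X^ (k ℕ.* v ℕ.+ r ℕ.* tri v) ⋆ X^ (weight w) ⋆ (gauss r v (M ∸ v) ⋆ gausses w))
              ≈⟨ ⋆-cong {selector (v ℕ.+ total w) κ} ≋.refl (⋆-cong (≋.sym (X^-+ (k ℕ.* v ℕ.+ r ℕ.* tri v) (weight w))) (λ n → refl)) ⟩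
            summand κ (v ∷ w) ∎

      -- The coefficient of z^κ in the product of 1 + z q^j, j < M r, computed in two ways: by the
      -- q-binomial theorem for q, and as a convolution over the residue classes modulo r, where the
      -- theorem holds for q^r.
      split : ∀ κ μ → κ ℕ.+ μ ≡ M ℕ.* r → X^ (tri κ) ⋆ gauss 1 κ μ ≋ ∑ₛ (vecs (below (suc M)) r) (summand κ)
      split κ μ e = begin
        X^ (tri κ) ⋆ gauss 1 κ μ                              ≈⟨ ⋆-cong (≡⇒≋ (cong X^ (lem κ (tri κ)))) (λ n → refl) ⟩
        X^ (0 ℕ.* κ ℕ.+ 1 ℕ.* tri κ) ⋆ gauss 1 κ μ            ≈⟨ q-binomial 1 0 κ μ ⟨
        ops (map X^ (row 1 (κ ℕ.+ μ) 0)) δ κ                  ≈⟨ ≡⇒≋ (cong (λ l → ops (map X^ l) δ κ) (trans (cong (λ L → row 1 L 0) e) (row-1 (M ℕ.* r)))) ⟩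
        ops (map X^ (below (M ℕ.* r))) δ κ                    ≈⟨ ops-↭ (map⁺ X^ (residue-classes r M)) δ κ ⟩
        ops (map X^ (concatMap (row r M) (below r))) δ κ      ≈⟨ expand r κ ⟩
        ∑ₛ (vecs (below (suc M)) r) (summand κ)               ∎
        where
        open import Relation.Binary.Reasoning.Setoid series-setoid
        lem : ∀ κ t → t ≡ 0 ℕ.* κ ℕ.+ 1 ℕ.* t
        lem = solve-∀
        row-1 : ∀ n → row 1 n 0 ≡ below n
        row-1 n = trans (List.map-cong (λ j → ℕ.*-identityˡ j) (below n)) (List.map-id (below n))

      -- T is the triangular number κ′(κ′-1)/2 of the centred index κ′ = κ - rm
      centred : ∀ κ μ T → κ ℕ.+ μ ≡ M ℕ.* r → tri κ ℕ.+ r ℕ.* (r ℕ.* (m ℕ.* m)) ≡ r ℕ.* (r ℕ.* tri m) ℕ.+ m ℕ.* tri r ℕ.+ r ℕ.* m ℕ.* κ ℕ.+ T →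
        X^ T ⋆ gauss 1 κ μ ≋ ∑ₛ (vecs (below (suc M)) r) (λ v → selector (total v) κ ⋆ (X^ (exponents v) ⋆ gausses v))
      centred κ μ T e e′ = X^-cancel off (begin
        X^ off ⋆ (X^ T ⋆ gauss 1 κ μ)                          ≈⟨ ≋.trans (≋.sym (⋆-assoc (X^ off) (X^ T) (gauss 1 κ μ))) (⋆-cong (≋.trans (≋.sym (X^-+ off T)) (≋.trans (≡⇒≋ (cong X^ (trans (sym e′) (ℕ.+-comm (tri κ) big)))) (X^-+ big (tri κ)))) (λ n → refl)) ⟩
        X^ big ⋆ X^ (tri κ) ⋆ gauss 1 κ μ                      ≈⟨ ≋.trans (⋆-assoc (X^ big) (X^ (tri κ)) (gauss 1 κ μ)) (⋆-cong {X^ big} ≋.refl (split κ μ e)) ⟩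
        X^ big ⋆ ∑ₛ vs (summand κ)                             ≈⟨ ⋆-∑ₛ vs (X^ big) (summand κ) ⟩
        ∑ₛ vs (λ v → X^ big ⋆ summand κ v)                     ≈⟨ ∑ₛ-cong vs termwise ⟩
        ∑ₛ vs (λ v → X^ off ⋆ (selector (total v) κ ⋆ (X^ (exponents v) ⋆ gausses v))) ≈⟨ ⋆-∑ₛ vs (X^ off) _ ⟨
        X^ off ⋆ ∑ₛ vs (λ v → selector (total v) κ ⋆ (X^ (exponents v) ⋆ gausses v)) ∎)
        where
        open import Relation.Binary.Reasoning.Setoid series-setoid
        vs = vecs (below (suc M)) r
        big = r ℕ.* (r ℕ.* (m ℕ.* m))
        off = r ℕ.* (r ℕ.* tri m) ℕ.+ m ℕ.* tri r ℕ.+ r ℕ.* m ℕ.* κ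
        termwise : ∀ v → X^ big ⋆ summand κ v ≋ X^ off ⋆ (selector (total v) κ ⋆ (X^ (exponents v) ⋆ gausses v))
        termwise v with total v ℕ.≟ κ
        ... | no ne = ≋.trans (zero-summand (X^ big) (X^ (weight v) ⋆ gausses v)) (≋.sym (zero-summand (X^ off) (X^ (exponents v) ⋆ gausses v)))
          where
          zero-summand : ∀ A B → A ⋆ (selector (total v) κ ⋆ B) ≋ 𝟎
          zero-summand A B = ≋.trans (⋆-cong {A} ≋.refl (≋.trans (⋆-cong (selector-no (total v) κ ne) (λ n → refl)) (⋆-zeroˡ B))) (⋆-zeroʳ A)
        ... | yes e₀ = ≋.trans (solve 4 (λ x s w g → x :* (s :* (w :* g)) := s :* (w :* x :* g)) (λ n → refl) (X^ big) (selector (total v) κ) (X^ (weight v)) (gausses v))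
          (≋.trans (⋆-cong {selector (total v) κ} ≋.refl (⋆-cong (≋.trans (≋.sym (X^-+ (weight v) big)) (≋.trans (≡⇒≋ (cong X^ (trans (weight-identity v ℕ.≤-refl) (cong (λ s → r ℕ.* (r ℕ.* tri m) ℕ.+ m ℕ.* tri r ℕ.+ r ℕ.* m ℕ.* s ℕ.+ exponents v) e₀)))) (X^-+ off (exponents v)))) (λ n → refl)))
            (solve 4 (λ x s w g → s :* (x :* w :* g) := x :* (s :* (w :* g))) (λ n → refl) (X^ off) (selector (total v) κ) (X^ (exponents v)) (gausses v)))

  poch-stable : ∀ g E d → 1 ≤ g → poch g (E ℕ.+ d) ≈[ E ] poch g E
  poch-stable g E zero    1≤g = ≋⇒≈ (≡⇒≋ (cong (poch g) (ℕ.+-identityʳ E)))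
  poch-stable g E (suc d) 1≤g = ≈-trans (≋⇒≈ (≡⇒≋ (cong (poch g) (ℕ.+-suc E d)))) (≈-trans (⋆-≈ {E} {poch g (E ℕ.+ d)} {poch g E} {𝟏 ⊟ X^ a} {𝟏} (poch-stable g E d 1≤g) one) (≋⇒≈ (⋆-identityʳ (poch g E))))
    where
    a = g ℕ.* suc (E ℕ.+ d)
    E≤a : E ≤ a
    E≤a = ℕ.≤-trans (ℕ.≤-trans (ℕ.m≤m+n E d) (ℕ.n≤1+n _)) (ℕ.m≤n*m (suc (E ℕ.+ d)) g {{ℕ.>-nonZero 1≤g}})
    one : 𝟏 ⊟ X^ a ≈[ E ] 𝟏
    one n lt = trans (cong (λ z → 𝟏 n ℤ.- z) (trans (sym (⋆-identityʳ (X^ a) n)) (X^-≈0 a 𝟏 E≤a n lt))) (ℤ.+-identityʳ (𝟏 n))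

  poch-unit : ∀ g n → 1 ≤ g → poch g n 0 ≡ 1ℤ
  poch-unit g       zero    1≤g = refl
  poch-unit (suc g) (suc n) 1≤g = cong (λ z → z ℤ.* (1ℤ ℤ.- 0ℤ)) (poch-unit (suc g) n 1≤g)

  -- Below degree E the products for κ, μ and κ + μ all agree with `poch g E`, so `poch-gauss` reads
  -- F F G ≈ F, and one F cancels.
  gauss-inverse : ∀ g E κ μ → 1 ≤ g → E ≤ κ → E ≤ μ → poch g E ⋆ gauss g κ μ ≈[ E ] 𝟏
  gauss-inverse g E κ μ 1≤g E≤κ E≤μ = unit-cancel F (F ⋆ gauss g κ μ) 𝟏 (poch-unit g E 1≤g)
    (≈-trans (≋⇒≈ (≋.sym (⋆-assoc F F (gauss g κ μ)))) (≈-trans (⋆-≈ {E} {F ⋆ F} (⋆-≈ (≈-sym (settled κ E≤κ)) (≈-sym (settled μ E≤μ))) (λ n _ → refl))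
      (≈-trans (≋⇒≈ (poch-gauss g κ μ)) (≈-trans (settled (κ ℕ.+ μ) (ℕ.≤-trans E≤κ (ℕ.m≤m+n κ μ))) (≋⇒≈ (≋.sym (⋆-identityʳ F)))))))
    where
    F = poch g E
    settled : ∀ k → E ≤ k → poch g k ≈[ E ] F
    settled k E≤k = subst (λ z → poch g z ≈[ E ] F) (ℕ.m+[n∸m]≡n E≤k) (poch-stable g E (k ∸ E) 1≤g)

  module Limit (r m E : ℕ) (1≤r : 1 ≤ r) (E<m : E ℕ.+ suc E ≤ m) where
    open Lattice r m
    M : ℕ
    M = m ℕ.+ m
    open Splitting M

    -- Distances d and e from the centre m, one of them zero: a coordinate further than E from the
    -- centre has a quadratic exponent of at least E and is invisible at this precision.
    far-exponent : ∀ i d e → suc E ≤ d ℕ.+ e → d ≡ 0 ⊎ e ≡ 0 → E ≤ r ℕ.* tri d ℕ.+ i ℕ.* d ℕ.+ (r ℕ.* tri e ℕ.+ (r ∸ i) ℕ.* e)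
    far-exponent i d e far (inj₁ refl) = ℕ.≤-trans (ℕ.≤-trans (ℕ.m≤m+n E (tri E)) (ℕ.≤-trans (tri-mono far) (ℕ.m≤n*m (tri e) r {{ℕ.>-nonZero 1≤r}})))
      (ℕ.≤-trans (ℕ.m≤m+n (r ℕ.* tri e) ((r ∸ i) ℕ.* e)) (ℕ.m≤n+m _ (r ℕ.* tri 0 ℕ.+ i ℕ.* 0)))
    far-exponent i d e far (inj₂ refl) = ℕ.≤-trans (ℕ.≤-trans (ℕ.m≤m+n E (tri E)) (ℕ.≤-trans (tri-mono (subst (suc E ≤_) (ℕ.+-identityʳ d) far)) (ℕ.m≤n*m (tri d) r {{ℕ.>-nonZero 1≤r}})))
      (ℕ.≤-trans (ℕ.m≤m+n (r ℕ.* tri d) (i ℕ.* d)) (ℕ.m≤m+n _ (r ℕ.* tri 0 ℕ.+ (r ∸ i) ℕ.* 0)))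

    one-zero : ∀ v → v ∸ m ≡ 0 ⊎ m ∸ v ≡ 0
    one-zero v with ℕ.≤-total v m
    ... | inj₁ v≤m = inj₁ (ℕ.m≤n⇒m∸n≡0 v≤m)
    ... | inj₂ m≤v = inj₂ (ℕ.m≤n⇒m∸n≡0 m≤v)

    far-or-middle : ∀ i v → (E ≤ v × E ≤ M ∸ v) ⊎ E ≤ exponent i v
    far-or-middle i v with E ℕ.≤? v | E ℕ.≤? M ∸ v
    ... | yes p | yes q = inj₁ (p , q)
    ... | no ¬p | _     = inj₂ (far-exponent i (v ∸ m) (m ∸ v) (ℕ.≤-trans far (ℕ.m≤n+m (m ∸ v) (v ∸ m))) (one-zero v))
      where
      far : suc E ≤ m ∸ v
      far = ℕ.≤-trans (ℕ.≤-reflexive (sym (ℕ.m+n∸m≡n E (suc E)))) (ℕ.≤-trans (ℕ.∸-monoˡ-≤ E E<m) (ℕ.∸-monoʳ-≤ m (ℕ.<⇒≤ (ℕ.≰⇒> ¬p))))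
    ... | yes _ | no ¬q = inj₂ (far-exponent i (v ∸ m) (m ∸ v) (ℕ.≤-trans far (ℕ.m≤m+n (v ∸ m) (m ∸ v))) (one-zero v))
      where
      M≤ : m ℕ.+ m ≤ v ℕ.+ E
      M≤ = ℕ.≤-trans (ℕ.m≤n+m∸n (m ℕ.+ m) v) (ℕ.+-monoʳ-≤ v (ℕ.<⇒≤ (ℕ.≰⇒> ¬q)))
      far : suc E ≤ v ∸ m
      far = ℕ.m+n≤o⇒m≤o∸n (suc E) (ℕ.+-cancelʳ-≤ E (suc E ℕ.+ m) v (ℕ.≤-trans (ℕ.≤-reflexive (lem E m)) (ℕ.≤-trans (ℕ.+-monoˡ-≤ m E<m) M≤)))
        where
        lem : ∀ E m → suc E ℕ.+ m ℕ.+ E ≡ E ℕ.+ suc E ℕ.+ m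
        lem = solve-∀

    F₁ Fᵣ : Series
    F₁ = poch 1 E
    Fᵣ = poch r E

    gausses-inverse : ∀ {k} (v : Vec ℕ k) → (gausses v ⋆ Fᵣ ↑ k ≈[ E ] 𝟏) ⊎ E ≤ exponents v
    gausses-inverse []               = inj₁ (≋⇒≈ (⋆-identityʳ 𝟏))
    gausses-inverse (_∷_ {i} v vs) with far-or-middle i v | gausses-inverse vs
    ... | inj₂ far | _ = inj₂ (ℕ.≤-trans far (ℕ.m≤m+n _ _))
    ... | inj₁ _   | inj₂ far = inj₂ (ℕ.≤-trans far (ℕ.m≤n+m _ _))
    ... | inj₁ (p , q) | inj₁ ih = inj₁ (≈-trans (≋⇒≈ (solve 4 (λ g h f k → g :* h :* (f :* k) := f :* g :* (h :* k)) (λ n → refl) (gauss r v (M ∸ v)) (gausses vs) Fᵣ (Fᵣ ↑ i)))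
      (≈-trans (⋆-≈ (gauss-inverse r E v (M ∸ v) 1≤r p q) ih) (≋⇒≈ (⋆-identityʳ 𝟏))))

    count : ℕ → Series
    count κ = ∑ₛ (vecs (below (suc M)) r) (λ v → selector (total v) κ ⋆ X^ (exponents v))

    -- Below degree E this is f_r^r / f_1, the generating function of r-cores; `gauss 1 E E` plays
    -- the part of 1 / f_1.
    core : Series
    core = gauss 1 E E ⋆ Fᵣ ↑ r

    F₁⋆core : F₁ ⋆ core ≈[ E ] Fᵣ ↑ r
    F₁⋆core = ≈-trans (≋⇒≈ (≋.sym (⋆-assoc F₁ (gauss 1 E E) (Fᵣ ↑ r)))) (≈-trans (⋆-≈ {E} {F₁ ⋆ gauss 1 E E} {𝟏} (gauss-inverse 1 E E E ℕ.≤-refl ℕ.≤-refl ℕ.≤-refl) (λ n _ → refl)) (≋⇒≈ (⋆-identityˡ (Fᵣ ↑ r))))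

    -- The identity `centred` multiplied by f_r^r. The Gaussian factors of a vector near the centre
    -- cancel against it, and the other vectors have exponents beyond E. All coordinate sums are
    -- covered, not only the centred sum 0 of genuine cores; another sum costs the factor q^T.
    count-core : ∀ κ μ T → E ≤ κ → E ≤ μ → κ ℕ.+ μ ≡ M ℕ.* r → tri κ ℕ.+ r ℕ.* (r ℕ.* (m ℕ.* m)) ≡ r ℕ.* (r ℕ.* tri m) ℕ.+ m ℕ.* tri r ℕ.+ r ℕ.* m ℕ.* κ ℕ.+ T →
      count κ ≈[ E ] X^ T ⋆ core
    count-core κ μ T E≤κ E≤μ e e′ = ≈-sym (unit-cancel F₁ (X^ T ⋆ core) (count κ) (poch-unit 1 E ℕ.≤-refl) equal)
      where
      vs = vecs (below (suc M)) r
      termwise : ∀ v → selector (total v) κ ⋆ (X^ (exponents v) ⋆ gausses v) ⋆ (Fᵣ ↑ r) ≈[ E ] selector (total v) κ ⋆ X^ (exponents v)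
      termwise v with gausses-inverse v
      ... | inj₁ inv = ≈-trans (≋⇒≈ (solve 4 (λ s x g f → s :* (x :* g) :* f := s :* x :* (g :* f)) (λ n → refl) (selector (total v) κ) (X^ (exponents v)) (gausses v) (Fᵣ ↑ r)))
        (≈-trans (⋆-≈ {E} {selector (total v) κ ⋆ X^ (exponents v)} (λ n _ → refl) inv) (≋⇒≈ (⋆-identityʳ _)))
      ... | inj₂ far = ≈-trans (≋⇒≈ (solve 4 (λ s x g f → s :* (x :* g) :* f := x :* (s :* g :* f)) (λ n → refl) (selector (total v) κ) (X^ (exponents v)) (gausses v) (Fᵣ ↑ r)))
        (≈-trans (X^-≈0 (exponents v) (selector (total v) κ ⋆ gausses v ⋆ Fᵣ ↑ r) far) (≈-sym (≈-trans (≋⇒≈ (⋆-comm (selector (total v) κ) (X^ (exponents v)))) (X^-≈0 (exponents v) (selector (total v) κ) far))))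
      equal : F₁ ⋆ (X^ T ⋆ core) ≈[ E ] F₁ ⋆ count κ
      equal = ≈-trans (≋⇒≈ (solve 3 (λ f x c → f :* (x :* c) := x :* (f :* c)) (λ n → refl) F₁ (X^ T) core))
        (≈-trans (⋆-≈ {E} {X^ T} (λ n _ → refl) F₁⋆core)
        (≈-trans (⋆-≈ {E} {X^ T} {X^ T ⋆ (F₁ ⋆ gauss 1 κ μ)} (≈-sym (≈-trans (⋆-≈ {E} {X^ T} (λ n _ → refl) (gauss-inverse 1 E κ μ ℕ.≤-refl E≤κ E≤μ)) (≋⇒≈ (⋆-identityʳ (X^ T))))) (λ n _ → refl))
        (≈-trans (≋⇒≈ (solve 4 (λ x f g k → x :* (f :* g) :* k := f :* (x :* g :* k)) (λ n → refl) (X^ T) F₁ (gauss 1 κ μ) (Fᵣ ↑ r)))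
        (⋆-≈ {E} {F₁} (λ n _ → refl) (≈-trans (≋⇒≈ (⋆-cong (centred κ μ T e e′) (λ n → refl))) (≈-trans (≋⇒≈ (∑ₛ-⋆ vs _ (Fᵣ ↑ r))) (∑ₛ-≈ vs termwise)))))))

-- The pentagonal number theorem.

module Pentagonal where

  open import Data.Nat as ℕ using (ℕ; zero; suc; _≤_; _∸_)
  import Data.Nat.Properties as ℕ
  open import Data.Nat.Tactic.RingSolver using (solve-∀)
  open import Data.Integer using (ℤ; +_; -[1+_]; 0ℤ)
  import Data.Integer as ℤ
  import Data.Integer.Properties as ℤ
  open import Relation.Binary.PropositionalEquality
  open Sums
  open Series
  open Gauss
  open Core
  open ≋-Solver using (solve; _:=_; _:+_; _:*_; _:-_; :-_; con)

  signˢ : ℕ → Series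
  signˢ zero    = 𝟏
  signˢ (suc k) = ⊝ signˢ k

  -- The generalized pentagonal number j(3j - 1)/2, with one clause for each sign to avoid the
  -- division.
  pent : ℤ → ℕ
  pent (+ n)    = n ℕ.* n ℕ.+ tri n
  pent -[1+ n ] = suc n ℕ.* suc n ℕ.+ tri (suc (suc n))

  theta-term : ℕ → ℤ → Series
  theta-term t j = signˢ ℤ.∣ j ∣ ⋆ X^ (t ℕ.* pent j)

  theta : ℕ → ℕ → Series
  theta t n = ∑ₛ (interval n) (theta-term t)

  -- Shanks' finite form of the pentagonal number theorem:
  -- Σ_{k≤n} (-1)^k Π_{k<i≤n} (1 - x^i) x^{nk + k(k+1)/2} = Σ_{|j|≤n} (-1)^j x^{j(3j-1)/2} with x = X^t.
  module Shanks (t : ℕ) where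

    segment : ℕ → ℕ → Series
    segment k zero    = 𝟏
    segment k (suc d) = segment k d ⋆ (𝟏 ⊟ X^ (t ℕ.* (k ℕ.+ suc d)))

    segment-left : ∀ k d → segment k (suc d) ≋ (𝟏 ⊟ X^ (t ℕ.* suc k)) ⋆ segment (suc k) d
    segment-left k zero    = ≋.trans (⋆-comm 𝟏 (𝟏 ⊟ X^ (t ℕ.* (k ℕ.+ 1)))) (⋆-cong (λ n → cong (λ z → 𝟏 n ℤ.- X^ (t ℕ.* z) n) (ℕ.+-comm k 1)) (λ n → refl))
    segment-left k (suc d) = ≋.trans (⋆-cong (segment-left k d) (λ n → cong (λ z → 𝟏 n ℤ.- X^ (t ℕ.* z) n) (ℕ.+-suc k (suc d))))
      (⋆-assoc (𝟏 ⊟ X^ (t ℕ.* suc k)) (segment (suc k) d) _)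

    segment-poch : ∀ n → segment 0 n ≋ poch t n
    segment-poch zero    = ≋.refl
    segment-poch (suc n) = ⋆-cong (segment-poch n) (λ n → refl)

    term : ℕ → ℕ → Series
    term k d = signˢ k ⋆ segment k d ⋆ X^ (t ℕ.* ((k ℕ.+ d) ℕ.* k ℕ.+ tri (suc k)))

    partial : ℕ → ℕ → Series
    partial n zero    = term 0 n
    partial n (suc K) = partial n K ⊞ term (suc K) (n ∸ suc K)

    -- Raising n by one changes the partial sum by a single boundary term. On the diagonal n = K
    -- this term and the new summand become the theta terms for j = K + 1 and j = -(K + 1).
    telescope : ∀ K d → partial (suc (K ℕ.+ d)) K ≋ partial (K ℕ.+ d) K ⊟ signˢ K ⋆ segment K d ⋆ X^ (t ℕ.* (suc (K ℕ.+ d) ℕ.* suc K ℕ.+ tri (suc K)))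
    telescope zero d = ≋.trans (⋆-cong {signˢ 0 ⋆ (segment 0 d ⋆ (𝟏 ⊟ X^ (t ℕ.* suc d)))} {_} {X^ (t ℕ.* (suc d ℕ.* 0 ℕ.+ 0))} {𝟏} ≋.refl (≡⇒≋ (cong X^ (lem₀ t (suc d)))))
      (≋.trans (solve 2 (λ s w → con (+ 1) :* (s :* (con (+ 1) :- w)) :* con (+ 1) := con (+ 1) :* s :* con (+ 1) :- con (+ 1) :* s :* w) (λ n → refl) (segment 0 d) (X^ (t ℕ.* suc d)))
        (λ n → cong₂ ℤ._-_ (⋆-cong {𝟏 ⋆ segment 0 d} ≋.refl (≡⇒≋ (cong X^ (sym (lem₀ t d)))) n) (⋆-cong {𝟏 ⋆ segment 0 d} ≋.refl (≡⇒≋ (cong X^ (lem₁ t (suc d)))) n)))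
      where
      lem₀ : ∀ t d → t ℕ.* (d ℕ.* 0 ℕ.+ 0) ≡ 0
      lem₀ = solve-∀
      lem₁ : ∀ t d → t ℕ.* d ≡ t ℕ.* (d ℕ.* 1 ℕ.+ 0)
      lem₁ = solve-∀
    telescope (suc K) d = begin
      partial n K ⊞ term (suc K) (n ∸ suc K)
        ≈⟨ ≋.+-cong (≋.trans (≡⇒≋ (cong (λ z → partial z K) (cong suc (sym (ℕ.+-suc K d))))) (≋.trans (telescope K (suc d)) (λ k → cong₂ ℤ._-_ (≡⇒≋ (cong (λ z → partial z K) (ℕ.+-suc K d)) k) (ih-term k)))) last-term ⟩
      partial n′ K ⊟ σ ⋆ ((𝟏 ⊟ y) ⋆ a) ⋆ u ⊞ ⊝ σ ⋆ (a ⋆ (𝟏 ⊟ w)) ⋆ (u ⋆ y)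
        ≈⟨ solve 6 (λ P σ y a u w → P :- σ :* ((con (+ 1) :- y) :* a) :* u :+ :- σ :* (a :* (con (+ 1) :- w)) :* (u :* y) := P :+ :- σ :* a :* u :- :- σ :* a :* (u :* y :* w)) (λ n → refl) (partial n′ K) σ y a u w ⟩
      partial n′ K ⊞ ⊝ σ ⋆ a ⋆ u ⊟ ⊝ σ ⋆ a ⋆ (u ⋆ y ⋆ w)
        ≈⟨ (λ k → cong₂ ℤ._-_ (cong (λ z → partial n′ K k ℤ.+ z) (⋆-cong {⊝ σ ⋆ a} ≋.refl (≡⇒≋ (cong X^ (lem₂ t K d (tri (suc K))))) k)) (⋆-cong {⊝ σ ⋆ a} ≋.refl (≋.trans (⋆-cong (≋.sym (X^-+ eu ey)) (λ n → refl)) (≋.trans (≋.sym (X^-+ (eu ℕ.+ ey) ew)) (≡⇒≋ (cong X^ (lem₃ t K d (tri (suc K))))))) k)) ⟩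
      partial n′ K ⊞ term (suc K) d ⊟ ⊝ σ ⋆ a ⋆ X^ (t ℕ.* (n ℕ.* suc (suc K) ℕ.+ tri (suc (suc K))))
        ≈⟨ (λ k → cong (λ z → partial n′ K k ℤ.+ term (suc K) z k ℤ.- (⊝ σ ⋆ a ⋆ X^ (t ℕ.* (n ℕ.* suc (suc K) ℕ.+ tri (suc (suc K))))) k) (sym (ℕ.m+n∸m≡n (suc K) d))) ⟩
      partial n′ (suc K) ⊟ signˢ (suc K) ⋆ segment (suc K) d ⋆ X^ (t ℕ.* (n ℕ.* suc (suc K) ℕ.+ tri (suc (suc K)))) ∎
      where
      open import Relation.Binary.Reasoning.Setoid series-setoid
      n n′ eu ey ew : ℕ
      n = suc (suc K ℕ.+ d)
      n′ = suc K ℕ.+ d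
      eu = t ℕ.* (n ℕ.* suc K ℕ.+ tri (suc K))
      ey = t ℕ.* suc K
      ew = t ℕ.* (suc K ℕ.+ suc d)
      σ a u y w : Series
      σ = signˢ K
      a = segment (suc K) d
      u = X^ eu
      y = X^ ey
      w = X^ ew
      lem₁ : ∀ t K d T → t ℕ.* (suc (suc K ℕ.+ d) ℕ.* suc K ℕ.+ T) ℕ.+ t ℕ.* suc K ≡ t ℕ.* ((suc K ℕ.+ suc d) ℕ.* suc K ℕ.+ (suc K ℕ.+ T))
      lem₁ = solve-∀
      lem₂ : ∀ t K d T → t ℕ.* (suc (suc K ℕ.+ d) ℕ.* suc K ℕ.+ T) ≡ t ℕ.* ((suc K ℕ.+ d) ℕ.* suc K ℕ.+ (suc K ℕ.+ T))
      lem₂ = solve-∀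
      lem₃ : ∀ t K d T → t ℕ.* (suc (suc K ℕ.+ d) ℕ.* suc K ℕ.+ T) ℕ.+ t ℕ.* suc K ℕ.+ t ℕ.* (suc K ℕ.+ suc d) ≡ t ℕ.* (suc (suc K ℕ.+ d) ℕ.* suc (suc K) ℕ.+ (suc K ℕ.+ T))
      lem₃ = solve-∀
      ih-term : σ ⋆ segment K (suc d) ⋆ X^ (t ℕ.* (suc (K ℕ.+ suc d) ℕ.* suc K ℕ.+ tri (suc K))) ≋ σ ⋆ ((𝟏 ⊟ y) ⋆ a) ⋆ u
      ih-term = ⋆-cong (⋆-cong {σ} ≋.refl (segment-left K d)) (≡⇒≋ (cong (λ z → X^ (t ℕ.* (suc z ℕ.* suc K ℕ.+ tri (suc K)))) (ℕ.+-suc K d)))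
      last-term : term (suc K) (n ∸ suc K) ≋ ⊝ σ ⋆ (a ⋆ (𝟏 ⊟ w)) ⋆ (u ⋆ y)
      last-term = ≋.trans (≡⇒≋ (cong (term (suc K)) (trans (cong (_∸ suc K) (sym (ℕ.+-suc (suc K) d))) (ℕ.m+n∸m≡n (suc K) (suc d)))))
        (⋆-cong {⊝ σ ⋆ (a ⋆ (𝟏 ⊟ w))} ≋.refl (≋.trans (≡⇒≋ (cong X^ (sym (lem₁ t K d (tri (suc K)))))) (X^-+ eu ey)))

    partial-theta : ∀ n → partial n n ≋ theta t n
    partial-theta zero    = ≋.trans (solve 1 (λ x → con (+ 1) :* con (+ 1) :* x := con (+ 1) :* x :+ con (+ 0)) (λ n → refl) (X^ (t ℕ.* 0)))
      (λ n → cong (λ z → (𝟏 ⋆ X^ (t ℕ.* 0)) n ℤ.+ z) (const-zero n))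
      where
      const-zero : ∀ n → const 0ℤ n ≡ 0ℤ
      const-zero zero    = refl
      const-zero (suc n) = refl
    partial-theta (suc K) = begin
      partial (suc K) K ⊞ term (suc K) (K ∸ K)
        ≈⟨ ≋.+-cong (≋.trans (≡⇒≋ (cong (λ z → partial (suc z) K) (sym (ℕ.+-identityʳ K)))) (telescope K 0)) (≡⇒≋ (cong (term (suc K)) (ℕ.n∸n≡0 K))) ⟩
      partial (K ℕ.+ 0) K ⊟ signˢ K ⋆ 𝟏 ⋆ X^ (t ℕ.* (suc (K ℕ.+ 0) ℕ.* suc K ℕ.+ tri (suc K))) ⊞ ⊝ signˢ K ⋆ 𝟏 ⋆ X^ (t ℕ.* ((suc K ℕ.+ 0) ℕ.* suc K ℕ.+ tri (suc (suc K))))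
        ≈⟨ solve 4 (λ P σ a b → P :- σ :* con (+ 1) :* a :+ :- σ :* con (+ 1) :* b := :- σ :* a :+ (:- σ :* b :+ P)) (λ n → refl) (partial (K ℕ.+ 0) K) (signˢ K) (X^ (t ℕ.* (suc (K ℕ.+ 0) ℕ.* suc K ℕ.+ tri (suc K)))) (X^ (t ℕ.* ((suc K ℕ.+ 0) ℕ.* suc K ℕ.+ tri (suc (suc K))))) ⟩
      ⊝ signˢ K ⋆ X^ (t ℕ.* (suc (K ℕ.+ 0) ℕ.* suc K ℕ.+ tri (suc K))) ⊞ (⊝ signˢ K ⋆ X^ (t ℕ.* ((suc K ℕ.+ 0) ℕ.* suc K ℕ.+ tri (suc (suc K)))) ⊞ partial (K ℕ.+ 0) K)
        ≈⟨ ≋.+-cong (reduce (tri (suc K))) (≋.+-cong (reduce (tri (suc (suc K)))) (≋.trans (≡⇒≋ (cong (λ z → partial z K) (ℕ.+-identityʳ K))) (partial-theta K))) ⟩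
      theta t (suc K) ∎
      where
      open import Relation.Binary.Reasoning.Setoid series-setoid
      reduce : ∀ T → ⊝ signˢ K ⋆ X^ (t ℕ.* (suc (K ℕ.+ 0) ℕ.* suc K ℕ.+ T)) ≋ ⊝ signˢ K ⋆ X^ (t ℕ.* (suc K ℕ.* suc K ℕ.+ T))
      reduce T = ⋆-cong {⊝ signˢ K} ≋.refl (≡⇒≋ (cong (λ z → X^ (t ℕ.* (suc z ℕ.* suc K ℕ.+ T))) (ℕ.+-identityʳ K)))

    -- All summands with k ≥ 1 carry an exponent of at least n, so only the product itself survives
    -- below E.
    partial-poch : ∀ {E} n K → 1 ≤ t → E ≤ n → K ≤ n → partial n K ≈[ E ] poch t n
    partial-poch n zero    1≤t E≤n K≤n = ≋⇒≈ (≋.trans (⋆-cong (⋆-identityˡ (segment 0 n)) (≡⇒≋ (cong X^ (lem t n)))) (≋.trans (⋆-identityʳ (segment 0 n)) (segment-poch n)))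
      where
      lem : ∀ t n → t ℕ.* (n ℕ.* 0 ℕ.+ 0) ≡ 0
      lem = solve-∀
    partial-poch {E} n (suc K) 1≤t E≤n K<n = ≈-trans (⊞-≈ (partial-poch n K 1≤t E≤n (ℕ.<⇒≤ K<n)) vanish) (λ k _ → ℤ.+-identityʳ (poch t n k))
      where
      large : E ≤ t ℕ.* ((suc K ℕ.+ (n ∸ suc K)) ℕ.* suc K ℕ.+ tri (suc (suc K)))
      large = ℕ.≤-trans E≤n (ℕ.≤-trans (ℕ.≤-reflexive (sym (ℕ.m+[n∸m]≡n K<n))) (ℕ.≤-trans (ℕ.m≤m*n (suc K ℕ.+ (n ∸ suc K)) (suc K)) (ℕ.≤-trans (ℕ.m≤m+n _ (tri (suc (suc K)))) (ℕ.m≤n*m _ t {{ℕ.>-nonZero 1≤t}}))))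
      vanish : term (suc K) (n ∸ suc K) ≈[ E ] 𝟎
      vanish = ≈-trans (≋⇒≈ (⋆-comm (signˢ (suc K) ⋆ segment (suc K) (n ∸ suc K)) _)) (X^-≈0 _ (signˢ (suc K) ⋆ segment (suc K) (n ∸ suc K)) large)

  pentagonal : ∀ t E J → 1 ≤ t → E ≤ J → poch t E ≈[ E ] theta t J
  pentagonal t E J 1≤t E≤J = ≈-trans (≈-sym (subst (λ z → poch t z ≈[ E ] poch t E) (ℕ.m+[n∸m]≡n E≤J) (poch-stable t E (J ∸ E) 1≤t)))
    (≈-trans (≈-sym (partial-poch J J 1≤t E≤J ℕ.≤-refl)) (≋⇒≈ (partial-theta J)))
    where open Shanks t

-- The generating function of t-regular partitions.

module Regular where

  open import Defs
  open import Data.Bool using (true; false)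
  open import Data.Nat as ℕ using (ℕ; zero; suc; _≤_; _<_; _∸_; z≤n; s≤s)
  import Data.Nat.Properties as ℕ
  open import Data.Nat.Divisibility using (_∣_; _∣?_; ∣⇒≤; ∣m+n∣m⇒∣n; n∣m*n; ∣m∣n⇒∣m+n; ∣-refl)
  open import Data.Integer using (ℤ; +_)
  import Data.Integer as ℤ
  import Data.Integer.Properties as ℤ
  open import Data.Product using (_×_; _,_)
  open import Data.Sum using (_⊎_; inj₁; inj₂)
  open import Relation.Nullary
  open import Relation.Nullary.Decidable using (dec-true; dec-false)
  open import Relation.Binary.PropositionalEquality
  open Series
  open Gauss
  open Core
  open ≋-Solver using (solve; _:=_; _:+_; _:*_; _:-_; con)

  <ᵇ-cases : ∀ k n → ((k ℕ.<ᵇ n) ≡ true × k < n) ⊎ ((k ℕ.<ᵇ n) ≡ false × n ≤ k)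
  <ᵇ-cases k n with k ℕ.<? n
  ... | yes lt = inj₁ (dec-true (k ℕ.<? n) lt , lt)
  ... | no nlt = inj₂ (dec-false (k ℕ.<? n) nlt , ℕ.≮⇒≥ nlt)

  -- Each copy removes at least 1 from n, so fuel n never runs out; with fuel 0 only n = 0 is left,
  -- where both clauses give f 0.
  fuel-irrelevant : ∀ f k {j j′ n} → n ≤ j → n ≤ j′ → sumCopies f j (suc k) n ≡ sumCopies f j′ (suc k) n
  fuel-irrelevant f k {zero}  {zero}   p q = refl
  fuel-irrelevant f k {zero}  {suc j′} z≤n q = sym (ℕ.+-identityʳ (f 0))
  fuel-irrelevant f k {suc j} {zero}   p z≤n = ℕ.+-identityʳ (f 0)
  fuel-irrelevant f k {suc j} {suc j′} {n} p q with <ᵇ-cases k n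
  ... | inj₂ (e , _) rewrite e = refl
  ... | inj₁ (e , lt) rewrite e = cong (f n ℕ.+_) (fuel-irrelevant f k (smaller lt p) (smaller lt q))
    where
    smaller : ∀ {n i} → k < n → n ≤ suc i → n ∸ suc k ≤ i
    smaller (s≤s {n = n} _) (s≤s n≤i) = ℕ.≤-trans (ℕ.m∸n≤m n k) n≤i

  copies : (ℕ → ℕ) → ℕ → ℕ → ℕ
  copies f k n = sumCopies f n (suc k) n

  copies-small : ∀ f k n → n < suc k → copies f k n ≡ f n
  copies-small f k zero    lt = refl
  copies-small f k (suc n) (s≤s n<k) with <ᵇ-cases k (suc n)
  ... | inj₁ (_ , k<n) = contradiction k<n (ℕ.≤⇒≯ n<k)
  ... | inj₂ (e , _) rewrite e = ℕ.+-identityʳ (f (suc n))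

  copies-step : ∀ f k n → copies f k (suc k ℕ.+ n) ≡ f (suc k ℕ.+ n) ℕ.+ copies f k n
  copies-step f k n with <ᵇ-cases k (suc k ℕ.+ n)
  ... | inj₂ (_ , le) = contradiction le (ℕ.<⇒≱ (s≤s (ℕ.m≤m+n k n)))
  ... | inj₁ (e , _) rewrite e = cong (f (suc k ℕ.+ n) ℕ.+_) (trans (cong (sumCopies f (k ℕ.+ n) (suc k)) (ℕ.m+n∸m≡n k n)) (fuel-irrelevant f k (ℕ.m≤n+m n k) ℕ.≤-refl))

  embed : (ℕ → ℕ) → Series
  embed f n = + f n

  -- The recursion g(n) = f(n) + g(n - k - 1) in the form of series: admitting the part k + 1
  -- divides by 1 - q^(k+1).
  copies-series : ∀ f k → embed (copies f k) ⋆ (𝟏 ⊟ X^ (suc k)) ≋ embed f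
  copies-series f k = ≋.trans (solve 2 (λ g x → g :* (con (+ 1) :- x) := g :- x :* g) (λ n → refl) g (X^ (suc k))) coefficient
    where
    g = embed (copies f k)
    cancel : ∀ a b → + (a ℕ.+ b) ℤ.- + b ≡ + a
    cancel a b = trans (cong (ℤ._- + b) (ℤ.pos-+ a b)) (trans (ℤ.+-assoc (+ a) (+ b) (ℤ.- + b)) (trans (cong (λ z → + a ℤ.+ z) (ℤ.+-inverseʳ (+ b))) (ℤ.+-identityʳ (+ a))))
    coefficient : ∀ n → g n ℤ.- (X^ (suc k) ⋆ g) n ≡ + f n
    coefficient n with suc k ℕ.≤? n
    ... | no nle = trans (cong₂ ℤ._-_ (cong +_ (copies-small f k n (ℕ.≰⇒> nle))) (X^-⋆-below (suc k) g n (ℕ.≰⇒> nle))) (ℤ.+-identityʳ (+ f n))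
    ... | yes le = subst (λ n → g n ℤ.- (X^ (suc k) ⋆ g) n ≡ + f n) (ℕ.m+[n∸m]≡n le) (at (n ∸ suc k))
      where
      at : ∀ d → g (suc k ℕ.+ d) ℤ.- (X^ (suc k) ⋆ g) (suc k ℕ.+ d) ≡ + f (suc k ℕ.+ d)
      at d = trans (cong₂ ℤ._-_ (cong +_ (copies-step f k d)) (X^-⋆-at (suc k) g d)) (cancel (f (suc k ℕ.+ d)) (copies f k d))

  module _ (t : ℕ) where

    -- The factors 1 - q^i of f_1 with t not dividing i, and those with t dividing i; "coprime"
    -- means no more than that.
    coprime-part divisible-part : ℕ → Series
    coprime-part zero    = 𝟏
    coprime-part (suc m) with t ∣? suc m
    ... | yes _ = coprime-part m
    ... | no _  = coprime-part m ⋆ (𝟏 ⊟ X^ (suc m))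
    divisible-part zero    = 𝟏
    divisible-part (suc m) with t ∣? suc m
    ... | yes _ = divisible-part m ⋆ (𝟏 ⊟ X^ (suc m))
    ... | no _  = divisible-part m

    parts-product : ∀ m → coprime-part m ⋆ divisible-part m ≋ poch 1 m
    parts-product zero    = ⋆-identityʳ 𝟏
    parts-product (suc m) with t ∣? suc m
    ... | yes _ = ≋.trans (≋.sym (⋆-assoc (coprime-part m) (divisible-part m) (𝟏 ⊟ X^ (suc m)))) (⋆-cong (parts-product m) (λ n → cong (λ a → 𝟏 n ℤ.- X^ a n) (sym (ℕ.*-identityˡ (suc m)))))
    ... | no _  = ≋.trans (solve 3 (λ a b c → a :* c :* b := a :* b :* c) (λ n → refl) (coprime-part m) (divisible-part m) (𝟏 ⊟ X^ (suc m))) (⋆-cong (parts-product m) (λ n → cong (λ a → 𝟏 n ℤ.- X^ a n) (sym (ℕ.*-identityˡ (suc m)))))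

    cnt-inverse : ∀ m → embed (cnt t m) ⋆ coprime-part m ≋ 𝟏
    cnt-inverse zero    = ≋.trans (⋆-identityʳ (embed (cnt t 0))) λ { zero → refl ; (suc n) → refl }
    cnt-inverse (suc m) with t ∣? suc m
    ... | yes _ = cnt-inverse m
    ... | no _  = ≋.trans (solve 3 (λ a b c → a :* (b :* c) := a :* c :* b) (λ n → refl) (embed (copies (cnt t m) m)) (coprime-part m) (𝟏 ⊟ X^ (suc m)))
      (≋.trans (⋆-cong (copies-series (cnt t m) m) (λ n → refl)) (cnt-inverse m))

    cnt-stable : ∀ n d → cnt t (n ℕ.+ d) n ≡ b t n
    cnt-stable n zero    = cong (λ m → cnt t m n) (ℕ.+-identityʳ n)
    cnt-stable n (suc d) = trans (cong (λ m → cnt t m n) (ℕ.+-suc n d)) (trans step (cnt-stable n d))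
      where
      step : cnt t (suc (n ℕ.+ d)) n ≡ cnt t (n ℕ.+ d) n
      step with t ∣? suc (n ℕ.+ d)
      ... | yes _ = refl
      ... | no _  = copies-small (cnt t (n ℕ.+ d)) (n ℕ.+ d) n (s≤s (ℕ.m≤m+n n d))

  divisible-poch : ∀ t n → divisible-part (suc t) (n ℕ.* suc t) ≋ poch (suc t) n
  divisible-poch t zero    = ≋.refl
  divisible-poch t (suc n) with suc t ∣? suc (t ℕ.+ n ℕ.* suc t)
  ... | no ∤   = contradiction (∣m∣n⇒∣m+n (∣-refl {suc t}) (n∣m*n n)) ∤
  ... | yes _  = ⋆-cong (≋.trans (skip t ℕ.≤-refl) (divisible-poch t n)) (λ k → cong (λ a → 𝟏 k ℤ.- X^ a k) (ℕ.*-comm (suc n) (suc t)))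
    where
    skip : ∀ i → i ≤ t → divisible-part (suc t) (i ℕ.+ n ℕ.* suc t) ≋ divisible-part (suc t) (n ℕ.* suc t)
    skip zero    _   = ≋.refl
    skip (suc i) i<t with suc t ∣? suc (i ℕ.+ n ℕ.* suc t)
    ... | yes d = contradiction (∣⇒≤ (∣m+n∣m⇒∣n (subst (suc t ∣_) (ℕ.+-comm (suc i) (n ℕ.* suc t)) d) (n∣m*n n))) (ℕ.<⇒≱ (s≤s i<t))
    ... | no _  = skip i (ℕ.<⇒≤ i<t)

  bˢ : ℕ → Series
  bˢ t = embed (b t)

  regular-generating : ∀ t E → 1 ≤ t → poch 1 E ⋆ bˢ t ≈[ E ] poch t E
  regular-generating (suc t) E _ = ≈-trans (⋆-≈ {E} {poch 1 E} {poch 1 m} (≈-sym (subst (λ z → poch 1 z ≈[ E ] poch 1 E) (ℕ.m+[n∸m]≡n E≤m) (poch-stable 1 E (m ∸ E) ℕ.≤-refl))) b≈)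
    (≈-trans (≋⇒≈ (≋.trans (⋆-cong (≋.sym (parts-product (suc t) m)) (λ n → refl))
      (≋.trans (solve 3 (λ c d p → c :* d :* p := p :* c :* d) (λ n → refl) (coprime-part (suc t) m) (divisible-part (suc t) m) (embed (cnt (suc t) m)))
        (≋.trans (⋆-cong (cnt-inverse (suc t) m) (λ n → refl)) (≋.trans (⋆-identityˡ (divisible-part (suc t) m)) (divisible-poch t E)))))) (λ n _ → refl))
    where
    -- A multiple of t, so that the divisible factors are exactly those of `poch (suc t) E`, and at
    -- least E, so that the truncation does not show below degree E.
    m = E ℕ.* suc t
    E≤m : E ≤ m
    E≤m = ℕ.m≤m*n E (suc t)
    b≈ : bˢ (suc t) ≈[ E ] embed (cnt (suc t) m)
    b≈ n n<E = cong +_ (sym (subst (λ z → cnt (suc t) z n ≡ b (suc t) n) (ℕ.m+[n∸m]≡n (ℕ.≤-trans (ℕ.<⇒≤ n<E) E≤m)) (cnt-stable (suc t) n (m ∸ n))))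

-- From exponents to squares in a coset.

module Coset where

  open import Data.Nat as ℕ using (ℕ; zero; suc; _∸_; s≤s)
  import Data.Nat.Properties as ℕ
  open import Data.Integer hiding (suc; _⊖_)
  open import Data.Integer.Properties
  open import Data.Integer.DivMod using (_/ℕ_; _%ℕ_; a≡a%ℕn+[a/ℕn]*n; n%ℕd<d)
  open import Data.Integer.Divisibility.Signed
  open import Data.Integer.Tactic.RingSolver using (solve-∀)
  open import Data.Vec using (Vec; []; _∷_)
  open import Data.Product using (_,_)
  open import Data.Sum using (inj₁; inj₂)
  open import Relation.Nullary
  open import Relation.Binary.PropositionalEquality
  open Sums
  open Vectors
  open Gauss using (tri)
  open Core using (tri-double; module Lattice)
  open Pentagonal using (pent)

  tri₂ : ∀ n → + 2 * + tri n ≡ + n * + n - + n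
  tri₂ n = trans (lem (+ tri n) (+ n)) (cong (_- + n) (trans (sym (trans (pos-+ (tri n ℕ.+ tri n) n) (cong (_+ + n) (pos-+ (tri n) (tri n))))) (trans (cong +_ (tri-double n)) (pos-* n n))))
    where
    lem : ∀ t n → + 2 * t ≡ t + t + n - n
    lem = solve-∀

  pent₂ : ∀ j → + 2 * + pent j ≡ + 3 * (j * j) - j
  pent₂ (+ n) = trans (cong (+ 2 *_) (trans (pos-+ (n ℕ.* n) (tri n)) (cong (_+ + tri n) (pos-* n n)))) (trans (*-distribˡ-+ (+ 2) (+ n * + n) (+ tri n)) (trans (cong (λ z → + 2 * (+ n * + n) + z) (tri₂ n)) (lem (+ n))))
    where
    lem : ∀ n → + 2 * (n * n) + (n * n - n) ≡ + 3 * (n * n) - n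
    lem = solve-∀
  pent₂ -[1+ n ] = trans (cong (+ 2 *_) (trans (pos-+ (suc n ℕ.* suc n) (tri (suc (suc n)))) (cong₂ _+_ (pos-* (suc n) (suc n)) (pos-+ (suc n) (tri (suc n))))))
    (trans (lem₁ (+ suc n) (+ tri (suc n))) (trans (cong (λ z → + 2 * (+ suc n * + suc n) + (+ 2 * + suc n + z)) (tri₂ (suc n))) (lem₂ (+ suc n))))
    where
    lem₁ : ∀ n t → + 2 * (n * n + (n + t)) ≡ + 2 * (n * n) + (+ 2 * n + + 2 * t)
    lem₁ = solve-∀
    lem₂ : ∀ n → + 2 * (n * n) + (+ 2 * n + (n * n - n)) ≡ + 3 * (- n * - n) - - n
    lem₂ = solve-∀

  sumᵥ : ∀ {k} → Vec ℤ k → ℤ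
  sumᵥ []       = 0ℤ
  sumᵥ (y ∷ ys) = y + sumᵥ ys

  alt : ℕ → ℤ
  alt zero    = 1ℤ
  alt (suc n) = - alt n

  alt-even : ∀ n → alt (n ℕ.* 2) ≡ 1ℤ
  alt-even zero    = refl
  alt-even (suc n) = trans (neg-involutive (alt (n ℕ.* 2))) (alt-even n)

  alt-double : ∀ q → alt ∣ q * + 2 ∣ ≡ 1ℤ
  alt-double q = trans (cong alt (abs-* q (+ 2))) (alt-even ∣ q ∣)

  alt-odd : ∀ q → alt ∣ + 1 + q * + 2 ∣ ≡ -1ℤ
  alt-odd (+ n) = trans (cong (λ z → alt ∣ + 1 + z ∣) (sym (pos-* n 2))) (cong -_ (alt-even n))
  alt-odd -[1+ n ] = trans (cong alt (trans (sym (∣-i∣≡∣i∣ (+ 1 + -[1+ n ] * + 2))) (cong ∣_∣ (trans (lem (+ suc n)) (trans (cong (_- + 1) (sym (pos-* (suc n) 2))) (+-comm (+ suc (suc (n ℕ.* 2))) (- + 1))))))) (cong -_ (alt-even n))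
    where
    lem : ∀ n → - (+ 1 + - n * + 2) ≡ n * + 2 - + 1
    lem = solve-∀

  -- σ′ k is (-1)^j for k = 3j and 0 otherwise
  σ′ : ℤ → ℤ
  σ′ k = 𝟙 (+ 6 ∣? k) - 𝟙 (+ 6 ∣? k - + 3)

  -- Writes the sign as a sum over j, so that the sum over j can be moved outside the sum over
  -- lattice vectors.
  σ′-expand : ∀ J k → ∣ k ∣ ℕ.≤ J → σ′ k ≡ ∑[ j ∈ interval J ] (𝟙 (+ 3 * j ≟ k) * alt ∣ j ∣)
  σ′-expand J k k≤J = by-cases (+ 6 ∣? k) (+ 6 ∣? k - + 3)
    where
    open ≡-Reasoning
    single : ∀ j₀ → k ≡ + 3 * j₀ → ∑[ j ∈ interval J ] (𝟙 (+ 3 * j ≟ k) * alt ∣ j ∣) ≡ alt ∣ j₀ ∣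
    single j₀ refl = trans (∑-cong (interval J) (λ j → cong (_* alt ∣ j ∣) (𝟙-⇔ (+ 3 * j ≟ + 3 * j₀) (j ≟ j₀) (*-cancelˡ-≡ (+ 3) j j₀) (cong (+ 3 *_)))))
      (∑-δ j₀ (interval J) (interval-∈! J (ℕ.≤-trans (ℕ.m≤n*m ∣ j₀ ∣ 3) (ℕ.≤-trans (ℕ.≤-reflexive (sym (abs-* (+ 3) j₀))) k≤J))) (λ j → alt ∣ j ∣))
    six∣three : ¬ + 6 ∣ + 3
    six∣three d = contradiction (ℕ.∣⇒≤ (∣⇒∣ᵤ d)) λ { (s≤s (s≤s (s≤s ()))) }
      where import Data.Nat.Divisibility as ℕ
    by-cases : (d : Dec (+ 6 ∣ k)) (e : Dec (+ 6 ∣ k - + 3)) → 𝟙 d - 𝟙 e ≡ ∑[ j ∈ interval J ] (𝟙 (+ 3 * j ≟ k) * alt ∣ j ∣)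
    by-cases (yes d) (yes e) = contradiction (subst (+ 6 ∣_) (lem k) (∣m∣n⇒∣m-n d e)) six∣three
      where
      lem : ∀ k → k - (k - + 3) ≡ + 3
      lem = solve-∀
    by-cases (yes (divides q e)) (no _) = sym (trans (single (q * + 2) (trans e (lem q))) (alt-double q))
      where
      lem : ∀ q → q * + 6 ≡ + 3 * (q * + 2)
      lem = solve-∀
    by-cases (no _) (yes (divides q e)) = sym (trans (single (+ 1 + q * + 2) (trans (lem₁ k) (trans (cong (λ z → z + + 3) e) (lem₂ q)))) (alt-odd q))
      where
      lem₁ : ∀ k → k ≡ k - + 3 + + 3
      lem₁ = solve-∀
      lem₂ : ∀ q → q * + 6 + + 3 ≡ + 3 * (+ 1 + q * + 2)
      lem₂ = solve-∀
    by-cases (no ∤) (no ∤′) = sym (∑-all0 (interval J) (λ j → 𝟙*-no (+ 3 * j ≟ k) (alt ∣ j ∣) (λ e → parity j (j %ℕ 2) (n%ℕd<d j 2) (a≡a%ℕn+[a/ℕn]*n j 2) e)))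
      where
      lem₁ : ∀ q → + 3 * (+ 0 + q * + 2) ≡ q * + 6
      lem₁ = solve-∀
      lem₂ : ∀ q → + 3 * (+ 1 + q * + 2) - + 3 ≡ q * + 6
      lem₂ = solve-∀
      parity : ∀ j p → p ℕ.< 2 → j ≡ + p + j /ℕ 2 * + 2 → + 3 * j ≢ k
      parity j 0 _ e refl = ∤ (divides (j /ℕ 2) (trans (cong (+ 3 *_) e) (lem₁ (j /ℕ 2))))
      parity j 1 _ e refl = ∤′ (divides (j /ℕ 2) (trans (cong (λ z → + 3 * z - + 3) e) (lem₂ (j /ℕ 2))))
      parity j (suc (suc p)) (s≤s (s≤s ())) e

  -- the representatives 2i - r, i < k, of the residues of y_i modulo 2r
  β : ℕ → ∀ k → Vec ℤ k
  β r zero    = []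
  β r (suc i) = (+ 2 * + i - + r) ∷ β r i

  module Shape (r m : ℕ) where
    open Lattice r m
    private
      R = + r

    -- Completes the square: with n = v - m and y = 2rn + 2i - r, one has y² = 8r (r n(n-1)/2 + i n)
    -- + (2i - r)².
    lattice-point : ∀ {k} → Vec ℕ k → Vec ℤ k
    lattice-point []             = []
    lattice-point (_∷_ {i} v vs) = (+ 2 * R * (+ v - + m) + (+ 2 * + i - R)) ∷ lattice-point vs

    sum-β : ∀ k → sumᵥ (β r k) ≡ + k * + k - + k - + k * R
    sum-β zero    = refl
    sum-β (suc i) = trans (cong (λ z → + 2 * + i - R + z) (sum-β i)) (lem (+ i) R)
      where
      lem : ∀ i R → + 2 * i - R + (i * i - i - i * R) ≡ (1ℤ + i) * (1ℤ + i) - (1ℤ + i) - (1ℤ + i) * R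
      lem = solve-∀

    sum-point : ∀ {k} (v : Vec ℕ k) → sumᵥ (lattice-point v) ≡ + 2 * R * (+ total v - + k * + m) + sumᵥ (β r k)
    sum-point []       = lem R (+ m)
      where
      lem : ∀ R m → 0ℤ ≡ + 2 * R * (0ℤ - 0ℤ * m) + 0ℤ
      lem = solve-∀
    sum-point (_∷_ {i} v vs) = trans (cong (λ z → + 2 * R * (+ v - + m) + (+ 2 * + i - R) + z) (sum-point vs))
      (trans (lem R (+ v) (+ m) (+ 2 * + i - R) (+ total vs) (+ i) (sumᵥ (β r i))) (cong (λ z → + 2 * R * (z - (1ℤ + + i) * + m) + (+ 2 * + i - R + sumᵥ (β r i))) (sym (pos-+ v (total vs)))))
      where
      lem : ∀ R v m c s i b → + 2 * R * (v - m) + c + (+ 2 * R * (s - i * m) + b) ≡ + 2 * R * (v + s - (1ℤ + i) * m) + (c + b)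
      lem = solve-∀

    exponent-above : ∀ i d → exponent i (m ℕ.+ d) ≡ r ℕ.* tri d ℕ.+ i ℕ.* d
    exponent-above i d rewrite ℕ.m+n∸m≡n m d | ℕ.m≤n⇒m∸n≡0 (ℕ.m≤m+n m d) | ℕ.*-zeroʳ r | ℕ.*-zeroʳ (r ∸ i) = ℕ.+-identityʳ _

    private
      pos-pair : ∀ a b c d → + (a ℕ.* b ℕ.+ c ℕ.* d) ≡ + a * + b + + c * + d
      pos-pair a b c d = trans (pos-+ (a ℕ.* b) (c ℕ.* d)) (cong₂ _+_ (pos-* a b) (pos-* c d))

    square-point : ∀ i v → i ℕ.≤ r → (+ 2 * R * (+ v - + m) + (+ 2 * + i - R)) * (+ 2 * R * (+ v - + m) + (+ 2 * + i - R)) ≡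
      + 8 * R * + exponent i v + (+ 2 * + i - R) * (+ 2 * + i - R)
    square-point i v i≤r with ℕ.≤-total m v
    ... | inj₁ m≤v = subst P (ℕ.m+[n∸m]≡n m≤v) (above (v ∸ m))
      where
      P : ℕ → Set
      P v = (+ 2 * R * (+ v - + m) + (+ 2 * + i - R)) * (+ 2 * R * (+ v - + m) + (+ 2 * + i - R)) ≡ + 8 * R * + exponent i v + (+ 2 * + i - R) * (+ 2 * + i - R)
      lem₁ : ∀ R m d i → (+ 2 * R * (m + d - m) + (+ 2 * i - R)) * (+ 2 * R * (m + d - m) + (+ 2 * i - R)) ≡ + 4 * R * (R * (d * d - d) + + 2 * (i * d)) + (+ 2 * i - R) * (+ 2 * i - R)
      lem₁ = solve-∀
      lem₂ : ∀ R t i d → + 4 * R * (R * (+ 2 * t) + + 2 * (i * d)) ≡ + 8 * R * (R * t + i * d)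
      lem₂ = solve-∀
      above : ∀ d → P (m ℕ.+ d)
      above d = trans (cong (λ z → (+ 2 * R * (z - + m) + (+ 2 * + i - R)) * (+ 2 * R * (z - + m) + (+ 2 * + i - R))) (pos-+ m d)) (trans (lem₁ R (+ m) (+ d) (+ i))
        (cong (_+ (+ 2 * + i - R) * (+ 2 * + i - R)) (trans (cong (λ z → + 4 * R * (R * z + + 2 * (+ i * + d))) (sym (tri₂ d))) (trans (lem₂ R (+ tri d) (+ i) (+ d))
          (cong (+ 8 * R *_) (trans (sym (pos-pair r (tri d) i d)) (cong +_ (sym (exponent-above i d)))))))))
    ... | inj₂ v≤m = under (m ∸ v) refl
      where
      lem₁ : ∀ R v d j → (+ 2 * R * (v - (v + d)) + (+ 2 * (R - j) - R)) * (+ 2 * R * (v - (v + d)) + (+ 2 * (R - j) - R)) ≡ + 4 * R * (R * (d * d - d) + + 2 * (j * d)) + (+ 2 * (R - j) - R) * (+ 2 * (R - j) - R)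
      lem₁ = solve-∀
      lem₂ : ∀ R t j d → + 4 * R * (R * (+ 2 * t) + + 2 * (j * d)) ≡ + 8 * R * (R * t + j * d)
      lem₂ = solve-∀
      i≡ : + i ≡ R - + (r ∸ i)
      i≡ = trans (lem (+ i) (+ (r ∸ i))) (cong (_- + (r ∸ i)) (trans (sym (pos-+ i (r ∸ i))) (cong +_ (ℕ.m+[n∸m]≡n i≤r))))
        where
        lem : ∀ a b → a ≡ a + b - b
        lem = solve-∀
      m≡ : ∀ d → m ∸ v ≡ d → + m ≡ + v + + d
      m≡ d e = trans (cong +_ (trans (sym (ℕ.m+[n∸m]≡n v≤m)) (cong (v ℕ.+_) e))) (pos-+ v d)
      exponent-below : ∀ d → m ∸ v ≡ d → exponent i v ≡ r ℕ.* tri d ℕ.+ (r ∸ i) ℕ.* d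
      exponent-below d e rewrite e | ℕ.m≤n⇒m∸n≡0 v≤m | ℕ.*-zeroʳ r | ℕ.*-zeroʳ i = refl
      under : ∀ d → m ∸ v ≡ d → _
      under d e = trans (cong₂ (λ M I → (+ 2 * R * (+ v - M) + (+ 2 * I - R)) * (+ 2 * R * (+ v - M) + (+ 2 * I - R))) (m≡ d e) i≡) (trans (lem₁ R (+ v) (+ d) (+ (r ∸ i)))
        (cong₂ _+_ (trans (cong (λ z → + 4 * R * (R * z + + 2 * (+ (r ∸ i) * + d))) (sym (tri₂ d))) (trans (lem₂ R (+ tri d) (+ (r ∸ i)) (+ d))
          (cong (+ 8 * R *_) (trans (sym (pos-pair r (tri d) (r ∸ i) d)) (cong +_ (sym (exponent-below d e)))))))
          (cong (λ I → (+ 2 * I - R) * (+ 2 * I - R)) (sym i≡))))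

    norm-point : ∀ {k} (v : Vec ℕ k) → k ℕ.≤ r → ⟨ lattice-point v , lattice-point v ⟩ ≡ + 8 * R * + exponents v + ⟨ β r k , β r k ⟩
    norm-point []             _   = lem R
      where
      lem : ∀ R → 0ℤ ≡ + 8 * R * 0ℤ + 0ℤ
      lem = solve-∀
    norm-point (_∷_ {i} v vs) i<r = trans (cong₂ _+_ (square-point i v (ℕ.<⇒≤ i<r)) (norm-point vs (ℕ.<⇒≤ i<r)))
      (trans (lem (+ 8 * R) (+ exponent i v) ((+ 2 * + i - R) * (+ 2 * + i - R)) (+ exponents vs) ⟨ β r i , β r i ⟩) (cong (λ z → + 8 * R * z + ((+ 2 * + i - R) * (+ 2 * + i - R) + ⟨ β r i , β r i ⟩)) (sym (pos-+ (exponent i v) (exponents vs)))))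
      where
      lem : ∀ a e c x b → a * e + c + (a * x + b) ≡ a * (e + x) + (c + b)
      lem = solve-∀

-- The quadratic form `B₀` and its positivity.

module Counting where

  open import Data.Nat as ℕ using (ℕ; zero; suc; _∸_; z≤n)
  import Data.Nat.Properties as ℕ
  open import Data.Integer hiding (suc; _⊖_)
  open import Data.Integer.Properties
  open import Data.Integer.Divisibility.Signed
  open import Data.Integer.Tactic.RingSolver using (solve-∀)
  import Data.Nat.Tactic.RingSolver as ℕ
  open import Data.Vec using (Vec; []; _∷_)
  open import Data.Vec.Relation.Unary.All using ([]; _∷_)
  open import Data.Product using (_,_)
  open import Relation.Nullary
  open import Relation.Binary.PropositionalEquality
  open import Function using (_∘_)
  open Sums
  open Vectors
  open Frames using (Bounded)
  open Gauss using (below)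
  open Coset

  module ℕᵥ = VecEnumeration ℕ._≟_

  below-∉ : ∀ n {k} → n ℕ.≤ k → ∑[ x ∈ below n ] 𝟙 (x ℕ.≟ k) ≡ 0ℤ
  below-∉ zero    le = refl
  below-∉ (suc n) {k} le = cong₂ _+_ (𝟙-no (n ℕ.≟ k) (ℕ.<⇒≢ le)) (below-∉ n (ℕ.≤-trans (ℕ.n≤1+n n) le))

  below-∈! : ∀ n {k} → k ℕ.< n → ∑[ x ∈ below n ] 𝟙 (x ℕ.≟ k) ≡ 1ℤ
  below-∈! (suc n) {k} lt with k ℕ.≟ n
  ... | yes refl = cong₂ _+_ (𝟙-yes (n ℕ.≟ n) refl) (below-∉ n ℕ.≤-refl)
  ... | no ne = cong₂ _+_ (𝟙-no (n ℕ.≟ k) (ne ∘ sym)) (below-∈! n (ℕ.≤∧≢⇒< (ℕ.≤-pred lt) ne))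

  square-nonneg : ∀ a → 0ℤ ≤ a * a
  square-nonneg (+ n)    = subst (0ℤ ≤_) (pos-* n n) (+≤+ z≤n)
  square-nonneg -[1+ n ] = +≤+ z≤n

  ⟨⟩-nonneg : ∀ {k} (y : Vec ℤ k) → 0ℤ ≤ ⟨ y , y ⟩
  ⟨⟩-nonneg []      = ≤-refl
  ⟨⟩-nonneg (a ∷ y) = +-mono-≤ (square-nonneg a) (⟨⟩-nonneg y)

  nonneg-* : ∀ k {a} → 0ℤ ≤ a → 0ℤ ≤ + k * a
  nonneg-* k {a} h = subst (_≤ + k * a) (*-zeroʳ (+ k)) (*-monoˡ-≤-nonNeg (+ k) h)

  spread : ∀ {k} → ℤ → Vec ℤ k → ℤ
  spread a []      = 0ℤ
  spread a (b ∷ y) = (b - a) * (b - a) + spread a y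

  spread-nonneg : ∀ {k} a (y : Vec ℤ k) → 0ℤ ≤ spread a y
  spread-nonneg a []      = ≤-refl
  spread-nonneg a (b ∷ y) = +-mono-≤ (square-nonneg (b - a)) (spread-nonneg a y)

  spread-identity : ∀ {k} a (y : Vec ℤ k) → spread a y ≡ ⟨ y , y ⟩ + + k * (a * a) - + 2 * a * sumᵥ y
  spread-identity a []      = lem a
    where
    lem : ∀ a → 0ℤ ≡ 0ℤ + 0ℤ * (a * a) - + 2 * a * 0ℤ
    lem = solve-∀
  spread-identity {suc k} a (b ∷ y) = trans (cong (λ z → (b - a) * (b - a) + z) (spread-identity a y)) (lem a b (+ k) ⟨ y , y ⟩ (sumᵥ y))
    where
    lem : ∀ a b k n s → (b - a) * (b - a) + (n + k * (a * a) - + 2 * a * s) ≡ b * b + n + (1ℤ + k) * (a * a) - + 2 * a * (b + s)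
    lem = solve-∀

  -- Σ_{i<j} (y_i - y_j)²
  deviation : ∀ {k} → Vec ℤ k → ℤ
  deviation []      = 0ℤ
  deviation (a ∷ y) = spread a y + deviation y

  deviation-nonneg : ∀ {k} (y : Vec ℤ k) → 0ℤ ≤ deviation y
  deviation-nonneg []      = ≤-refl
  deviation-nonneg (a ∷ y) = +-mono-≤ (spread-nonneg a y) (deviation-nonneg y)

  -- Lagrange's identity, which is the Cauchy-Schwarz inequality with its remainder. It controls the
  -- square of the coordinate sum when t - 3 is negative.
  deviation-identity : ∀ {k} (y : Vec ℤ k) → + k * ⟨ y , y ⟩ ≡ sumᵥ y * sumᵥ y + deviation y
  deviation-identity []              = refl
  deviation-identity {suc k} (a ∷ y) = trans (lem₁ (+ k) a ⟨ y , y ⟩) (trans (cong (λ z → a * a + ⟨ y , y ⟩ + + k * (a * a) + z) (deviation-identity y))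
    (trans (lem₂ (+ k) a ⟨ y , y ⟩ (sumᵥ y) (deviation y)) (cong (λ z → (a + sumᵥ y) * (a + sumᵥ y) + (z + deviation y)) (sym (spread-identity a y)))))
    where
    lem₁ : ∀ k a n → (1ℤ + k) * (a * a + n) ≡ a * a + n + k * (a * a) + k * n
    lem₁ = solve-∀
    lem₂ : ∀ k a n s d → a * a + n + k * (a * a) + (s * s + d) ≡ (a + s) * (a + s) + (n + k * (a * a) - + 2 * a * s + d)
    lem₂ = solve-∀

  ⟨⟩-coercive : ∀ {k n} (y : Vec ℤ k) → ⟨ y , y ⟩ ≤ + n → Bounded n y
  ⟨⟩-coercive []      h = []
  ⟨⟩-coercive {n = n} (a ∷ y) h = bound a (≤-trans (subst (_≤ a * a + ⟨ y , y ⟩) (+-identityʳ (a * a)) (+-monoʳ-≤ (a * a) (⟨⟩-nonneg y))) h)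
    ∷ ⟨⟩-coercive y (≤-trans (subst (_≤ a * a + ⟨ y , y ⟩) (+-identityˡ ⟨ y , y ⟩) (+-monoˡ-≤ ⟨ y , y ⟩ (square-nonneg a))) h)
    where
    n≤n² : ∀ n → n ℕ.≤ n ℕ.* n
    n≤n² zero    = z≤n
    n≤n² (suc n) = ℕ.m≤m*n (suc n) (suc n)
    bound : ∀ a → a * a ≤ + n → ∣ a ∣ ℕ.≤ n
    bound (+ k)    le = ℕ.≤-trans (n≤n² k) (drop‿+≤+ (subst (_≤ + n) (sym (pos-* k k)) le))
    bound -[1+ k ] le = ℕ.≤-trans (n≤n² (suc k)) (drop‿+≤+ le)

  module Norm (r t : ℕ) where

    -- By the completed squares 3r⟨y, y⟩ is 24r² times the exponent plus a constant. If the
    -- coordinate sum is r(6j - 1), its square is r²(24 pent(j) + 1). The factor t - 3 collects t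
    -- pent(j) from the pentagonal series of f_t and -3 pent(j) from the shift q^T of `count-core`,
    -- where T = 3j(3j - 1)/2.
    B₀ : Vec ℤ r → Vec ℤ r → ℤ
    B₀ x y = + 3 * + r * ⟨ x , y ⟩ + (+ t - + 3) * (sumᵥ x * sumᵥ y)

    -- For t = 2 the second coefficient is -1. One of the three copies of r⟨y, y⟩ absorbs the square
    -- of the sum by `deviation-identity`, and the others leave at least ⟨y, y⟩.
    B₀-lower : 1 ℕ.≤ r → 2 ℕ.≤ t → ∀ y → ⟨ y , y ⟩ ≤ B₀ y y
    B₀-lower 1≤r 2≤t y = subst (⟨ y , y ⟩ ≤_) (sym split) (subst (_≤ + (r ∸ 1) * ⟨ y , y ⟩ + ⟨ y , y ⟩ + rest) (trans (+-identityʳ (0ℤ + ⟨ y , y ⟩)) (+-identityˡ ⟨ y , y ⟩))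
        (+-mono-≤ (+-monoˡ-≤ ⟨ y , y ⟩ (nonneg-* (r ∸ 1) (⟨⟩-nonneg y))) rest≥0))
      where
      S = sumᵥ y
      rest : ℤ
      rest = + r * ⟨ y , y ⟩ + (deviation y + + (t ∸ 2) * (S * S))
      rest≥0 : 0ℤ ≤ rest
      rest≥0 = +-mono-≤ (nonneg-* r (⟨⟩-nonneg y)) (+-mono-≤ (deviation-nonneg y) (nonneg-* (t ∸ 2) (square-nonneg S)))
      r≡ : + r ≡ + (r ∸ 1) + 1ℤ
      r≡ = trans (cong +_ (sym (ℕ.m∸n+n≡m 1≤r))) (pos-+ (r ∸ 1) 1)
      t≡ : + t ≡ + (t ∸ 2) + + 2
      t≡ = trans (cong +_ (sym (ℕ.m∸n+n≡m 2≤t))) (pos-+ (t ∸ 2) 2)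
      lem : ∀ R N s T r′ d → R * N ≡ s + d → R ≡ r′ + 1ℤ → + 3 * R * N + (T + + 2 - + 3) * s ≡ r′ * N + N + (R * N + (d + T * s))
      lem R N s T r′ d e refl = trans (lem₁ (r′ + 1ℤ) N s T) (trans (cong (λ z → + 2 * ((r′ + 1ℤ) * N) + z - s + T * s) e) (lem₂ r′ N s T d))
        where
        lem₁ : ∀ R N s T → + 3 * R * N + (T + + 2 - + 3) * s ≡ + 2 * (R * N) + R * N - s + T * s
        lem₁ = solve-∀
        lem₂ : ∀ r N s T d → + 2 * ((r + 1ℤ) * N) + (s + d) - s + T * s ≡ r * N + N + ((r + 1ℤ) * N + (d + T * s))
        lem₂ = solve-∀
      split : B₀ y y ≡ + (r ∸ 1) * ⟨ y , y ⟩ + ⟨ y , y ⟩ + rest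
      split = trans (cong (λ z → + 3 * + r * ⟨ y , y ⟩ + (z - + 3) * (S * S)) t≡) (lem (+ r) ⟨ y , y ⟩ (S * S) (+ (t ∸ 2)) (+ (r ∸ 1)) (deviation y) (deviation-identity y) r≡)

    -- the coset condition and the sign of the theta series: Σ y_i = r(6j - 1) contributes (-1)^j
    σ : ℤ → ℤ
    σ S = 𝟙 (+ (12 ℕ.* r) ∣? S + + r) - 𝟙 (+ (12 ℕ.* r) ∣? S - + 5 * + r)

    β₀ : Vec ℤ r
    β₀ = β r r

    character : Vec ℤ r → ℤ
    character y = 𝟙 ((2 ℕ.* r) ∣ᵥ? y ⊖ β₀) * σ (sumᵥ y)

    q₀ : ℤ
    q₀ = B₀ β₀ β₀

    -- The box size b is independent of the level M, so that counts at several levels can share one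
    -- box.
    theta-count : ℕ → ℕ → ℤ
    theta-count b M = ∑[ y ∈ box b r ] (𝟙 (B₀ y y ≟ + M) * character y)

-- The vectors of the coset as lattice points in a finite window.

module Enumerate where

  open import Data.Nat as ℕ using (ℕ; suc; _∸_; s≤s; z≤n)
  import Data.Nat.Properties as ℕ
  import Data.Nat.Divisibility as ℕ
  open import Data.Integer hiding (suc; _⊖_)
  open import Data.Integer.Properties
  open import Data.Integer.DivMod using (_/ℕ_)
  open import Data.Integer.Divisibility.Signed
  open import Data.Integer.Tactic.RingSolver using (solve-∀)
  import Data.Nat.Tactic.RingSolver as ℕ
  open import Data.Vec using (Vec; []; _∷_)
  import Data.Vec.Properties as Vec
  open import Data.Vec.Relation.Unary.All using (All; []; _∷_)
  open import Data.Product using (_×_; _,_; proj₁; proj₂)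
  open import Relation.Nullary
  open import Relation.Binary.PropositionalEquality
  open Sums
  open Vectors
  open Frames using (Bounded)
  open Parseval using (/ℕ-exact)
  open Gauss using (below)
  open Core
  open Coset
  open Counting

  sum-bound : ∀ {k n} (y : Vec ℤ k) → Bounded n y → ∣ sumᵥ y ∣ ℕ.≤ k ℕ.* n
  sum-bound []      []       = z≤n
  sum-bound (a ∷ y) (p ∷ ps) = ℕ.≤-trans (∣i+j∣≤∣i∣+∣j∣ a (sumᵥ y)) (ℕ.+-mono-≤ p (sum-bound y ps))

  module _ (r t : ℕ) (1≤r : 1 ℕ.≤ r) (2≤t : 2 ℕ.≤ t) where
    open Norm r t
    private
      R : ℤ
      R = + r
      instance
        r≢0 : ℕ.NonZero r
        r≢0 = ℕ.>-nonZero 1≤r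
        2r≢0 : ℕ.NonZero (2 ℕ.* r)
        2r≢0 = ℕ.m*n≢0 2 r

    B₀-coercive : ∀ {n} y → B₀ y y ≡ + n → Bounded n y
    B₀-coercive {n} y e = ⟨⟩-coercive y (subst (⟨ y , y ⟩ ≤_) e (B₀-lower 1≤r 2≤t y))

    module Window (m : ℕ) where
      open Shape r m
      open Lattice r m

      -- Inverse of `lattice-point` on the coset; elsewhere the rounding makes the value
      -- meaningless, and such vectors carry the weight 0.
      index : ∀ {k} → Vec ℤ k → Vec ℕ k
      index []             = []
      index (_∷_ {i} y ys) = ∣ (y - (+ 2 * + i - R)) /ℕ (2 ℕ.* r) + + m ∣ ∷ index ys

      index-point : ∀ {k} (v : Vec ℕ k) → index (lattice-point v) ≡ v
      index-point []             = refl
      index-point (_∷_ {i} v vs) = cong₂ _∷_ (trans (cong (λ z → ∣ z + + m ∣) (trans (cong (_/ℕ (2 ℕ.* r)) (trans (lem₁ (+ 2 * R * (+ v - + m)) (+ 2 * + i - R)) (cong (_* (+ v - + m)) (sym (pos-* 2 r))))) (/ℕ-exact (2 ℕ.* r) (+ v - + m)))) (cong ∣_∣ (lem₂ (+ v) (+ m)))) (index-point vs)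
        where
        lem₁ : ∀ a b → a + b - b ≡ a
        lem₁ = solve-∀
        lem₂ : ∀ v m → v - m + m ≡ v
        lem₂ = solve-∀

      point-coset : ∀ {k} (v : Vec ℕ k) → (2 ℕ.* r) ∣ᵥ lattice-point v ⊖ β r k
      point-coset []             = []
      point-coset (_∷_ {i} v vs) = divides (+ v - + m) (trans (lem (+ 2 * R) (+ v - + m) (+ 2 * + i - R)) (cong ((+ v - + m) *_) (sym (pos-* 2 r)))) ∷ point-coset vs
        where
        lem : ∀ a b c → a * b + c - c ≡ b * a
        lem = solve-∀

      module _ (M : ℕ) (large : M ℕ.+ r ℕ.≤ m) where

        quotient-bound : ∀ i w y → i ℕ.≤ r → y - (+ 2 * + i - R) ≡ w * + (2 ℕ.* r) → ∣ y ∣ ℕ.≤ M → ∣ w ∣ ℕ.≤ m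
        quotient-bound i w y i≤r e y≤M = ℕ.≤-trans (ℕ.m≤m*n ∣ w ∣ (2 ℕ.* r)) (ℕ.≤-trans (ℕ.≤-reflexive (trans (sym (abs-* w (+ (2 ℕ.* r)))) (cong ∣_∣ (sym e))))
          (ℕ.≤-trans (∣i-j∣≤∣i∣+∣j∣ y (+ 2 * + i - R)) (ℕ.≤-trans (ℕ.+-mono-≤ y≤M shift-bound) large)))
          where
          shift-bound : ∣ + 2 * + i - R ∣ ℕ.≤ r
          shift-bound = subst (λ z → ∣ z ∣ ℕ.≤ r) (trans (sym (m-n≡m⊖n i (r ∸ i))) (trans (lem (+ i) (+ (r ∸ i))) (cong (λ z → + 2 * + i - z) (trans (sym (pos-+ i (r ∸ i))) (cong +_ (ℕ.m+[n∸m]≡n i≤r))))))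
            (ℕ.≤-trans (∣m⊝n∣≤m⊔n i (r ∸ i)) (ℕ.⊔-lub i≤r (ℕ.m∸n≤m r i)))
            where
            lem : ∀ a b → a - b ≡ + 2 * a - (a + b)
            lem = solve-∀

        abs-shift : ∀ w → ∣ w ∣ ℕ.≤ m → + ∣ w + + m ∣ ≡ w + + m × ∣ w + + m ∣ ℕ.≤ m ℕ.+ m
        abs-shift w le = FrameStep.shift w m le , ℕ.≤-trans (∣i+j∣≤∣i∣+∣j∣ w (+ m)) (ℕ.+-monoˡ-≤ m le)

        point-index : ∀ {k} (y : Vec ℤ k) → k ℕ.≤ r → (2 ℕ.* r) ∣ᵥ y ⊖ β r k → Bounded M y →
          lattice-point (index y) ≡ y × All (λ x → ∑[ z ∈ below (suc (m ℕ.+ m)) ] 𝟙 (z ℕ.≟ x) ≡ 1ℤ) (index y)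
        point-index []             _   []                 []       = refl , []
        point-index (_∷_ {i} y ys) i<r (divides w e ∷ ds) (p ∷ ps) = cong₂ _∷_ (trans (cong (λ z → + 2 * R * (z - + m) + (+ 2 * + i - R)) index≡) (trans (lem R w (+ m) (+ 2 * + i - R)) (trans (cong (_+ (+ 2 * + i - R)) (trans (cong (w *_) (sym (pos-* 2 r))) (sym e))) (lem′ y (+ 2 * + i - R))))) (proj₁ rest)
          , below-∈! (suc (m ℕ.+ m)) (s≤s (subst (λ z → ∣ z + + m ∣ ℕ.≤ m ℕ.+ m) (sym quot≡) (proj₂ shifted))) ∷ proj₂ rest
          where
          rest = point-index ys (ℕ.<⇒≤ i<r) ds ps
          shifted : + ∣ w + + m ∣ ≡ w + + m × ∣ w + + m ∣ ℕ.≤ m ℕ.+ m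
          shifted = abs-shift w (quotient-bound i w y (ℕ.<⇒≤ i<r) e p)
          quot≡ : (y - (+ 2 * + i - R)) /ℕ (2 ℕ.* r) ≡ w
          quot≡ = trans (cong (_/ℕ (2 ℕ.* r)) (trans e (*-comm w (+ (2 ℕ.* r))))) (/ℕ-exact (2 ℕ.* r) w)
          index≡ : + ∣ (y - (+ 2 * + i - R)) /ℕ (2 ℕ.* r) + + m ∣ ≡ w + + m
          index≡ = trans (cong (λ z → + ∣ z + + m ∣) quot≡) (proj₁ shifted)
          lem : ∀ R w m c → + 2 * R * (w + m - m) + c ≡ w * (+ 2 * R) + c
          lem = solve-∀
          lem′ : ∀ y c → y - c + c ≡ y
          lem′ = solve-∀

        F : Vec ℤ r → ℤ
        F y = 𝟙 (B₀ y y ≟ + M) * character y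

        G : Vec ℕ r → ℤ
        G v = 𝟙 (B₀ (lattice-point v) (lattice-point v) ≟ + M) * σ (sumᵥ (lattice-point v))

        F-point : ∀ v → F (lattice-point v) ≡ G v
        F-point v = cong (𝟙 (B₀ (lattice-point v) (lattice-point v) ≟ + M) *_) (𝟙*-yes ((2 ℕ.* r) ∣ᵥ? lattice-point v ⊖ β₀) (σ (sumᵥ (lattice-point v))) (point-coset v))

        F⇒G : ∀ y → B₀ y y ≡ + M → (2 ℕ.* r) ∣ᵥ y ⊖ β₀ → index y ℕᵥ.V.∈! vecs (below (suc (m ℕ.+ m))) r × G (index y) ≡ F y × lattice-point (index y) ≡ y
        F⇒G y e d = ℕᵥ.vecs-∈! (proj₂ back) , trans (sym (F-point (index y))) (cong F (proj₁ back)) , proj₁ back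
          where
          back = point-index y ℕ.≤-refl d (B₀-coercive y e)

        -- A vector of norm M has entries at most M, and M + r ≤ m keeps its index inside the window
        -- from 0 to 2m. The right side does not depend on b.
        on-points : ∀ b → M ℕ.≤ b → theta-count b M ≡ ∑ (vecs (below (suc (m ℕ.+ m))) r) G
        on-points b M≤b = ∑-bij _≟ᵥ_ (Vec.≡-dec ℕ._≟_) (box b r) (vecs (below (suc (m ℕ.+ m))) r) {F} {G} index lattice-point
          (λ y ne → let (e , ne′) = 𝟙*≢0 (B₀ y y ≟ + M) (character y) ne in F⇒G y e (proj₁ (𝟙*≢0 ((2 ℕ.* r) ∣ᵥ? y ⊖ β₀) (σ (sumᵥ y)) ne′)))
          (λ v ne → let (e , _) = 𝟙*≢0 (B₀ (lattice-point v) (lattice-point v) ≟ + M) (σ (sumᵥ (lattice-point v))) ne in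
            box-∈! b (lattice-point v) (widen (B₀-coercive (lattice-point v) e)) , F-point v , index-point v)
          where
          widen : ∀ {k} {y : Vec ℤ k} → Bounded M y → Bounded b y
          widen []       = []
          widen (p ∷ ps) = ℕ.≤-trans p M≤b ∷ widen ps

-- The theta coefficients of `B₀` as coefficients of b_t · f_r^r.

module Evaluate where

  open import Data.Nat as ℕ using (ℕ; zero; suc; _∸_; s≤s; z≤n)
  import Data.Nat.Properties as ℕ
  open import Data.Integer hiding (suc; _⊖_)
  open import Data.Integer.Properties
  open import Data.Integer.Divisibility.Signed
  open import Data.Integer.Tactic.RingSolver using (solve-∀)
  import Data.Nat.Tactic.RingSolver as ℕ
  open import Data.List using (List)
  open import Data.Vec using (Vec)
  open import Data.Product using (_×_; _,_; proj₁; proj₂; ∃)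
  open import Relation.Nullary
  open import Relation.Binary.PropositionalEquality hiding (J)
  open Sums
  open Vectors
  open Series
  open Gauss using (tri; below; poch)
  open Core
  open Pentagonal
  open Regular
  open Coset
  open Counting
  open Enumerate

  pent-bound : ∀ J j → ∣ j ∣ ℕ.≤ J → pent j ℕ.≤ suc J ℕ.* suc J ℕ.+ tri (suc (suc J))
  pent-bound J (+ n)    le = ℕ.+-mono-≤ (ℕ.*-mono-≤ (ℕ.m≤n⇒m≤1+n le) (ℕ.m≤n⇒m≤1+n le)) (tri-mono (ℕ.m≤n⇒m≤1+n (ℕ.m≤n⇒m≤1+n le)))
  pent-bound J -[1+ n ] le = ℕ.+-mono-≤ (ℕ.*-mono-≤ (ℕ.m≤n⇒m≤1+n le) (ℕ.m≤n⇒m≤1+n le)) (tri-mono (s≤s (ℕ.m≤n⇒m≤1+n le)))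

  selector-coefficient : ∀ s κ f n → (selector s κ ⋆ f) n ≡ 𝟙 (s ℕ.≟ κ) * f n
  selector-coefficient s κ f n = by-cases (s ℕ.≟ κ)
    where
    by-cases : (d : Dec (s ≡ κ)) → (selector s κ ⋆ f) n ≡ 𝟙 d * f n
    by-cases (yes refl) = trans (⋆-cong (selector-yes s) (λ _ → refl) n) (trans (⋆-identityˡ f n) (sym (*-identityˡ (f n))))
    by-cases (no ne)    = trans (⋆-cong (selector-no s κ ne) (λ _ → refl) n) (⋆-zeroˡ f n)

  ≈-weaken : ∀ {E E′ f g} → E′ ℕ.≤ E → f ≈[ E ] g → f ≈[ E′ ] g
  ≈-weaken le h n lt = h n (ℕ.<-≤-trans lt le)

  signˢ-coefficient : ∀ k f n → (signˢ k ⋆ f) n ≡ alt k * f n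
  signˢ-coefficient zero    f n = trans (⋆-identityˡ f n) (sym (*-identityˡ (f n)))
  signˢ-coefficient (suc k) f n = trans (⋆-cong {⊝ signˢ k} {λ m → -1ℤ * signˢ k m} (λ m → sym (-1*i≡-i (signˢ k m))) (λ _ → refl) n) (trans (⋆-scale -1ℤ (signˢ k) f n)
    (trans (cong (-1ℤ *_) (signˢ-coefficient k f n)) (trans (-1*i≡-i (alt k * f n)) (neg-distribˡ-* (alt k) (f n)))))

  -- A coefficient of X^a ⋆ f depends on n - a alone, as an integer. This trades the shift 3 pent(j)
  -- at n for the shift t pent(j) at x.
  same-distance : ∀ a b f n x → n ℕ.+ b ≡ x ℕ.+ a → (X^ a ⋆ f) n ≡ (X^ b ⋆ f) x
  same-distance a b f n x e with a ℕ.≤? n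
  ... | yes a≤n = trans (cong (X^ a ⋆ f) (sym (ℕ.m+[n∸m]≡n a≤n))) (trans (X^-⋆-at a f (n ∸ a)) (trans (sym (X^-⋆-at b f (n ∸ a))) (cong (X^ b ⋆ f) x≡)))
    where
    x≡ : b ℕ.+ (n ∸ a) ≡ x
    x≡ = ℕ.+-cancelʳ-≡ a (b ℕ.+ (n ∸ a)) x (trans (ℕ.+-assoc b (n ∸ a) a) (trans (cong (b ℕ.+_) (ℕ.m∸n+n≡m a≤n)) (trans (ℕ.+-comm b n) e)))
  ... | no a≰n = trans (X^-⋆-below a f n (ℕ.≰⇒> a≰n)) (sym (X^-⋆-below b f x (ℕ.+-cancelʳ-< a x b (subst (ℕ._< b ℕ.+ a) e (subst (n ℕ.+ b ℕ.<_) (ℕ.+-comm a b) (ℕ.+-monoˡ-< b (ℕ.≰⇒> a≰n)))))))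

  module _ (r t : ℕ) (1≤r : 1 ℕ.≤ r) (2≤t : 2 ℕ.≤ t) where
    open Norm r t
    private
      R T : ℤ
      R = + r
      T = + t
      instance
        r≢0 : ℕ.NonZero r
        r≢0 = ℕ.>-nonZero 1≤r
      R≢0 : NonZero R
      R≢0 = r≢0

    sum-β₀ : sumᵥ β₀ ≡ - R
    sum-β₀ = trans (sum-β′ r) (lem R)
      where
      lem : ∀ R → R * R - R - R * R ≡ - R
      lem = solve-∀
      sum-β′ : ∀ k → sumᵥ (β r k) ≡ + k * + k - + k - + k * R
      sum-β′ = Shape.sum-β r 0

    q₀≡ : q₀ ≡ + 3 * R * ⟨ β₀ , β₀ ⟩ + (T - + 3) * (R * R)
    q₀≡ = cong (λ z → + 3 * R * ⟨ β₀ , β₀ ⟩ + (T - + 3) * z) (trans (cong₂ _*_ sum-β₀ sum-β₀) (lem R))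
      where
      lem : ∀ R → - R * - R ≡ R * R
      lem = solve-∀

    q₀-nonneg : 0ℤ ≤ q₀
    q₀-nonneg = ≤-trans (⟨⟩-nonneg β₀) (B₀-lower 1≤r 2≤t β₀)

    σ-σ′ : ∀ k → σ (R * (+ 2 * k - 1ℤ)) ≡ σ′ k
    σ-σ′ k = cong₂ _-_ (𝟙-⇔ (+ (12 ℕ.* r) ∣? R * (+ 2 * k - 1ℤ) + R) (+ 6 ∣? k) (λ d → cancel (subst₂ _∣_ twelve (lem₁ R k) d)) (λ d → subst₂ _∣_ (sym twelve) (sym (lem₁ R k)) (*-monoʳ-∣ (+ 2 * R) d)))
      (𝟙-⇔ (+ (12 ℕ.* r) ∣? R * (+ 2 * k - 1ℤ) - + 5 * R) (+ 6 ∣? k - + 3) (λ d → cancel (subst₂ _∣_ twelve (lem₂ R k) d)) (λ d → subst₂ _∣_ (sym twelve) (sym (lem₂ R k)) (*-monoʳ-∣ (+ 2 * R) d)))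
      where
      lem₀ : ∀ R → + 12 * R ≡ + 2 * R * + 6
      lem₀ = solve-∀
      twelve : + (12 ℕ.* r) ≡ + 2 * R * + 6
      twelve = trans (pos-* 12 r) (lem₀ R)
      lem₁ : ∀ R k → R * (+ 2 * k - 1ℤ) + R ≡ + 2 * R * k
      lem₁ = solve-∀
      lem₂ : ∀ R k → R * (+ 2 * k - 1ℤ) - + 5 * R ≡ + 2 * R * (k - + 3)
      lem₂ = solve-∀
      cancel : ∀ {a} → + 2 * R * + 6 ∣ + 2 * R * a → + 6 ∣ a
      cancel = *-cancelˡ-∣ (+ 2 * R) {{i*j≢0 (+ 2) R {{_}} {{R≢0}}}}

    module Fixed (M : ℕ) where
      -- `J` bounds the centred sum k, and with it |j|, at level M; `PB` bounds pent(j) for |j| ≤ J;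
      -- `E` exceeds every exponent that occurs, namely n ≤ x + 3 pent(j). The three parts of `m`
      -- make room for the truncation E, the sums r m ± 3j, and the window of norm M.
      J PB E m : ℕ
      J  = suc M
      PB = suc J ℕ.* suc J ℕ.+ tri (suc (suc J))
      E  = suc (J ℕ.+ 3 ℕ.* PB)
      m  = E ℕ.+ suc E ℕ.+ 3 ℕ.* J ℕ.+ (M ℕ.+ r)

      private
        2E≤m : E ℕ.+ suc E ℕ.≤ m
        2E≤m = ℕ.≤-trans (ℕ.m≤m+n (E ℕ.+ suc E) (3 ℕ.* J)) (ℕ.m≤m+n _ (M ℕ.+ r))
        E+3J≤m : E ℕ.+ 3 ℕ.* J ℕ.≤ m
        E+3J≤m = ℕ.≤-trans (ℕ.+-monoˡ-≤ (3 ℕ.* J) (ℕ.m≤m+n E (suc E))) (ℕ.m≤m+n _ (M ℕ.+ r))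
        M+r≤m : M ℕ.+ r ℕ.≤ m
        M+r≤m = ℕ.m≤n+m (M ℕ.+ r) (E ℕ.+ suc E ℕ.+ 3 ℕ.* J)

      open Shape r m
      open Lattice r m
      open Limit r m E 1≤r 2E≤m using (core; count; count-core; F₁; Fᵣ; F₁⋆core)
      module W = Window r t 1≤r 2≤t m

      vs : List (Vec ℕ r)
      vs = vecs (below (suc (m ℕ.+ m))) r

      k : Vec ℕ r → ℤ
      k v = + total v - R * + m

      Q : Vec ℕ r → ℤ
      Q v = B₀ (lattice-point v) (lattice-point v)

      sum-k : ∀ v → sumᵥ (lattice-point v) ≡ R * (+ 2 * k v - 1ℤ)
      sum-k v = trans (sum-point v) (trans (cong (λ z → + 2 * R * (+ total v - R * + m) + z) sum-β₀) (lem R (+ total v - R * + m)))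
        where
        lem : ∀ R k → + 2 * R * k + - R ≡ R * (+ 2 * k - 1ℤ)
        lem = solve-∀

      -- The computation behind the choice of `B₀`: the square terms yield the exponent, the square
      -- of the sum yields pent(j), and the constants add up to `q₀`.
      Q-formula : ∀ v j → + 3 * j ≡ k v → Q v ≡ q₀ + + 24 * (R * R) * (+ exponents v + (T - + 3) * + pent j)
      Q-formula v j e = trans (cong₂ (λ N S → + 3 * R * N + (T - + 3) * (S * S)) (norm-point v ℕ.≤-refl) (trans (sum-k v) (cong (λ z → R * (+ 2 * z - 1ℤ)) (sym e))))
        (trans (lem₁ R T j (+ exponents v) ⟨ β₀ , β₀ ⟩) (trans (cong (λ z → + 3 * R * ⟨ β₀ , β₀ ⟩ + (T - + 3) * (R * R) + + 24 * (R * R) * + exponents v + (T - + 3) * (R * R) * (+ 12 * z)) (sym (pent₂ j)))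
          (trans (lem₂ R T (+ pent j) (+ exponents v) ⟨ β₀ , β₀ ⟩) (cong (λ z → z + + 24 * (R * R) * (+ exponents v + (T - + 3) * + pent j)) (sym q₀≡)))))
        where
        lem₁ : ∀ R T j e N → + 3 * R * (+ 8 * R * e + N) + (T - + 3) * ((R * (+ 2 * (+ 3 * j) - 1ℤ)) * (R * (+ 2 * (+ 3 * j) - 1ℤ))) ≡
          + 3 * R * N + (T - + 3) * (R * R) + + 24 * (R * R) * e + (T - + 3) * (R * R) * (+ 12 * (+ 3 * (j * j) - j))
        lem₁ = solve-∀
        lem₂ : ∀ R T p e N → + 3 * R * N + (T - + 3) * (R * R) + + 24 * (R * R) * e + (T - + 3) * (R * R) * (+ 12 * (+ 2 * p)) ≡
          + 3 * R * N + (T - + 3) * (R * R) + + 24 * (R * R) * (e + (T - + 3) * p)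
        lem₂ = solve-∀

      -- Norm M bounds every coordinate by M. The coordinate sum r(2k - 1) is then at most r M in
      -- absolute value, and r cancels.
      k-bound : ∀ v → Q v ≡ + M → ∣ k v ∣ ℕ.≤ J
      k-bound v e = ℕ.≤-trans (ℕ.m≤n*m ∣ k v ∣ 2) (ℕ.≤-trans (ℕ.≤-reflexive (sym (abs-* (+ 2) (k v)))) (ℕ.≤-trans (ℕ.≤-reflexive (cong ∣_∣ (lem (+ 2 * k v))))
        (ℕ.≤-trans (∣i+j∣≤∣i∣+∣j∣ (+ 2 * k v - 1ℤ) 1ℤ) (ℕ.≤-trans (ℕ.+-monoˡ-≤ 1 odd-bound) (ℕ.≤-reflexive (ℕ.+-comm M 1))))))
        where
        lem : ∀ a → a ≡ a - 1ℤ + 1ℤ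
        lem = solve-∀
        odd-bound : ∣ + 2 * k v - 1ℤ ∣ ℕ.≤ M
        odd-bound = ℕ.*-cancelˡ-≤ r (ℕ.≤-trans (ℕ.≤-reflexive (trans (sym (abs-* R (+ 2 * k v - 1ℤ))) (cong ∣_∣ (sym (sum-k v))))) (sum-bound (lattice-point v) (B₀-coercive r t 1≤r 2≤t (lattice-point v) e)))

      hit : ℤ → Vec ℕ r → ℤ
      hit j v = 𝟙 (+ 3 * j ≟ k v) * 𝟙 (Q v ≟ + M)

      -- The sign of a vector is resolved by j: only centred sums k = 3j contribute, with (-1)^j.
      G-expand : ∀ v → W.G M M+r≤m v ≡ ∑[ j ∈ interval J ] (alt ∣ j ∣ * hit j v)
      G-expand v = by-cases (Q v ≟ + M)
        where
        lem : ∀ a b c → a * b * c ≡ b * (a * c)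
        lem = solve-∀
        by-cases : (d : Dec (Q v ≡ + M)) → 𝟙 d * σ (sumᵥ (lattice-point v)) ≡ ∑[ j ∈ interval J ] (alt ∣ j ∣ * (𝟙 (+ 3 * j ≟ k v) * 𝟙 d))
        by-cases (no _)  = sym (∑-all0 (interval J) (λ j → trans (cong (alt ∣ j ∣ *_) (*-zeroʳ (𝟙 (+ 3 * j ≟ k v)))) (*-zeroʳ (alt ∣ j ∣))))
        by-cases (yes e) = trans (*-identityˡ (σ (sumᵥ (lattice-point v)))) (trans (trans (cong σ (sum-k v)) (σ-σ′ (k v))) (trans (σ′-expand J (k v) (k-bound v e))
          (∑-cong (interval J) (λ j → trans (*-comm (𝟙 (+ 3 * j ≟ k v)) (alt ∣ j ∣)) (cong (alt ∣ j ∣ *_) (sym (*-identityʳ (𝟙 (+ 3 * j ≟ k v)))))))))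

      inner : ℤ → ℤ
      inner j = ∑[ v ∈ vs ] hit j v

      by-signs : ∀ b → M ℕ.≤ b → theta-count b M ≡ ∑[ j ∈ interval J ] (alt ∣ j ∣ * inner j)
      by-signs b M≤b = trans (W.on-points M M+r≤m b M≤b) (trans (∑-cong vs G-expand) (trans (∑-swap vs (interval J) (λ v j → alt ∣ j ∣ * hit j v)) (∑-cong (interval J) (λ j → ∑-*ˡ vs (alt ∣ j ∣) (hit j)))))

      -- The uncentred coordinate sum r m + 3j and its complement in 2 m r; `J` is small against m,
      -- so the absolute values change nothing for |j| ≤ J.
      κ μ : ℤ → ℕ
      κ j = ∣ R * + m + + 3 * j ∣
      μ j = ∣ R * + m - + 3 * j ∣

      private
        rm≥ : E ℕ.+ 3 ℕ.* J ℕ.≤ r ℕ.* m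
        rm≥ = ℕ.≤-trans E+3J≤m (ℕ.m≤n*m m r)

        shift-pos : ∀ i → ∣ i ∣ ℕ.≤ 3 ℕ.* J → + ∣ R * + m + i ∣ ≡ R * + m + i × E ℕ.≤ ∣ R * + m + i ∣
        shift-pos i i≤ = unsigned , ℕ.+-cancelʳ-≤ (3 ℕ.* J) E ∣ R * + m + i ∣ (ℕ.≤-trans rm≥ (ℕ.≤-trans (ℕ.≤-reflexive (trans (sym (abs-* R (+ m))) (cong ∣_∣ (lem (R * + m) i))))
          (ℕ.≤-trans (∣i-j∣≤∣i∣+∣j∣ (R * + m + i) i) (ℕ.+-monoʳ-≤ ∣ R * + m + i ∣ i≤))))
          where
          lem : ∀ a i → a ≡ a + i - i
          lem = solve-∀
          unsigned : + ∣ R * + m + i ∣ ≡ R * + m + i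
          unsigned = trans (cong (λ z → + ∣ z ∣) (trans (cong (_+ i) (sym (pos-* r m))) (+-comm (+ (r ℕ.* m)) i))) (trans (FrameStep.shift i (r ℕ.* m) (ℕ.≤-trans i≤ (ℕ.≤-trans (ℕ.m≤n+m (3 ℕ.* J) E) rm≥)))
            (trans (+-comm i (+ (r ℕ.* m))) (cong (_+ i) (pos-* r m))))

        triple : ∀ j → ∣ j ∣ ℕ.≤ J → ∣ + 3 * j ∣ ℕ.≤ 3 ℕ.* J
        triple j le = ℕ.≤-trans (ℕ.≤-reflexive (abs-* (+ 3) j)) (ℕ.*-monoʳ-≤ 3 le)

      κ-facts : ∀ j → ∣ j ∣ ℕ.≤ J → + κ j ≡ R * + m + + 3 * j × E ℕ.≤ κ j
      κ-facts j le = shift-pos (+ 3 * j) (triple j le)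

      μ-facts : ∀ j → ∣ j ∣ ℕ.≤ J → + μ j ≡ R * + m - + 3 * j × E ℕ.≤ μ j
      μ-facts j le = shift-pos (- (+ 3 * j)) (ℕ.≤-trans (ℕ.≤-reflexive (∣-i∣≡∣i∣ (+ 3 * j))) (triple j le))

      κ+μ : ∀ j → ∣ j ∣ ℕ.≤ J → κ j ℕ.+ μ j ≡ (m ℕ.+ m) ℕ.* r
      κ+μ j le = +-injective (trans (pos-+ (κ j) (μ j)) (trans (cong₂ _+_ (proj₁ (κ-facts j le)) (proj₁ (μ-facts j le))) (trans (lem R (+ m) (+ 3 * j)) (trans (cong (_* R) (sym (pos-+ m m))) (sym (pos-* (m ℕ.+ m) r))))))
        where
        lem : ∀ R m i → R * m + i + (R * m - i) ≡ (m + m) * R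
        lem = solve-∀

      -- The centred index is 3j, and its triangular number 3j(3j - 1)/2 is 3 pent(j). The identity
      -- is checked after doubling, where `tri` and `pent` are polynomials.
      tri-identity : ∀ j → ∣ j ∣ ℕ.≤ J → tri (κ j) ℕ.+ r ℕ.* (r ℕ.* (m ℕ.* m)) ≡ r ℕ.* (r ℕ.* tri m) ℕ.+ m ℕ.* tri r ℕ.+ r ℕ.* m ℕ.* κ j ℕ.+ 3 ℕ.* pent j
      tri-identity j le = +-injective (*-cancelˡ-≡ (+ 2) _ _ (trans (cong (+ 2 *_) left) (trans (doubled (+ κ j) (+ tri (κ j)) (+ m) (+ tri m) (+ tri r) (+ pent j) (tri₂ (κ j)) (tri₂ m) (tri₂ r) (proj₁ (κ-facts j le)) (pent₂ j)) (cong (+ 2 *_) (sym right)))))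
        where
        left : + (tri (κ j) ℕ.+ r ℕ.* (r ℕ.* (m ℕ.* m))) ≡ + tri (κ j) + R * (R * (+ m * + m))
        left = trans (pos-+ (tri (κ j)) _) (cong (λ z → + tri (κ j) + z) (trans (pos-* r (r ℕ.* (m ℕ.* m))) (cong (R *_) (trans (pos-* r (m ℕ.* m)) (cong (R *_) (pos-* m m))))))
        right : + (r ℕ.* (r ℕ.* tri m) ℕ.+ m ℕ.* tri r ℕ.+ r ℕ.* m ℕ.* κ j ℕ.+ 3 ℕ.* pent j) ≡ R * (R * + tri m) + + m * + tri r + R * + m * + κ j + + 3 * + pent j
        right = trans (pos-+ (r ℕ.* (r ℕ.* tri m) ℕ.+ m ℕ.* tri r ℕ.+ r ℕ.* m ℕ.* κ j) (3 ℕ.* pent j)) (cong₂ _+_ (trans (pos-+ (r ℕ.* (r ℕ.* tri m) ℕ.+ m ℕ.* tri r) (r ℕ.* m ℕ.* κ j)) (cong₂ _+_ (trans (pos-+ (r ℕ.* (r ℕ.* tri m)) (m ℕ.* tri r))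
          (cong₂ _+_ (trans (pos-* r (r ℕ.* tri m)) (cong (R *_) (pos-* r (tri m)))) (pos-* m (tri r)))) (trans (pos-* (r ℕ.* m) (κ j)) (cong (_* + κ j) (pos-* r m))))) (pos-* 3 (pent j)))
        doubled : ∀ K tK m tm tr p → + 2 * tK ≡ K * K - K → + 2 * tm ≡ m * m - m → + 2 * tr ≡ R * R - R → K ≡ R * m + + 3 * j → + 2 * p ≡ + 3 * (j * j) - j →
          + 2 * (tK + R * (R * (m * m))) ≡ + 2 * (R * (R * tm) + m * tr + R * m * K + + 3 * p)
        doubled K tK m tm tr p e₁ e₂ e₃ refl e₅ = trans (lem₁ tK R m) (trans (cong (_+ + 2 * (R * (R * (m * m)))) e₁) (trans (lem₂ R m j) (sym (trans (lem₃ R m (R * m + + 3 * j) tm tr p)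
          (trans (cong₂ (λ a b → R * R * a + m * b + + 2 * (R * m * (R * m + + 3 * j)) + + 3 * (+ 2 * p)) e₂ e₃) (cong (λ z → R * R * (m * m - m) + m * (R * R - R) + + 2 * (R * m * (R * m + + 3 * j)) + + 3 * z) e₅))))))
          where
          lem₁ : ∀ t R m → + 2 * (t + R * (R * (m * m))) ≡ + 2 * t + + 2 * (R * (R * (m * m)))
          lem₁ = solve-∀
          lem₂ : ∀ R m j → (R * m + + 3 * j) * (R * m + + 3 * j) - (R * m + + 3 * j) + + 2 * (R * (R * (m * m))) ≡ R * R * (m * m - m) + m * (R * R - R) + + 2 * (R * m * (R * m + + 3 * j)) + + 3 * (+ 3 * (j * j) - j)
          lem₂ = solve-∀
          lem₃ : ∀ R m K tm tr p → + 2 * (R * (R * tm) + m * tr + R * m * K + + 3 * p) ≡ R * R * (+ 2 * tm) + m * (+ 2 * tr) + + 2 * (R * m * K) + + 3 * (+ 2 * p)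
          lem₃ = solve-∀

      count-at : ∀ j → ∣ j ∣ ℕ.≤ J → ∀ n → n ℕ.< E → ∑[ v ∈ vs ] (𝟙 (total v ℕ.≟ κ j) * 𝟙 (exponents v ℕ.≟ n)) ≡ (X^ (3 ℕ.* pent j) ⋆ core) n
      count-at j le n n<E = trans (∑-cong vs (λ v → sym (trans (selector-coefficient (total v) (κ j) (X^ (exponents v)) n) (cong (𝟙 (total v ℕ.≟ κ j) *_) (X^-coefficient (exponents v) n)))))
        (count-core (κ j) (μ j) (3 ℕ.* pent j) (proj₂ (κ-facts j le)) (proj₂ (μ-facts j le)) (κ+μ j le) (tri-identity j le) n n<E)

      module Level (X : ℤ) (M≡ : + M ≡ q₀ + + 24 * (R * R) * X) where

        -- At level q₀ + 24r²X the vectors with centred sum 3j are those with exponent n = X + 3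
        -- pent(j) - t pent(j), which may be negative.
        hit-level : ∀ j → ∣ j ∣ ℕ.≤ J → ∀ n → n + T * + pent j ≡ X + + 3 * + pent j → ∀ v → hit j v ≡ 𝟙 (total v ℕ.≟ κ j) * 𝟙 (+ exponents v ≟ n)
        hit-level j le n e v = trans (sym (𝟙-× (+ 3 * j ≟ k v) (Q v ≟ + M) both (λ x → x) _,_)) (𝟙-× (total v ℕ.≟ κ j) (+ exponents v ≟ n) both (λ { (p , q) → to-total p , to-exponent p q }) (λ p q → from-total p , from-exponent p q))
          where
          both : Dec (+ 3 * j ≡ k v × Q v ≡ + M)
          both = (+ 3 * j ≟ k v) ×-dec (Q v ≟ + M)
            where open import Relation.Nullary.Decidable using (_×-dec_)
          lem₁ : ∀ a b → a ≡ b + (a - b)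
          lem₁ = solve-∀
          lem₂ : ∀ a b → b ≡ a + b - a
          lem₂ = solve-∀
          to-total : + 3 * j ≡ k v → total v ≡ κ j
          to-total p = +-injective (trans (lem₁ (+ total v) (R * + m)) (trans (cong (λ z → R * + m + z) (sym p)) (sym (proj₁ (κ-facts j le)))))
          from-total : total v ≡ κ j → + 3 * j ≡ k v
          from-total p = trans (lem₂ (R * + m) (+ 3 * j)) (cong (_- R * + m) (trans (sym (proj₁ (κ-facts j le))) (cong +_ (sym p))))
          lem₃ : ∀ e T p → e + T * p ≡ e + (T - + 3) * p + + 3 * p
          lem₃ = solve-∀
          lem₄ : ∀ e T p → e + (T - + 3) * p ≡ e + T * p - + 3 * p
          lem₄ = solve-∀
          cancel-24 : ∀ {a c} → q₀ + + 24 * (R * R) * a ≡ q₀ + + 24 * (R * R) * c → a ≡ c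
          cancel-24 {a} {c} eq = *-cancelˡ-≡ (+ 24 * (R * R)) a c {{i*j≢0 (+ 24) (R * R) {{_}} {{i*j≢0 R R {{R≢0}} {{R≢0}}}}}} (trans (lem₂ q₀ (+ 24 * (R * R) * a)) (trans (cong (_- q₀) eq) (sym (lem₂ q₀ (+ 24 * (R * R) * c)))))
          to-exponent : + 3 * j ≡ k v → Q v ≡ + M → + exponents v ≡ n
          to-exponent p q = trans (lem₂ (T * + pent j) (+ exponents v)) (trans (cong (_- T * + pent j) (trans (+-comm (T * + pent j) (+ exponents v)) (trans (lem₃ (+ exponents v) T (+ pent j))
            (trans (cong (_+ + 3 * + pent j) (cancel-24 {+ exponents v + (T - + 3) * + pent j} {X} (trans (sym (Q-formula v j p)) (trans q M≡)))) (trans (sym e) (+-comm n (T * + pent j)))))) ) (sym (lem₂ (T * + pent j) n)))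
          from-exponent : total v ≡ κ j → + exponents v ≡ n → Q v ≡ + M
          from-exponent p q = trans (Q-formula v j (from-total p)) (trans (cong (λ z → q₀ + + 24 * (R * R) * z) (trans (cong (λ z → z + (T - + 3) * + pent j) q) (trans (lem₄ n T (+ pent j)) (trans (cong (_- + 3 * + pent j) (trans e (+-comm X (+ 3 * + pent j)))) (sym (lem₂ (+ 3 * + pent j) X)))))) (sym M≡))

        inner-count : ∀ j → ∣ j ∣ ℕ.≤ J → ∀ n → n ℕ.< E → + n + T * + pent j ≡ X + + 3 * + pent j → inner j ≡ (X^ (3 ℕ.* pent j) ⋆ core) n
        inner-count j le n n<E e = trans (∑-cong vs (λ v → trans (hit-level j le (+ n) e v) (cong (𝟙 (total v ℕ.≟ κ j) *_) (𝟙-⇔ (+ exponents v ≟ + n) (exponents v ℕ.≟ n) +-injective (cong (λ y → + y)))))) (count-at j le n n<E)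

        inner-empty : ∀ j → ∣ j ∣ ℕ.≤ J → ∀ n → -[1+ n ] + T * + pent j ≡ X + + 3 * + pent j → inner j ≡ 0ℤ
        inner-empty j le n e = ∑-all0 vs (λ v → trans (hit-level j le -[1+ n ] e v) (trans (cong (𝟙 (total v ℕ.≟ κ j) *_) (𝟙-no (+ exponents v ≟ -[1+ n ]) λ ())) (*-zeroʳ (𝟙 (total v ℕ.≟ κ j)))))

        level-index : ∀ j → ∃ λ n → n + T * + pent j ≡ X + + 3 * + pent j
        level-index j = X + + 3 * + pent j - T * + pent j , lem (X + + 3 * + pent j) (T * + pent j)
          where
          lem : ∀ a b → a - b + b ≡ a
          lem = solve-∀

      3pent≤ : ∀ j → ∣ j ∣ ℕ.≤ J → 3 ℕ.* pent j ℕ.≤ 3 ℕ.* PB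
      3pent≤ j le = ℕ.*-monoʳ-≤ 3 (pent-bound J j le)

      private
        natural : ∀ n a x p → + n + T * + a ≡ + x + + 3 * + p → n ℕ.+ t ℕ.* a ≡ x ℕ.+ 3 ℕ.* p
        natural n a x p e = +-injective (trans (trans (pos-+ n (t ℕ.* a)) (cong (λ z → + n + z) (pos-* t a))) (trans e (sym (trans (pos-+ x (3 ℕ.* p)) (cong (λ z → + x + z) (pos-* 3 p))))))

        move : ∀ n A x P → -[1+ n ] + A ≡ x + P → A ≡ x + + suc n + P
        move n A x P e = trans (lem₁ (+ suc n) A) (trans (cong (λ z → + suc n + z) e) (lem₂ (+ suc n) x P))
          where
          lem₁ : ∀ s A → A ≡ s + (- s + A)
          lem₁ = solve-∀
          lem₂ : ∀ s x P → s + (x + P) ≡ x + s + P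
          lem₂ = solve-∀

      inner-nonneg : ∀ x → + M ≡ q₀ + + 24 * (R * R) * + x → x ℕ.≤ J → ∀ j → ∣ j ∣ ℕ.≤ J → inner j ≡ (X^ (t ℕ.* pent j) ⋆ core) x
      inner-nonneg x M≡ x≤J j le = by-sign (proj₁ (level-index j)) (proj₂ (level-index j))
        where
        open Level (+ x) M≡
        by-sign : ∀ n → n + T * + pent j ≡ + x + + 3 * + pent j → inner j ≡ (X^ (t ℕ.* pent j) ⋆ core) x
        by-sign (+ n) e = trans (inner-count j le n n<E e) (same-distance (3 ℕ.* pent j) (t ℕ.* pent j) core n x (natural n (pent j) x (pent j) e))
          where
          n<E : n ℕ.< E
          n<E = s≤s (ℕ.≤-trans (ℕ.m≤m+n n (t ℕ.* pent j)) (ℕ.≤-trans (ℕ.≤-reflexive (natural n (pent j) x (pent j) e)) (ℕ.+-mono-≤ x≤J (3pent≤ j le))))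
        by-sign -[1+ n ] e = trans (inner-empty j le n e) (sym (X^-⋆-below (t ℕ.* pent j) core x (ℕ.≤-trans (ℕ.≤-trans (ℕ.≤-trans (ℕ.s≤s (ℕ.m≤m+n x n)) (ℕ.≤-reflexive (sym (ℕ.+-suc x n)))) (ℕ.m≤m+n (x ℕ.+ suc n) (3 ℕ.* pent j))) (ℕ.≤-reflexive (sym nat)))))
          where
          nat : t ℕ.* pent j ≡ x ℕ.+ suc n ℕ.+ 3 ℕ.* pent j
          nat = +-injective (trans (pos-* t (pent j)) (trans (move n (T * + pent j) (+ x) (+ 3 * + pent j) e) (sym (trans (pos-+ (x ℕ.+ suc n) (3 ℕ.* pent j)) (cong₂ _+_ (pos-+ x (suc n)) (pos-* 3 (pent j)))))))

      -- With a negative index the exponent is either negative or less than 3 pent(j), and the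
      -- series q^(3 pent(j)) · `core` has no coefficient there.
      inner-negative : ∀ x → + M ≡ q₀ + + 24 * (R * R) * -[1+ x ] → ∀ j → ∣ j ∣ ℕ.≤ J → inner j ≡ 0ℤ
      inner-negative x M≡ j le = by-sign (proj₁ (level-index j)) (proj₂ (level-index j))
        where
        open Level -[1+ x ] M≡
        by-sign : ∀ n → n + T * + pent j ≡ -[1+ x ] + + 3 * + pent j → inner j ≡ 0ℤ
        by-sign -[1+ n ] e = inner-empty j le n e
        by-sign (+ n) e = trans (inner-count j le n (ℕ.<-≤-trans n<3p (ℕ.≤-trans (3pent≤ j le) (ℕ.≤-trans (ℕ.m≤n+m (3 ℕ.* PB) J) (ℕ.n≤1+n _)))) e) (X^-⋆-below (3 ℕ.* pent j) core n n<3p)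
          where
          n<3p : n ℕ.< 3 ℕ.* pent j
          n<3p = ℕ.≤-trans (ℕ.≤-trans (ℕ.s≤s (ℕ.≤-trans (ℕ.m≤m+n n (t ℕ.* pent j)) (ℕ.m≤m+n (n ℕ.+ t ℕ.* pent j) x))) (ℕ.≤-reflexive (sym (ℕ.+-suc (n ℕ.+ t ℕ.* pent j) x)))) (ℕ.≤-reflexive (sym nat))
            where
            nat : 3 ℕ.* pent j ≡ n ℕ.+ t ℕ.* pent j ℕ.+ suc x
            nat = +-injective (trans (pos-* 3 (pent j)) (trans (move x (+ 3 * + pent j) (+ n) (T * + pent j) (trans (sym e) refl)) (trans (lem (+ n) (+ suc x) (T * + pent j)) (sym (trans (pos-+ (n ℕ.+ t ℕ.* pent j) (suc x)) (cong (_+ + suc x) (trans (pos-+ n (t ℕ.* pent j)) (cong (λ z → + n + z) (pos-* t (pent j))))))))))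
              where
              lem : ∀ n s P → n + s + P ≡ n + P + s
              lem = solve-∀

      -- the series b_t · f_r^r, up to the chosen precision
      product-series : Series
      product-series = bˢ t ⋆ Fᵣ ↑ r

      -- Multiplied by f_1, both sides become f_t f_r^r: the left by the pentagonal theorem and the
      -- definition of `core`, the right by the generating function of b_t.
      theta-product : ∀ x → x ℕ.≤ M → (theta t J ⋆ core) x ≡ product-series x
      theta-product x x≤M = sym (unit-cancel {suc x} F₁ product-series (theta t J ⋆ core) (poch-unit 1 E ℕ.≤-refl) equal x ℕ.≤-refl)
        where
        open ≋-Solver using (solve; _:=_; _:*_)
        x<J : suc x ℕ.≤ J
        x<J = s≤s x≤M
        x<E : suc x ℕ.≤ E
        x<E = ℕ.≤-trans x<J (ℕ.≤-trans (ℕ.m≤m+n J (3 ℕ.* PB)) (ℕ.n≤1+n _))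
        1≤t : 1 ℕ.≤ t
        1≤t = ℕ.≤-trans (s≤s z≤n) 2≤t
        poch≈theta : poch t E ≈[ suc x ] theta t J
        poch≈theta = ≈-trans (subst (λ z → poch t z ≈[ suc x ] poch t (suc x)) (ℕ.m+[n∸m]≡n x<E) (poch-stable t (suc x) (E ∸ suc x) 1≤t)) (pentagonal t (suc x) J 1≤t x<J)
        equal : F₁ ⋆ product-series ≈[ suc x ] F₁ ⋆ (theta t J ⋆ core)
        equal = ≈-trans (≋⇒≈ (≋.sym (⋆-assoc F₁ (bˢ t) (Fᵣ ↑ r)))) (≈-trans (⋆-≈ {suc x} {F₁ ⋆ bˢ t} {theta t J} (≈-trans (≈-weaken x<E (regular-generating t E 1≤t)) poch≈theta) (λ _ _ → refl))
          (≈-trans (⋆-≈ {suc x} {theta t J} (λ _ _ → refl) (≈-sym (≈-weaken x<E F₁⋆core))) (≋⇒≈ (solve 3 (λ a f c → a :* (f :* c) := f :* (a :* c)) (λ n → refl) (theta t J) F₁ core))))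

      -- The sum over j of (-1)^j q^(t pent(j)) · `core` is f_t f_r^r / f_1, that is b_t · f_r^r,
      -- once all inner counts refer to the same index x.
      theta-count-value : ∀ b → M ℕ.≤ b → ∀ x → + M ≡ q₀ + + 24 * (R * R) * + x → x ℕ.≤ M → theta-count b M ≡ product-series x
      theta-count-value b M≤b x M≡ x≤M = trans (by-signs b M≤b) (trans (∑-interval-cong J (λ j le → cong (alt ∣ j ∣ *_) (inner-nonneg x M≡ (ℕ.m≤n⇒m≤1+n x≤M) j le)))
        (trans (∑-cong (interval J) (λ j → sym (signˢ-coefficient ∣ j ∣ (X^ (t ℕ.* pent j) ⋆ core) x)))
          (trans (∑ₛ-cong (interval J) (λ j → ≋.sym (⋆-assoc (signˢ ∣ j ∣) (X^ (t ℕ.* pent j)) core)) x) (trans (sym (∑ₛ-⋆ (interval J) (theta-term t) core x)) (theta-product x x≤M)))))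

      theta-count-negative : ∀ b → M ℕ.≤ b → ∀ x → + M ≡ q₀ + + 24 * (R * R) * -[1+ x ] → theta-count b M ≡ 0ℤ
      theta-count-negative b M≤b x M≡ = trans (by-signs b M≤b) (trans (∑-interval-cong J (λ j le → trans (cong (alt ∣ j ∣ *_) (inner-negative x M≡ j le)) (*-zeroʳ (alt ∣ j ∣)))) (∑-zero (interval J)))

-- Sections modulo r of the theta series.

module Section where

  open import Defs using (b)
  open import Data.Nat as ℕ using (ℕ; zero; suc; s≤s; z≤n)
  import Data.Nat.Properties as ℕ
  import Data.Nat.Divisibility as ℕ
  open import Data.Integer hiding (suc; _⊖_)
  open import Data.Integer.Properties
  open import Data.Integer.Divisibility.Signed
  open import Data.Integer.Tactic.RingSolver using (solve-∀)
  open import Data.Product using (_×_; _,_; ∃)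
  open import Relation.Nullary
  open import Relation.Binary.PropositionalEquality
  open import Function using (_∘_)
  open Sums
  open Vectors
  open Series
  open Gauss using (poch)
  open Core
  open Regular
  open Counting
  open Evaluate

  ⋆-∣ : ∀ {q} n f g → (∀ i j → i ℕ.+ j ≡ n → q ∣ f i * g j) → q ∣ (f ⋆ g) n
  ⋆-∣ zero    f g h = h 0 0 refl
  ⋆-∣ (suc n) f g h = ∣m∣n⇒∣m+n (h 0 (suc n) refl) (⋆-∣ n (f ∘ suc) g (λ i j e → h (suc i) j (cong suc e)))

  ⋆-vanish : ∀ n f g → (∀ i j → i ℕ.+ j ≡ n → f i * g j ≡ 0ℤ) → (f ⋆ g) n ≡ 0ℤ
  ⋆-vanish zero    f g h = h 0 0 refl
  ⋆-vanish (suc n) f g h = cong₂ _+_ (h 0 (suc n) refl) (⋆-vanish n (f ∘ suc) g (λ i j e → h (suc i) j (cong suc e)))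

  Supported : ℕ → Series → Set
  Supported r f = ∀ n → ¬ r ℕ.∣ n → f n ≡ 0ℤ

  Supported-⋆ : ∀ {r f g} → Supported r f → Supported r g → Supported r (f ⋆ g)
  Supported-⋆ {r} {f} {g} sf sg n r∤n = ⋆-vanish n f g λ i j e → by-cases i j e (r ℕ.∣? i)
    where
    by-cases : ∀ i j → i ℕ.+ j ≡ n → Dec (r ℕ.∣ i) → f i * g j ≡ 0ℤ
    by-cases i j e (no r∤i)  = cong (_* g j) (sf i r∤i)
    by-cases i j e (yes r∣i) = trans (cong (f i *_) (sg j (λ r∣j → r∤n (subst (r ℕ.∣_) e (ℕ.∣m∣n⇒∣m+n r∣i r∣j))))) (*-zeroʳ (f i))

  Supported-𝟏 : ∀ {r} → Supported r 𝟏
  Supported-𝟏 {r} zero    r∤0 = contradiction (r ℕ.∣0) r∤0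
  Supported-𝟏 (suc n) _  = refl

  Supported-poch : ∀ r n → Supported r (poch r n)
  Supported-poch r zero    = Supported-𝟏
  Supported-poch r (suc n) = Supported-⋆ {r} {poch r n} (Supported-poch r n) λ k r∤k → cong₂ _-_ (Supported-𝟏 k r∤k)
    (trans (X^-coefficient (r ℕ.* suc n) k) (𝟙-no (r ℕ.* suc n ℕ.≟ k) (λ e → r∤k (subst (r ℕ.∣_) e (ℕ.m∣m*n (suc n))))))

  Supported-↑ : ∀ {r f} k → Supported r f → Supported r (f ↑ k)
  Supported-↑ zero    s = Supported-𝟏
  Supported-↑ {r} {f} (suc k) s = Supported-⋆ {r} {f} s (Supported-↑ k s)

  ↑-unit : ∀ f k → f 0 ≡ 1ℤ → (f ↑ k) 0 ≡ 1ℤ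
  ↑-unit f zero    e = refl
  ↑-unit f (suc k) e = cong₂ _*_ e (↑-unit f k e)

  module _ (r t : ℕ) (1≤r : 1 ℕ.≤ r) (2≤t : 2 ℕ.≤ t) where
    open Norm r t
    private
      R : ℤ
      R = + r
      instance
        r≢0 : ℕ.NonZero r
        r≢0 = ℕ.>-nonZero 1≤r

    -- `q₀` is the level of index 0, where b_t · f_r^r has the constant term 1.
    theta-count-q₀ : theta-count ∣ q₀ ∣ ∣ q₀ ∣ ≡ 1ℤ
    theta-count-q₀ = trans (theta-count-value ∣ q₀ ∣ ℕ.≤-refl 0 (trans (0≤i⇒+∣i∣≡i (q₀-nonneg r t 1≤r 2≤t)) (lem q₀ (+ 24 * (R * R)))) z≤n)
      (trans (cong (λ z → + 1 * z) (↑-unit (poch r E) r (poch-unit r E 1≤r))) refl)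
      where
      open Evaluate.Fixed r t 1≤r 2≤t ∣ q₀ ∣
      lem : ∀ q c → q ≡ q + c * 0ℤ
      lem = solve-∀

    -- The coefficient at x = s + rZ involves only b_t(i) with i ≤ x, so a search over n ≤ x is
    -- exhaustive. A negative index cannot occur, since the theta coefficient would be 0 there.
    section-visible : ∀ {ℓ} s → s ℕ.< r → ∀ B M → M ℕ.≤ B → (Z : ℤ) → + M ≡ q₀ + + 24 * (R * R) * (+ s + R * Z) →
      ¬ + ℓ ∣ theta-count B M → ∃ λ n → ¬ + ℓ ∣ + b t (r ℕ.* n ℕ.+ s)
    section-visible {ℓ} s s<r B M M≤B Z M≡ h = by-sign (+ s + R * Z) refl
      where
      open Evaluate.Fixed r t 1≤r 2≤t M
      zero-∣ : + ℓ ∣ 0ℤ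
      zero-∣ = divides 0ℤ refl
      by-sign : ∀ X → X ≡ + s + R * Z → ∃ λ n → ¬ + ℓ ∣ + b t (r ℕ.* n ℕ.+ s)
      by-sign -[1+ x ] eX = contradiction (subst (+ ℓ ∣_) (sym (theta-count-negative B M≤B x (trans M≡ (cong (λ z → q₀ + + 24 * (R * R) * z) (sym eX))))) zero-∣) h
      by-sign (+ x) eX = search (ℕ.anyUpTo? (λ n → ¬? (+ ℓ ∣? + b t (r ℕ.* n ℕ.+ s))) (suc x))
        where
        M≡x : + M ≡ q₀ + + 24 * (R * R) * + x
        M≡x = trans M≡ (cong (λ z → q₀ + + 24 * (R * R) * z) (sym eX))
        x≤M : x ℕ.≤ M
        x≤M = ℕ.≤-trans (ℕ.≤-trans (ℕ.m≤n*m x (24 ℕ.* (r ℕ.* r)) {{ℕ.m*n≢0 24 (r ℕ.* r) {{_}} {{ℕ.m*n≢0 r r}}}}) (ℕ.m≤n+m (24 ℕ.* (r ℕ.* r) ℕ.* x) ∣ q₀ ∣))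
          (ℕ.≤-reflexive (+-injective (trans (pos-+ ∣ q₀ ∣ (24 ℕ.* (r ℕ.* r) ℕ.* x)) (trans (cong₂ _+_ (0≤i⇒+∣i∣≡i (q₀-nonneg r t 1≤r 2≤t))
            (trans (pos-* (24 ℕ.* (r ℕ.* r)) x) (cong (_* + x) (trans (pos-* 24 (r ℕ.* r)) (cong (+ 24 *_) (pos-* r r)))))) (sym M≡x)))))
        value : theta-count B M ≡ product-series x
        value = theta-count-value B M≤B x M≡x x≤M
        search : Dec (∃ λ n → n ℕ.< suc x × ¬ + ℓ ∣ + b t (r ℕ.* n ℕ.+ s)) → ∃ λ n → ¬ + ℓ ∣ + b t (r ℕ.* n ℕ.+ s)
        search (yes (n , _ , n∤)) = n , n∤
        search (no none) = contradiction (subst (+ ℓ ∣_) (sym value) (⋆-∣ x (bˢ t) (poch r E ↑ r) termwise)) h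
          where
          below : ∀ n → n ℕ.≤ x → + ℓ ∣ + b t (r ℕ.* n ℕ.+ s)
          below n le = decidable-stable (+ ℓ ∣? + b t (r ℕ.* n ℕ.+ s)) (λ n∤ → none (n , s≤s le , n∤))
          termwise : ∀ i j → i ℕ.+ j ≡ x → + ℓ ∣ + b t i * (poch r E ↑ r) j
          termwise i j e = by-support (r ℕ.∣? j)
            where
            by-support : Dec (r ℕ.∣ j) → + ℓ ∣ + b t i * (poch r E ↑ r) j
            by-support (no r∤j) = subst (+ ℓ ∣_) (sym (trans (cong (+ b t i *_) (Supported-↑ {r} {poch r E} r (Supported-poch r E) j r∤j)) (*-zeroʳ (+ b t i)))) zero-∣
            -- As r divides j, the index i = x - j is s + r(Z - j′); s < r excludes a negative Z -
            -- j′, so i belongs to the searched progression.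
            by-support (yes (ℕ.divides j′ ej)) = ∣m⇒∣m*n ((poch r E ↑ r) j) (index (Z - + j′) refl)
              where
              lem : ∀ s R Z j → s + R * Z - j * R ≡ R * (Z - j) + s
              lem = solve-∀
              i≡ : + i ≡ R * (Z - + j′) + + s
              i≡ = trans (lem′ (+ i) (+ j)) (trans (cong₂ _-_ (trans (sym (pos-+ i j)) (trans (cong +_ e) eX)) (trans (cong +_ ej) (pos-* j′ r))) (lem (+ s) R Z (+ j′)))
                where
                lem′ : ∀ a c → a ≡ a + c - c
                lem′ = solve-∀
              index : ∀ w → w ≡ Z - + j′ → + ℓ ∣ + b t i
              index (+ n) ew = subst (λ k → + ℓ ∣ + b t k) (sym i-nat) (below n (ℕ.≤-trans (ℕ.m≤n*m n r) (ℕ.≤-trans (ℕ.m≤m+n (r ℕ.* n) s) (ℕ.≤-trans (ℕ.≤-reflexive (sym i-nat)) (ℕ.≤-trans (ℕ.m≤m+n i j) (ℕ.≤-reflexive e))))))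
                where
                i-nat : i ≡ r ℕ.* n ℕ.+ s
                i-nat = +-injective (trans i≡ (trans (cong (λ z → R * z + + s) (sym ew)) (sym (trans (pos-+ (r ℕ.* n) s) (cong (_+ + s) (pos-* r n))))))
              index -[1+ n ] ew = contradiction s<r (ℕ.≤⇒≯ (ℕ.≤-trans (ℕ.≤-trans (ℕ.m≤m*n r (suc n)) (ℕ.m≤n+m (r ℕ.* suc n) i)) (ℕ.≤-reflexive balance)))
                where
                lem″ : ∀ R n s → R * - n + s + R * n ≡ s
                lem″ = solve-∀
                balance : i ℕ.+ r ℕ.* suc n ≡ s
                balance = +-injective (trans (pos-+ i (r ℕ.* suc n)) (trans (cong₂ _+_ (trans i≡ (cong (λ z → R * z + + s) (sym ew))) (pos-* r (suc n))) (lem″ R (+ suc n) (+ s))))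

-- Orthogonal sums, and the splitting of four copies modulo p.

module OrthSum where

  open import Data.Nat as ℕ using (ℕ; zero; suc; s≤s; z≤n)
  import Data.Nat.Properties as ℕ
  import Data.Nat.DivMod as ℕ
  import Data.Nat.Divisibility as ℕ
  open import Data.Nat.Primality using (Prime; prime⇒nonZero)
  open import Data.Integer hiding (suc; _⊖_)
  open import Data.Integer.Properties
  open import Data.Integer.DivMod using (n%ℕd<d)
  open import Data.Integer.Divisibility.Signed
  open import Data.Integer.Tactic.RingSolver using (solve-∀)
  open import Data.Fin using (Fin; zero; suc; toℕ; fromℕ<; splitAt)
  import Data.Fin.Properties as Fin
  open import Data.Vec using (Vec; []; _∷_; take; drop; _++_)
  open import Data.Vec.Properties using (take-zipWith; take-map; drop-zipWith; drop-map)
  open import Data.Vec.Relation.Unary.All using (All; []; _∷_)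
  open import Data.Product using (_×_; _,_; proj₁; proj₂; ∃)
  open import Data.Sum using (_⊎_; inj₁; inj₂)
  open import Data.Empty using (⊥)
  open import Relation.Binary.Definitions using (tri<; tri≈; tri>)
  open import Relation.Nullary
  open import Relation.Binary.PropositionalEquality
  open import Function using (_∘_)
  open LinDep using (PrimeIdeal)
  open Sums
  open Vectors
  open ModPrime
  open Frames
  open Hecke

  All-take : ∀ {P : ℤ → Set} a {b} {x : Vec ℤ (a ℕ.+ b)} → All P x → All P (take a x)
  All-take zero    ps       = []
  All-take (suc a) {x = _ ∷ _} (p ∷ ps) = p ∷ All-take a ps

  All-drop : ∀ {P : ℤ → Set} a {b} {x : Vec ℤ (a ℕ.+ b)} → All P x → All P (drop a x)
  All-drop zero    ps       = ps
  All-drop (suc a) {x = _ ∷ _} (p ∷ ps) = All-drop a ps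

  All-join : ∀ {P : ℤ → Set} a {b} (x : Vec ℤ (a ℕ.+ b)) → All P (take a x) → All P (drop a x) → All P x
  All-join zero    x       _        q = q
  All-join (suc a) (_ ∷ x) (p ∷ ps) q = p ∷ All-join a x ps q

  summand≤ : ∀ a b {n} → 0ℤ ≤ a → 0ℤ ≤ b → a + b ≡ + n → (∃ λ k → a ≡ + k × k ℕ.≤ n) × (∃ λ k → b ≡ + k × k ℕ.≤ n)
  summand≤ (+ a) (+ b) _ _ e = (a , refl , subst (a ℕ.≤_) (+-injective e) (ℕ.m≤m+n a b)) , (b , refl , subst (b ℕ.≤_) (+-injective e) (ℕ.m≤n+m b a))

  Bounded-mono : ∀ {a b m} {x : Vec ℤ m} → a ℕ.≤ b → Bounded a x → Bounded b x
  Bounded-mono le []       = []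
  Bounded-mono le (p ∷ ps) = ℕ.≤-trans p le ∷ Bounded-mono le ps

  infixr 5 _⊞ᶠ_
  _⊞ᶠ_ : ∀ {a b} → Form a → Form b → Form (a ℕ.+ b)
  _⊞ᶠ_ {a} {b} F G = record
    { B = λ x y → F.B (take a x) (take a y) + G.B (drop a x) (drop a y)
    ; B-comm = λ x y → cong₂ _+_ (F.B-comm (take a x) (take a y)) (G.B-comm (drop a x) (drop a y))
    ; B-⊕ = λ x y z → trans (cong₂ _+_ (trans (cong (λ w → F.B w (take a z)) (take-zipWith _+_ x y)) (F.B-⊕ (take a x) (take a y) (take a z)))
                                      (trans (cong (λ w → G.B w (drop a z)) (drop-zipWith _+_ x y)) (G.B-⊕ (drop a x) (drop a y) (drop a z))))
        (interchange (F.B (take a x) (take a z)) (F.B (take a y) (take a z)) (G.B (drop a x) (drop a z)) (G.B (drop a y) (drop a z)))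
    ; B-· = λ k x y → trans (cong₂ _+_ (trans (cong (λ w → F.B w (take a y)) (take-map (k *_) a x)) (F.B-· k (take a x) (take a y)))
                                      (trans (cong (λ w → G.B w (drop a y)) (drop-map (k *_) a x)) (G.B-· k (drop a x) (drop a y))))
        (sym (*-distribˡ-+ k (F.B (take a x) (take a y)) (G.B (drop a x) (drop a y))))
    ; bound = F.bound ℕ.+ G.bound
    ; B-bound = λ {b₁} {b₂} x y p q → ℕ.≤-trans (∣i+j∣≤∣i∣+∣j∣ (F.B (take a x) (take a y)) (G.B (drop a x) (drop a y)))
        (ℕ.≤-trans (ℕ.+-mono-≤ (F.B-bound (take a x) (take a y) (All-take a p) (All-take a q)) (G.B-bound (drop a x) (drop a y) (All-drop a p) (All-drop a q)))
          (ℕ.≤-reflexive (sym (ℕ.*-distribʳ-+ (b₁ ℕ.* b₂) F.bound G.bound))))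
    ; nonneg = λ x → +-mono-≤ (F.nonneg (take a x)) (G.nonneg (drop a x))
    ; coercive = λ x e → let ((k , e₁ , k≤) , (l , e₂ , l≤)) = summand≤ _ _ (F.nonneg (take a x)) (G.nonneg (drop a x)) e in
        All-join a x (Bounded-mono k≤ (F.coercive (take a x) e₁)) (Bounded-mono l≤ (G.coercive (drop a x) e₂))
    }
    where
    module F = Form F
    module G = Form G
    interchange : ∀ p q r s → p + q + (r + s) ≡ p + r + (q + s)
    interchange = solve-∀

  ∑-box-++ : ∀ n a b (f : Vec ℤ (a ℕ.+ b) → ℤ) → ∑ (box n (a ℕ.+ b)) f ≡ ∑[ x ∈ box n a ] ∑[ y ∈ box n b ] f (x ++ y)
  ∑-box-++ n zero    b f = sym (+-identityʳ _)
  ∑-box-++ n (suc a) b f = trans (∑-vecs (interval n) (a ℕ.+ b) f) (trans (∑-cong (interval n) (λ z → ∑-box-++ n a b (λ v → f (z ∷ v))))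
    (sym (∑-vecs (interval n) a (λ x → ∑[ y ∈ box n b ] f (x ++ y)))))

  -- the squares i² and the numbers -1 - j² with i, j ≤ p/2 give more than p residues
  sum-of-two-squares : ∀ {p} → Prime p → ∃ λ a → ∃ λ b → + p ∣ a * a + b * b + 1ℤ
  sum-of-two-squares {p} pp = collide (Fin.pigeonhole p<2k+2 f)
    where
    open PrimeIdeal (prime-ideal pp)
    instance
      p≢0 : ℕ.NonZero p
      p≢0 = prime⇒nonZero pp
    k = p ℕ./ 2
    n = suc k
    sq anti : Fin n → ℤ
    sq i = + toℕ i * + toℕ i
    anti i = -1ℤ - + toℕ i * + toℕ i
    value : Fin n ⊎ Fin n → ℤ
    value (inj₁ i) = sq i
    value (inj₂ i) = anti i
    f : Fin (n ℕ.+ n) → Fin p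
    f x = fromℕ< (n%ℕd<d (value (splitAt n x)) p)
    p<2k+2 : p ℕ.< n ℕ.+ n
    p<2k+2 = subst₂ ℕ._<_ (sym (ℕ.m≡m%n+[m/n]*n p 2)) (lem k) (ℕ.+-monoˡ-< (k ℕ.* 2) (ℕ.m%n<n p 2))
      where
      open import Data.Nat.Tactic.RingSolver using () renaming (solve-∀ to ℕ-solve)
      lem : ∀ k → 2 ℕ.+ k ℕ.* 2 ≡ suc k ℕ.+ suc k
      lem = ℕ-solve
    2k≤p : k ℕ.+ k ℕ.≤ p
    2k≤p = ℕ.≤-trans (ℕ.≤-reflexive (trans (cong (k ℕ.+_) (sym (ℕ.+-identityʳ k))) (ℕ.*-comm 2 k))) (ℕ.m/n*n≤m p 2)
    small-sum : ∀ a b → a ℕ.≤ k → b ℕ.≤ k → a ℕ.< b → + p ∣ + a * + a - + b * + b → ⊥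
    small-sum a b a≤k b≤k a<b d = Data.Sum.[ difference , total ]′ (prime (+ a - + b) (+ a + + b) (subst (+ p ∣_) (lem (+ a) (+ b)) d))
      where
      import Data.Sum
      lem : ∀ a b → a * a - b * b ≡ (a - b) * (a + b)
      lem = solve-∀
      a+b<p : a ℕ.+ b ℕ.< p
      a+b<p = ℕ.<-≤-trans (ℕ.+-mono-<-≤ (ℕ.<-≤-trans a<b b≤k) b≤k) 2k≤p
      difference : + p ∣ + a - + b → ⊥
      difference d = ℕ.<⇒≢ a<b (small-∣⇒≡ (ℕ.≤-<-trans (ℕ.m≤m+n a b) a+b<p) (ℕ.≤-<-trans (ℕ.m≤n+m b a) a+b<p) d)
      total : + p ∣ + a + + b → ⊥
      total d = contradiction (ℕ.∣⇒≤ {{ℕ.>-nonZero (ℕ.≤-trans (ℕ.≤-trans (s≤s z≤n) a<b) (ℕ.m≤n+m b a))}} (∣⇒∣ᵤ d)) (ℕ.<⇒≱ a+b<p)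
    toℕ≤k : (i : Fin n) → toℕ i ℕ.≤ k
    toℕ≤k i = ℕ.≤-pred (Fin.toℕ<n i)
    distinct : (i j : Fin n) → i ≢ j → ¬ + p ∣ sq i - sq j
    distinct i j i≢j d with ℕ.<-cmp (toℕ i) (toℕ j)
    ... | tri< lt _ _ = small-sum (toℕ i) (toℕ j) (toℕ≤k i) (toℕ≤k j) lt d
    ... | tri≈ _ e _  = i≢j (Fin.toℕ-injective e)
    ... | tri> _ _ gt = small-sum (toℕ j) (toℕ i) (toℕ≤k j) (toℕ≤k i) gt (subst (+ p ∣_) (lem (sq i) (sq j)) (∣m⇒∣-m d))
      where
      lem : ∀ a b → - (a - b) ≡ b - a
      lem = solve-∀
    collide : (∃ λ x → ∃ λ y → (x Data.Fin.< y) × f x ≡ f y) → ∃ λ a → ∃ λ b → + p ∣ a * a + b * b + 1ℤ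
    collide (x , y , x<y , e) = by-cases (splitAt n x) (splitAt n y) refl refl
      (%≡⇒∣ p {value (splitAt n x)} {value (splitAt n y)} (Fin.fromℕ<-injective _ _ (n%ℕd<d (value (splitAt n x)) p) (n%ℕd<d (value (splitAt n y)) p) e))
      where
      x≢y : x ≢ y
      x≢y refl = ℕ.<-irrefl refl x<y
      lem₁ : ∀ a b → a - (-1ℤ - b) ≡ a + b + 1ℤ
      lem₁ = solve-∀
      lem₂ : ∀ a b → - (-1ℤ - a - b) ≡ a + b + 1ℤ
      lem₂ = solve-∀
      lem₃ : ∀ a b → - (-1ℤ - a - (-1ℤ - b)) ≡ a - b
      lem₃ = solve-∀
      by-cases : ∀ s s′ → splitAt n x ≡ s → splitAt n y ≡ s′ → + p ∣ value (splitAt n x) - value (splitAt n y) → ∃ λ a → ∃ λ b → + p ∣ a * a + b * b + 1ℤ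
      by-cases (inj₁ i) (inj₁ j) ex ey d = contradiction (subst₂ (λ u v → + p ∣ value u - value v) ex ey d) (distinct i j λ { refl → x≢y (trans (sym (Fin.splitAt⁻¹-↑ˡ ex)) (Fin.splitAt⁻¹-↑ˡ ey)) })
      by-cases (inj₁ i) (inj₂ j) ex ey d = + toℕ i , + toℕ j , subst (+ p ∣_) (lem₁ (sq i) (sq j)) (subst₂ (λ u v → + p ∣ value u - value v) ex ey d)
      by-cases (inj₂ i) (inj₁ j) ex ey d = + toℕ i , + toℕ j , subst (+ p ∣_) (lem₂ (sq i) (sq j)) (∣m⇒∣-m (subst₂ (λ u v → + p ∣ value u - value v) ex ey d))
      by-cases (inj₂ i) (inj₂ j) ex ey d = contradiction (subst (+ p ∣_) (lem₃ (sq i) (sq j)) (∣m⇒∣-m (subst₂ (λ u v → + p ∣ value u - value v) ex ey d)))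
        (distinct i j λ { refl → x≢y (trans (sym (Fin.splitAt⁻¹-↑ʳ ex)) (Fin.splitAt⁻¹-↑ʳ ey)) })

  -- Four copies of a form split modulo p: with a² + b² = -1 the form Q(x₁) + Q(x₂) + Q(x₃) + Q(x₄) equals
  -- Q(x₁) - Q(a x₃ + b x₄) + Q(x₂) - Q(b x₃ - a x₄).
  module FourCopies {r : ℕ} (F : Form r) where
    private module F = Form F

    four : Form ((r ℕ.+ r) ℕ.+ (r ℕ.+ r))
    four = (F ⊞ᶠ F) ⊞ᶠ (F ⊞ᶠ F)

    private
      X = Vec ℤ ((r ℕ.+ r) ℕ.+ (r ℕ.+ r))

    p₁ p₂ p₃ p₄ : X → Vec ℤ r
    p₁ x = take r (take (r ℕ.+ r) x)
    p₂ x = drop r (take (r ℕ.+ r) x)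
    p₃ x = take r (drop (r ℕ.+ r) x)
    p₄ x = drop r (drop (r ℕ.+ r) x)

    private
      Linear : ∀ {a b} → (Vec ℤ a → Vec ℤ b) → Set
      Linear f = (∀ x y → f (x ⊕ y) ≡ f x ⊕ f y) × (∀ k x → f (k · x) ≡ k · f x)

      linear-∘ : ∀ {a b c} {f : Vec ℤ b → Vec ℤ c} {g : Vec ℤ a → Vec ℤ b} → Linear f → Linear g → Linear (f ∘ g)
      linear-∘ {f = f} {g} (f⊕ , f·) (g⊕ , g·) = (λ x y → trans (cong f (g⊕ x y)) (f⊕ (g x) (g y))) , (λ k x → trans (cong f (g· k x)) (f· k (g x)))

      linear-⊕ : ∀ {a b} {f g : Vec ℤ a → Vec ℤ b} → Linear f → Linear g → Linear (λ x → f x ⊕ g x)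
      linear-⊕ {f = f} {g} (f⊕ , f·) (g⊕ , g·) = (λ x y → trans (cong₂ _⊕_ (f⊕ x y) (g⊕ x y)) (⊕-interchange (f x) (f y) (g x) (g y))) ,
        (λ k x → trans (cong₂ _⊕_ (f· k x) (g· k x)) (sym (·-distribˡ k (f x) (g x))))

      linear-· : ∀ {a b} c {f : Vec ℤ a → Vec ℤ b} → Linear f → Linear (λ x → c · f x)
      linear-· c {f} (f⊕ , f·) = (λ x y → trans (cong (c ·_) (f⊕ x y)) (·-distribˡ c (f x) (f y))) ,
        (λ k x → trans (cong (c ·_) (f· k x)) (trans (sym (·-assoc c k (f x))) (trans (cong (_· f x) (*-comm c k)) (·-assoc k c (f x)))))

      linear-take : ∀ a {b} → Linear (take a {b})
      linear-take a = take-zipWith _+_ , (λ k x → take-map (k *_) a x)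

      linear-drop : ∀ a {b} → Linear (drop a {b})
      linear-drop a = drop-zipWith _+_ , (λ k x → drop-map (k *_) a x)

      linear-++ : ∀ {a b c} {f : Vec ℤ a → Vec ℤ b} {g : Vec ℤ a → Vec ℤ c} → Linear f → Linear g → Linear (λ x → f x ++ g x)
      linear-++ {f = f} {g} (f⊕ , f·) (g⊕ , g·) = (λ x y → trans (cong₂ _++_ (f⊕ x y) (g⊕ x y)) (++-⊕ (f x) (f y) (g x) (g y))) , (λ k x → trans (cong₂ _++_ (f· k x) (g· k x)) (++-· k (f x) (g x)))
        where
        ++-⊕ : ∀ {b c} (u v : Vec ℤ b) (w z : Vec ℤ c) → (u ⊕ v) ++ (w ⊕ z) ≡ (u ++ w) ⊕ (v ++ z)
        ++-⊕ []      []      w z = refl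
        ++-⊕ (a ∷ u) (b ∷ v) w z = cong (a + b ∷_) (++-⊕ u v w z)
        ++-· : ∀ {b c} k (u : Vec ℤ b) (w : Vec ℤ c) → (k · u) ++ (k · w) ≡ k · (u ++ w)
        ++-· k []      w = refl
        ++-· k (a ∷ u) w = cong (k * a ∷_) (++-· k u w)

    module _ (G : Vec ℤ r → Vec ℤ r) (G-⊕ : ∀ x y → G (x ⊕ y) ≡ G x ⊕ G y) (G-· : ∀ k x → G (k · x) ≡ k · G x)
             (G-B : ∀ x y → ⟨ x , G y ⟩ ≡ F.B x y) where

      module Split {p : ℕ} (pp : Prime p) (2<p : 2 ℕ.< p) (G-faithful : ∀ y → p ∣ᵥ G y → p ∣ᵥ y) (a b : ℤ) (ab : + p ∣ a * a + b * b + 1ℤ) where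
        open PrimeIdeal (prime-ideal pp)
        z w : X → Vec ℤ r
        z x = a · p₃ x ⊕ b · p₄ x
        w x = b · p₃ x ⊕ (- a) · p₄ x
        -- A difference of squares: ⟨s - t, G(s + t)⟩ = Q(s) - Q(t), because the Gram map `G` turns
        -- the dot product into the form.
        u v : X → Vec ℤ (r ℕ.+ r)
        u x = (p₁ x ⊕ -1ℤ · z x) ++ (p₂ x ⊕ -1ℤ · w x)
        v x = G (p₁ x ⊕ z x) ++ G (p₂ x ⊕ w x)
        l₁ : Linear p₁
        l₁ = linear-∘ {f = take r} {take (r ℕ.+ r)} (linear-take r) (linear-take (r ℕ.+ r))
        l₂ : Linear p₂
        l₂ = linear-∘ {f = drop r} {take (r ℕ.+ r)} (linear-drop r) (linear-take (r ℕ.+ r))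
        l₃ : Linear p₃
        l₃ = linear-∘ {f = take r} {drop (r ℕ.+ r)} (linear-take r) (linear-drop (r ℕ.+ r))
        l₄ : Linear p₄
        l₄ = linear-∘ {f = drop r} {drop (r ℕ.+ r)} (linear-drop r) (linear-drop (r ℕ.+ r))
        lz : Linear z
        lz = linear-⊕ {f = λ x → a · p₃ x} {λ x → b · p₄ x} (linear-· a {p₃} l₃) (linear-· b {p₄} l₄)
        lw : Linear w
        lw = linear-⊕ {f = λ x → b · p₃ x} {λ x → (- a) · p₄ x} (linear-· b {p₃} l₃) (linear-· (- a) {p₄} l₄)
        u-linear : Linear u
        u-linear = linear-++ {f = λ x → p₁ x ⊕ -1ℤ · z x} {λ x → p₂ x ⊕ -1ℤ · w x} (linear-⊕ {f = p₁} {λ x → -1ℤ · z x} l₁ (linear-· -1ℤ {z} lz)) (linear-⊕ {f = p₂} {λ x → -1ℤ · w x} l₂ (linear-· -1ℤ {w} lw))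
        v-linear : Linear v
        v-linear = linear-++ {f = λ x → G (p₁ x ⊕ z x)} {λ x → G (p₂ x ⊕ w x)} (linear-∘ {f = G} {λ x → p₁ x ⊕ z x} (G-⊕ , G-·) (linear-⊕ {f = p₁} {z} l₁ lz)) (linear-∘ {f = G} {λ x → p₂ x ⊕ w x} (G-⊕ , G-·) (linear-⊕ {f = p₂} {w} l₂ lw))
        ⟨⟩-++ : ∀ {m n} (s s′ : Vec ℤ m) (t t′ : Vec ℤ n) → ⟨ s ++ t , s′ ++ t′ ⟩ ≡ ⟨ s , s′ ⟩ + ⟨ t , t′ ⟩
        ⟨⟩-++ []      []       t t′ = sym (+-identityˡ ⟨ t , t′ ⟩)
        ⟨⟩-++ (c ∷ s) (d ∷ s′) t t′ = trans (cong (λ k → c * d + k) (⟨⟩-++ s s′ t t′)) (sym (+-assoc (c * d) ⟨ s , s′ ⟩ ⟨ t , t′ ⟩))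
        difference : ∀ s t → ⟨ s ⊕ -1ℤ · t , G (s ⊕ t) ⟩ ≡ F.B s s - F.B t t
        difference s t = trans (G-B (s ⊕ -1ℤ · t) (s ⊕ t)) (trans (F.B-⊕ s (-1ℤ · t) (s ⊕ t)) (trans (cong₂ _+_ (F.B-⊕ʳ s s t) (trans (F.B-· -1ℤ t (s ⊕ t)) (cong (-1ℤ *_) (trans (F.B-⊕ʳ t s t) (cong (_+ F.B t t) (F.B-comm t s))))))
          (lem (F.B s s) (F.B s t) (F.B t t))))
          where
          lem : ∀ A C D → A + C + -1ℤ * (C + D) ≡ A - D
          lem = solve-∀
        square : ∀ c d s t → F.B (c · s ⊕ d · t) (c · s ⊕ d · t) ≡ c * c * F.B s s + + 2 * (c * d * F.B s t) + d * d * F.B t t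
        square c d s t = trans (F.B-⊕ (c · s) (d · t) y) (trans (cong₂ _+_ (trans (F.B-· c s y) (cong (c *_) (trans (F.B-⊕ʳ s (c · s) (d · t)) (cong₂ _+_ (F.B-·ʳ c s s) (F.B-·ʳ d s t)))))
            (trans (F.B-· d t y) (cong (d *_) (trans (F.B-⊕ʳ t (c · s) (d · t)) (cong₂ _+_ (trans (F.B-·ʳ c t s) (cong (c *_) (F.B-comm t s))) (F.B-·ʳ d t t))))))
          (lem c d (F.B s s) (F.B s t) (F.B t t)))
          where
          y = c · s ⊕ d · t
          lem : ∀ c d A C D → c * (c * A + d * C) + d * (c * C + d * D) ≡ c * c * A + + 2 * (c * d * C) + d * d * D
          lem = solve-∀
        -- In Q(z) + Q(w) the mixed terms cancel, which leaves (a² + b²)(Q(x₃) + Q(x₄)), and a² + b²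
        -- ≡ -1.
        split : ∀ x → + p ∣ Form.B four x x - ⟨ u x , v x ⟩
        split x = subst (+ p ∣_) (sym (trans (cong (λ k → F.B (p₁ x) (p₁ x) + F.B (p₂ x) (p₂ x) + (F.B (p₃ x) (p₃ x) + F.B (p₄ x) (p₄ x)) - k)
            (trans (⟨⟩-++ (p₁ x ⊕ -1ℤ · z x) (G (p₁ x ⊕ z x)) (p₂ x ⊕ -1ℤ · w x) (G (p₂ x ⊕ w x)))
              (cong₂ _+_ (trans (difference (p₁ x) (z x)) (cong (λ k → F.B (p₁ x) (p₁ x) - k) (square a b (p₃ x) (p₄ x))))
                         (trans (difference (p₂ x) (w x)) (cong (λ k → F.B (p₂ x) (p₂ x) - k) (square b (- a) (p₃ x) (p₄ x)))))))
            (lem a b (F.B (p₁ x) (p₁ x)) (F.B (p₂ x) (p₂ x)) (F.B (p₃ x) (p₃ x)) (F.B (p₄ x) (p₄ x)) (F.B (p₃ x) (p₄ x)))))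
          (∣m⇒∣m*n (F.B (p₃ x) (p₃ x) + F.B (p₄ x) (p₄ x)) ab)
          where
          lem : ∀ a b q₁ q₂ q₃ q₄ c → q₁ + q₂ + (q₃ + q₄) - (q₁ - (a * a * q₃ + + 2 * (a * b * c) + b * b * q₄) + (q₂ - (b * b * q₃ + + 2 * (b * - a * c) + - a * - a * q₄))) ≡ (a * a + b * b + 1ℤ) * (q₃ + q₄)
          lem = solve-∀
        ∣ᵥ-++⁻ : ∀ {m n} (s : Vec ℤ m) {t : Vec ℤ n} → p ∣ᵥ s ++ t → (p ∣ᵥ s) × (p ∣ᵥ t)
        ∣ᵥ-++⁻ []      d        = [] , d
        ∣ᵥ-++⁻ (c ∷ s) (d ∷ ds) = d ∷ proj₁ (∣ᵥ-++⁻ s ds) , proj₂ (∣ᵥ-++⁻ s ds)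
        not-two : ¬ + p ∣ + 2
        not-two d = contradiction (ℕ.∣⇒≤ (∣⇒∣ᵤ d)) (ℕ.<⇒≱ 2<p)
        halves : ∀ {m} (s t : Vec ℤ m) → p ∣ᵥ s ⊕ -1ℤ · t → p ∣ᵥ s ⊕ t → (p ∣ᵥ s) × (p ∣ᵥ t)
        halves []      []      _        _        = [] , []
        halves (c ∷ s) (d ∷ t) (e ∷ es) (f ∷ fs) = half c (subst (+ p ∣_) (lem₁ c d) (∣m∣n⇒∣m+n e f)) ∷ proj₁ (halves s t es fs) ,
                                                  half d (subst (+ p ∣_) (lem₂ c d) (∣m∣n⇒∣m-n f e)) ∷ proj₂ (halves s t es fs)
          where
          import Data.Sum
          half : ∀ c → + p ∣ + 2 * c → + p ∣ c
          half c d = Data.Sum.fromInj₂ (λ e → contradiction e not-two) (prime (+ 2) c d)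
          lem₁ : ∀ c d → c + -1ℤ * d + (c + d) ≡ + 2 * c
          lem₁ = solve-∀
          lem₂ : ∀ c d → c + d - (c + -1ℤ * d) ≡ + 2 * d
          lem₂ = solve-∀
        recover : ∀ {m} (s t : Vec ℤ m) → p ∣ᵥ a · s ⊕ b · t → p ∣ᵥ b · s ⊕ (- a) · t → (p ∣ᵥ s) × (p ∣ᵥ t)
        recover []      []      _        _        = [] , []
        recover (c ∷ s) (d ∷ t) (e ∷ es) (f ∷ fs) = ∣-lin₃ (- a) (- b) c e f ab (lem₁ a b c d) ∷ proj₁ (recover s t es fs) ,
                                                   ∣-lin₃ (- b) a d e f ab (lem₂ a b c d) ∷ proj₂ (recover s t es fs)
          where
          lem₁ : ∀ a b c d → c ≡ - a * (a * c + b * d) + - b * (b * c + - a * d) + c * (a * a + b * b + 1ℤ)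
          lem₁ = solve-∀
          lem₂ : ∀ a b c d → d ≡ - b * (a * c + b * d) + a * (b * c + - a * d) + d * (a * a + b * b + 1ℤ)
          lem₂ = solve-∀
        -- The Gram map is injective modulo p, so s - t and s + t vanish modulo p, and then s and t
        -- do since p is odd. From z and w one recovers x₃ and x₄, the determinant -(a² + b²) being
        -- 1 modulo p.
        faithful : ∀ x → p ∣ᵥ u x → p ∣ᵥ v x → p ∣ᵥ x
        faithful x du dv = All-join (r ℕ.+ r) x (All-join r (take (r ℕ.+ r) x) (proj₁ h₁) (proj₁ h₂)) (All-join r (drop (r ℕ.+ r) x) (proj₁ h₃) (proj₂ h₃))
          where
          du′ = ∣ᵥ-++⁻ (p₁ x ⊕ -1ℤ · z x) du
          dv′ = ∣ᵥ-++⁻ (G (p₁ x ⊕ z x)) dv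
          h₁ : (p ∣ᵥ p₁ x) × (p ∣ᵥ z x)
          h₁ = halves (p₁ x) (z x) (proj₁ du′) (G-faithful (p₁ x ⊕ z x) (proj₁ dv′))
          h₂ : (p ∣ᵥ p₂ x) × (p ∣ᵥ w x)
          h₂ = halves (p₂ x) (w x) (proj₂ du′) (G-faithful (p₂ x ⊕ w x) (proj₂ dv′))
          h₃ : (p ∣ᵥ p₃ x) × (p ∣ᵥ p₄ x)
          h₃ = recover (p₃ x) (p₄ x) (proj₂ h₁) (proj₂ h₂)

      hyperbolic : ∀ {p} → Prime p → 2 ℕ.< p → (∀ y → p ∣ᵥ G y → p ∣ᵥ y) → Hyperbolic four p (r ℕ.+ r)
      hyperbolic {p} pp 2<p G-faithful = from (sum-of-two-squares pp)
        where
        from : (∃ λ a → ∃ λ b → + p ∣ a * a + b * b + 1ℤ) → Hyperbolic four p (r ℕ.+ r)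
        from (a , b , ab) = record
          { u = u ; v = v ; u-⊕ = proj₁ u-linear ; u-· = proj₂ u-linear ; v-⊕ = proj₁ v-linear ; v-· = proj₂ v-linear ; split = split ; faithful = faithful }
          where open Split pp 2<p G-faithful a b ab

-- The multiplier: congruent to d or -d, and without small prime factors.

module Arith where

  open import Defs using (dTerm)
  open import Data.Nat as ℕ using (ℕ; zero; suc; z≤n)
  import Data.Nat.Properties as ℕ
  import Data.Nat.DivMod as ℕ
  open import Data.Nat.Divisibility as ℕ using () renaming (_∣_ to _∣ₙ_)
  open import Data.Nat.Coprimality using (Coprime; coprime?)
  open import Data.Nat.Primality using (Prime; prime⇒nonZero; euclidsLemma; ¬prime[1])
  open import Data.Nat.Primality.Factorisation using (PrimeFactorisation; factorise)
  open import Data.Nat.ListAction using (product)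
  open import Data.Integer hiding (suc; _⊖_)
  open import Data.Integer.Properties
  open import Data.Integer.DivMod using (div-pos-is-/ℕ)
  open import Data.Integer.Divisibility.Signed
  open import Data.Integer.Tactic.RingSolver using (solve-∀)
  open import Data.List using (List; []; _∷_)
  open import Data.List.Relation.Unary.All using (All; []; _∷_)
  open import Data.Product using (_×_; _,_)
  open import Data.Sum using (_⊎_; inj₁; inj₂)
  open import Data.Empty using (⊥; ⊥-elim)
  open import Relation.Nullary
  open import Relation.Nullary.Decidable using (toWitness; _⊎-dec_)
  open import Relation.Binary.PropositionalEquality
  open import Function using (_∘_)
  open ModPrime using (∤⇒coprime)
  open Parseval using (/ℕ-exact)

  coprime⇒∤ : ∀ {n m q} → Coprime n m → q ∣ₙ m → q ≢ 1 → ¬ q ∣ₙ n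
  coprime⇒∤ c q∣m q≢1 q∣n = q≢1 (c (q∣n , q∣m))

  residue-∣ : ∀ {q n} m .{{_ : ℕ.NonZero m}} → q ∣ₙ m → q ∣ₙ n ℕ.% m → q ∣ₙ n
  residue-∣ {q} {n} m q∣m q∣r = subst (q ∣ₙ_) (sym (ℕ.m≡m%n+[m/n]*n n m)) (ℕ.∣m∣n⇒∣m+n q∣r (ℕ.∣n⇒∣m*n (n ℕ./ m) q∣m))

  -- Units modulo 24 have square 1, checked on all residues; 23 takes the place of -1 to avoid
  -- subtraction.
  residues-24 : ∀ {ρ} → ρ ℕ.< 24 → 2 ∣ₙ ρ ⊎ 3 ∣ₙ ρ ⊎ 24 ∣ₙ ρ ℕ.* ρ ℕ.+ 23
  residues-24 = toWitness {a? = ℕ.allUpTo? (λ ρ → (2 ℕ.∣? ρ) ⊎-dec (3 ℕ.∣? ρ) ⊎-dec (24 ℕ.∣? ρ ℕ.* ρ ℕ.+ 23)) 24} _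

  residues-6 : ∀ {ρ} → ρ ℕ.< 6 → 2 ∣ₙ ρ ⊎ 3 ∣ₙ ρ ⊎ ρ ≡ 1 ⊎ ρ ≡ 5
  residues-6 = toWitness {a? = ℕ.allUpTo? (λ ρ → (2 ℕ.∣? ρ) ⊎-dec (3 ℕ.∣? ρ) ⊎-dec (ρ ℕ.≟ 1) ⊎-dec (ρ ℕ.≟ 5)) 6} _

  square-abs : ∀ d → d * d ≡ + ∣ d ∣ * + ∣ d ∣
  square-abs (+ n)    = refl
  square-abs -[1+ n ] = refl

  dTerm-exact : ∀ d → ¬ 2 ∣ₙ ∣ d ∣ → ¬ 3 ∣ₙ ∣ d ∣ → d * d - 1ℤ ≡ + 24 * dTerm d
  dTerm-exact d 2∤ 3∤ = by-cases (residues-24 {n ℕ.% 24} (ℕ.m%n<n n 24))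
    where
    n = ∣ d ∣
    lem : ∀ ρ q k → ρ * ρ + + 23 ≡ k * + 24 → (ρ + q * + 24) * (ρ + q * + 24) - 1ℤ ≡ + 24 * (k - 1ℤ + + 2 * ρ * q + + 24 * (q * q))
    lem ρ q k e = trans (lem₁ ρ q) (trans (cong (λ z → z - + 24 + + 48 * ρ * q + + 576 * (q * q)) e) (lem₂ ρ q k))
      where
      lem₁ : ∀ ρ q → (ρ + q * + 24) * (ρ + q * + 24) - 1ℤ ≡ ρ * ρ + + 23 - + 24 + + 48 * ρ * q + + 576 * (q * q)
      lem₁ = solve-∀
      lem₂ : ∀ ρ q k → k * + 24 - + 24 + + 48 * ρ * q + + 576 * (q * q) ≡ + 24 * (k - 1ℤ + + 2 * ρ * q + + 24 * (q * q))
      lem₂ = solve-∀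
    exact : ∀ k → d * d - 1ℤ ≡ + 24 * k → d * d - 1ℤ ≡ + 24 * dTerm d
    exact k e = trans e (cong (+ 24 *_) (sym (trans (div-pos-is-/ℕ (d * d - 1ℤ) 24) (trans (cong (_/ℕ 24) e) (/ℕ-exact 24 k)))))
    by-cases : 2 ∣ₙ n ℕ.% 24 ⊎ 3 ∣ₙ n ℕ.% 24 ⊎ 24 ∣ₙ (n ℕ.% 24) ℕ.* (n ℕ.% 24) ℕ.+ 23 → d * d - 1ℤ ≡ + 24 * dTerm d
    by-cases (inj₁ e)        = contradiction (residue-∣ 24 (ℕ.divides 12 refl) e) 2∤
    by-cases (inj₂ (inj₁ e)) = contradiction (residue-∣ 24 (ℕ.divides 8 refl) e) 3∤
    by-cases (inj₂ (inj₂ (ℕ.divides k e))) = exact (+ k - 1ℤ + + 2 * + (n ℕ.% 24) * + (n ℕ./ 24) + + 24 * (+ (n ℕ./ 24) * + (n ℕ./ 24)))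
      (trans (cong (_- 1ℤ) (trans (square-abs d) (cong₂ _*_ n≡ n≡))) (lem (+ (n ℕ.% 24)) (+ (n ℕ./ 24)) (+ k)
        (trans (cong (_+ + 23) (sym (pos-* (n ℕ.% 24) (n ℕ.% 24)))) (trans (sym (pos-+ ((n ℕ.% 24) ℕ.* (n ℕ.% 24)) 23)) (trans (cong +_ e) (pos-* k 24))))))
      where
      n≡ : + n ≡ + (n ℕ.% 24) + + (n ℕ./ 24) * + 24
      n≡ = trans (cong +_ (ℕ.m≡m%n+[m/n]*n n 24)) (trans (pos-+ (n ℕ.% 24) _) (cong (λ z → + (n ℕ.% 24) + z) (pos-* (n ℕ./ 24) 24)))

  -- Only d² matters, so the sign of d is free. It is used to achieve e ≡ 1 modulo 6, which
  -- preserves the class of -r modulo 6r that contains the coordinate sums r(6j - 1).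
  record Representative (N : ℕ) (d : ℤ) : Set where
    field
      e       : ℕ
      coprime : Coprime e N
      square  : + N ∣ + e * + e - d * d
      one     : + 6 ∣ + e - 1ℤ

  -- A unit modulo 6 is 1 or 5. In the second case (N - 1)|d| is a natural number congruent to -|d|
  -- modulo N.
  representative : ∀ N d → 1 ℕ.≤ N → 6 ∣ₙ N → Coprime ∣ d ∣ N → Representative N d
  representative N d 1≤N 6∣N c = by-cases (residues-6 {n ℕ.% 6} (ℕ.m%n<n n 6))
    where
    n = ∣ d ∣
    n≡ : ∀ ρ → n ℕ.% 6 ≡ ρ → + n ≡ + ρ + + (n ℕ./ 6) * + 6
    n≡ ρ e = trans (cong +_ (trans (ℕ.m≡m%n+[m/n]*n n 6) (cong (ℕ._+ n ℕ./ 6 ℕ.* 6) e))) (trans (pos-+ ρ _) (cong (λ z → + ρ + z) (pos-* (n ℕ./ 6) 6)))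
    by-cases : 2 ∣ₙ n ℕ.% 6 ⊎ 3 ∣ₙ n ℕ.% 6 ⊎ n ℕ.% 6 ≡ 1 ⊎ n ℕ.% 6 ≡ 5 → Representative N d
    by-cases (inj₁ e)        = contradiction (residue-∣ 6 (ℕ.divides 3 refl) e) (coprime⇒∤ c (ℕ.∣-trans (ℕ.divides 3 refl) 6∣N) λ ())
    by-cases (inj₂ (inj₁ e)) = contradiction (residue-∣ 6 (ℕ.divides 2 refl) e) (coprime⇒∤ c (ℕ.∣-trans (ℕ.divides 2 refl) 6∣N) λ ())
    by-cases (inj₂ (inj₂ (inj₁ e))) = record
      { e = n ; coprime = c ; square = divides 0ℤ (i≡j⇒i-j≡0 (sym (square-abs d)))
      ; one = divides (+ (n ℕ./ 6)) (trans (cong (_- 1ℤ) (n≡ 1 e)) (lem (+ (n ℕ./ 6) * + 6))) }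
      where
      lem : ∀ a → + 1 + a - 1ℤ ≡ a
      lem = solve-∀
    by-cases (inj₂ (inj₂ (inj₂ e))) = record
      { e = N₁ ℕ.* n ; coprime = λ {i} → coprime′ {i}
      ; square = divides ((+ N - + 2) * (+ n * + n)) (trans (cong₂ _-_ (cong₂ _*_ e≡ e≡) (square-abs d)) (lem₁ (+ N) (+ n)))
      ; one = divides (k * + n - + (n ℕ./ 6) - 1ℤ) (trans (cong (_- 1ℤ) e≡) (trans (cong (λ z → (z - 1ℤ) * + n - 1ℤ) N≡) (trans (lem₂ k (+ n)) (trans (cong (λ z → k * + n * + 6 - z - 1ℤ) (n≡ 5 e)) (lem₃ (k * + n) (+ (n ℕ./ 6))))))) }
      where
      N₁ = N ℕ.∸ 1
      k = + ℕ.quotient 6∣N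
      N≡ : + N ≡ k * + 6
      N≡ = trans (cong +_ (ℕ._∣_.equality 6∣N)) (pos-* (ℕ.quotient 6∣N) 6)
      Nn : N ℕ.* n ≡ N₁ ℕ.* n ℕ.+ n
      Nn = trans (cong (ℕ._* n) (trans (sym (ℕ.m+[n∸m]≡n 1≤N)) refl)) (ℕ.+-comm n (N₁ ℕ.* n))
      coprime′ : ∀ {i} → i ∣ₙ N₁ ℕ.* n × i ∣ₙ N → i ≡ 1
      coprime′ {i} (i∣e , i∣N) = c (ℕ.∣m+n∣m⇒∣n {m = N₁ ℕ.* n} (subst (i ∣ₙ_) Nn (ℕ.∣m⇒∣m*n n i∣N)) i∣e , i∣N)
      e≡ : + (N₁ ℕ.* n) ≡ (+ N - 1ℤ) * + n
      e≡ = trans (pos-* N₁ n) (cong (_* + n) (trans (lem (+ N₁)) (cong (_- 1ℤ) (trans (sym (pos-+ 1 N₁)) (cong +_ (ℕ.m+[n∸m]≡n 1≤N))))))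
        where
        lem : ∀ a → a ≡ + 1 + a - 1ℤ
        lem = solve-∀
      lem₁ : ∀ N n → (N - 1ℤ) * n * ((N - 1ℤ) * n) - n * n ≡ (N - + 2) * (n * n) * N
      lem₁ = solve-∀
      lem₂ : ∀ k n → (k * + 6 - 1ℤ) * n - 1ℤ ≡ k * n * + 6 - n - 1ℤ
      lem₂ = solve-∀
      lem₃ : ∀ a q → a * + 6 - (+ 5 + q * + 6) - 1ℤ ≡ (a - q - 1ℤ) * + 6
      lem₃ = solve-∀

  -- Built to contain every prime up to n that does not divide e, and no prime that does.
  coprimes-product : ℕ → ℕ → ℕ
  coprimes-product e zero    = 1
  coprimes-product e (suc n) with coprime? (suc n) e
  ... | yes _ = suc n ℕ.* coprimes-product e n
  ... | no _  = coprimes-product e n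

  ∣-coprimes-product : ∀ e n {p} → Prime p → p ℕ.≤ n → ¬ p ∣ₙ e → p ∣ₙ coprimes-product e n
  ∣-coprimes-product e zero    {suc p} pp () p∤e
  ∣-coprimes-product e zero    {zero}  pp z≤n p∤e = contradiction refl (ℕ.≢-nonZero⁻¹ 0 {{prime⇒nonZero pp}})
  ∣-coprimes-product e (suc n) {p} pp p≤n p∤e with p ℕ.≟ suc n | coprime? (suc n) e
  ... | yes refl | yes _ = ℕ.m∣m*n (coprimes-product e n)
  ... | yes refl | no ¬c = ⊥-elim (¬c (λ {d} → ∤⇒coprime pp p∤e {d}))
  ... | no ne | yes _ = ℕ.∣n⇒∣m*n (suc n) (∣-coprimes-product e n pp (ℕ.≤-pred (ℕ.≤∧≢⇒< p≤n ne)) p∤e)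
  ... | no ne | no _  = ∣-coprimes-product e n pp (ℕ.≤-pred (ℕ.≤∧≢⇒< p≤n ne)) p∤e

  ∤-coprimes-product : ∀ e n {p} → Prime p → p ∣ₙ e → ¬ p ∣ₙ coprimes-product e n
  ∤-coprimes-product e zero    pp p∣e d = ¬prime[1] (subst Prime (ℕ.∣1⇒≡1 d) pp)
  ∤-coprimes-product e (suc n) {p} pp p∣e with coprime? (suc n) e
  ... | no _  = ∤-coprimes-product e n pp p∣e
  ... | yes c = λ d → Data.Sum.[ (λ p∣n → ¬prime[1] (subst Prime (c (p∣n , p∣e)) pp)) , ∤-coprimes-product e n pp p∣e ]′ (euclidsLemma (suc n) (coprimes-product e n) pp d)
    where import Data.Sum

  record Rough (e N Y : ℕ) : Set where
    field
      primes  : List ℕ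
      large   : All (λ p → Prime p × Y ℕ.< p) primes
      congruent : + N ∣ + product primes - + e

  -- An elementary substitute for Dirichlet's theorem. Let p ≤ Y divide e + N P. If p divides N, it
  -- divides e, against coprimality; if p divides e, it divides N P but neither factor; otherwise p
  -- divides P, hence e. So all prime factors exceed Y, though they need not be congruent to e
  -- themselves.
  rough : ∀ e N Y → 2 ℕ.≤ N → Coprime e N → Rough e N Y
  rough e N Y 2≤N c = record { primes = factors ; large = largeness (λ q → q) factorsPrime ; congruent = divides (+ P) (trans (cong (_- + e) (trans (cong +_ (sym isFactorisation)) (trans (pos-+ e (N ℕ.* P)) (cong (λ z → + e + z) (pos-* N P))))) (lem (+ e) (+ N) (+ P))) }
    where
    P = coprimes-product e Y
    D = e ℕ.+ N ℕ.* P
    lem : ∀ e N P → e + N * P - e ≡ P * N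
    lem = solve-∀
    e≢0 : e ≢ 0
    e≢0 refl = ℕ.<⇒≢ 2≤N (sym (c (N ℕ.∣0 , ℕ.∣-refl)))
    instance
      D≢0 : ℕ.NonZero D
      D≢0 = ℕ.≢-nonZero (λ e≡ → e≢0 (ℕ.m+n≡0⇒m≡0 e e≡))
    open PrimeFactorisation (factorise D)
    no-small : ∀ {p} → Prime p → p ∣ₙ D → ¬ p ℕ.≤ Y
    no-small {p} pp p∣D p≤Y = by-cases (p ℕ.∣? N) (p ℕ.∣? e)
      where
      by-cases : Dec (p ∣ₙ N) → Dec (p ∣ₙ e) → ⊥
      by-cases (yes p∣N) _         = coprime⇒∤ c p∣N (λ p≡1 → ¬prime[1] (subst Prime p≡1 pp)) (ℕ.∣m+n∣m⇒∣n (subst (p ∣ₙ_) (ℕ.+-comm e (N ℕ.* P)) p∣D) (ℕ.∣m⇒∣m*n P p∣N))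
      by-cases (no p∤N)  (yes p∣e) = Data.Sum.[ p∤N , ∤-coprimes-product e Y pp p∣e ]′ (euclidsLemma N P pp (ℕ.∣m+n∣m⇒∣n p∣D p∣e))
        where import Data.Sum
      by-cases (no _)    (no p∤e)  = p∤e (ℕ.∣m+n∣m⇒∣n (subst (p ∣ₙ_) (ℕ.+-comm e (N ℕ.* P)) p∣D) (ℕ.∣n⇒∣m*n N (∣-coprimes-product e Y pp p≤Y p∤e)))
    largeness : ∀ {ps} → (∀ {p} → p ∣ₙ product ps → p ∣ₙ product factors) → All Prime ps → All (λ p → Prime p × Y ℕ.< p) ps
    largeness h []         = []
    largeness {p ∷ ps} h (pp ∷ pps) = (pp , ℕ.≰⇒> (no-small pp (subst (p ∣ₙ_) (sym isFactorisation) (h (ℕ.m∣m*n (product ps)))))) ∷ largeness (h ∘ ℕ.∣n⇒∣m*n p) pps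

-- Scaling the character by D.

module Twist where

  open import Data.Nat as ℕ using (ℕ; zero; suc; s≤s)
  import Data.Nat.Properties as ℕ
  open import Data.Integer hiding (suc; _⊖_)
  open import Data.Integer.Properties
  open import Data.Integer.DivMod using (_/ℕ_; _%ℕ_; n%ℕd<d; a≡a%ℕn+[a/ℕn]*n)
  open import Data.Integer.Divisibility.Signed
  open import Data.Integer.Tactic.RingSolver using (solve-∀)
  open import Data.Fin using (Fin; zero; suc; toℕ; fromℕ<; opposite)
  import Data.Fin.Properties as Fin
  open import Data.Fin.Permutation using (Permutation′; permutation; _⟨$⟩ʳ_)
  open import Data.Vec using (Vec; []; _∷_; lookup; tabulate)
  open import Data.Vec.Properties using (lookup∘tabulate; tabulate∘lookup; tabulate-cong; lookup-zipWith; lookup-map)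
  open import Data.Vec.Relation.Unary.All using ([]; _∷_)
  open import Data.Product using (_×_; _,_; proj₁; proj₂; ∃)
  open import Data.Sum using (_⊎_; inj₁; inj₂)
  open import Relation.Binary.PropositionalEquality
  open import Algebra.Properties.CommutativeMonoid.Sum +-0-commutativeMonoid using (sum; sum-permute; sum-cong-≗)
  open Sums
  open Vectors
  open ModPrime
  open Frames using (∣ᵥ-lookup⁻)
  open OrthSum using (Bounded-mono)
  open Coset
  open Counting
  open Enumerate using (B₀-coercive)

  sumᵥ-lookup : ∀ {k} (y : Vec ℤ k) → sumᵥ y ≡ sum (lookup y)
  sumᵥ-lookup []      = refl
  sumᵥ-lookup (a ∷ y) = cong (λ z → a + z) (sumᵥ-lookup y)

  ⟨⟩-lookup : ∀ {k} (y : Vec ℤ k) → ⟨ y , y ⟩ ≡ sum (λ l → lookup y l * lookup y l)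
  ⟨⟩-lookup []      = refl
  ⟨⟩-lookup (a ∷ y) = cong (λ z → a * a + z) (⟨⟩-lookup y)

  sumᵥ-· : ∀ {k} c (y : Vec ℤ k) → sumᵥ (c · y) ≡ c * sumᵥ y
  sumᵥ-· c []      = sym (*-zeroʳ c)
  sumᵥ-· c (a ∷ y) = trans (cong (λ z → c * a + z) (sumᵥ-· c y)) (sym (*-distribˡ-+ c a (sumᵥ y)))

  sumᵥ-∣ : ∀ {p k} (x y : Vec ℤ k) → p ∣ᵥ x ⊖ y → + p ∣ sumᵥ x - sumᵥ y
  sumᵥ-∣ []      []      []       = divides 0ℤ refl
  sumᵥ-∣ (a ∷ x) (b ∷ y) (d ∷ ds) = ∣-lin₂ 1ℤ 1ℤ d (sumᵥ-∣ x y ds) (lem a b (sumᵥ x) (sumᵥ y))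
    where
    lem : ∀ a b s t → a + s - (b + t) ≡ 1ℤ * (a - b) + 1ℤ * (s - t)
    lem = solve-∀

  lookup-β : ∀ r k l → lookup (β r k) l ≡ + 2 * + toℕ (opposite l) - + r
  lookup-β r (suc i) zero    = cong (λ z → + 2 * + z - + r) (sym (Fin.toℕ-fromℕ i))
  lookup-β r (suc i) (suc l) = trans (lookup-β r i l) (cong (λ z → + 2 * + z - + r) (sym (Fin.toℕ-inject₁ (opposite l))))

  ∣ᵥ-lookup : ∀ {p m} {v : Vec ℤ m} → p ∣ᵥ v → ∀ i → + p ∣ lookup v i
  ∣ᵥ-lookup (d ∷ ds) zero    = d
  ∣ᵥ-lookup (d ∷ ds) (suc i) = ∣ᵥ-lookup ds i

  permute : ∀ {r} → Permutation′ r → Vec ℤ r → Vec ℤ r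
  permute π y = tabulate (λ l → lookup y (π ⟨$⟩ʳ l))

  module _ {r : ℕ} (π : Permutation′ r) where

    sumᵥ-permute : ∀ y → sumᵥ (permute π y) ≡ sumᵥ y
    sumᵥ-permute y = trans (sumᵥ-lookup (permute π y)) (trans (sum-cong-≗ (lookup∘tabulate (λ l → lookup y (π ⟨$⟩ʳ l)))) (trans (sym (sum-permute (lookup y) π)) (sym (sumᵥ-lookup y))))

    ⟨⟩-permute : ∀ y → ⟨ permute π y , permute π y ⟩ ≡ ⟨ y , y ⟩
    ⟨⟩-permute y = trans (⟨⟩-lookup (permute π y)) (trans (sum-cong-≗ (λ l → cong (λ z → z * z) (lookup∘tabulate (λ l → lookup y (π ⟨$⟩ʳ l)) l)))
      (trans (sym (sum-permute (λ l → lookup y l * lookup y l) π)) (sym (⟨⟩-lookup y))))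

  permute-inverse : ∀ {r} (π ρ : Permutation′ r) → (∀ l → ρ ⟨$⟩ʳ (π ⟨$⟩ʳ l) ≡ l) → ∀ y → permute π (permute ρ y) ≡ y
  permute-inverse π ρ h y = trans (tabulate-cong (λ l → trans (lookup∘tabulate (λ l → lookup y (ρ ⟨$⟩ʳ l)) (π ⟨$⟩ʳ l)) (cong (lookup y) (h l)))) (tabulate∘lookup y)

  module Residues (r : ℕ) (1≤r : 1 ℕ.≤ r) where
    private
      R : ℤ
      R = + r
      instance
        r≢0 : ℕ.NonZero r
        r≢0 = ℕ.>-nonZero 1≤r

    βᵢ : Fin r → ℤ
    βᵢ = lookup (β r r)

    2R : + (2 ℕ.* r) ≡ + 2 * R
    2R = pos-* 2 r

    -- The classes 2i - r with i < r are exactly the residues modulo 2r of the parity of r, which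
    -- odd multipliers preserve.
    representative-of : ∀ z → + 2 ∣ z + R → ∃ λ l → + (2 ℕ.* r) ∣ z - βᵢ l
    representative-of z (divides w e) = l , divides (w /ℕ r) (trans (cong (λ b → z - b) (trans (lookup-β r r l) (cong (λ i → + 2 * + i - R) index≡)))
        (trans (lem₁ z R (+ (w %ℕ r))) (trans (cong (_- + 2 * + (w %ℕ r)) (trans e (cong (_* + 2) (a≡a%ℕn+[a/ℕn]*n w r)))) (trans (lem₂ (+ (w %ℕ r)) (w /ℕ r) R) (cong (w /ℕ r *_) (sym 2R))))))
      where
      l = opposite (fromℕ< (n%ℕd<d w r))
      index≡ : toℕ (opposite l) ≡ w %ℕ r
      index≡ = trans (cong toℕ (Fin.opposite-involutive (fromℕ< (n%ℕd<d w r)))) (Fin.toℕ-fromℕ< (n%ℕd<d w r))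
      lem₁ : ∀ z R i → z - (+ 2 * i - R) ≡ z + R - + 2 * i
      lem₁ = solve-∀
      lem₂ : ∀ i q R → (i + q * R) * + 2 - + 2 * i ≡ q * (+ 2 * R)
      lem₂ = solve-∀

    β-injective : ∀ l m → + (2 ℕ.* r) ∣ βᵢ l - βᵢ m → l ≡ m
    β-injective l m d = trans (sym (Fin.opposite-involutive l)) (trans (cong opposite (Fin.toℕ-injective (small-∣⇒≡ (Fin.toℕ<n (opposite l)) (Fin.toℕ<n (opposite m))
        (*-cancelˡ-∣ (+ 2) (subst₂ _∣_ 2R (trans (cong₂ _-_ (lookup-β r r l) (lookup-β r r m)) (lem (+ toℕ (opposite l)) (+ toℕ (opposite m)) R)) d))))) (Fin.opposite-involutive m))
      where
      lem : ∀ a b R → + 2 * a - R - (+ 2 * b - R) ≡ + 2 * (a - b)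
      lem = solve-∀

    β-parity : ∀ l → + 2 ∣ βᵢ l + R
    β-parity l = divides (+ toℕ (opposite l)) (trans (cong (_+ R) (lookup-β r r l)) (lem (+ toℕ (opposite l)) R))
      where
      lem : ∀ a R → + 2 * a - R + R ≡ a * + 2
      lem = solve-∀

    2∣2r : + 2 ∣ + (2 ℕ.* r)
    2∣2r = divides R (trans 2R (*-comm (+ 2) R))

    module Multiplier (D D′ : ℤ) (inverse : + (2 ℕ.* r) ∣ D * D′ - 1ℤ) (one : + 6 ∣ D - 1ℤ) where

      odd : + 2 ∣ D - 1ℤ
      odd = ∣-trans (divides (+ 3) refl) one

      odd′ : + 2 ∣ D′ - 1ℤ
      odd′ = ∣-lin₂ 1ℤ (- D′) (∣-trans 2∣2r inverse) odd (lem D D′)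
        where
        lem : ∀ a b → b - 1ℤ ≡ 1ℤ * (a * b - 1ℤ) + - b * (a - 1ℤ)
        lem = solve-∀

      multiple : ∀ E → + 2 ∣ E - 1ℤ → ∀ l → ∃ λ m → + (2 ℕ.* r) ∣ E * βᵢ l - βᵢ m
      multiple E h l = representative-of (E * βᵢ l) (∣-lin₂ E (- R) (β-parity l) h (lem E (βᵢ l) R))
        where
        lem : ∀ e b R → e * b + R ≡ e * (b + R) + - R * (e - 1ℤ)
        lem = solve-∀

      to from : Fin r → Fin r
      to l   = proj₁ (multiple D′ odd′ l)
      from l = proj₁ (multiple D odd l)

      to-spec : ∀ l → + (2 ℕ.* r) ∣ D′ * βᵢ l - βᵢ (to l)
      to-spec l = proj₂ (multiple D′ odd′ l)

      from-spec : ∀ l → + (2 ℕ.* r) ∣ D * βᵢ l - βᵢ (from l)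
      from-spec l = proj₂ (multiple D odd l)

      from-to : ∀ l → from (to l) ≡ l
      from-to l = β-injective (from (to l)) l (∣-lin₃ -1ℤ (- D) (βᵢ l) (from-spec (to l)) (to-spec l) inverse (lem D D′ (βᵢ l) (βᵢ (to l)) (βᵢ (from (to l)))))
        where
        lem : ∀ D D′ a b c → c - a ≡ -1ℤ * (D * b - c) + - D * (D′ * a - b) + a * (D * D′ - 1ℤ)
        lem = solve-∀

      to-from : ∀ l → to (from l) ≡ l
      to-from l = β-injective (to (from l)) l (∣-lin₃ -1ℤ (- D′) (βᵢ l) (to-spec (from l)) (from-spec l) inverse (lem D D′ (βᵢ l) (βᵢ (from l)) (βᵢ (to (from l)))))
        where
        lem : ∀ D D′ a b c → c - a ≡ -1ℤ * (D′ * b - c) + - D′ * (D * a - b) + a * (D * D′ - 1ℤ)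
        lem = solve-∀

      -- Multiplication by the odd unit D′ permutes the classes `βᵢ` modulo 2r; this is the
      -- resulting permutation of the coordinates.
      π : Permutation′ r
      π = permutation to from to-from from-to

      π⁻¹ : Permutation′ r
      π⁻¹ = permutation from to from-to to-from

      φ ψ : Vec ℤ r → Vec ℤ r
      φ = permute π⁻¹
      ψ = permute π

      ψφ : ∀ y → ψ (φ y) ≡ y
      ψφ = permute-inverse π π⁻¹ from-to

      φψ : ∀ y → φ (ψ y) ≡ y
      φψ = permute-inverse π⁻¹ π to-from

      φ-to : ∀ y l → lookup (φ y) (to l) ≡ lookup y l
      φ-to y l = trans (lookup∘tabulate (λ l → lookup y (from l)) (to l)) (cong (lookup y) (from-to l))

      lookup-coset : ∀ x l → lookup (x ⊖ β r r) l ≡ lookup x l - βᵢ l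
      lookup-coset x l = lookup-zipWith _-_ l x (β r r)

      lookup-D : ∀ x l → lookup (D · x ⊖ β r r) l ≡ D * lookup x l - βᵢ l
      lookup-D x l = trans (lookup-coset (D · x) l) (cong (_- βᵢ l) (lookup-map l (D *_) x))

      coset⇒ : ∀ y → (2 ℕ.* r) ∣ᵥ D · y ⊖ β r r → (2 ℕ.* r) ∣ᵥ φ y ⊖ β r r
      coset⇒ y h = ∣ᵥ-lookup⁻ (φ y ⊖ β r r) (λ l → subst (+ (2 ℕ.* r) ∣_) (sym (trans (lookup-coset (φ y) l) (cong (_- βᵢ l) (lookup∘tabulate (λ l → lookup y (from l)) l))))
        (∣-lin₃ D′ (- lookup y (from l)) 1ℤ (subst (+ (2 ℕ.* r) ∣_) (lookup-D y (from l)) (∣ᵥ-lookup h (from l))) inverse (subst (λ m → + (2 ℕ.* r) ∣ D′ * βᵢ (from l) - βᵢ m) (to-from l) (to-spec (from l)))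
          (lem D D′ (lookup y (from l)) (βᵢ l) (βᵢ (from l)))))
        where
        lem : ∀ D D′ y b c → y - b ≡ D′ * (D * y - c) + - y * (D * D′ - 1ℤ) + 1ℤ * (D′ * c - b)
        lem = solve-∀

      coset⇐ : ∀ y → (2 ℕ.* r) ∣ᵥ φ y ⊖ β r r → (2 ℕ.* r) ∣ᵥ D · y ⊖ β r r
      coset⇐ y h = ∣ᵥ-lookup⁻ (D · y ⊖ β r r) (λ l → subst (+ (2 ℕ.* r) ∣_) (sym (lookup-D y l))
        (∣-lin₂ D 1ℤ (subst (+ (2 ℕ.* r) ∣_) (trans (lookup-coset (φ y) (to l)) (cong (_- βᵢ (to l)) (φ-to y l))) (∣ᵥ-lookup h (to l)))
          (subst (λ m → + (2 ℕ.* r) ∣ D * βᵢ (to l) - βᵢ m) (from-to l) (from-spec (to l))) (lem D (lookup y l) (βᵢ l) (βᵢ (to l)))))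
        where
        lem : ∀ D y b c → D * y - b ≡ D * (y - c) + 1ℤ * (D * c - b)
        lem = solve-∀

      R∣sum : ∀ y → (2 ℕ.* r) ∣ᵥ y ⊖ β r r → R ∣ sumᵥ y
      R∣sum y h = ∣-lin₂ 1ℤ -1ℤ (∣-trans (divides (+ 2) 2R) (sumᵥ-∣ y (β r r) h)) (∣-refl {R}) (trans (lem (sumᵥ y) R) (cong (λ z → 1ℤ * (sumᵥ y - z) + -1ℤ * R) (sym (trans (Shape.sum-β r 0 r) (lem′ R)))))
        where
        lem : ∀ s R → s ≡ 1ℤ * (s - - R) + -1ℤ * R
        lem = solve-∀
        lem′ : ∀ R → R * R - R - R * R ≡ - R
        lem′ = solve-∀

      module _ (t : ℕ) where
        open Norm r t

        private
          12r : ℤ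
          12r = + (12 ℕ.* r)

          12r∣ : ∀ {S} → R ∣ S → 12r ∣ + 12 * S
          12r∣ {S} d = subst (_∣ + 12 * S) (sym (pos-* 12 r)) (*-monoʳ-∣ (+ 12) d)

          swap : ∀ a b {c d} → a ≡ d → b ≡ c → a - b ≡ -1ℤ * (c - d)
          swap a b refl refl = lem a b
            where
            lem : ∀ a b → a - b ≡ -1ℤ * (b - a)
            lem = solve-∀

        -- D is 1 or 7 modulo 12, and 7 interchanges the residues -1 and 5
        σ-scaled : ∃ λ ε → (ε ≡ 1ℤ ⊎ ε ≡ -1ℤ) × ∀ S → R ∣ S → σ (D * S) ≡ ε * σ S
        σ-scaled = by-parity one
          where
          by-parity : + 6 ∣ D - 1ℤ → ∃ λ ε → (ε ≡ 1ℤ ⊎ ε ≡ -1ℤ) × ∀ S → R ∣ S → σ (D * S) ≡ ε * σ S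
          by-parity (divides k e) = by-residue (k %ℕ 2) (n%ℕd<d k 2) (a≡a%ℕn+[a/ℕn]*n k 2)
            where
            q = k /ℕ 2
            D≡ : ∀ ρ → k ≡ + ρ + q * + 2 → D ≡ 1ℤ + + 6 * + ρ + + 12 * q
            D≡ ρ ek = trans (lem₁ D) (trans (cong (_+ 1ℤ) (trans e (cong (_* + 6) ek))) (lem₂ (+ ρ) q))
              where
              lem₁ : ∀ D → D ≡ D - 1ℤ + 1ℤ
              lem₁ = solve-∀
              lem₂ : ∀ ρ q → (ρ + q * + 2) * + 6 + 1ℤ ≡ 1ℤ + + 6 * ρ + + 12 * q
              lem₂ = solve-∀
            by-residue : ∀ ρ → ρ ℕ.< 2 → k ≡ + ρ + q * + 2 → ∃ λ ε → (ε ≡ 1ℤ ⊎ ε ≡ -1ℤ) × ∀ S → R ∣ S → σ (D * S) ≡ ε * σ S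
            by-residue 0 _ ek = 1ℤ , inj₁ refl , λ S d → trans (cong₂ _-_ (same S (D * S) R d (shift S R)) (same S (D * S) (- (+ 5 * R)) d (shift S (- (+ 5 * R))))) (sym (*-identityˡ (σ S)))
              where
              shift : ∀ S c → D * S + c ≡ S + c + q * (+ 12 * S)
              shift S c = trans (cong (λ z → z * S + c) (D≡ 0 ek)) (lem q S c)
                where
                lem : ∀ q S c → (1ℤ + + 6 * 0ℤ + + 12 * q) * S + c ≡ S + c + q * (+ 12 * S)
                lem = solve-∀
              same : ∀ S S′ c → R ∣ S → S′ + c ≡ S + c + q * (+ 12 * S) → 𝟙 (12r ∣? S′ + c) ≡ 𝟙 (12r ∣? S + c)
              same S S′ c d eq = 𝟙-⇔ (12r ∣? S′ + c) (12r ∣? S + c)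
                (λ h → ∣-lin₂ 1ℤ (- q) h (12r∣ d) (trans (lem (S + c) q (+ 12 * S)) (cong (λ z → 1ℤ * z + - q * (+ 12 * S)) (sym eq))))
                (λ h → ∣-lin₂ 1ℤ q h (12r∣ d) (trans eq (cong (_+ q * (+ 12 * S)) (sym (*-identityˡ (S + c))))))
                where
                lem : ∀ a q b → a ≡ 1ℤ * (a + q * b) + - q * b
                lem = solve-∀
            by-residue 1 _ ek = -1ℤ , inj₂ refl , λ S d → swap (𝟙 (12r ∣? D * S + R)) (𝟙 (12r ∣? D * S - + 5 * R))
                (𝟙-⇔ (12r ∣? D * S + R) (12r ∣? S - + 5 * R)
                  (λ h → ∣-lin₃ (+ 7) (- (+ 4 + + 7 * q)) -1ℤ h (12r∣ d) (12r∣ {R} ∣-refl) (trans (lem₁ q S R) (cong (λ z → + 7 * (z * S + R) + - (+ 4 + + 7 * q) * (+ 12 * S) + -1ℤ * (+ 12 * R)) (sym (D≡ 1 ek)))))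
                  (λ h → ∣-lin₃ (+ 7) q (+ 3) h (12r∣ d) (12r∣ {R} ∣-refl) (trans (cong (λ z → z * S + R) (D≡ 1 ek)) (lem₂ q S R))))
                (𝟙-⇔ (12r ∣? D * S - + 5 * R) (12r ∣? S + R)
                  (λ h → ∣-lin₃ (+ 7) (- (+ 4 + + 7 * q)) (+ 3) h (12r∣ d) (12r∣ {R} ∣-refl) (trans (lem₃ q S R) (cong (λ z → + 7 * (z * S - + 5 * R) + - (+ 4 + + 7 * q) * (+ 12 * S) + + 3 * (+ 12 * R)) (sym (D≡ 1 ek)))))
                  (λ h → ∣-lin₃ (+ 7) q -1ℤ h (12r∣ d) (12r∣ {R} ∣-refl) (trans (cong (λ z → z * S - + 5 * R) (D≡ 1 ek)) (lem₄ q S R))))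
              where
              lem₁ : ∀ q S R → S - + 5 * R ≡ + 7 * ((1ℤ + + 6 * 1ℤ + + 12 * q) * S + R) + - (+ 4 + + 7 * q) * (+ 12 * S) + -1ℤ * (+ 12 * R)
              lem₁ = solve-∀
              lem₂ : ∀ q S R → (1ℤ + + 6 * 1ℤ + + 12 * q) * S + R ≡ + 7 * (S - + 5 * R) + q * (+ 12 * S) + + 3 * (+ 12 * R)
              lem₂ = solve-∀
              lem₃ : ∀ q S R → S + R ≡ + 7 * ((1ℤ + + 6 * 1ℤ + + 12 * q) * S - + 5 * R) + - (+ 4 + + 7 * q) * (+ 12 * S) + + 3 * (+ 12 * R)
              lem₃ = solve-∀
              lem₄ : ∀ q S R → (1ℤ + + 6 * 1ℤ + + 12 * q) * S - + 5 * R ≡ + 7 * (S + R) + q * (+ 12 * S) + -1ℤ * (+ 12 * R)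
              lem₄ = solve-∀
            by-residue (suc (suc ρ)) (s≤s (s≤s ())) ek

        -- D · y lies in the coset of β exactly if y with its coordinates permuted does, and the
        -- coordinate sum is unchanged by the permutation, so only the sign of D remains.
        character-scaled : ∀ {ε} → (∀ S → R ∣ S → σ (D * S) ≡ ε * σ S) → ∀ y → character (D · y) ≡ ε * character (φ y)
        character-scaled {ε} hε y = trans (cong (_* σ (sumᵥ (D · y))) (𝟙-⇔ ((2 ℕ.* r) ∣ᵥ? D · y ⊖ β₀) ((2 ℕ.* r) ∣ᵥ? φ y ⊖ β₀) (coset⇒ y) (coset⇐ y)))
          (trans (𝟙*-cong ((2 ℕ.* r) ∣ᵥ? φ y ⊖ β₀) {σ (sumᵥ (D · y))} {ε * σ (sumᵥ (φ y))} (λ h → trans (cong σ (trans (sumᵥ-· D y) (cong (D *_) (sym (sumᵥ-permute π⁻¹ y))))) (hε (sumᵥ (φ y)) (R∣sum (φ y) h))))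
            (lem (𝟙 ((2 ℕ.* r) ∣ᵥ? φ y ⊖ β₀)) ε (σ (sumᵥ (φ y)))))
          where
          lem : ∀ a e b → a * (e * b) ≡ e * (a * b)
          lem = solve-∀

        B₀-permute : ∀ ρ y → B₀ (permute ρ y) (permute ρ y) ≡ B₀ y y
        B₀-permute ρ y = cong₂ (λ a s → + 3 * R * a + (+ t - + 3) * (s * s)) (⟨⟩-permute ρ y) (sumᵥ-permute ρ y)

        -- `B₀` is symmetric in the coordinates, so the permutation is an isometry and turns the
        -- scaled count into ±1 times the original one, at every level.
        theta-count-scaled : 2 ℕ.≤ t → ∃ λ ε → (ε ≡ 1ℤ ⊎ ε ≡ -1ℤ) × ∀ b M → M ℕ.≤ b → ∑[ y ∈ box b r ] (𝟙 (B₀ y y ≟ + M) * character (D · y)) ≡ ε * theta-count b M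
        theta-count-scaled 2≤t = from-sign σ-scaled
          where
          from-sign : (∃ λ ε → (ε ≡ 1ℤ ⊎ ε ≡ -1ℤ) × ∀ S → R ∣ S → σ (D * S) ≡ ε * σ S) → _
          from-sign (ε , ε≡ , hε) = ε , ε≡ , counts
            where
            module _ (b M : ℕ) (M≤b : M ℕ.≤ b) where
              f g : Vec ℤ r → ℤ
              f y = 𝟙 (B₀ y y ≟ + M) * character (D · y)
              g y = 𝟙 (B₀ y y ≟ + M) * character y
              g-φ : ∀ y → ε * g (φ y) ≡ f y
              g-φ y = trans (lem ε (𝟙 (B₀ (φ y) (φ y) ≟ + M)) (character (φ y))) (cong₂ _*_ (cong (λ z → 𝟙 (z ≟ + M)) (B₀-permute π⁻¹ y)) (sym (character-scaled {ε} hε y)))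
                where
                lem : ∀ e a b → e * (a * b) ≡ a * (e * b)
                lem = solve-∀
              in-box : ∀ y → B₀ y y ≡ + M → y V.∈! box b r
              in-box y e = box-∈! b y (Bounded-mono M≤b (B₀-coercive r t 1≤r 2≤t y e))
              counts : ∑ (box b r) f ≡ ε * ∑ (box b r) g
              counts = trans (∑-bij _≟ᵥ_ _≟ᵥ_ (box b r) (box b r) {f} {λ y → ε * g y} φ ψ
                (λ y ne → in-box (φ y) (trans (B₀-permute π⁻¹ y) (proj₁ (𝟙*≢0 (B₀ y y ≟ + M) (character (D · y)) ne))) , g-φ y , ψφ y)
                (λ y ne → in-box (ψ y) (trans (B₀-permute π y) (proj₁ (𝟙*≢0 (B₀ y y ≟ + M) (character y) (λ e → ne (trans (cong (ε *_) e) (*-zeroʳ ε)))))) , trans (sym (g-φ (ψ y))) (cong (λ z → ε * g z) (φψ y)) , φψ y))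
                (∑-*ˡ (box b r) ε g)

-- The Gram map of `B₀` and the periodic weight of a section.

module Weight where

  open import Data.Nat as ℕ using (ℕ; zero; suc; s≤s; z≤n)
  import Data.Nat.Properties as ℕ
  import Data.Nat.Divisibility as ℕ
  open import Data.Nat.Primality using (Prime)
  open import Data.Integer hiding (suc; _⊖_)
  open import Data.Integer.Properties
  open import Data.Integer.Divisibility.Signed
  open import Data.Integer.Tactic.RingSolver using (solve-∀)
  import Data.Nat.Tactic.RingSolver as ℕ
  open import Data.Vec using (Vec; []; _∷_; replicate)
  open import Data.Vec.Relation.Unary.All using ([]; _∷_)
  open import Data.Product using (_,_)
  import Data.Sum as Sum
  open import Relation.Nullary
  open import Relation.Binary.PropositionalEquality
  open LinDep using (PrimeIdeal)
  open Sums
  open Vectors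
  open ModPrime
  open Frames using (Bounded; Form)
  open Coset
  open Counting
  open Enumerate using (B₀-coercive; sum-bound)
  open Evaluate using (q₀≡)
  open Twist using (sumᵥ-·)

  sumᵥ-⊕ : ∀ {k} (x y : Vec ℤ k) → sumᵥ (x ⊕ y) ≡ sumᵥ x + sumᵥ y
  sumᵥ-⊕ []      []      = refl
  sumᵥ-⊕ (a ∷ x) (b ∷ y) = trans (cong (λ z → a + b + z) (sumᵥ-⊕ x y)) (lem a b (sumᵥ x) (sumᵥ y))
    where
    lem : ∀ a b s t → a + b + (s + t) ≡ a + s + (b + t)
    lem = solve-∀

  ∣ᵥ-sum : ∀ {p k} {y : Vec ℤ k} → p ∣ᵥ y → + p ∣ sumᵥ y
  ∣ᵥ-sum []       = divides 0ℤ refl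
  ∣ᵥ-sum (d ∷ ds) = ∣m∣n⇒∣m+n d (∣ᵥ-sum ds)

  ⟨⟩-bound : ∀ {k b b′} (x y : Vec ℤ k) → Bounded b x → Bounded b′ y → ∣ ⟨ x , y ⟩ ∣ ℕ.≤ k ℕ.* (b ℕ.* b′)
  ⟨⟩-bound []      []      []       []       = z≤n
  ⟨⟩-bound (a ∷ x) (c ∷ y) (p ∷ ps) (q ∷ qs) = ℕ.≤-trans (∣i+j∣≤∣i∣+∣j∣ (a * c) ⟨ x , y ⟩) (ℕ.+-mono-≤ (ℕ.≤-trans (ℕ.≤-reflexive (abs-* a c)) (ℕ.*-mono-≤ p q)) (⟨⟩-bound x y ps qs))

  ones : ∀ {k} → Vec ℤ k
  ones = replicate _ 1ℤ

  ⟨⟩-ones : ∀ {k} (x : Vec ℤ k) → ⟨ x , ones ⟩ ≡ sumᵥ x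
  ⟨⟩-ones []      = refl
  ⟨⟩-ones (a ∷ x) = cong₂ _+_ (*-identityʳ a) (⟨⟩-ones x)

  sum-ones : ∀ k → sumᵥ (ones {k}) ≡ + k
  sum-ones zero    = refl
  sum-ones (suc k) = trans (cong (λ z → 1ℤ + z) (sum-ones k)) (sym (pos-+ 1 k))

  square-β : ∀ r k → + 3 * ⟨ β r k , β r k ⟩ ≡ + 2 * + k * (+ k - 1ℤ) * (+ 2 * + k - 1ℤ) - + 6 * + r * + k * (+ k - 1ℤ) + + 3 * + k * (+ r * + r)
  square-β r zero    = lem (+ r)
    where
    lem : ∀ r → 0ℤ ≡ + 2 * 0ℤ * (0ℤ - 1ℤ) * (+ 2 * 0ℤ - 1ℤ) - + 6 * r * 0ℤ * (0ℤ - 1ℤ) + + 3 * 0ℤ * (r * r)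
    lem = solve-∀
  square-β r (suc i) = trans (*-distribˡ-+ (+ 3) ((+ 2 * + i - + r) * (+ 2 * + i - + r)) ⟨ β r i , β r i ⟩) (trans (cong (λ z → + 3 * ((+ 2 * + i - + r) * (+ 2 * + i - + r)) + z) (square-β r i)) (trans (lem (+ i) (+ r))
    (cong (λ k → + 2 * k * (k - 1ℤ) * (+ 2 * k - 1ℤ) - + 6 * + r * k * (k - 1ℤ) + + 3 * k * (+ r * + r)) (sym (pos-+ 1 i)))))
    where
    lem : ∀ i r → + 3 * ((+ 2 * i - r) * (+ 2 * i - r)) + (+ 2 * i * (i - 1ℤ) * (+ 2 * i - 1ℤ) - + 6 * r * i * (i - 1ℤ) + + 3 * i * (r * r)) ≡
      + 2 * (1ℤ + i) * (1ℤ + i - 1ℤ) * (+ 2 * (1ℤ + i) - 1ℤ) - + 6 * r * (1ℤ + i) * (1ℤ + i - 1ℤ) + + 3 * (1ℤ + i) * (r * r)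
    lem = solve-∀

  module Quadratic (r t : ℕ) (1≤r : 1 ℕ.≤ r) (2≤t : 2 ℕ.≤ t) where
    open Norm r t public
    private
      R T : ℤ
      R = + r
      T = + t

    -- From the sum of the squares (2i - r)². Both the bound q₀ < N and the congruence that reaches
    -- the section rest on this closed form.
    q₀-value : q₀ ≡ R * R * (R * R + T - 1ℤ)
    q₀-value = trans (q₀≡ r t 1≤r 2≤t) (trans (lem₁ R T ⟨ β₀ , β₀ ⟩) (trans (cong (λ z → R * z + (T - + 3) * (R * R)) (square-β r r)) (lem₂ R T)))
      where
      lem₁ : ∀ R T n → + 3 * R * n + (T - + 3) * (R * R) ≡ R * (+ 3 * n) + (T - + 3) * (R * R)
      lem₁ = solve-∀
      lem₂ : ∀ R T → R * (+ 2 * R * (R - 1ℤ) * (+ 2 * R - 1ℤ) - + 6 * R * R * (R - 1ℤ) + + 3 * R * (R * R)) + (T - + 3) * (R * R) ≡ R * R * (R * R + T - 1ℤ)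
      lem₂ = solve-∀

    form : Form r
    form = record
      { B = B₀
      ; B-comm = λ x y → cong₂ (λ a s → + 3 * R * a + (T - + 3) * s) (⟨,⟩-comm x y) (*-comm (sumᵥ x) (sumᵥ y))
      ; B-⊕ = λ x y z → trans (cong₂ (λ a s → + 3 * R * a + (T - + 3) * (s * sumᵥ z)) (⟨,⟩-⊕ x y z) (sumᵥ-⊕ x y)) (lem₁ (+ 3 * R) (T - + 3) ⟨ x , z ⟩ ⟨ y , z ⟩ (sumᵥ x) (sumᵥ y) (sumᵥ z))
      ; B-· = λ k x y → trans (cong₂ (λ a s → + 3 * R * a + (T - + 3) * (s * sumᵥ y)) (⟨,⟩-· k x y) (sumᵥ-· k x)) (lem₂ (+ 3 * R) (T - + 3) k ⟨ x , y ⟩ (sumᵥ x) (sumᵥ y))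
      ; bound = 3 ℕ.* r ℕ.* r ℕ.+ ∣ T - + 3 ∣ ℕ.* (r ℕ.* r)
      ; B-bound = bounded
      ; nonneg = λ x → ≤-trans (⟨⟩-nonneg x) (B₀-lower 1≤r 2≤t x)
      ; coercive = λ {n} x e → B₀-coercive r t 1≤r 2≤t x e
      }
      where
      lem₁ : ∀ a b x y s t u → a * (x + y) + b * ((s + t) * u) ≡ a * x + b * (s * u) + (a * y + b * (t * u))
      lem₁ = solve-∀
      lem₂ : ∀ a b k x s u → a * (k * x) + b * (k * s * u) ≡ k * (a * x + b * (s * u))
      lem₂ = solve-∀
      bounded : ∀ {b b′} x y → Bounded b x → Bounded b′ y → ∣ B₀ x y ∣ ℕ.≤ (3 ℕ.* r ℕ.* r ℕ.+ ∣ T - + 3 ∣ ℕ.* (r ℕ.* r)) ℕ.* (b ℕ.* b′)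
      bounded {b} {b′} x y p q = ℕ.≤-trans (∣i+j∣≤∣i∣+∣j∣ (+ 3 * R * ⟨ x , y ⟩) ((T - + 3) * (sumᵥ x * sumᵥ y))) (ℕ.≤-trans (ℕ.+-mono-≤
          (ℕ.≤-trans (ℕ.≤-reflexive (trans (abs-* (+ 3 * R) ⟨ x , y ⟩) (cong (ℕ._* ∣ ⟨ x , y ⟩ ∣) (abs-* (+ 3) R)))) (ℕ.*-monoʳ-≤ (3 ℕ.* r) (⟨⟩-bound x y p q)))
          (ℕ.≤-trans (ℕ.≤-reflexive (trans (abs-* (T - + 3) (sumᵥ x * sumᵥ y)) (cong (∣ T - + 3 ∣ ℕ.*_) (abs-* (sumᵥ x) (sumᵥ y))))) (ℕ.*-monoʳ-≤ ∣ T - + 3 ∣ (ℕ.*-mono-≤ (sum-bound x p) (sum-bound y q)))))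
        (ℕ.≤-reflexive (lem r ∣ T - + 3 ∣ b b′)))
        where
        lem : ∀ r c b b′ → 3 ℕ.* r ℕ.* (r ℕ.* (b ℕ.* b′)) ℕ.+ c ℕ.* (r ℕ.* b ℕ.* (r ℕ.* b′)) ≡ (3 ℕ.* r ℕ.* r ℕ.+ c ℕ.* (r ℕ.* r)) ℕ.* (b ℕ.* b′)
        lem = ℕ.solve-∀

    gram : Vec ℤ r → Vec ℤ r
    gram y = (+ 3 * R) · y ⊕ ((T - + 3) * sumᵥ y) · ones

    gram-⊕ : ∀ x y → gram (x ⊕ y) ≡ gram x ⊕ gram y
    gram-⊕ x y = trans (cong₂ _⊕_ (·-distribˡ (+ 3 * R) x y) (trans (cong (_· ones) (trans (cong ((T - + 3) *_) (sumᵥ-⊕ x y)) (*-distribˡ-+ (T - + 3) (sumᵥ x) (sumᵥ y)))) (·-distribʳ ((T - + 3) * sumᵥ x) ((T - + 3) * sumᵥ y) ones)))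
      (⊕-interchange ((+ 3 * R) · x) ((+ 3 * R) · y) (((T - + 3) * sumᵥ x) · ones) (((T - + 3) * sumᵥ y) · ones))

    gram-· : ∀ k x → gram (k · x) ≡ k · gram x
    gram-· k x = trans (cong₂ _⊕_ (trans (sym (·-assoc (+ 3 * R) k x)) (trans (cong (_· x) (*-comm (+ 3 * R) k)) (·-assoc k (+ 3 * R) x)))
        (trans (cong (_· ones) (trans (cong ((T - + 3) *_) (sumᵥ-· k x)) (lem (T - + 3) k (sumᵥ x)))) (·-assoc k ((T - + 3) * sumᵥ x) ones)))
      (sym (·-distribˡ k ((+ 3 * R) · x) (((T - + 3) * sumᵥ x) · ones)))
      where
      lem : ∀ a k s → a * (k * s) ≡ k * (a * s)
      lem = solve-∀

    gram-B : ∀ x y → ⟨ x , gram y ⟩ ≡ B₀ x y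
    gram-B x y = trans (⟨,⟩-⊕ʳ x ((+ 3 * R) · y) (((T - + 3) * sumᵥ y) · ones)) (cong₂ _+_ (⟨,⟩-·ʳ (+ 3 * R) x y)
      (trans (⟨,⟩-·ʳ ((T - + 3) * sumᵥ y) x ones) (trans (cong ((T - + 3) * sumᵥ y *_) (⟨⟩-ones x)) (lem (T - + 3) (sumᵥ y) (sumᵥ x)))))
      where
      lem : ∀ a s u → a * s * u ≡ a * (u * s)
      lem = solve-∀

    -- The Gram matrix is 3r times the identity plus t - 3 times the all-ones matrix. It multiplies
    -- the coordinate sum by r t, so p divides that sum, and then 3r y; a prime above 3rt divides
    -- neither factor.
    gram-faithful : ∀ {p} → Prime p → 3 ℕ.* r ℕ.* t ℕ.< p → ∀ y → p ∣ᵥ gram y → p ∣ᵥ y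
    gram-faithful {p} pp large y d = cancel y (subst (p ∣ᵥ_) (lem-⊖ ((+ 3 * R) · y) (((T - + 3) * sumᵥ y) · ones)) (∣ᵥ-⊖ d (∣ᵥ-scaled ones (∣n⇒∣m*n (T - + 3) p∣S))))
      where
      open PrimeIdeal (prime-ideal pp)
      ∤small : ∀ n → 1 ℕ.≤ n → n ℕ.≤ 3 ℕ.* r ℕ.* t → ¬ + p ∣ + n
      ∤small n 1≤n n≤ d = ℕ.<⇒≱ large (ℕ.≤-trans (ℕ.∣⇒≤ {{ℕ.>-nonZero 1≤n}} (∣⇒∣ᵤ d)) n≤)
      1≤t : 1 ℕ.≤ t
      1≤t = ℕ.≤-trans (s≤s z≤n) 2≤t
      1≤3r : 1 ℕ.≤ 3 ℕ.* r
      1≤3r = ℕ.≤-trans 1≤r (ℕ.m≤n*m r 3)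
      ∤3R : ¬ + p ∣ + 3 * R
      ∤3R d = ∤small (3 ℕ.* r) 1≤3r (ℕ.m≤m*n (3 ℕ.* r) t {{ℕ.>-nonZero 1≤t}}) (subst (+ p ∣_) (sym (pos-* 3 r)) d)
      ∤RT : ¬ + p ∣ R * T
      ∤RT d = ∤small (r ℕ.* t) (ℕ.*-mono-≤ 1≤r 1≤t) (ℕ.*-monoˡ-≤ t (ℕ.m≤n*m r 3)) (subst (+ p ∣_) (sym (pos-* r t)) d)
      sum-gram : sumᵥ (gram y) ≡ R * T * sumᵥ y
      sum-gram = trans (sumᵥ-⊕ ((+ 3 * R) · y) (((T - + 3) * sumᵥ y) · ones {r})) (trans (cong₂ _+_ (sumᵥ-· (+ 3 * R) y) (trans (sumᵥ-· ((T - + 3) * sumᵥ y) (ones {r})) (cong ((T - + 3) * sumᵥ y *_) (sum-ones r)))) (lem R T (sumᵥ y)))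
        where
        lem : ∀ R T s → + 3 * R * s + (T - + 3) * s * R ≡ R * T * s
        lem = solve-∀
      p∣S : + p ∣ sumᵥ y
      p∣S = Sum.fromInj₂ (λ d → contradiction d ∤RT) (prime (R * T) (sumᵥ y) (subst (+ p ∣_) sum-gram (∣ᵥ-sum d)))
      lem-⊖ : ∀ {k} (u v : Vec ℤ k) → (u ⊕ v) ⊖ v ≡ u
      lem-⊖ []      []      = refl
      lem-⊖ (a ∷ u) (b ∷ v) = cong₂ _∷_ (lem a b) (lem-⊖ u v)
        where
        lem : ∀ a b → a + b - b ≡ a
        lem = solve-∀
      cancel : ∀ {k} (y : Vec ℤ k) → p ∣ᵥ (+ 3 * R) · y → p ∣ᵥ y
      cancel []      []       = []
      cancel (a ∷ y) (d ∷ ds) = Sum.fromInj₂ (λ d → contradiction d ∤3R) (prime (+ 3 * R) a d) ∷ cancel y ds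

  ∣ᵥ-shift : ∀ {p k} (y w b : Vec ℤ k) → p ∣ᵥ w → p ∣ᵥ y ⊖ b → p ∣ᵥ (y ⊕ w) ⊖ b
  ∣ᵥ-shift []      []      []      []       []       = []
  ∣ᵥ-shift (a ∷ y) (c ∷ w) (b ∷ v) (d ∷ ds) (e ∷ es) = ∣-lin₂ 1ℤ 1ℤ d e (lem a b c) ∷ ∣ᵥ-shift y w v ds es
    where
    lem : ∀ a b c → a + c - b ≡ 1ℤ * c + 1ℤ * (a - b)
    lem = solve-∀

  ∣ᵥ-unshift : ∀ {p k} (y w b : Vec ℤ k) → p ∣ᵥ w → p ∣ᵥ (y ⊕ w) ⊖ b → p ∣ᵥ y ⊖ b
  ∣ᵥ-unshift []      []      []      []       []       = []
  ∣ᵥ-unshift (a ∷ y) (c ∷ w) (b ∷ v) (d ∷ ds) (e ∷ es) = ∣-lin₂ -1ℤ 1ℤ d e (lem a b c) ∷ ∣ᵥ-unshift y w v ds es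
    where
    lem : ∀ a b c → a - b ≡ -1ℤ * c + 1ℤ * (a + c - b)
    lem = solve-∀

  module SectionWeight (r t : ℕ) (1≤r : 1 ℕ.≤ r) (2≤t : 2 ℕ.≤ t) (s : ℕ) where
    open Quadratic r t 1≤r 2≤t
    open Form form using (B-⊕; B-⊕ʳ; B-·; B-·ʳ; B-comm)
    private
      R T : ℤ
      R = + r
      T = + t

    -- Levels are q₀ + 24r²x, so x ≡ s modulo r is a congruence modulo `P` = 24r³. `N` is a multiple
    -- of `P` and of the moduli 2r and 12r of the character, its prime factors divide 6tr, and the
    -- factor r t makes it exceed `q₀`.
    P N : ℕ
    P = 24 ℕ.* (r ℕ.* r ℕ.* r)
    N = P ℕ.* (r ℕ.* t)

    offset : ℤ
    offset = q₀ + + 24 * (R * R) * + s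

    weight : Vec ℤ r → ℤ
    weight y = character y * 𝟙 (+ P ∣? B₀ y y - offset)

    𝟙-shift : ∀ {n} a w → n ∣ w → 𝟙 (n ∣? a + w) ≡ 𝟙 (n ∣? a)
    𝟙-shift {n} a w d = 𝟙-⇔ (n ∣? a + w) (n ∣? a) (λ h → ∣m+n∣n⇒∣m h d) (λ h → ∣m∣n⇒∣m+n h d)

    2r∣N : 2 ℕ.* r ℕ.∣ N
    2r∣N = ℕ.divides (12 ℕ.* (r ℕ.* r) ℕ.* (r ℕ.* t)) (lem r t)
      where
      lem : ∀ r t → 24 ℕ.* (r ℕ.* r ℕ.* r) ℕ.* (r ℕ.* t) ≡ 12 ℕ.* (r ℕ.* r) ℕ.* (r ℕ.* t) ℕ.* (2 ℕ.* r)
      lem = ℕ.solve-∀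

    12r∣N : 12 ℕ.* r ℕ.∣ N
    12r∣N = ℕ.divides (2 ℕ.* (r ℕ.* r) ℕ.* (r ℕ.* t)) (lem r t)
      where
      lem : ∀ r t → 24 ℕ.* (r ℕ.* r ℕ.* r) ℕ.* (r ℕ.* t) ≡ 2 ℕ.* (r ℕ.* r) ℕ.* (r ℕ.* t) ℕ.* (12 ℕ.* r)
      lem = ℕ.solve-∀

    P∣N : P ℕ.∣ N
    P∣N = ℕ.m∣m*n (r ℕ.* t)

    character-periodic : ∀ y z → character (y ⊕ + N · z) ≡ character y
    character-periodic y z = cong₂ _*_ (𝟙-⇔ ((2 ℕ.* r) ∣ᵥ? (y ⊕ + N · z) ⊖ β₀) ((2 ℕ.* r) ∣ᵥ? y ⊖ β₀) (∣ᵥ-unshift y (+ N · z) β₀ 2r∣Nz) (∣ᵥ-shift y (+ N · z) β₀ 2r∣Nz))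
        (trans (cong σ (trans (sumᵥ-⊕ y (+ N · z)) (cong (λ w → sumᵥ y + w) (sumᵥ-· (+ N) z)))) (cong₂ _-_ (shifted R) (shifted (- (+ 5 * R)))))
      where
      2r∣Nz : (2 ℕ.* r) ∣ᵥ + N · z
      2r∣Nz = ∣ᵥ-scaled {k = + N} z (∣ᵤ⇒∣ 2r∣N)
      lem : ∀ a w c → a + w + c ≡ a + c + w
      lem = solve-∀
      shifted : ∀ c → 𝟙 (+ (12 ℕ.* r) ∣? sumᵥ y + + N * sumᵥ z + c) ≡ 𝟙 (+ (12 ℕ.* r) ∣? sumᵥ y + c)
      shifted c = trans (cong (λ w → 𝟙 (+ (12 ℕ.* r) ∣? w)) (lem (sumᵥ y) (+ N * sumᵥ z) c)) (𝟙-shift (sumᵥ y + c) (+ N * sumᵥ z) (∣m⇒∣m*n {+ (12 ℕ.* r)} {+ N} (sumᵥ z) (∣ᵤ⇒∣ 12r∣N)))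

    weight-periodic : ∀ y z → weight (y ⊕ + N · z) ≡ weight y
    weight-periodic y z = cong₂ _*_ (character-periodic y z) (trans (cong (λ w → 𝟙 (+ P ∣? w - offset)) expand)
        (trans (cong (λ w → 𝟙 (+ P ∣? w)) (lem′ (B₀ y y) (+ N * (+ 2 * B₀ y z + + N * B₀ z z)) offset)) (𝟙-shift (B₀ y y - offset) (+ N * (+ 2 * B₀ y z + + N * B₀ z z)) (∣m⇒∣m*n {+ P} {+ N} (+ 2 * B₀ y z + + N * B₀ z z) (∣ᵤ⇒∣ P∣N)))))
      where
      lem : ∀ N a b c → a + N * b + (N * (b + N * c)) ≡ a + N * (+ 2 * b + N * c)
      lem = solve-∀
      lem′ : ∀ a w c → a + w - c ≡ a - c + w
      lem′ = solve-∀
      w = + N · z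
      expand : B₀ (y ⊕ w) (y ⊕ w) ≡ B₀ y y + + N * (+ 2 * B₀ y z + + N * B₀ z z)
      expand = trans (B-⊕ y w (y ⊕ w)) (trans (cong₂ _+_ (trans (B-⊕ʳ y y w) (cong (λ k → B₀ y y + k) (B-·ʳ (+ N) y z)))
        (trans (B-· (+ N) z (y ⊕ w)) (cong (+ N *_) (trans (B-⊕ʳ z y w) (cong₂ _+_ (B-comm z y) (B-·ʳ (+ N) z z)))))) (lem (+ N) (B₀ y y) (B₀ y z) (B₀ z z)))

    -- The coordinate sum 0 has no sign, since 12r divides neither r nor 5r.
    weight-𝟘 : weight 𝟘 ≡ 0ℤ
    weight-𝟘 = cong (_* 𝟙 (+ P ∣? B₀ 𝟘 𝟘 - offset)) (trans (cong (𝟙 ((2 ℕ.* r) ∣ᵥ? 𝟘 ⊖ β₀) *_) (trans (cong σ (sum-𝟘 r)) (cong₂ _-_ (𝟙-no (+ (12 ℕ.* r) ∣? 0ℤ + R) (λ d → too-small 1 (s≤s (s≤s z≤n)) (subst (+ (12 ℕ.* r) ∣_) (lem₁ R) d)))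
          (𝟙-no (+ (12 ℕ.* r) ∣? 0ℤ - + 5 * R) (λ d → too-small 5 (s≤s (s≤s (s≤s (s≤s (s≤s (s≤s z≤n)))))) (subst (+ (12 ℕ.* r) ∣_) (lem₂ R) (∣m⇒∣-m d)))))))
        (*-zeroʳ (𝟙 ((2 ℕ.* r) ∣ᵥ? 𝟘 ⊖ β₀))))
      where
      sum-𝟘 : ∀ k → sumᵥ (𝟘 {k}) ≡ 0ℤ
      sum-𝟘 zero    = refl
      sum-𝟘 (suc k) = trans (+-identityˡ _) (sum-𝟘 k)
      lem₁ : ∀ R → 0ℤ + R ≡ + 1 * R
      lem₁ = solve-∀
      lem₂ : ∀ R → - (0ℤ - + 5 * R) ≡ + 5 * R
      lem₂ = solve-∀
      too-small : ∀ k → k ℕ.< 12 → {{ℕ.NonZero k}} → ¬ + (12 ℕ.* r) ∣ + k * R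
      too-small k k<12 {{k≢0}} d = ℕ.<⇒≱ (ℕ.*-monoˡ-< r {{ℕ.>-nonZero 1≤r}} k<12) (ℕ.∣⇒≤ {{ℕ.m*n≢0 k r {{k≢0}} {{ℕ.>-nonZero 1≤r}}}} (∣⇒∣ᵤ (subst (+ (12 ℕ.* r) ∣_) (sym (pos-* k r)) d)))

-- Extending a weight to an orthogonal sum.

module Copies where

  open import Data.Nat as ℕ using (ℕ; zero; suc; z≤n)
  import Data.Nat.Properties as ℕ
  import Data.Nat.Divisibility as ℕ
  open import Data.Integer hiding (suc; _⊖_)
  open import Data.Integer.Properties
  open import Data.Integer.Divisibility.Signed
  open import Data.Integer.Tactic.RingSolver using (solve-∀)
  open import Data.Vec using (Vec; []; _∷_; take; drop; _++_)
  open import Data.Vec.Properties using (take-zipWith; take-map; drop-zipWith; drop-map)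
  open import Data.Vec.Relation.Unary.All using ([]; _∷_)
  open import Data.Product using (_×_; _,_; proj₁; proj₂; ∃)
  open import Relation.Nullary
  open import Relation.Binary.PropositionalEquality
  open Sums
  open Vectors
  open ModPrime
  open Frames using (Bounded; Form)
  open OrthSum
  open Weight

  take-++ : ∀ {A : Set} m {n} (x : Vec A m) (y : Vec A n) → take m (x ++ y) ≡ x
  take-++ zero    []      y = refl
  take-++ (suc m) (a ∷ x) y = cong (a ∷_) (take-++ m x y)

  drop-++ : ∀ {A : Set} m {n} (x : Vec A m) (y : Vec A n) → drop m (x ++ y) ≡ y
  drop-++ zero    []      y = refl
  drop-++ (suc m) (a ∷ x) y = drop-++ m x y

  𝟘-++ : ∀ m {n} → 𝟘 {m} ++ 𝟘 {n} ≡ 𝟘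
  𝟘-++ zero    = refl
  𝟘-++ (suc m) = cong (0ℤ ∷_) (𝟘-++ m)

  ∣ᵥ-bounded : ∀ {N n m} → n ℕ.< N → (x : Vec ℤ m) → N ∣ᵥ x → Bounded n x → x ≡ 𝟘
  ∣ᵥ-bounded n<N []      []       []       = refl
  ∣ᵥ-bounded {N} {n} n<N (a ∷ x) (d ∷ ds) (p ∷ ps) = cong₂ _∷_ (∣i∣≡0⇒i≡0 (zero? ∣ a ∣ p (∣⇒∣ᵤ d))) (∣ᵥ-bounded n<N x ds ps)
    where
    zero? : ∀ a → a ℕ.≤ n → N ℕ.∣ a → a ≡ 0
    zero? zero    _  _ = refl
    zero? (suc a) le d = contradiction (ℕ.∣⇒≤ d) (ℕ.<⇒≱ (ℕ.≤-<-trans le n<N))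

  ∣ᵥ-cancel : ∀ {N m} D D′ → + N ∣ D * D′ - 1ℤ → (x : Vec ℤ m) → N ∣ᵥ D · x → N ∣ᵥ x
  ∣ᵥ-cancel D D′ inv []      []       = []
  ∣ᵥ-cancel D D′ inv (a ∷ x) (d ∷ ds) = ∣-lin₂ D′ (- a) d inv (lem D D′ a) ∷ ∣ᵥ-cancel D D′ inv x ds
    where
    lem : ∀ D D′ a → a ≡ D′ * (D * a) + - a * (D * D′ - 1ℤ)
    lem = solve-∀

  ∣ᵥ-𝟘 : ∀ {N} m → N ∣ᵥ 𝟘 {m}
  ∣ᵥ-𝟘 zero    = []
  ∣ᵥ-𝟘 (suc m) = divides 0ℤ refl ∷ ∣ᵥ-𝟘 m

  𝟙ᵥ-periodic : ∀ N {m} (x y : Vec ℤ m) → 𝟙 (N ∣ᵥ? x ⊕ + N · y) ≡ 𝟙 (N ∣ᵥ? x)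
  𝟙ᵥ-periodic N x y = 𝟙-⇔ (N ∣ᵥ? x ⊕ + N · y) (N ∣ᵥ? x) (back x y) (λ h → ∣ᵥ-⊕ h (∣ᵥ-scaled {k = + N} y ∣-refl))
    where
    back : ∀ {m} (x y : Vec ℤ m) → N ∣ᵥ x ⊕ + N · y → N ∣ᵥ x
    back []      []      []       = []
    back (a ∷ x) (b ∷ y) (d ∷ ds) = ∣m+n∣n⇒∣m d (∣m⇒∣m*n {+ N} {+ N} b ∣-refl) ∷ back x y ds

  module Extended {a b : ℕ} (N : ℕ) (w : Vec ℤ a → ℤ) where

    -- The new component is confined to multiples of N: this keeps the weight periodic modulo N and
    -- removes all short vectors except those with second component 𝟘.
    extend : Vec ℤ (a ℕ.+ b) → ℤ
    extend x = w (take a x) * 𝟙 (N ∣ᵥ? drop a x)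

    extend-periodic : (∀ x y → w (x ⊕ + N · y) ≡ w x) → ∀ x y → extend (x ⊕ + N · y) ≡ extend x
    extend-periodic per x y = cong₂ _*_
      (trans (cong w (trans (take-zipWith _+_ x (+ N · y)) (cong (take a x ⊕_) (take-map (+ N *_) a y)))) (per (take a x) (take a y)))
      (trans (cong (λ z → 𝟙 (N ∣ᵥ? z)) (trans (drop-zipWith _+_ x (+ N · y)) (cong (drop a x ⊕_) (drop-map (+ N *_) a y)))) (𝟙ᵥ-periodic N (drop a x) (drop a y)))

    extend-𝟘 : w 𝟘 ≡ 0ℤ → extend 𝟘 ≡ 0ℤ
    extend-𝟘 w0 = cong (_* 𝟙 (N ∣ᵥ? drop a (𝟘 {a ℕ.+ b}))) (trans (cong w (trans (cong (take a) (sym (𝟘-++ a))) (take-++ a 𝟘 (𝟘 {b})))) w0)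

    extend-++ : ∀ x y → extend (x ++ y) ≡ w x * 𝟙 (N ∣ᵥ? y)
    extend-++ x y = cong₂ (λ u v → w u * 𝟙 (N ∣ᵥ? v)) (take-++ a x y) (drop-++ a x y)

  ·-++ : ∀ {a b} k (x : Vec ℤ a) (y : Vec ℤ b) → k · (x ++ y) ≡ k · x ++ k · y
  ·-++ k []      y = refl
  ·-++ k (c ∷ x) y = cong (k * c ∷_) (·-++ k x y)

  module ExtendedSeries {a b : ℕ} (F : Form a) (G : Form b) (N : ℕ) (w : Vec ℤ a → ℤ) where
    private
      module F = Form F
      module G = Form G
      module S = Form (F ⊞ᶠ G)
    open Extended {a} {b} N w

    B-++ : ∀ x y → S.B (x ++ y) (x ++ y) ≡ F.B x x + G.B y y
    B-++ x y = cong₂ (λ u v → F.B u u + G.B v v) (take-++ a x y) (drop-++ a x y)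

    module _ (D : ℤ) (n : ℕ) where

      term : Vec ℤ (a ℕ.+ b) → ℤ
      term x = 𝟙 (S.B x x ≟ + n) * extend (D · x)

      term-++ : ∀ x y → term (x ++ y) ≡ 𝟙 (F.B x x + G.B y y ≟ + n) * (w (D · x) * 𝟙 (N ∣ᵥ? D · y))
      term-++ x y = cong₂ _*_ (cong (λ z → 𝟙 (z ≟ + n)) (B-++ x y)) (trans (cong extend (·-++ D x y)) (extend-++ (D · x) (D · y)))

      -- only the vectors with vanishing second component are short enough
      restrict : ∀ D′ → + N ∣ D * D′ - 1ℤ → n ℕ.< N →
        ∑ (box n (a ℕ.+ b)) term ≡ ∑[ x ∈ box n a ] (𝟙 (F.B x x ≟ + n) * w (D · x))
      restrict D′ inv n<N = trans (∑-box-++ n a b term) (∑-cong (box n a) inner)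
        where
        inner : ∀ x → ∑[ y ∈ box n b ] term (x ++ y) ≡ 𝟙 (F.B x x ≟ + n) * w (D · x)
        inner x = trans (V.∑-only 𝟘 (box n b) {λ y → term (x ++ y)} (box-∈! n 𝟘 (zeros b)) only) value
          where
          zeros : ∀ m → Bounded n (𝟘 {m})
          zeros zero    = []
          zeros (suc m) = z≤n ∷ zeros m
          value : term (x ++ 𝟘) ≡ 𝟙 (F.B x x ≟ + n) * w (D · x)
          value = trans (term-++ x 𝟘) (cong₂ (λ z k → 𝟙 (z ≟ + n) * k) (trans (cong (λ z → F.B x x + z) (G.B𝟘 𝟘)) (+-identityʳ (F.B x x)))
            (trans (cong (w (D · x) *_) (𝟙-yes (N ∣ᵥ? D · 𝟘) (subst (N ∣ᵥ_) (sym (·𝟘 b D)) (∣ᵥ-𝟘 b)))) (*-identityʳ (w (D · x)))))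
          only : ∀ y → term (x ++ y) ≢ 0ℤ → y ≡ 𝟘
          only y ne = ∣ᵥ-bounded n<N y (∣ᵥ-cancel D D′ inv y N∣Dy) (Bounded-mono k≤n (G.coercive {k} y eG))
            where
            hyp : (F.B x x + G.B y y ≡ + n) × w (D · x) * 𝟙 (N ∣ᵥ? D · y) ≢ 0ℤ
            hyp = 𝟙*≢0 (F.B x x + G.B y y ≟ + n) (w (D · x) * 𝟙 (N ∣ᵥ? D · y)) (λ e → ne (trans (term-++ x y) e))
            N∣Dy : N ∣ᵥ D · y
            N∣Dy = proj₁ (𝟙*≢0 (N ∣ᵥ? D · y) (w (D · x)) (λ e → proj₂ hyp (trans (*-comm (w (D · x)) (𝟙 (N ∣ᵥ? D · y))) e)))
            bound : ∃ λ k → G.B y y ≡ + k × k ℕ.≤ n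
            bound = proj₂ (summand≤ (F.B x x) (G.B y y) (F.nonneg x) (G.nonneg y) (proj₁ hyp))
            k = proj₁ bound
            eG = proj₁ (proj₂ bound)
            k≤n = proj₂ (proj₂ bound)

    -- Grouping by the second component y, some y must contribute a sum that is not divisible by ℓ.
    -- That sum is a coefficient of the first form at the level M = n - G(y, y), which cannot be
    -- negative.
    visible-component : ∀ {ℓ} n n₀ → n ℕ.≤ n₀ → ¬ + ℓ ∣ ∑[ x ∈ box n₀ (a ℕ.+ b) ] (𝟙 (S.B x x ≟ + n) * extend x) →
      ∃ λ M → M ℕ.≤ n × ¬ + ℓ ∣ ∑[ x ∈ box n₀ a ] (𝟙 (F.B x x ≟ + M) * w x)
    visible-component {ℓ} n n₀ n≤n₀ h = from-y (∑-nonzero (box n₀ b) (+ ℓ ∣_) (+ ℓ ∣?_) zero-∣ ∣m∣n⇒∣m+n (λ d → h (subst (+ ℓ ∣_) (sym (trans (∑-box-++ n₀ a b f) (∑-swap (box n₀ a) (box n₀ b) (λ x y → f (x ++ y))))) d)))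
      where
      zero-∣ : + ℓ ∣ 0ℤ
      zero-∣ = divides 0ℤ refl
      f : Vec ℤ (a ℕ.+ b) → ℤ
      f x = 𝟙 (S.B x x ≟ + n) * extend x
      f-++ : ∀ x y → f (x ++ y) ≡ 𝟙 (F.B x x + G.B y y ≟ + n) * (w x * 𝟙 (N ∣ᵥ? y))
      f-++ x y = cong₂ _*_ (cong (λ z → 𝟙 (z ≟ + n)) (B-++ x y)) (extend-++ x y)
      from-y : (∃ λ y → ¬ + ℓ ∣ ∑[ x ∈ box n₀ a ] f (x ++ y)) → ∃ λ M → M ℕ.≤ n × ¬ + ℓ ∣ ∑[ x ∈ box n₀ a ] (𝟙 (F.B x x ≟ + M) * w x)
      from-y (y , hy) = level (+ n - G.B y y) refl
        where
        lem₁ : ∀ a b c → a + b ≡ c → a ≡ c - b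
        lem₁ a b c refl = lem a b
          where
          lem : ∀ a b → a ≡ a + b - b
          lem = solve-∀
        lem₂ : ∀ a b c → a ≡ c - b → a + b ≡ c
        lem₂ a b c refl = lem b c
          where
          lem : ∀ b c → c - b + b ≡ c
          lem = solve-∀
        level : ∀ M → M ≡ + n - G.B y y → ∃ λ M → M ℕ.≤ n × ¬ + ℓ ∣ ∑[ x ∈ box n₀ a ] (𝟙 (F.B x x ≟ + M) * w x)
        level -[1+ k ] eM = contradiction (subst (+ ℓ ∣_) (sym (∑-all0 (box n₀ a) {λ x → f (x ++ y)} (λ x → trans (f-++ x y)
          (𝟙*-no (F.B x x + G.B y y ≟ + n) (w x * 𝟙 (N ∣ᵥ? y)) (λ e → non-negative x (trans (lem₁ (F.B x x) (G.B y y) (+ n) e) (sym eM))))))) zero-∣) hy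
          where
          non-negative : ∀ x → F.B x x ≢ -[1+ k ]
          non-negative x e = contradiction (subst (0ℤ ≤_) e (F.nonneg x)) λ ()
        level (+ M) eM = M , M≤n , λ d → hy (subst (+ ℓ ∣_) (sym sum≡) (∣m⇒∣m*n (𝟙 (N ∣ᵥ? y)) d))
          where
          M≤n : M ℕ.≤ n
          M≤n = drop‿+≤+ (subst₂ _≤_ (sym eM) (+-identityʳ (+ n)) (+-monoʳ-≤ (+ n) (neg-mono-≤ (G.nonneg y))))
          lem : ∀ a b c → a * (b * c) ≡ a * b * c
          lem = solve-∀
          sum≡ : ∑[ x ∈ box n₀ a ] f (x ++ y) ≡ ∑[ x ∈ box n₀ a ] (𝟙 (F.B x x ≟ + M) * w x) * 𝟙 (N ∣ᵥ? y)
          sum≡ = trans (∑-cong (box n₀ a) (λ x → trans (f-++ x y) (trans (cong (_* (w x * 𝟙 (N ∣ᵥ? y))) (𝟙-⇔ (F.B x x + G.B y y ≟ + n) (F.B x x ≟ + M)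
              (λ e → trans (lem₁ (F.B x x) (G.B y y) (+ n) e) (sym eM)) (λ e → lem₂ (F.B x x) (G.B y y) (+ n) (trans e eM)))) (lem (𝟙 (F.B x x ≟ + M)) (w x) (𝟙 (N ∣ᵥ? y))))))
            (∑-*ʳ (box n₀ a) (𝟙 (N ∣ᵥ? y)) (λ x → 𝟙 (F.B x x ≟ + M) * w x))

-- The Hecke argument applied to four copies.

module Fourfold where

  open import Data.Nat as ℕ using (ℕ; suc)
  import Data.Nat.Properties as ℕ
  open import Data.Nat.Primality using (Prime)
  open import Data.Nat.ListAction using (product)
  open import Data.Integer hiding (suc; _⊖_)
  open import Data.Integer.Divisibility.Signed
  open import Data.List using (List)
  open import Data.List.Relation.Unary.All using () renaming (All to AllL; map to mapL)
  open import Data.Vec using (Vec)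
  open import Data.Product using (_×_; _,_; ∃)
  open import Relation.Nullary
  open import Relation.Binary.PropositionalEquality
  open Sums
  open Vectors
  open Frames using (Form)
  open Hecke using (module Principle; Hyperbolic)
  open OrthSum using (_⊞ᶠ_; module FourCopies)
  open Copies

  module Conjugation {r : ℕ} (1≤r : 1 ℕ.≤ r) (F : Form r) (N : ℕ) .{{N≢0 : ℕ.NonZero N}} {ℓ : ℕ} (ℓ-prime : Prime ℓ)
    (G : Vec ℤ r → Vec ℤ r) (G-⊕ : ∀ x y → G (x ⊕ y) ≡ G x ⊕ G y) (G-· : ∀ k x → G (k · x) ≡ k · G x)
    (G-B : ∀ x y → ⟨ x , G y ⟩ ≡ Form.B F x y)
    (K : ℕ) (G-faithful : ∀ {p} → Prime p → K ℕ.< p → ∀ y → p ∣ᵥ G y → p ∣ᵥ y)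
    (w : Vec ℤ r → ℤ) (w-periodic : ∀ x y → w (x ⊕ + N · y) ≡ w x) (w-𝟘 : w 𝟘 ≡ 0ℤ) where
    open Form F

    -- The level n < N is part of the requirement: it is what lets the coefficient survive the
    -- passage to four copies.
    Conjugate : ℕ → Set
    Conjugate Y = ∃ λ ps → AllL (λ p → Prime p × Y ℕ.< p) ps × (∃ λ D′ → + N ∣ + product ps * D′ - 1ℤ) ×
      ∃ λ n → n ℕ.< N × ¬ + ℓ ∣ ∑[ x ∈ box n r ] (𝟙 (B x x ≟ + n) * w (+ product ps · x))

    private
      two : Form (r ℕ.+ r)
      two = F ⊞ᶠ F
      open FourCopies F using (four; hyperbolic)
      module Inner = Extended {r} {r} N w
      module Outer = Extended {r ℕ.+ r} {r ℕ.+ r} N Inner.extend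
      module Inner′ = ExtendedSeries F F N w
      module Outer′ = ExtendedSeries two two N Inner.extend

      dimension : ℕ
      dimension = (r ℕ.+ r) ℕ.+ (r ℕ.+ r)

      periodic : ∀ x y → Outer.extend (x ⊕ + N · y) ≡ Outer.extend x
      periodic = Outer.extend-periodic (Inner.extend-periodic w-periodic)

      vanishes : Outer.extend 𝟘 ≡ 0ℤ
      vanishes = Outer.extend-𝟘 (Inner.extend-𝟘 w-𝟘)

      twisted : List ℕ → ℕ → ℤ
      twisted ps n = ∑ (box n dimension) (Outer′.term (+ product ps) n)

      twisted-value : ∀ ps n → n ℕ.< N → (∃ λ D′ → + N ∣ + product ps * D′ - 1ℤ) → twisted ps n ≡ ∑[ x ∈ box n r ] (𝟙 (B x x ≟ + n) * w (+ product ps · x))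
      twisted-value ps n n<N (D′ , inv) = trans (Outer′.restrict (+ product ps) n D′ inv n<N) (Inner′.restrict (+ product ps) n D′ inv n<N)

      plain : ℕ → ℤ
      plain n = ∑[ x ∈ box n dimension ] (𝟙 (Form.B four x x ≟ + n) * Outer.extend x)

      principle : (∀ Y → ∃ λ ps → AllL (λ p → Prime p × 2 ℕ.< p × ℓ ≢ p × Hyperbolic four p (r ℕ.+ r) × Y ℕ.< p) ps × ∃ λ n → ¬ + ℓ ∣ twisted ps n) → ∃ λ n → ¬ + ℓ ∣ plain n
      principle = at 1≤r four Outer.extend periodic vanishes
        where
        at : ∀ {r} → 1 ℕ.≤ r → (Φ : Form ((r ℕ.+ r) ℕ.+ (r ℕ.+ r))) (c : Vec ℤ ((r ℕ.+ r) ℕ.+ (r ℕ.+ r)) → ℤ) → (∀ x y → c (x ⊕ + N · y) ≡ c x) → c 𝟘 ≡ 0ℤ →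
          (∀ Y → ∃ λ ps → AllL (λ p → Prime p × 2 ℕ.< p × ℓ ≢ p × Hyperbolic Φ p (r ℕ.+ r) × Y ℕ.< p) ps × ∃ λ n → ¬ + ℓ ∣ ∑[ x ∈ box n ((r ℕ.+ r) ℕ.+ (r ℕ.+ r)) ] (𝟙 (Form.B Φ x x ≟ + n) * c (+ product ps · x))) →
          ∃ λ n → ¬ + ℓ ∣ ∑[ x ∈ box n ((r ℕ.+ r) ℕ.+ (r ℕ.+ r)) ] (𝟙 (Form.B Φ x x ≟ + n) * c x)
        at {suc r′} _ Φ c = visible c
          where open Principle {r′ ℕ.+ suc r′} Φ N ℓ-prime

    visible-from-conjugates : (∀ Y → Conjugate Y) → ∃ λ n → ∃ λ M → M ℕ.≤ n × ¬ + ℓ ∣ ∑[ x ∈ box n r ] (𝟙 (B x x ≟ + M) * w x)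
    visible-from-conjugates conjugate = descend (principle lift)
      where
      lift : ∀ Y → ∃ λ ps → AllL (λ p → Prime p × 2 ℕ.< p × ℓ ≢ p × Hyperbolic four p (r ℕ.+ r) × Y ℕ.< p) ps × ∃ λ n → ¬ + ℓ ∣ twisted ps n
      lift Y = from (conjugate Y′)
        where
        Y′ : ℕ
        -- Primes above this bound are odd, different from ℓ, large enough for the Gram map to be
        -- faithful, and larger than Y.
        Y′ = Y ℕ.+ (2 ℕ.+ (ℓ ℕ.+ K))
        admissible : ∀ {p} → Prime p × Y′ ℕ.< p → Prime p × 2 ℕ.< p × ℓ ≢ p × Hyperbolic four p (r ℕ.+ r) × Y ℕ.< p
        admissible {p} (pp , Y′<p) = pp , 2<p , (λ ℓ≡p → ℕ.<⇒≢ (ℕ.≤-<-trans (ℕ.m≤m+n ℓ K) tail₂<p) ℓ≡p) ,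
            hyperbolic G G-⊕ G-· G-B pp 2<p (G-faithful pp (ℕ.≤-<-trans (ℕ.m≤n+m K ℓ) tail₂<p)) , ℕ.≤-<-trans (ℕ.m≤m+n Y _) Y′<p
          where
          tail₁<p : 2 ℕ.+ (ℓ ℕ.+ K) ℕ.< p
          tail₁<p = ℕ.≤-<-trans (ℕ.m≤n+m (2 ℕ.+ (ℓ ℕ.+ K)) Y) Y′<p
          2<p : 2 ℕ.< p
          2<p = ℕ.≤-<-trans (ℕ.m≤m+n 2 (ℓ ℕ.+ K)) tail₁<p
          tail₂<p : ℓ ℕ.+ K ℕ.< p
          tail₂<p = ℕ.≤-<-trans (ℕ.m≤n+m (ℓ ℕ.+ K) 2) tail₁<p
        from : Conjugate Y′ → _
        from (ps , large , inv , n , n<N , n∤) = ps , mapL admissible large , n , λ d → n∤ (subst (+ ℓ ∣_) (twisted-value ps n n<N inv) d)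
      descend : (∃ λ n → ¬ + ℓ ∣ plain n) → ∃ λ n → ∃ λ M → M ℕ.≤ n × ¬ + ℓ ∣ ∑[ x ∈ box n r ] (𝟙 (B x x ≟ + M) * w x)
      descend (n , n∤) = inner (Outer′.visible-component n n ℕ.≤-refl n∤)
        where
        inner : (∃ λ n₁ → n₁ ℕ.≤ n × ¬ + ℓ ∣ ∑[ x ∈ box n (r ℕ.+ r) ] (𝟙 (Form.B two x x ≟ + n₁) * Inner.extend x)) → _
        inner (n₁ , n₁≤n , h) = wrap (Inner′.visible-component n₁ n n₁≤n h)
          where
          wrap : (∃ λ M → M ℕ.≤ n₁ × ¬ + ℓ ∣ ∑[ x ∈ box n r ] (𝟙 (B x x ≟ + M) * w x)) → ∃ λ n → ∃ λ M → M ℕ.≤ n × ¬ + ℓ ∣ ∑[ x ∈ box n r ] (𝟙 (B x x ≟ + M) * w x)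
          wrap (M , M≤n₁ , h) = n , M , ℕ.≤-trans M≤n₁ n₁≤n , h

-- The multiplier D carries the level `q₀` into the section of s.

module Nonvanishing where

  open import Defs
  open import Data.Nat as ℕ using (ℕ; _∸_; s≤s; z≤n)
  import Data.Nat.Properties as ℕ
  import Data.Nat.Divisibility as ℕ
  open import Data.Nat.Primality using (Prime)
  open import Data.Nat.Coprimality using (Coprime)
  import Data.Nat.Coprimality as Coprime
  open import Data.Nat.ListAction using (product)
  open import Data.Integer hiding (suc; _⊖_)
  open import Data.Integer.Properties
  open import Data.Integer.Divisibility.Signed
  open import Data.Integer.Divisibility using () renaming (_∣_ to _∣ᵤ_)
  open import Data.Integer.Tactic.RingSolver using (solve-∀)
  import Data.Nat.Tactic.RingSolver as ℕ
  open import Data.Product using (_×_; _,_; proj₁; proj₂; ∃)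
  open import Data.Sum using (_⊎_; inj₁; inj₂)
  open import Relation.Nullary
  open import Relation.Binary.PropositionalEquality
  open LinDep using (PrimeIdeal)
  open Sums
  open Vectors
  open ModPrime
  open Frames using (Form)
  open Section using (theta-count-q₀; section-visible)
  open Evaluate using (q₀-nonneg)
  open Arith
  open Twist using (module Residues)
  open Weight
  open Fourfold using (module Conjugation)

  Coprime-* : ∀ {n a c} → Coprime n a → Coprime n c → Coprime n (a ℕ.* c)
  Coprime-* {n} {a} {c} ca cc {i} (i∣n , i∣ac) = cc (i∣n , Coprime.coprime-divisor {i} {a} {c} (λ { (j∣i , j∣a) → ca (ℕ.∣-trans j∣i i∣n , j∣a) }) i∣ac)

  module Assembly {ℓ : ℕ} (ℓ-prime : Prime ℓ) (t r : ℕ) (1≤r : 1 ℕ.≤ r) (2≤t : 2 ℕ.≤ t) (s : ℕ) (s<r : s ℕ.< r) (d : ℤ)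
    (coprime : Coprime ∣ d ∣ (6 ℕ.* t ℕ.* r)) (index : + r ∣ᵤ + s - + (t ∸ 1) * dTerm d) where

    private
      R T τ : ℤ
      R = + r
      T = + t
      τ = dTerm d
      1≤t : 1 ℕ.≤ t
      1≤t = ℕ.≤-trans (s≤s z≤n) 2≤t

    open Quadratic r t 1≤r 2≤t
    open SectionWeight r t 1≤r 2≤t s
    private
      n : ℕ
      n = ∣ q₀ ∣

      n≡ : + n ≡ q₀
      n≡ = 0≤i⇒+∣i∣≡i (q₀-nonneg r t 1≤r 2≤t)

      T-1 : T - 1ℤ ≡ + (t ∸ 1)
      T-1 = trans (cong (_- 1ℤ) (trans (cong +_ (sym (ℕ.m+[n∸m]≡n 1≤t))) (pos-+ 1 (t ∸ 1)))) (lem (+ (t ∸ 1)))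
        where
        lem : ∀ a → 1ℤ + a - 1ℤ ≡ a
        lem = solve-∀

      X : ℕ
      X = r ℕ.* r ℕ.* (r ℕ.* r ℕ.* t)

      1≤X : 1 ℕ.≤ X
      1≤X = ℕ.*-mono-≤ {1} {r ℕ.* r} {1} {r ℕ.* r ℕ.* t} (ℕ.*-mono-≤ 1≤r 1≤r) (ℕ.*-mono-≤ {1} {r ℕ.* r} {1} {t} (ℕ.*-mono-≤ 1≤r 1≤r) 1≤t)

      N≡ : N ≡ 24 ℕ.* X
      N≡ = lem r t
        where
        lem : ∀ r t → 24 ℕ.* (r ℕ.* r ℕ.* r) ℕ.* (r ℕ.* t) ≡ 24 ℕ.* (r ℕ.* r ℕ.* (r ℕ.* r ℕ.* t))
        lem = ℕ.solve-∀

      -- With a = r², `q₀` = a(a + t - 1) is at most a · a t, which is N / 24.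
      n<N : n ℕ.< N
      n<N = ℕ.≤-<-trans n≤X (subst (X ℕ.<_) (trans (ℕ.*-comm X 24) (sym N≡)) (ℕ.m<m*n X 24 {{ℕ.>-nonZero 1≤X}} (s≤s (s≤s z≤n))))
        where
        a = r ℕ.* r
        t′ = t ∸ 1
        n-nat : n ≡ a ℕ.* (a ℕ.+ t′)
        n-nat = +-injective (trans n≡ (trans q₀-value (trans (trans (cong (R * R *_) (trans (+-assoc (R * R) T -1ℤ) (cong (λ z → R * R + z) T-1))) (cong₂ _*_ (sym (pos-* r r)) (trans (cong (_+ + t′) (sym (pos-* r r))) (sym (pos-+ a t′))))) (sym (pos-* a (a ℕ.+ t′))))))
        grow : a ℕ.+ t′ ℕ.≤ a ℕ.* t
        grow = ℕ.≤-trans (ℕ.+-monoʳ-≤ a (ℕ.m≤n*m t′ a {{ℕ.m*n≢0 r r {{ℕ.>-nonZero 1≤r}} {{ℕ.>-nonZero 1≤r}}}})) (ℕ.≤-reflexive (trans (sym (ℕ.*-suc a t′)) (cong (a ℕ.*_) (ℕ.m+[n∸m]≡n 1≤t))))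
        n≤X : n ℕ.≤ X
        n≤X = ℕ.≤-trans (ℕ.≤-reflexive n-nat) (ℕ.*-monoʳ-≤ a grow)

      2≤N : 2 ℕ.≤ N
      2≤N = ℕ.≤-trans (ℕ.*-mono-≤ {2} {24} {1} {X} (s≤s (s≤s z≤n)) 1≤X) (ℕ.≤-reflexive (sym N≡))

      6∣N : 6 ℕ.∣ N
      6∣N = ℕ.∣-trans (ℕ.divides 4 refl) (subst (24 ℕ.∣_) (sym N≡) (ℕ.m∣m*n X))

      instance
        N≢0 : ℕ.NonZero N
        N≢0 = ℕ.>-nonZero (ℕ.≤-trans (s≤s z≤n) 2≤N)

      part : ∀ {k} → k ℕ.∣ 6 ℕ.* t ℕ.* r → Coprime ∣ d ∣ k
      part k∣ {i} (i∣d , i∣k) = coprime (i∣d , ℕ.∣-trans i∣k k∣)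

      coprime-N : Coprime ∣ d ∣ N
      coprime-N {i} = Coprime-* {∣ d ∣} {P} {r ℕ.* t} (λ {i} → Coprime-* {∣ d ∣} {24} {r ℕ.* r ℕ.* r} (λ {i} → c24 {i}) (λ {i} → Coprime-* {∣ d ∣} {r ℕ.* r} {r} (λ {i} → Coprime-* {∣ d ∣} {r} {r} (λ {i} → cr {i}) (λ {i} → cr {i}) {i}) (λ {i} → cr {i}) {i}) {i}) (λ {i} → part {r ℕ.* t} (ℕ.divides 6 (lem r t)) {i}) {i}
        where
        lem : ∀ r t → 6 ℕ.* t ℕ.* r ≡ 6 ℕ.* (r ℕ.* t)
        lem = ℕ.solve-∀
        cr : Coprime ∣ d ∣ r
        cr {i} = part {r} (ℕ.n∣m*n (6 ℕ.* t)) {i}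
        c6 : Coprime ∣ d ∣ 6
        c6 {i} = part {6} (ℕ.∣-trans (ℕ.m∣m*n t) (ℕ.m∣m*n r)) {i}
        c2 : Coprime ∣ d ∣ 4
        c2 {i} = Coprime-* {∣ d ∣} {2} {2} (λ {i} x → c6 {i} (proj₁ x , ℕ.∣-trans (proj₂ x) (ℕ.divides 3 refl))) (λ {i} x → c6 {i} (proj₁ x , ℕ.∣-trans (proj₂ x) (ℕ.divides 3 refl))) {i}
        c24 : Coprime ∣ d ∣ 24
        c24 {i} = Coprime-* {∣ d ∣} {6} {4} (λ {i} → c6 {i}) (λ {i} → c2 {i}) {i}

      d²≡ : d * d - 1ℤ ≡ + 24 * τ
      d²≡ = dTerm-exact d (coprime⇒∤ {∣ d ∣} {N} {2} (λ {i} → coprime-N {i}) (ℕ.∣-trans (ℕ.divides 3 refl) 6∣N) λ ()) (coprime⇒∤ {∣ d ∣} {N} {3} (λ {i} → coprime-N {i}) (ℕ.∣-trans (ℕ.divides 2 refl) 6∣N) λ ())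

      congruent-to-±d : Representative N d
      congruent-to-±d = representative N d (ℕ.≤-trans (s≤s z≤n) 2≤N) 6∣N (λ {i} → coprime-N {i})

      open Representative congruent-to-±d renaming (coprime to e-coprime)

      P≡ : + P ≡ + 24 * (R * R * R)
      P≡ = trans (pos-* 24 (r ℕ.* r ℕ.* r)) (cong (+ 24 *_) (trans (pos-* (r ℕ.* r) r) (cong (_* R) (pos-* r r))))

      -- The norm of D · y is D²q₀, and D² ≡ 1 + 24τ modulo N. Since q₀ = r²(r² + t - 1), modulo
      -- 24r³ this is q₀ + 24r²(t - 1)τ, and (t - 1)τ ≡ s modulo r. So every y of norm q₀ meets the
      -- section condition after scaling.
      section-weight : ∀ (D u v : ℤ) → D * D - d * d ≡ u * + N → + s - + (t ∸ 1) * τ ≡ v * R → ∀ y → B₀ y y ≡ + n → weight (D · y) ≡ character (D · y)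
      section-weight D u v eu ev y e = trans (cong (character (D · y) *_) (𝟙-yes (+ P ∣? B₀ (D · y) (D · y) - offset) (divides (u * (R * T) * q₀ + (τ * R - v)) difference))) (*-identityʳ (character (D · y)))
        where
        open Form form using (B-·; B-·ʳ)
        scaled : B₀ (D · y) (D · y) ≡ D * (D * q₀)
        scaled = trans (B-· D y (D · y)) (cong (D *_) (trans (B-·ʳ D y y) (cong (D *_) (trans e n≡))))
        D²≡ : D * D - 1ℤ ≡ u * (+ 24 * (R * R * R) * (R * T)) + + 24 * τ
        D²≡ = trans (lem (D * D) (d * d)) (cong₂ _+_ (trans eu (cong (u *_) (trans (pos-* P (r ℕ.* t)) (cong₂ _*_ P≡ (pos-* r t))))) d²≡)
          where
          lem : ∀ a b → a - 1ℤ ≡ a - b + (b - 1ℤ)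
          lem = solve-∀
        s≡ : + s ≡ v * R + (T - 1ℤ) * τ
        s≡ = trans (lem (+ s) (+ (t ∸ 1) * τ)) (cong₂ (λ a b → a + b * τ) ev (sym T-1))
          where
          lem : ∀ s a → s ≡ s - a + a
          lem = solve-∀
        difference : B₀ (D · y) (D · y) - offset ≡ (u * (R * T) * q₀ + (τ * R - v)) * + P
        difference = trans (cong (_- offset) scaled) (trans (lem₁ D q₀ (+ 24 * (R * R) * + s)) (trans (cong₂ (λ a b → a * q₀ - + 24 * (R * R) * b) D²≡ s≡)
          (trans (lem₂ u R T q₀ τ v) (trans (cong (λ q → u * (+ 24 * (R * R * R) * (R * T)) * q₀ + + 24 * τ * q - + 24 * (R * R) * (v * R + (T - 1ℤ) * τ)) q₀-value)
            (trans (lem₃ u R T q₀ τ v) (cong ((u * (R * T) * q₀ + (τ * R - v)) *_) (sym P≡)))))))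
          where
          lem₁ : ∀ D q c → D * (D * q) - (q + c) ≡ (D * D - 1ℤ) * q - c
          lem₁ = solve-∀
          lem₂ : ∀ u R T q τ v → (u * (+ 24 * (R * R * R) * (R * T)) + + 24 * τ) * q - + 24 * (R * R) * (v * R + (T - 1ℤ) * τ) ≡
            u * (+ 24 * (R * R * R) * (R * T)) * q + + 24 * τ * q - + 24 * (R * R) * (v * R + (T - 1ℤ) * τ)
          lem₂ = solve-∀
          lem₃ : ∀ u R T q τ v → u * (+ 24 * (R * R * R) * (R * T)) * q + + 24 * τ * (R * R * (R * R + T - 1ℤ)) - + 24 * (R * R) * (v * R + (T - 1ℤ) * τ) ≡
            (u * (R * T) * q + (τ * R - v)) * (+ 24 * (R * R * R))
          lem₃ = solve-∀

      module _ (D : ℕ) (D≡e : + N ∣ + D - + e) where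

        inverse-mod-N : ∃ λ D′ → + N ∣ + D * D′ - 1ℤ
        inverse-mod-N = from (coprime-inverse {N} (+ e) (λ {i} → Coprime.sym (λ {i} → e-coprime {i}) {i}))
          where
          lem : ∀ D e e′ → D * e′ - 1ℤ ≡ e′ * (D - e) + 1ℤ * (e * e′ - 1ℤ)
          lem = solve-∀
          from : (∃ λ e′ → + N ∣ + e * e′ - 1ℤ) → ∃ λ D′ → + N ∣ + D * D′ - 1ℤ
          from (e′ , inv) = e′ , ∣-lin₂ e′ 1ℤ D≡e inv (lem (+ D) (+ e) e′)

        D-one : + 6 ∣ + D - 1ℤ
        D-one = ∣-lin₂ 1ℤ 1ℤ (∣-trans (∣ᵤ⇒∣ {+ 6} {+ N} 6∣N) D≡e) one (lem (+ D) (+ e))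
          where
          lem : ∀ D e → D - 1ℤ ≡ 1ℤ * (D - e) + 1ℤ * (e - 1ℤ)
          lem = solve-∀

        D-square : + N ∣ + D * + D - d * d
        D-square = ∣-lin₂ (+ D + + e) 1ℤ D≡e square (lem (+ D) (+ e) (d * d))
          where
          lem : ∀ D e c → D * D - c ≡ (D + e) * (D - e) + 1ℤ * (e * e - c)
          lem = solve-∀

        -- At level q₀ the scaled weight is the scaled character. Its sum is ± the original count,
        -- and that count is 1.
        conjugate-sum : ∃ λ ε → (ε ≡ 1ℤ ⊎ ε ≡ -1ℤ) × ∑[ y ∈ box n r ] (𝟙 (B₀ y y ≟ + n) * weight (+ D · y)) ≡ ε
        conjugate-sum = from inverse-mod-N D-square (∣ᵤ⇒∣ {R} {+ s - + (t ∸ 1) * τ} index)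
          where
          Goal : Set
          Goal = ∃ λ ε → (ε ≡ 1ℤ ⊎ ε ≡ -1ℤ) × ∑[ y ∈ box n r ] (𝟙 (B₀ y y ≟ + n) * weight (+ D · y)) ≡ ε
          from : (∃ λ D′ → + N ∣ + D * D′ - 1ℤ) → + N ∣ + D * + D - d * d → R ∣ + s - + (t ∸ 1) * τ → Goal
          from (D′ , inv) (divides u eu) (divides v ev) = finish (theta-count-scaled t 2≤t)
            where
            open Residues.Multiplier r 1≤r (+ D) D′ (∣-trans (∣ᵤ⇒∣ {+ (2 ℕ.* r)} {+ N} 2r∣N) inv) D-one using (theta-count-scaled)
            finish : (∃ λ ε → (ε ≡ 1ℤ ⊎ ε ≡ -1ℤ) × ∀ b M → M ℕ.≤ b → ∑[ y ∈ box b r ] (𝟙 (B₀ y y ≟ + M) * character (+ D · y)) ≡ ε * theta-count b M) → Goal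
            finish (ε , ε≡ , hε) = ε , ε≡ ,
              trans (∑-cong (box n r) (λ y → 𝟙*-cong (B₀ y y ≟ + n) {weight (+ D · y)} {character (+ D · y)} (section-weight (+ D) u v eu ev y)))
                (trans (hε n n ℕ.≤-refl) (trans (cong (ε *_) (theta-count-q₀ r t 1≤r 2≤t)) (*-identityʳ ε)))

    open Conjugation 1≤r form N ℓ-prime gram gram-⊕ gram-· gram-B (3 ℕ.* r ℕ.* t) gram-faithful weight weight-periodic weight-𝟘

    conjugate : ∀ Y → Conjugate Y
    conjugate Y = from (rough e N Y 2≤N (λ {i} → e-coprime {i}))
      where
      from : Rough e N Y → Conjugate Y
      from ρ = primes , large , inverse-mod-N (product primes) congruent , n , n<N , unit (conjugate-sum (product primes) congruent)
        where
        open Rough ρ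
        module L = PrimeIdeal (prime-ideal ℓ-prime)
        unit : ∀ {a} → (∃ λ ε → (ε ≡ 1ℤ ⊎ ε ≡ -1ℤ) × a ≡ ε) → ¬ + ℓ ∣ a
        unit (ε , inj₁ refl , refl) d = L.proper d
        unit (ε , inj₂ refl , refl) d = L.proper (∣m⇒∣-m d)

    -- At a fixed level M the section condition is a constant factor, so a nonzero coefficient
    -- forces M ≡ `offset` modulo P, which means an index s + rZ.
    section : (∃ λ n → ∃ λ M → M ℕ.≤ n × ¬ + ℓ ∣ ∑[ y ∈ box n r ] (𝟙 (B₀ y y ≟ + M) * weight y)) → ∃ λ n → ¬ + ℓ ∣ + b t (r ℕ.* n ℕ.+ s)
    section (n , M , M≤n , h) = by-section (+ P ∣? + M - offset)
      where
      lem : ∀ a b c → a * (b * c) ≡ a * b * c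
      lem = solve-∀
      factored : ∑[ y ∈ box n r ] (𝟙 (B₀ y y ≟ + M) * weight y) ≡ theta-count n M * 𝟙 (+ P ∣? + M - offset)
      factored = trans (∑-cong (box n r) (λ y → trans (𝟙*-cong (B₀ y y ≟ + M) {weight y} {character y * 𝟙 (+ P ∣? + M - offset)} (λ e → cong (λ z → character y * 𝟙 (+ P ∣? z - offset)) e))
        (lem (𝟙 (B₀ y y ≟ + M)) (character y) (𝟙 (+ P ∣? + M - offset))))) (∑-*ʳ (box n r) (𝟙 (+ P ∣? + M - offset)) (λ y → 𝟙 (B₀ y y ≟ + M) * character y))
      by-section : Dec (+ P ∣ + M - offset) → ∃ λ n → ¬ + ℓ ∣ + b t (r ℕ.* n ℕ.+ s)
      by-section (no P∤) = contradiction (subst (+ ℓ ∣_) (sym (trans factored (trans (cong (theta-count n M *_) (𝟙-no (+ P ∣? + M - offset) P∤)) (*-zeroʳ (theta-count n M))))) (divides 0ℤ refl)) h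
      by-section (yes (divides Z eZ)) = section-visible r t 1≤r 2≤t {ℓ} s s<r n M M≤n Z M≡ (λ d → h (subst (+ ℓ ∣_) (sym factored) (∣m⇒∣m*n (𝟙 (+ P ∣? + M - offset)) d)))
        where
        lem₁ : ∀ M o → M ≡ M - o + o
        lem₁ = solve-∀
        lem₂ : ∀ Z R q s → Z * (+ 24 * (R * R * R)) + (q + + 24 * (R * R) * s) ≡ q + + 24 * (R * R) * (s + R * Z)
        lem₂ = solve-∀
        M≡ : + M ≡ q₀ + + 24 * (R * R) * (+ s + R * Z)
        M≡ = trans (lem₁ (+ M) offset) (trans (cong (_+ offset) (trans eZ (cong (Z *_) P≡))) (lem₂ Z R q₀ (+ s)))

    nonvanishing : ∃ λ n → ¬ ℓ ℕ.∣ b t (r ℕ.* n ℕ.+ s)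
    nonvanishing = unsigned (section (visible-from-conjugates conjugate))
      where
      unsigned : (∃ λ n → ¬ + ℓ ∣ + b t (r ℕ.* n ℕ.+ s)) → ∃ λ n → ¬ ℓ ℕ.∣ b t (r ℕ.* n ℕ.+ s)
      unsigned (n , h) = n , λ d → h (∣ᵤ⇒∣ d)

open import Defs
open import Data.Nat using (ℕ; _+_; _*_; _∸_; _<_; _≥_)
open import Data.Nat.Divisibility using (_∣_)
open import Data.Nat.Primality using (Prime)
open import Data.Nat.Coprimality using (Coprime)
open import Data.Integer as ℤ using (ℤ)
open import Data.Integer.Divisibility using () renaming (_∣_ to _∣ℤ_)
open import Data.Product using (∃; _×_; _,_)
open import Relation.Nullary using (¬_)
open Nonvanishing using (module Assembly)

theorem1p10 : (ℓ t r : ℕ) → Prime ℓ → t ≥ 2 → r ≥ 1 →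
    (s : ℕ) → s < r →
    (∃ λ (d : ℤ) → Coprime ℤ.∣ d ∣ (6 * t * r) ×
    (ℤ.+ r) ∣ℤ (ℤ.+ s ℤ.- (ℤ.+ (t ∸ 1)) ℤ.* dTerm d)) →
    ∃ λ (n : ℕ) → ¬ (ℓ ∣ b t (r * n + s))
theorem1p10 ℓ t r ℓ-prime 2≤t 1≤r s s<r (d , coprime , index) =
  Assembly.nonvanishing ℓ-prime t r 1≤r 2≤t s s<r d (λ {i} → coprime {i}) index
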